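{- The theory $\mathrm{VL}$ proves the following statement: for every (string encoding an) undirected graph $G$ and every vertex $x$ of $G$, there exist strings $H$ and $Z$ such that (i) $H$ is a subgraph of $G$ whose vertex set contains $x$; (ii) for every vertex $u$ of $H$, the string $Z^{[u]}$ encodes a path in $G$ from $x$ to $u$; and (iii) there is no edge $\{u,v\}$ of $G$ with $u$ a vertex of $H$ and $v$ not a vertex of $H$.
   Context: $\mathrm{V}^0$ is the two-sorted theory of bounded arithmetic of Cook and Nguyen (Logical Foundations of Proof Complexity). It has a number sort and a string sort (finite sets of numbers), the symbols $0,1,+,\cdot,\le,=$, membership $X(i)$ (also written $i\in X$), and string length $|X|$ (one plus the largest element of $X$). Its axioms are finitely many basic open axioms, extensionality, and $\Sigma^B_0$-comprehension $\exists X{\le}y\,\forall z{<}y\,(X(z)\leftrightarrow\varphi(z))$ for $\Sigma^B_0$ formulas $\varphi$ (formulas with only bounded number quantifiers and no string quantifiers). Sequences are coded by strings: $Z(i,y)$ abbreviates $Z(\langle i,y\rangle)$ for a pairing function, and $(Z)^i$ is the least $y$ with $Z(i,y)$ (or $|Z|$ if there is none). A string $X$ codes a directed graph on $\{0,\dots,a\}$ via $X(y,z)$. Define $\delta_{\mathrm{PATH}}(a,b,X,Z)\equiv \forall i{\le}b\,((Z)^i\le a)\wedge \forall i{<}b\,X((Z)^i,(Z)^{i+1})\wedge (Z)^0=0$ and $\mathrm{Unique}(a,X)\equiv\forall x{\le}a\,\exists! y{\le}a\,X(x,y)$. $\mathrm{VL}$ is $\mathrm{V}^0$ plus the axiom $\mathrm{Unique}(a,X)\rightarrow\exists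 Z\,\delta_{\mathrm{PATH}}(a,a,X,Z)$. For a multi-indexed string $Z$, the slice $Z^{[u]}$ is the string with $Z^{[u]}(i,y)\leftrightarrow Z(u,i,y)$. "$Z^{[u]}$ encodes a path from $x$ to $u$" means that the sequence coded by $Z^{[u]}$ starts at $x$, ends at $u$, and consecutive elements are joined by edges of $G$. -}

module Defs where

open import Data.Nat using (ℕ; zero; suc)
open import Data.Fin using (Fin; zero; suc)
open import Data.List using (List; []; _∷_; map)
open import Data.List.Membership.Propositional using (_∈_)
open import Data.Product using (Σ)
open import Function using (id; _∘_)

-- Two-sorted syntax, de Bruijn indices for each sort separately.
-- n = number of number variables in scope, m = number of string variables.
-- String terms are string variables (Fin m).

infixl 7 _`*_
infixl 6 _`+_

data Tm (n m : ℕ) : Set where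
  var        : Fin n → Tm n m
  `0 `1      : Tm n m
  _`+_ _`*_  : Tm n m → Tm n m → Tm n m
  len        : Fin m → Tm n m

infix  4 _≤'_ _≐_ _≐S_ _∈'_
infixr 3 _∧'_
infixr 2 _∨'_
infixr 1 _⇒_

data Fm (n m : ℕ) : Set where
  _≤'_ _≐_  : Tm n m → Tm n m → Fm n m
  _≐S_      : Fin m → Fin m → Fm n m
  _∈'_      : Tm n m → Fin m → Fm n m
  ⊥'        : Fm n m
  _⇒_ _∧'_ _∨'_ : Fm n m → Fm n m → Fm n m
  ∀N ∃N     : Fm (suc n) m → Fm n m
  ∀S ∃S     : Fm n (suc m) → Fm n m

renT : ∀ {n m n' m'} → (Fin n → Fin n') → (Fin m → Fin m') → Tm n m → Tm n' m'
renT f g (var i)  = var (f i)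
renT f g `0       = `0
renT f g `1       = `1
renT f g (t `+ s) = renT f g t `+ renT f g s
renT f g (t `* s) = renT f g t `* renT f g s
renT f g (len X)  = len (g X)

subT : ∀ {n m n' m'} → (Fin n → Tm n' m') → (Fin m → Fin m') → Tm n m → Tm n' m'
subT σ ρ (var i)  = σ i
subT σ ρ `0       = `0
subT σ ρ `1       = `1
subT σ ρ (t `+ s) = subT σ ρ t `+ subT σ ρ s
subT σ ρ (t `* s) = subT σ ρ t `* subT σ ρ s
subT σ ρ (len X)  = len (ρ X)

liftN : ∀ {n n' m'} → (Fin n → Tm n' m') → Fin (suc n) → Tm (suc n') m'
liftN σ zero    = var zero
liftN {m' = m'} σ (suc i) = renT suc (id {A = Fin m'}) (σ i)

liftS : ∀ {m m'} → (Fin m → Fin m') → Fin (suc m) → Fin (suc m')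
liftS ρ zero    = zero
liftS ρ (suc j) = suc (ρ j)

subF : ∀ {n m n' m'} → (Fin n → Tm n' m') → (Fin m → Fin m') → Fm n m → Fm n' m'
subF σ ρ (t ≤' s)  = subT σ ρ t ≤' subT σ ρ s
subF σ ρ (t ≐ s)   = subT σ ρ t ≐ subT σ ρ s
subF σ ρ (X ≐S Y)  = ρ X ≐S ρ Y
subF σ ρ (t ∈' X)  = subT σ ρ t ∈' ρ X
subF σ ρ ⊥'        = ⊥'
subF σ ρ (φ ⇒ ψ)   = subF σ ρ φ ⇒ subF σ ρ ψ
subF σ ρ (φ ∧' ψ)  = subF σ ρ φ ∧' subF σ ρ ψ
subF σ ρ (φ ∨' ψ)  = subF σ ρ φ ∨' subF σ ρ ψ
subF σ ρ (∀N φ)    = ∀N (subF (liftN σ) ρ φ)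
subF σ ρ (∃N φ)    = ∃N (subF (liftN σ) ρ φ)
subF σ ρ (∀S φ)    = ∀S (subF (λ i → renT (λ j → j) suc (σ i)) (liftS ρ) φ)
subF σ ρ (∃S φ)    = ∃S (subF (λ i → renT (λ j → j) suc (σ i)) (liftS ρ) φ)

↑T : ∀ {n m} → Tm n m → Tm (suc n) m
↑T {m = m} = renT suc (id {A = Fin m})

wkN : ∀ {n m} → Fm n m → Fm (suc n) m
wkN = subF (var ∘ suc) id

wkS : ∀ {n m} → Fm n m → Fm n (suc m)
wkS = subF var suc

consN : ∀ {n m} → Tm n m → Fin (suc n) → Tm n m
consN t zero    = t
consN t (suc i) = var i

consS : ∀ {m} → Fin m → Fin (suc m) → Fin m
consS Y zero    = Y
consS Y (suc j) = j

instN : ∀ {n m} → Fm (suc n) m → Tm n m → Fm n m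
instN φ t = subF (consN t) id φ

instS : ∀ {n m} → Fm n (suc m) → Fin m → Fm n m
instS φ Y = subF var (consS Y) φ

emb : ∀ {n m} → Fm 0 0 → Fm n m
emb = subF (λ ()) (λ ())

v0 : ∀ {n m} → Tm (suc n) m
v0 = var zero
v1 : ∀ {n m} → Tm (suc (suc n)) m
v1 = var (suc zero)
v2 : ∀ {n m} → Tm (suc (suc (suc n))) m
v2 = var (suc (suc zero))
v3 : ∀ {n m} → Tm (suc (suc (suc (suc n)))) m
v3 = var (suc (suc (suc zero)))

infix 4 _<'_
infix 0 _⇔_

¬' : ∀ {n m} → Fm n m → Fm n m
¬' φ = φ ⇒ ⊥'

_⇔_ : ∀ {n m} → Fm n m → Fm n m → Fm n m
φ ⇔ ψ = (φ ⇒ ψ) ∧' (ψ ⇒ φ)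

_<'_ : ∀ {n m} → Tm n m → Tm n m → Fm n m
t <' s = (t ≤' s) ∧' ¬' (t ≐ s)

∀≤ ∃≤ ∀< ∃< : ∀ {n m} → Tm n m → Fm (suc n) m → Fm n m
∀≤ t φ = ∀N ((v0 ≤' ↑T t) ⇒ φ)
∃≤ t φ = ∃N ((v0 ≤' ↑T t) ∧' φ)
∀< t φ = ∀N ((v0 <' ↑T t) ⇒ φ)
∃< t φ = ∃N ((v0 <' ↑T t) ∧' φ)

-- Cook–Nguyen pairing function  ⟨x,y⟩ = (x+y)(x+y+1) + 2y
pair : ∀ {n m} → Tm n m → Tm n m → Tm n m
pair x y = (x `+ y) `* ((x `+ y) `+ `1) `+ (`1 `+ `1) `* y

Mem2 : ∀ {n m} → Tm n m → Tm n m → Fin m → Fm n m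
Mem2 x y X = pair x y ∈' X

-- "(W)^i = t": t is the least y with W(i,y), or |W| if there is none
Val : ∀ {n m} → Fin m → Tm n m → Tm n m → Fm n m
Val W i t =
  ((t <' len W) ∧' Mem2 i t W ∧' ∀< t (¬' (Mem2 (↑T i) v0 W)))
  ∨' ((t ≐ len W) ∧' ∀< (len W) (¬' (Mem2 (↑T i) v0 W)))

-- At W i P  expresses  P((W)^i)  (P's variable 0 stands for (W)^i)
At : ∀ {n m} → Fin m → Tm n m → Fm (suc n) m → Fm n m
At W i P = ∃≤ (len W) (Val W (↑T i) v0 ∧' P)

data Σ0 {n m : ℕ} : Fm n m → Set where
  s≤  : ∀ {t s} → Σ0 (t ≤' s)
  s≐  : ∀ {t s} → Σ0 (t ≐ s)
  s≐S : ∀ {X Y} → Σ0 (X ≐S Y)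
  s∈  : ∀ {t X} → Σ0 (t ∈' X)
  s⊥  : Σ0 ⊥'
  s⇒  : ∀ {φ ψ} → Σ0 φ → Σ0 ψ → Σ0 (φ ⇒ ψ)
  s∧  : ∀ {φ ψ} → Σ0 φ → Σ0 ψ → Σ0 (φ ∧' ψ)
  s∨  : ∀ {φ ψ} → Σ0 φ → Σ0 ψ → Σ0 (φ ∨' ψ)
  s∀≤ : ∀ {t φ} → Σ0 φ → Σ0 (∀≤ t φ)
  s∃≤ : ∀ {t φ} → Σ0 φ → Σ0 (∃≤ t φ)
  s∀< : ∀ {t φ} → Σ0 φ → Σ0 (∀< t φ)
  s∃< : ∀ {t φ} → Σ0 φ → Σ0 (∃< t φ)

-- 2-BASIC (Cook–Nguyen): B1–B12, L1, L2, SE, as closed formulas.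
-- In ∀N ∀N φ, the first bound variable is v1 and the second v0.
data BasicAx : Fm 0 0 → Set where
  B1  : BasicAx (∀N (¬' (v0 `+ `1 ≐ `0)))
  B2  : BasicAx (∀N (∀N ((v1 `+ `1 ≐ v0 `+ `1) ⇒ (v1 ≐ v0))))
  B3  : BasicAx (∀N (v0 `+ `0 ≐ v0))
  B4  : BasicAx (∀N (∀N (v1 `+ (v0 `+ `1) ≐ (v1 `+ v0) `+ `1)))
  B5  : BasicAx (∀N (v0 `* `0 ≐ `0))
  B6  : BasicAx (∀N (∀N (v1 `* (v0 `+ `1) ≐ (v1 `* v0) `+ v1)))
  B7  : BasicAx (∀N (∀N (((v1 ≤' v0) ∧' (v0 ≤' v1)) ⇒ (v1 ≐ v0))))
  B8  : BasicAx (∀N (∀N (v1 ≤' v1 `+ v0)))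
  B9  : BasicAx (∀N (`0 ≤' v0))
  B10 : BasicAx (∀N (∀N ((v1 ≤' v0) ∨' (v0 ≤' v1))))
  B11 : BasicAx (∀N (∀N ((v1 ≤' v0) ⇔ (v1 <' v0 `+ `1))))
  B12 : BasicAx (∀N (¬' (v0 ≐ `0) ⇒ ∃≤ v0 (v0 `+ `1 ≐ v1)))
  L1  : BasicAx (∀N (∀S ((v0 ∈' zero) ⇒ (v0 <' len zero))))
  L2  : BasicAx (∀N (∀S ((v0 `+ `1 ≐ len zero) ⇒ (v0 ∈' zero))))
  SE  : BasicAx (∀S (∀S (((len (suc zero) ≐ len zero)
           ∧' ∀< (len (suc zero)) ((v0 ∈' suc zero) ⇔ (v0 ∈' zero)))
           ⇒ (suc zero ≐S zero))))

-- Σ^B_0-comprehension instance for φ(z, params) (z = number variable 0):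
--   ∀y ∃X (|X| ≤ y ∧ ∀z<y (X(z) ↔ φ(z)))   (X not free in φ)
compShift : ∀ {n m} → Fin (suc n) → Tm (suc (suc n)) (suc m)
compShift zero    = var zero
compShift (suc i) = var (suc (suc i))

Comp : ∀ {n m} → Fm (suc n) m → Fm n m
Comp φ = ∀N (∃S ((len zero ≤' v0)
           ∧' ∀< v0 ((v0 ∈' zero) ⇔ subF compShift suc φ)))

Unique : ∀ {n m} → Tm n m → Fin m → Fm n m
Unique a X = ∀≤ a (∃≤ (↑T a) (Mem2 v1 v0 X
               ∧' ∀≤ (↑T (↑T a)) (Mem2 v2 v0 X ⇒ (v0 ≐ v1))))

δPATH : ∀ {n m} → Tm n m → Tm n m → Fin m → Fin m → Fm n m
δPATH a b X Z =
  ∀≤ b (At Z v0 (v0 ≤' ↑T (↑T a)))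
  ∧' ∀< b (At Z v0 (At Z (v1 `+ `1) (Mem2 v1 v0 X)))
  ∧' At Z `0 (v0 ≐ `0)

VLAxiom : Fm 0 0
VLAxiom = ∀N (∀S (Unique v0 zero ⇒ ∃S (δPATH v0 v0 (suc zero) zero)))

data Ax {n m : ℕ} : Fm n m → Set where
  basic : ∀ {φ} → BasicAx φ → Ax (emb φ)
  comp  : (φ : Fm (suc n) m) → Σ0 φ → Ax (Comp φ)
  vl    : Ax (emb VLAxiom)

infix -1 _⊢_

data _⊢_ : ∀ {n m} → List (Fm n m) → Fm n m → Set where
  hyp  : ∀ {n m} {Γ : List (Fm n m)} {φ} → φ ∈ Γ → Γ ⊢ φ
  ax   : ∀ {n m} {Γ : List (Fm n m)} {φ} → Ax φ → Γ ⊢ φ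
  raa  : ∀ {n m} {Γ : List (Fm n m)} {φ} → (¬' φ ∷ Γ) ⊢ ⊥' → Γ ⊢ φ
  ⇒I   : ∀ {n m} {Γ : List (Fm n m)} {φ ψ} → (φ ∷ Γ) ⊢ ψ → Γ ⊢ φ ⇒ ψ
  ⇒E   : ∀ {n m} {Γ : List (Fm n m)} {φ ψ} → Γ ⊢ φ ⇒ ψ → Γ ⊢ φ → Γ ⊢ ψ
  ∧I   : ∀ {n m} {Γ : List (Fm n m)} {φ ψ} → Γ ⊢ φ → Γ ⊢ ψ → Γ ⊢ φ ∧' ψ
  ∧E₁  : ∀ {n m} {Γ : List (Fm n m)} {φ ψ} → Γ ⊢ φ ∧' ψ → Γ ⊢ φ
  ∧E₂  : ∀ {n m} {Γ : List (Fm n m)} {φ ψ} → Γ ⊢ φ ∧' ψ → Γ ⊢ ψ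
  ∨I₁  : ∀ {n m} {Γ : List (Fm n m)} {φ ψ} → Γ ⊢ φ → Γ ⊢ φ ∨' ψ
  ∨I₂  : ∀ {n m} {Γ : List (Fm n m)} {φ ψ} → Γ ⊢ ψ → Γ ⊢ φ ∨' ψ
  ∨E   : ∀ {n m} {Γ : List (Fm n m)} {φ ψ χ} →
         Γ ⊢ φ ∨' ψ → (φ ∷ Γ) ⊢ χ → (ψ ∷ Γ) ⊢ χ → Γ ⊢ χ
  ∀NI  : ∀ {n m} {Γ : List (Fm n m)} {φ} → map wkN Γ ⊢ φ → Γ ⊢ ∀N φ
  ∀NE  : ∀ {n m} {Γ : List (Fm n m)} {φ} → Γ ⊢ ∀N φ → (t : Tm n m) → Γ ⊢ instN φ t
  ∃NI  : ∀ {n m} {Γ : List (Fm n m)} {φ} (t : Tm n m) → Γ ⊢ instN φ t → Γ ⊢ ∃N φ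
  ∃NE  : ∀ {n m} {Γ : List (Fm n m)} {φ ψ} →
         Γ ⊢ ∃N φ → (φ ∷ map wkN Γ) ⊢ wkN ψ → Γ ⊢ ψ
  ∀SI  : ∀ {n m} {Γ : List (Fm n m)} {φ} → map wkS Γ ⊢ φ → Γ ⊢ ∀S φ
  ∀SE  : ∀ {n m} {Γ : List (Fm n m)} {φ} → Γ ⊢ ∀S φ → (Y : Fin m) → Γ ⊢ instS φ Y
  ∃SI  : ∀ {n m} {Γ : List (Fm n m)} {φ} (Y : Fin m) → Γ ⊢ instS φ Y → Γ ⊢ ∃S φ
  ∃SE  : ∀ {n m} {Γ : List (Fm n m)} {φ ψ} →
         Γ ⊢ ∃S φ → (φ ∷ map wkS Γ) ⊢ wkS ψ → Γ ⊢ ψ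
  ≐refl  : ∀ {n m} {Γ : List (Fm n m)} {t} → Γ ⊢ t ≐ t
  ≐subst : ∀ {n m} {Γ : List (Fm n m)} (φ : Fm (suc n) m) {t s} →
           Γ ⊢ t ≐ s → Γ ⊢ instN φ t → Γ ⊢ instN φ s
  ≐Srefl  : ∀ {n m} {Γ : List (Fm n m)} {X} → Γ ⊢ X ≐S X
  ≐Ssubst : ∀ {n m} {Γ : List (Fm n m)} (φ : Fm n (suc m)) {X Y} →
            Γ ⊢ X ≐S Y → Γ ⊢ instS φ X → Γ ⊢ instS φ Y

-- VL proves the sentence φ (derivable from no hypotheses, in some scope
-- of free variables; free variables keep both sorts non-empty).
VL⊢ : Fm 0 0 → Set
VL⊢ φ = Σ ℕ λ n → Σ ℕ λ m → [] ⊢ emb {n} {m} φ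

Undirected : ∀ {n m} → Tm n m → Fin m → Fm n m
Undirected a G = ∀≤ a (∀≤ (↑T a) (Mem2 v1 v0 G ⇒ Mem2 v0 v1 G))

-- W is the slice Z^[u], i.e. W(i,y) ↔ Z(u,i,y) = Z(⟨⟨u,i⟩,y⟩) and nothing else
Slice : ∀ {n m} → Fin m → Fin m → Tm n m → Fm n m
Slice W Z u = (len W ≤' len Z)
  ∧' ∀< (len Z) ((v0 ∈' W) ⇔
        ∃≤ v0 (∃≤ v1 ((v2 ≐ pair v1 v0)
          ∧' (pair (pair (↑T (↑T (↑T u))) v1) v0 ∈' Z))))

PathBody : ∀ {n m} → Tm n m → Fin m → Fin m → Tm n m → Tm n m → Tm n m → Fm n m
PathBody a G W x u b =
    At W `0 (v0 ≐ ↑T x)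
    ∧' At W b (v0 ≐ ↑T u)
    ∧' ∀≤ b (At W v0 (v0 ≤' ↑T (↑T a)))
    ∧' ∀< b (At W v0 (At W (v1 `+ `1) (Mem2 v1 v0 G)))

Path : ∀ {n m} → Tm n m → Fin m → Fin m → Tm n m → Tm n m → Fm n m
Path a G W x u = ∃N (PathBody (↑T a) G W (↑T x) (↑T u) v0)

-- ∀a ∀G ∀x ( x ≤ a ∧ G undirected →
--    ∃H ∃Z ( H ⊆ {0..a} ∧ H(x)
--          ∧ ∀u (H(u) → Z^[u] is a path in G from x to u)
--          ∧ ¬∃u,v ≤ a (G(u,v) ∧ H(u) ∧ ¬H(v)) ) )
-- Scope inside ∃H ∃Z : numbers x = v0, a = v1; strings Z = 0, H = 1, G = 2.
Thm47 : Fm 0 0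
Thm47 =
  ∀N (∀S (∀N (((v0 ≤' v1) ∧' Undirected v1 zero) ⇒
    ∃S (∃S (
        (∀< (len H) ((v0 ∈' H) ⇒ (v0 ≤' v2)) ∧' (v0 ∈' H))
      ∧' ∀N ((v0 ∈' H) ⇒
            ∀S (Slice zero (suc zero) v0
                ⇒ Path v2 (suc (suc (suc zero))) zero v1 v0))
      ∧' ¬' (∃N (∃N ((v1 ≤' v3) ∧' (v0 ≤' v3) ∧' Mem2 v1 v0 G
                      ∧' (v1 ∈' H) ∧' ¬' (v0 ∈' H)))))))))
  where
  H G : Fin 3
  H = suc zero
  G = suc (suc zero)

{-# OPTIONS --safe #-}
-- Derivability from VL is reduced to truth in models by a constructive completeness theorem: the term model
-- of a maximal Henkin theory interprets ⊥' as "VL derives the sentence", which is a stable falsity, so that one may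
-- argue classically inside an arbitrary model of VL. In a model, call a function definable if it is Σ0-definable
-- on every initial segment; the VL axiom closes these functions under bounded iteration.
--
-- G is first replaced by a graph G_0 of constant degree whose edges are given by involutions, each vertex
-- becoming a cloud. Then G_{i+1} is obtained from G_i by replacing every vertex by a cloud of constant size 2^k: a
-- label of G_{i+1} either moves inside the cloud, by one of the generators of an expanding Cayley graph of F_2^k,
-- or follows in G_i the path of length 384 that is written in the cloud vertex. A neighbour in G_i is computed by
-- a stack machine in time exponential in i only, so for logarithmically many levels its run is a definable function.
--
-- Let f_i(v), v in G_i, count the addresses leading from v to x through all levels above i. The Poincaré
-- inequality of the Cayley graph and the convexity of ‖P^j f‖² / D^{2j} show that the Dirichlet energy of f_i
-- relative to its mass decreases by a factor 4 from each level to the one below. After logarithmically many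
-- levels f_0 is therefore almost constant along edges, and since its level sets {f_0 > jΔ} cannot all be distinct,
-- the support of f_0 is closed under edges. It is the component of x: an address counted by f_0(v) makes the
-- machine trace a lazy walk from v to x, and deleting its repetitions gives the path.
module Submission where

open import Defs

-- The obstacle is that VL can speak neither of eigenvalues nor of eigenvectors: its numbers have
-- polynomial size, and sums of definable functions are all there is. The growth of the spectral gap
-- is therefore observed on a single function per level. A step down sums this function over each
-- cloud and then applies 191 steps of the walk; the walk makes the energy along one edge small
-- against the energy along walks of length 384, and the edges between clouds are exactly such
-- walks. All inequalities are multiplied out so that they hold between natural numbers. Whatever
-- concerns one level (degree, cloud size, generators) has standard size and is settled outside the
-- model; only vertices, levels and addresses are elements of it. The functions are counts of
-- addresses because a count has a definable value and, when it is positive, an actual walk behind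
-- it: positivity of the count at a vertex is itself a connection with x.

-- Two-sorted structures with an arbitrary falsity.

module Structures where
  open import Data.Nat using (suc)
  open import Data.Fin using (suc)
  open import Data.Vec using (Vec; _∷_; lookup)
  open import Data.Product using (Σ; _×_)
  open import Data.Sum using (_⊎_)

  record Struct : Set₁ where
    field
      M S 𝕆      : Set
      0M 1M      : M
      _+M_ _*M_  : M → M → M
      lenM       : S → M
      _≤M_ _≈M_  : M → M → Set
      _∈M_       : M → S → Set
      _≈S_       : S → S → Set

  module Sem (𝔖 : Struct) where
    open Struct 𝔖

    ev : ∀ {n m} → Tm n m → Vec M n → Vec S m → M
    ev (var i)  ρ τ = lookup ρ i
    ev `0       ρ τ = 0M
    ev `1       ρ τ = 1M
    ev (t `+ s) ρ τ = ev t ρ τ +M ev s ρ τ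
    ev (t `* s) ρ τ = ev t ρ τ *M ev s ρ τ
    ev (len X)  ρ τ = lenM (lookup τ X)

    -- ⊥' is interpreted by an arbitrary 𝕆 (an exploding model); ∨' is read through 𝕆,
    -- while Henkin witnesses allow a strong ∃.
    sat : ∀ {n m} → Fm n m → Vec M n → Vec S m → Set
    sat (t ≤' s) ρ τ = ev t ρ τ ≤M ev s ρ τ
    sat (t ≐ s)  ρ τ = ev t ρ τ ≈M ev s ρ τ
    sat (X ≐S Y) ρ τ = lookup τ X ≈S lookup τ Y
    sat (t ∈' X) ρ τ = ev t ρ τ ∈M lookup τ X
    sat ⊥'       ρ τ = 𝕆
    sat (φ ⇒ ψ)  ρ τ = sat φ ρ τ → sat ψ ρ τ
    sat (φ ∧' ψ) ρ τ = sat φ ρ τ × sat ψ ρ τ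
    sat (φ ∨' ψ) ρ τ = ((sat φ ρ τ ⊎ sat ψ ρ τ) → 𝕆) → 𝕆
    sat (∀N φ)   ρ τ = (x : M) → sat φ (x ∷ ρ) τ
    sat (∃N φ)   ρ τ = Σ M λ x → sat φ (x ∷ ρ) τ
    sat (∀S φ)   ρ τ = (X : S) → sat φ ρ (X ∷ τ)
    sat (∃S φ)   ρ τ = Σ S λ X → sat φ ρ (X ∷ τ)

  -- Since `𝕆` may be inhabited, a model may satisfy every formula. All of classical logic sits in
  -- `stab`, and it is granted to formulas only, not to arbitrary types.
  record Model : Set₁ where
    field struct : Struct
    open Struct struct public
    open Sem struct public
    field
      stab   : ∀ {n m} (φ : Fm n m) ρ τ → ((sat φ ρ τ → 𝕆) → 𝕆) → sat φ ρ τ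
      sound  : ∀ {n m} {φ : Fm n m} → Ax φ → ∀ ρ τ → sat φ ρ τ
      leibN  : ∀ {n m} (φ : Fm (suc n) m) {x y} ρ τ → x ≈M y → sat φ (x ∷ ρ) τ → sat φ (y ∷ ρ) τ
      reflN  : ∀ {x} → x ≈M x

open Structures

-- Injective codes for pairs and trees.

module Numbering where
  open import Data.Nat using (ℕ; zero; suc; _+_; _*_; _<_; _≤_; s≤s; z≤n)
  import Data.Nat.Properties as ℕ
  open import Data.Product using (_×_; _,_)
  open import Data.Empty using (⊥-elim)
  open import Relation.Nullary using (¬_)
  open import Relation.Binary.Definitions using (tri<; tri≈; tri>)
  open import Relation.Binary.PropositionalEquality

  ⟨_,_⟩ : ℕ → ℕ → ℕ
  ⟨ a , b ⟩ = (a + b) * (a + b) + a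

  -- With `s = a + b` the code lies between `s * s` and `s * s + s`, hence below `suc s * suc s`:
  -- different sums have codes in disjoint intervals.
  ⟨⟩-sum : ∀ a b c d → ⟨ a , b ⟩ ≡ ⟨ c , d ⟩ → ¬ (a + b < c + d)
  ⟨⟩-sum a b c d e l = ℕ.<-irrefl e (begin-strict
      (a + b) * (a + b) + a            ≤⟨ ℕ.+-monoʳ-≤ ((a + b) * (a + b)) (ℕ.m≤m+n a b) ⟩
      (a + b) * (a + b) + (a + b)      ≡⟨ ℕ.+-comm _ (a + b) ⟩
      suc (a + b) * (a + b)            <⟨ ℕ.*-monoʳ-< (suc (a + b)) (ℕ.n<1+n (a + b)) ⟩
      suc (a + b) * suc (a + b)        ≤⟨ ℕ.*-mono-≤ l l ⟩
      (c + d) * (c + d)                ≤⟨ ℕ.m≤m+n _ c ⟩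
      (c + d) * (c + d) + c            ∎)
    where open ℕ.≤-Reasoning

  ⟨⟩-inj : ∀ a b c d → ⟨ a , b ⟩ ≡ ⟨ c , d ⟩ → a ≡ c × b ≡ d
  ⟨⟩-inj a b c d e with ℕ.<-cmp (a + b) (c + d)
  ... | tri< l _ _ = ⊥-elim (⟨⟩-sum a b c d e l)
  ... | tri> _ _ l = ⊥-elim (⟨⟩-sum c d a b (sym e) l)
  ... | tri≈ _ s _ = ac , ℕ.+-cancelˡ-≡ a b d (trans s (cong (_+ d) (sym ac)))
    where ac : a ≡ c
          ac = ℕ.+-cancelˡ-≡ ((a + b) * (a + b)) a c (trans e (cong (λ z → z * z + c) (sym s)))

  -- Intermediate codes for syntax: leaves receive odd numbers and nodes even ones. A code also
  -- bounds the codes of its parts and exceeds the numbers at its leaves, which later yields names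
  -- that do not occur in a closure.
  data Tree : Set where
    lf : ℕ → Tree
    nd : Tree → Tree → Tree

  even≢odd : ∀ a b → ¬ (suc (a + a) ≡ b + b)
  even≢odd zero (suc zero) ()
  even≢odd zero (suc (suc b)) ()
  even≢odd (suc a) (suc b) e = even≢odd a b (ℕ.suc-injective (ℕ.suc-injective
    (trans (cong (λ z → suc (suc z)) (sym (ℕ.+-suc a a))) (trans e (cong suc (ℕ.+-suc b b))))))

  dbl-inj : ∀ a b → a + a ≡ b + b → a ≡ b
  dbl-inj zero zero e = refl
  dbl-inj (suc a) (suc b) e = cong suc (dbl-inj a b (ℕ.suc-injective (ℕ.suc-injective
    (trans (cong suc (sym (ℕ.+-suc a a))) (trans e (cong suc (ℕ.+-suc b b)))))))

  sq-≤ : ∀ n → n ≤ n * n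
  sq-≤ zero = z≤n
  sq-≤ (suc n) = ℕ.m≤m*n (suc n) (suc n)

  abstract
    # : Tree → ℕ
    # (lf n)   = suc (n + n)
    # (nd s t) = let c = ⟨ # s , # t ⟩ in c + c

    #-inj : ∀ s t → # s ≡ # t → s ≡ t
    #-inj (lf a) (lf b) e = cong lf (dbl-inj a b (ℕ.suc-injective e))
    #-inj (lf a) (nd s t) e = ⊥-elim (even≢odd a ⟨ # s , # t ⟩ e)
    #-inj (nd s t) (lf a) e = ⊥-elim (even≢odd a ⟨ # s , # t ⟩ (sym e))
    #-inj (nd s t) (nd u v) e with ⟨⟩-inj (# s) (# t) (# u) (# v) (dbl-inj ⟨ # s , # t ⟩ ⟨ # u , # v ⟩ e)
    ... | p , q = cong₂ nd (#-inj s u p) (#-inj t v q)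

    #ˡ : ∀ s t → # s ≤ # (nd s t)
    #ˡ s t = ℕ.≤-trans (ℕ.≤-trans (ℕ.m≤m+n (# s) (# t)) (ℕ.≤-trans (sq-≤ (# s + # t)) (ℕ.m≤m+n ((# s + # t) * (# s + # t)) (# s)))) (ℕ.m≤m+n ⟨ # s , # t ⟩ ⟨ # s , # t ⟩)

    #ʳ : ∀ s t → # t ≤ # (nd s t)
    #ʳ s t = ℕ.≤-trans (ℕ.≤-trans (ℕ.m≤n+m (# t) (# s)) (ℕ.≤-trans (sq-≤ (# s + # t)) (ℕ.m≤m+n ((# s + # t) * (# s + # t)) (# s)))) (ℕ.m≤m+n ⟨ # s , # t ⟩ ⟨ # s , # t ⟩)

    lf< : ∀ c {d} → # (lf c) ≤ d → c < d
    lf< c p = ℕ.≤-trans (s≤s (ℕ.m≤m+n c c)) p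

-- Substitution, parameters and the constructive completeness theorem.

module Completeness where
  open Numbering
  open import Data.Nat using (ℕ; zero; suc; _+_; _<_; _≤_)
  import Data.Nat.Properties as ℕ
  open import Data.Fin using (Fin; zero; suc; toℕ)
  open import Data.Vec using (Vec; []; _∷_; lookup)
  open import Data.List using (List; []; _∷_; map; _++_)
  open import Data.List.Membership.Propositional using (_∈_)
  open import Data.List.Membership.Propositional.Properties using (∈-++⁺ˡ; ∈-++⁺ʳ)
  open import Data.List.Relation.Unary.Any using (here; there)
  open import Data.List.Relation.Unary.All as All using (All; []; _∷_)
  import Data.List.Relation.Unary.All.Properties as Allₚ
  open import Data.List.Relation.Binary.Subset.Propositional using (_⊆_)
  open import Data.List.Relation.Binary.Subset.Propositional.Properties using (map⁺; ∷⁺ʳ)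
  open import Data.Maybe using (Maybe; just; nothing; _>>=_)
  open import Data.Maybe.Properties using (just-injective)
  open import Data.Product using (Σ; _×_; _,_)
  open import Data.Sum using (_⊎_; inj₁; inj₂; [_,_]′)
  open import Data.Empty using (⊥-elim)
  open import Data.Unit using (⊤; tt)
  open import Function using (id; _∘_; case_of_)
  open import Relation.Nullary using (yes; no; ¬_)
  open import Relation.Binary.PropositionalEquality

  subT-cong : ∀ {n m n' m'} {σ σ' : Fin n → Tm n' m'} {ρ ρ' : Fin m → Fin m'} →
    (∀ i → σ i ≡ σ' i) → (∀ j → ρ j ≡ ρ' j) → ∀ t → subT σ ρ t ≡ subT σ' ρ' t
  subT-cong p q (var i)  = p i
  subT-cong p q `0       = refl
  subT-cong p q `1       = refl
  subT-cong p q (t `+ s) = cong₂ _`+_ (subT-cong p q t) (subT-cong p q s)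
  subT-cong p q (t `* s) = cong₂ _`*_ (subT-cong p q t) (subT-cong p q s)
  subT-cong p q (len X)  = cong len (q X)

  renT-sub : ∀ {n m n' m'} (f : Fin n → Fin n') (g : Fin m → Fin m') t →
    renT f g t ≡ subT (var ∘ f) g t
  renT-sub f g (var i)  = refl
  renT-sub f g `0       = refl
  renT-sub f g `1       = refl
  renT-sub f g (t `+ s) = cong₂ _`+_ (renT-sub f g t) (renT-sub f g s)
  renT-sub f g (t `* s) = cong₂ _`*_ (renT-sub f g t) (renT-sub f g s)
  renT-sub f g (len X)  = refl

  subT-subT : ∀ {n m n' m' n'' m''} (σ' : Fin n' → Tm n'' m'') (ρ' : Fin m' → Fin m'')
    (σ : Fin n → Tm n' m') (ρ : Fin m → Fin m') t →
    subT σ' ρ' (subT σ ρ t) ≡ subT (subT σ' ρ' ∘ σ) (ρ' ∘ ρ) t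
  subT-subT σ' ρ' σ ρ (var i)  = refl
  subT-subT σ' ρ' σ ρ `0       = refl
  subT-subT σ' ρ' σ ρ `1       = refl
  subT-subT σ' ρ' σ ρ (t `+ s) = cong₂ _`+_ (subT-subT σ' ρ' σ ρ t) (subT-subT σ' ρ' σ ρ s)
  subT-subT σ' ρ' σ ρ (t `* s) = cong₂ _`*_ (subT-subT σ' ρ' σ ρ t) (subT-subT σ' ρ' σ ρ s)
  subT-subT σ' ρ' σ ρ (len X)  = refl

  subT-ren : ∀ {n m n' m' n'' m''} (σ : Fin n' → Tm n'' m'') (ρ : Fin m' → Fin m'')
    (f : Fin n → Fin n') (g : Fin m → Fin m') t →
    subT σ ρ (renT f g t) ≡ subT (σ ∘ f) (ρ ∘ g) t
  subT-ren σ ρ f g t = trans (cong (subT σ ρ) (renT-sub f g t)) (subT-subT σ ρ (var ∘ f) g t)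

  ren-subT : ∀ {n m n' m' n'' m''} (f : Fin n' → Fin n'') (g : Fin m' → Fin m'')
    (σ : Fin n → Tm n' m') (ρ : Fin m → Fin m') t →
    renT f g (subT σ ρ t) ≡ subT (renT f g ∘ σ) (g ∘ ρ) t
  ren-subT f g σ ρ t = trans (renT-sub f g _) (trans (subT-subT (var ∘ f) g σ ρ t)
    (subT-cong (λ i → sym (renT-sub f g (σ i))) (λ _ → refl) t))

  subT-id : ∀ {n m} (t : Tm n m) → subT var id t ≡ t
  subT-id (var i)  = refl
  subT-id `0       = refl
  subT-id `1       = refl
  subT-id (t `+ s) = cong₂ _`+_ (subT-id t) (subT-id s)
  subT-id (t `* s) = cong₂ _`*_ (subT-id t) (subT-id s)
  subT-id (len X)  = refl

  liftN-cong : ∀ {n n' m'} {σ σ' : Fin n → Tm n' m'} → (∀ i → σ i ≡ σ' i) → ∀ i → liftN σ i ≡ liftN σ' i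
  liftN-cong p zero    = refl
  liftN-cong p (suc i) = cong (renT suc id) (p i)

  liftS-cong : ∀ {m m'} {ρ ρ' : Fin m → Fin m'} → (∀ i → ρ i ≡ ρ' i) → ∀ i → liftS ρ i ≡ liftS ρ' i
  liftS-cong p zero    = refl
  liftS-cong p (suc i) = cong suc (p i)

  subF-cong : ∀ {n m n' m'} {σ σ' : Fin n → Tm n' m'} {ρ ρ' : Fin m → Fin m'} →
    (∀ i → σ i ≡ σ' i) → (∀ j → ρ j ≡ ρ' j) → ∀ φ → subF σ ρ φ ≡ subF σ' ρ' φ
  subF-cong p q (t ≤' s)  = cong₂ _≤'_ (subT-cong p q t) (subT-cong p q s)
  subF-cong p q (t ≐ s)   = cong₂ _≐_ (subT-cong p q t) (subT-cong p q s)
  subF-cong p q (X ≐S Y)  = cong₂ _≐S_ (q X) (q Y)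
  subF-cong p q (t ∈' X)  = cong₂ _∈'_ (subT-cong p q t) (q X)
  subF-cong p q ⊥'        = refl
  subF-cong p q (φ ⇒ ψ)   = cong₂ _⇒_ (subF-cong p q φ) (subF-cong p q ψ)
  subF-cong p q (φ ∧' ψ)  = cong₂ _∧'_ (subF-cong p q φ) (subF-cong p q ψ)
  subF-cong p q (φ ∨' ψ)  = cong₂ _∨'_ (subF-cong p q φ) (subF-cong p q ψ)
  subF-cong p q (∀N φ)    = cong ∀N (subF-cong (liftN-cong p) q φ)
  subF-cong p q (∃N φ)    = cong ∃N (subF-cong (liftN-cong p) q φ)
  subF-cong p q (∀S φ)    = cong ∀S (subF-cong (λ i → cong (renT (λ j → j) suc) (p i)) (liftS-cong q) φ)
  subF-cong p q (∃S φ)    = cong ∃S (subF-cong (λ i → cong (renT (λ j → j) suc) (p i)) (liftS-cong q) φ)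

  module _ {n m n' m' n'' m''} (σ' : Fin n' → Tm n'' m'') (ρ' : Fin m' → Fin m'')
           (σ : Fin n → Tm n' m') (ρ : Fin m → Fin m') where

    liftN-sub : ∀ i → subT (liftN σ') ρ' (liftN σ i) ≡ liftN (subT σ' ρ' ∘ σ) i
    liftN-sub zero    = refl
    liftN-sub (suc i) = trans (subT-ren (liftN σ') ρ' suc id (σ i)) (sym (ren-subT suc id σ' ρ' (σ i)))

    liftS-sub : ∀ i → liftS ρ' (liftS ρ i) ≡ liftS (ρ' ∘ ρ) i
    liftS-sub zero    = refl
    liftS-sub (suc i) = refl

    upS-sub : ∀ i → subT (renT (λ j → j) suc ∘ σ') (liftS ρ') (renT (λ j → j) suc (σ i))
                   ≡ renT (λ j → j) suc (subT σ' ρ' (σ i))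
    upS-sub i = trans (subT-ren (renT id suc ∘ σ') (liftS ρ') id suc (σ i)) (sym (ren-subT id suc σ' ρ' (σ i)))

  subF-subF : ∀ {n m n' m' n'' m''} (σ' : Fin n' → Tm n'' m'') (ρ' : Fin m' → Fin m'')
    (σ : Fin n → Tm n' m') (ρ : Fin m → Fin m') φ →
    subF σ' ρ' (subF σ ρ φ) ≡ subF (subT σ' ρ' ∘ σ) (ρ' ∘ ρ) φ
  subF-subF σ' ρ' σ ρ (t ≤' s)  = cong₂ _≤'_ (subT-subT σ' ρ' σ ρ t) (subT-subT σ' ρ' σ ρ s)
  subF-subF σ' ρ' σ ρ (t ≐ s)   = cong₂ _≐_ (subT-subT σ' ρ' σ ρ t) (subT-subT σ' ρ' σ ρ s)
  subF-subF σ' ρ' σ ρ (X ≐S Y)  = refl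
  subF-subF σ' ρ' σ ρ (t ∈' X)  = cong (_∈' _) (subT-subT σ' ρ' σ ρ t)
  subF-subF σ' ρ' σ ρ ⊥'        = refl
  subF-subF σ' ρ' σ ρ (φ ⇒ ψ)   = cong₂ _⇒_ (subF-subF σ' ρ' σ ρ φ) (subF-subF σ' ρ' σ ρ ψ)
  subF-subF σ' ρ' σ ρ (φ ∧' ψ)  = cong₂ _∧'_ (subF-subF σ' ρ' σ ρ φ) (subF-subF σ' ρ' σ ρ ψ)
  subF-subF σ' ρ' σ ρ (φ ∨' ψ)  = cong₂ _∨'_ (subF-subF σ' ρ' σ ρ φ) (subF-subF σ' ρ' σ ρ ψ)
  subF-subF σ' ρ' σ ρ (∀N φ)    = cong ∀N (trans (subF-subF _ _ _ _ φ)
    (subF-cong (liftN-sub σ' ρ' σ ρ) (λ _ → refl) φ))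
  subF-subF σ' ρ' σ ρ (∃N φ)    = cong ∃N (trans (subF-subF _ _ _ _ φ)
    (subF-cong (liftN-sub σ' ρ' σ ρ) (λ _ → refl) φ))
  subF-subF σ' ρ' σ ρ (∀S φ)    = cong ∀S (trans (subF-subF _ _ _ _ φ)
    (subF-cong (upS-sub σ' ρ' σ ρ) (liftS-sub σ' ρ' σ ρ) φ))
  subF-subF σ' ρ' σ ρ (∃S φ)    = cong ∃S (trans (subF-subF _ _ _ _ φ)
    (subF-cong (upS-sub σ' ρ' σ ρ) (liftS-sub σ' ρ' σ ρ) φ))

  subF-id : ∀ {n m} (φ : Fm n m) → subF var id φ ≡ φ
  subF-id (t ≤' s) = cong₂ _≤'_ (subT-id t) (subT-id s)
  subF-id (t ≐ s)  = cong₂ _≐_ (subT-id t) (subT-id s)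
  subF-id (X ≐S Y) = refl
  subF-id (t ∈' X) = cong (_∈' X) (subT-id t)
  subF-id ⊥'       = refl
  subF-id (φ ⇒ ψ)  = cong₂ _⇒_ (subF-id φ) (subF-id ψ)
  subF-id (φ ∧' ψ) = cong₂ _∧'_ (subF-id φ) (subF-id ψ)
  subF-id (φ ∨' ψ) = cong₂ _∨'_ (subF-id φ) (subF-id ψ)
  subF-id (∀N φ)   = cong ∀N (trans (subF-cong (λ { zero → refl ; (suc j) → refl }) (λ _ → refl) φ) (subF-id φ))
  subF-id (∃N φ)   = cong ∃N (trans (subF-cong (λ { zero → refl ; (suc j) → refl }) (λ _ → refl) φ) (subF-id φ))
  subF-id (∀S φ)   = cong ∀S (trans (subF-cong (λ _ → refl) (λ { zero → refl ; (suc j) → refl }) φ) (subF-id φ))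
  subF-id (∃S φ)   = cong ∃S (trans (subF-cong (λ _ → refl) (λ { zero → refl ; (suc j) → refl }) φ) (subF-id φ))

  emb-sub : ∀ {n m n' m'} (σ : Fin n → Tm n' m') (ρ : Fin m → Fin m') φ → subF σ ρ (emb φ) ≡ emb φ
  emb-sub σ ρ φ = trans (subF-subF _ _ _ _ φ) (subF-cong (λ ()) (λ ()) φ)

  Σ0-sub : ∀ {n m n' m'} (σ : Fin n → Tm n' m') (ρ : Fin m → Fin m') {φ} → Σ0 φ → Σ0 (subF σ ρ φ)
  Σ0-sub σ ρ s≤  = s≤
  Σ0-sub σ ρ s≐  = s≐
  Σ0-sub σ ρ s≐S = s≐S
  Σ0-sub σ ρ s∈  = s∈
  Σ0-sub σ ρ s⊥  = s⊥
  Σ0-sub σ ρ (s⇒ a b) = s⇒ (Σ0-sub σ ρ a) (Σ0-sub σ ρ b)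
  Σ0-sub σ ρ (s∧ a b) = s∧ (Σ0-sub σ ρ a) (Σ0-sub σ ρ b)
  Σ0-sub σ ρ (s∨ a b) = s∨ (Σ0-sub σ ρ a) (Σ0-sub σ ρ b)
  Σ0-sub σ ρ (s∀≤ {t} a) rewrite trans (subT-ren (liftN σ) ρ suc id t) (sym (ren-subT suc id σ ρ t))
    = s∀≤ (Σ0-sub (liftN σ) ρ a)
  Σ0-sub σ ρ (s∃≤ {t} a) rewrite trans (subT-ren (liftN σ) ρ suc id t) (sym (ren-subT suc id σ ρ t))
    = s∃≤ (Σ0-sub (liftN σ) ρ a)
  Σ0-sub σ ρ (s∀< {t} a) rewrite trans (subT-ren (liftN σ) ρ suc id t) (sym (ren-subT suc id σ ρ t))
    = s∀< (Σ0-sub (liftN σ) ρ a)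
  Σ0-sub σ ρ (s∃< {t} a) rewrite trans (subT-ren (liftN σ) ρ suc id t) (sym (ren-subT suc id σ ρ t))
    = s∃< (Σ0-sub (liftN σ) ρ a)

  -- Axioms are needed at every realisation of their parameters by terms, so the comprehension
  -- scheme has to be closed under substitution.
  Comp-sub : ∀ {n m n' m'} (σ : Fin n → Tm n' m') (ρ : Fin m → Fin m') (φ : Fm (suc n) m) →
    subF σ ρ (Comp φ) ≡ Comp (subF (liftN σ) ρ φ)
  Comp-sub σ ρ φ = cong (λ ψ → ∀N (∃S ((len zero ≤' v0) ∧' ∀< v0 ((v0 ∈' zero) ⇔ ψ))))
    (trans (subF-subF _ _ _ _ φ) (trans (subF-cong eq (λ _ → refl) φ) (sym (subF-subF _ _ _ _ φ))))
    where
    eq : ∀ i → subT (liftN (renT (λ j → j) suc ∘ liftN σ)) (liftS ρ) (compShift i)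
             ≡ subT compShift suc (liftN σ i)
    eq zero    = refl
    eq (suc i) = trans (cong (renT suc id) (trans (cong (renT id suc) refl) refl))
       (trans (trans (cong (renT suc id) (trans (renT-sub id suc _) (trans (cong (subT var suc) (renT-sub suc id (σ i))) (subT-subT var suc (var ∘ suc) id (σ i)))))
         (ren-subT suc id (var ∘ suc) suc (σ i)))
       (sym (subT-ren compShift suc suc id (σ i))))

  -- Number and string parameters are named by ℕ.
  data PT : Set where
    par     : ℕ → PT
    o i     : PT
    _⊕_ _⊗_ : PT → PT → PT
    ln      : ℕ → PT

  record Clo : Set where
    constructor clo
    field
      {cn cm} : ℕ
      cφ : Fm cn cm
      cρ : Vec PT cn
      cτ : Vec ℕ cm

  module _ {n m} (η : ℕ → Tm n m) (κ : ℕ → Fin m) where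
    rT : PT → Tm n m
    rT (par c) = η c
    rT o       = `0
    rT i       = `1
    rT (s ⊕ t) = rT s `+ rT t
    rT (s ⊗ t) = rT s `* rT t
    rT (ln c)  = len (κ c)

    real : Clo → Fm n m
    real (clo φ ρ τ) = subF (rT ∘ lookup ρ) (κ ∘ lookup τ) φ

  infix 4 _⊩_
  -- A derivation between closures is a family over all scopes and all realisations of the
  -- parameters. Renaming is thereby built in: a parameter becomes an eigenvariable by the choice of
  -- another `η` or `κ`.
  record _⊩_ (Γ : List Clo) (Φ : Clo) : Set where
    constructor deriv
    field at : ∀ {n m} (η : ℕ → Tm n m) κ → map (real η κ) Γ ⊢ real η κ Φ
  open _⊩_

  instN-real : ∀ {a b n m} (η : ℕ → Tm n m) κ (φ : Fm (suc a) b) ρ τ t →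
    instN (subF (liftN (rT η κ ∘ lookup ρ)) (κ ∘ lookup τ) φ) (rT η κ t) ≡ real η κ (clo φ (t ∷ ρ) τ)
  instN-real η κ φ ρ τ t = trans (subF-subF _ _ _ _ φ) (subF-cong eq (λ _ → refl) φ)
    where
    eq : ∀ j → subT (consN (rT η κ t)) id (liftN (rT η κ ∘ lookup ρ) j) ≡ rT η κ (lookup (t ∷ ρ) j)
    eq zero    = refl
    eq (suc j) = trans (subT-ren _ _ suc id (rT η κ (lookup ρ j))) (subT-id _)

  instS-real : ∀ {a b n m} (η : ℕ → Tm n m) κ (φ : Fm a (suc b)) ρ τ c →
    instS (subF (renT (λ j → j) suc ∘ rT η κ ∘ lookup ρ) (liftS (κ ∘ lookup τ)) φ) (κ c)
    ≡ real η κ (clo φ ρ (c ∷ τ))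
  instS-real η κ φ ρ τ c = trans (subF-subF _ _ _ _ φ) (subF-cong
      (λ j → trans (subT-ren var (consS (κ c)) id suc (rT η κ (lookup ρ j))) (subT-id _)) eq φ)
    where
    eq : ∀ j → consS (κ c) (liftS (κ ∘ lookup τ) j) ≡ κ (lookup (c ∷ τ) j)
    eq zero    = refl
    eq (suc j) = refl

  instN-v0 : ∀ {n m} (φ : Fm (suc n) m) → instN (subF (liftN (var ∘ suc)) id φ) v0 ≡ φ
  instN-v0 φ = trans (subF-subF _ _ _ _ φ) (trans (subF-cong (λ { zero → refl ; (suc j) → refl }) (λ _ → refl) φ) (subF-id φ))

  instS-0 : ∀ {n m} (φ : Fm n (suc m)) → instS (subF (renT (λ j → j) suc ∘ var) (liftS suc) φ) zero ≡ φ
  instS-0 φ = trans (subF-subF _ _ _ _ φ) (trans (subF-cong (λ _ → refl) (λ { zero → refl ; (suc j) → refl }) φ) (subF-id φ))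

  LtT : ℕ → PT → Set
  LtT c (par d) = d < c
  LtT c o       = ⊤
  LtT c i       = ⊤
  LtT c (s ⊕ t) = LtT c s × LtT c t
  LtT c (s ⊗ t) = LtT c s × LtT c t
  LtT c (ln d)  = d < c

  LtC : ℕ → Clo → Set
  LtC c (clo φ ρ τ) = (∀ j → LtT c (lookup ρ j)) × (∀ j → lookup τ j < c)

  LtT-mono : ∀ {c d} → c ≤ d → ∀ t → LtT c t → LtT d t
  LtT-mono p (par _) q = ℕ.<-≤-trans q p
  LtT-mono p o q = tt
  LtT-mono p i q = tt
  LtT-mono p (s ⊕ t) (q , r) = LtT-mono p s q , LtT-mono p t r
  LtT-mono p (s ⊗ t) (q , r) = LtT-mono p s q , LtT-mono p t r
  LtT-mono p (ln _) q = ℕ.<-≤-trans q p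

  LtC-mono : ∀ {c d} → c ≤ d → ∀ Φ → LtC c Φ → LtC d Φ
  LtC-mono p (clo φ ρ τ) (q , r) = (λ j → LtT-mono p (lookup ρ j) (q j)) , (λ j → ℕ.<-≤-trans (r j) p)

  module _ {A : Set} (c : ℕ) (new : A) (old : ℕ → A) where
    upd : ℕ → A
    upd d with d ℕ.≟ c
    ... | yes _ = new
    ... | no _  = old d
    upd-eq : upd c ≡ new
    upd-eq with c ℕ.≟ c
    ... | yes _ = refl
    ... | no p  = ⊥-elim (p refl)
    upd-lt : ∀ {d} → d < c → upd d ≡ old d
    upd-lt {d} p with d ℕ.≟ c
    ... | yes refl = ⊥-elim (ℕ.<-irrefl refl p)
    ... | no _     = refl

  module _ {n m} (η : ℕ → Tm n m) (κ : ℕ → Fin m) (c : ℕ) where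
    ηN : ℕ → Tm (suc n) m
    ηN = upd c (var zero) (↑T ∘ η)
    ηS : ℕ → Tm n (suc m)
    ηS = renT (λ j → j) suc ∘ η
    κS : ℕ → Fin (suc m)
    κS = upd c zero (suc ∘ κ)

    rT-N : ∀ t → LtT c t → rT ηN κ t ≡ renT suc id (rT η κ t)
    rT-N (par d) p = upd-lt c _ _ p
    rT-N o p = refl
    rT-N i p = refl
    rT-N (s ⊕ t) (p , q) = cong₂ _`+_ (rT-N s p) (rT-N t q)
    rT-N (s ⊗ t) (p , q) = cong₂ _`*_ (rT-N s p) (rT-N t q)
    rT-N (ln d) p = refl

    rT-S : ∀ t → LtT c t → rT ηS κS t ≡ renT id suc (rT η κ t)
    rT-S (par d) p = refl
    rT-S o p = refl
    rT-S i p = refl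
    rT-S (s ⊕ t) (p , q) = cong₂ _`+_ (rT-S s p) (rT-S t q)
    rT-S (s ⊗ t) (p , q) = cong₂ _`*_ (rT-S s p) (rT-S t q)
    rT-S (ln d) p = cong len (upd-lt c _ _ p)

    real-N : ∀ Φ → LtC c Φ → real ηN κ Φ ≡ wkN (real η κ Φ)
    real-N (clo φ ρ τ) (p , q) = trans (subF-cong (λ j → trans (rT-N _ (p j)) (renT-sub suc id _)) (λ _ → refl) φ)
      (sym (subF-subF _ _ _ _ φ))

    real-S : ∀ Φ → LtC c Φ → real ηS κS Φ ≡ wkS (real η κ Φ)
    real-S (clo φ ρ τ) (p , q) = trans (subF-cong (λ j → trans (rT-S _ (p j)) (renT-sub id suc _))
      (λ j → upd-lt c _ _ (q j)) φ) (sym (subF-subF _ _ _ _ φ))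

    map-N : ∀ Γ → All (LtC c) Γ → map (real ηN κ) Γ ≡ map wkN (map (real η κ) Γ)
    map-N [] [] = refl
    map-N (Φ ∷ Γ) (p ∷ ps) = cong₂ _∷_ (real-N Φ p) (map-N Γ ps)

    map-S : ∀ Γ → All (LtC c) Γ → map (real ηS κS) Γ ≡ map wkS (map (real η κ) Γ)
    map-S [] [] = refl
    map-S (Φ ∷ Γ) (p ∷ ps) = cong₂ _∷_ (real-S Φ p) (map-S Γ ps)

  weaken : ∀ {n m} {Γ Δ : List (Fm n m)} {φ} → Γ ⊆ Δ → Γ ⊢ φ → Δ ⊢ φ
  weaken s (hyp x)        = hyp (s x)
  weaken s (ax x)         = ax x
  weaken s (raa d)        = raa (weaken (∷⁺ʳ _ s) d)
  weaken s (⇒I d)         = ⇒I (weaken (∷⁺ʳ _ s) d)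
  weaken s (⇒E d e)       = ⇒E (weaken s d) (weaken s e)
  weaken s (∧I d e)       = ∧I (weaken s d) (weaken s e)
  weaken s (∧E₁ d)        = ∧E₁ (weaken s d)
  weaken s (∧E₂ d)        = ∧E₂ (weaken s d)
  weaken s (∨I₁ d)        = ∨I₁ (weaken s d)
  weaken s (∨I₂ d)        = ∨I₂ (weaken s d)
  weaken s (∨E d e f)     = ∨E (weaken s d) (weaken (∷⁺ʳ _ s) e) (weaken (∷⁺ʳ _ s) f)
  weaken s (∀NI d)        = ∀NI (weaken (map⁺ wkN s) d)
  weaken s (∀NE d t)      = ∀NE (weaken s d) t
  weaken s (∃NI t d)      = ∃NI t (weaken s d)
  weaken s (∃NE d e)      = ∃NE (weaken s d) (weaken (∷⁺ʳ _ (map⁺ wkN s)) e)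
  weaken s (∀SI d)        = ∀SI (weaken (map⁺ wkS s) d)
  weaken s (∀SE d t)      = ∀SE (weaken s d) t
  weaken s (∃SI t d)      = ∃SI t (weaken s d)
  weaken s (∃SE d e)      = ∃SE (weaken s d) (weaken (∷⁺ʳ _ (map⁺ wkS s)) e)
  weaken s ≐refl          = ≐refl
  weaken s (≐subst φ d e) = ≐subst φ (weaken s d) (weaken s e)
  weaken s ≐Srefl         = ≐Srefl
  weaken s (≐Ssubst φ d e) = ≐Ssubst φ (weaken s d) (weaken s e)

  castD : ∀ {n m} {Γ : List (Fm n m)} {φ ψ} → φ ≡ ψ → Γ ⊢ φ → Γ ⊢ ψ
  castD refl d = d

  ⊥C : Clo
  ⊥C = clo ⊥' [] []

  -- The parameter `c` is realised by a new variable. The remaining hypotheses only mention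
  -- parameters below `c`, so they turn into weakenings and the existential can be eliminated.
  fresh-N : ∀ {a b} c (φ : Fm (suc a) b) ρ τ Γ → LtC c (clo (∃N φ) ρ τ) → All (LtC c) Γ →
    (clo φ (par c ∷ ρ) τ ∷ Γ) ⊩ ⊥C → (clo (∃N φ) ρ τ ∷ Γ) ⊩ ⊥C
  fresh-N c φ ρ τ Γ (p , q) ps d = deriv λ η κ → ∃NE (hyp (here refl))
      (weaken (∷⁺ʳ _ there) (subst (_⊢ ⊥') (eq η κ) (at d (ηN η κ c) κ)))
    where
    e0 : ∀ {n m} (η : ℕ → Tm n m) κ → real (ηN η κ c) κ (clo φ (par c ∷ ρ) τ) ≡ subF (liftN (rT η κ ∘ lookup ρ)) (κ ∘ lookup τ) φ
    e0 η κ = subF-cong (λ { zero → upd-eq c _ _ ; (suc j) → rT-N η κ c _ (p j) }) (λ _ → refl) φ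
    eq : ∀ {n m} (η : ℕ → Tm n m) κ → _
    eq η κ = cong₂ _∷_ (e0 η κ) (map-N η κ c Γ ps)

  fresh-S : ∀ {a b} c (φ : Fm a (suc b)) ρ τ Γ → LtC c (clo (∃S φ) ρ τ) → All (LtC c) Γ →
    (clo φ ρ (c ∷ τ) ∷ Γ) ⊩ ⊥C → (clo (∃S φ) ρ τ ∷ Γ) ⊩ ⊥C
  fresh-S c φ ρ τ Γ (p , q) ps d = deriv λ η κ → ∃SE (hyp (here refl))
      (weaken (∷⁺ʳ _ there) (subst (_⊢ ⊥') (eq η κ) (at d (ηS η κ c) (κS η κ c))))
    where
    e0 : ∀ {n m} (η : ℕ → Tm n m) κ → real (ηS η κ c) (κS η κ c) (clo φ ρ (c ∷ τ))
       ≡ subF (renT (λ j → j) suc ∘ rT η κ ∘ lookup ρ) (liftS (κ ∘ lookup τ)) φ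
    e0 η κ = subF-cong (λ j → rT-S η κ c _ (p j)) (λ { zero → upd-eq c _ _ ; (suc j) → upd-lt c _ _ (q j) }) φ
    eq : ∀ {n m} (η : ℕ → Tm n m) κ → _
    eq η κ = cong₂ _∷_ (e0 η κ) (map-S η κ c Γ ps)

  -- The code of a closure exceeds every parameter occurring in it, so stage s may use s as a fresh witness.

  decFin : ∀ n → ℕ → Maybe (Fin n)
  decFin zero    _       = nothing
  decFin (suc n) zero    = just zero
  decFin (suc n) (suc k) = decFin n k >>= (just ∘ suc)

  decFin-toℕ : ∀ {n} (j : Fin n) → decFin n (toℕ j) ≡ just j
  decFin-toℕ zero = refl
  decFin-toℕ (suc j) rewrite decFin-toℕ j = refl

  encT : ∀ {n m} → Tm n m → Tree
  encT (var j)  = nd (lf 0) (lf (toℕ j))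
  encT `0       = nd (lf 1) (lf 0)
  encT `1       = nd (lf 2) (lf 0)
  encT (t `+ s) = nd (lf 3) (nd (encT t) (encT s))
  encT (t `* s) = nd (lf 4) (nd (encT t) (encT s))
  encT (len X)  = nd (lf 5) (lf (toℕ X))

  decT : ∀ n m → Tree → Maybe (Tm n m)
  decT n m (nd (lf 0) (lf k)) = decFin n k >>= (just ∘ var)
  decT n m (nd (lf 1) _) = just `0
  decT n m (nd (lf 2) _) = just `1
  decT n m (nd (lf 3) (nd s t)) = decT n m s >>= λ a → decT n m t >>= λ b → just (a `+ b)
  decT n m (nd (lf 4) (nd s t)) = decT n m s >>= λ a → decT n m t >>= λ b → just (a `* b)
  decT n m (nd (lf 5) (lf k)) = decFin m k >>= (just ∘ len)
  decT n m _ = nothing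

  dec-encT : ∀ {n m} (t : Tm n m) → decT n m (encT t) ≡ just t
  dec-encT (var j) rewrite decFin-toℕ j = refl
  dec-encT `0 = refl
  dec-encT `1 = refl
  dec-encT (t `+ s) rewrite dec-encT t | dec-encT s = refl
  dec-encT (t `* s) rewrite dec-encT t | dec-encT s = refl
  dec-encT (len X) rewrite decFin-toℕ X = refl

  encF : ∀ {n m} → Fm n m → Tree
  encF (t ≤' s) = nd (lf 0) (nd (encT t) (encT s))
  encF (t ≐ s)  = nd (lf 1) (nd (encT t) (encT s))
  encF (X ≐S Y) = nd (lf 2) (nd (lf (toℕ X)) (lf (toℕ Y)))
  encF (t ∈' X) = nd (lf 3) (nd (encT t) (lf (toℕ X)))
  encF ⊥'       = nd (lf 4) (lf 0)
  encF (φ ⇒ ψ)  = nd (lf 5) (nd (encF φ) (encF ψ))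
  encF (φ ∧' ψ) = nd (lf 6) (nd (encF φ) (encF ψ))
  encF (φ ∨' ψ) = nd (lf 7) (nd (encF φ) (encF ψ))
  encF (∀N φ)   = nd (lf 8) (encF φ)
  encF (∃N φ)   = nd (lf 9) (encF φ)
  encF (∀S φ)   = nd (lf 10) (encF φ)
  encF (∃S φ)   = nd (lf 11) (encF φ)

  decF : ∀ n m → Tree → Maybe (Fm n m)
  decF n m (nd (lf 0) (nd s t)) = decT n m s >>= λ a → decT n m t >>= λ b → just (a ≤' b)
  decF n m (nd (lf 1) (nd s t)) = decT n m s >>= λ a → decT n m t >>= λ b → just (a ≐ b)
  decF n m (nd (lf 2) (nd (lf j) (lf k))) = decFin m j >>= λ a → decFin m k >>= λ b → just (a ≐S b)
  decF n m (nd (lf 3) (nd s (lf k))) = decT n m s >>= λ a → decFin m k >>= λ b → just (a ∈' b)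
  decF n m (nd (lf 4) _) = just ⊥'
  decF n m (nd (lf 5) (nd s t)) = decF n m s >>= λ a → decF n m t >>= λ b → just (a ⇒ b)
  decF n m (nd (lf 6) (nd s t)) = decF n m s >>= λ a → decF n m t >>= λ b → just (a ∧' b)
  decF n m (nd (lf 7) (nd s t)) = decF n m s >>= λ a → decF n m t >>= λ b → just (a ∨' b)
  decF n m (nd (lf 8) s)  = decF (suc n) m s >>= (just ∘ ∀N)
  decF n m (nd (lf 9) s)  = decF (suc n) m s >>= (just ∘ ∃N)
  decF n m (nd (lf 10) s) = decF n (suc m) s >>= (just ∘ ∀S)
  decF n m (nd (lf 11) s) = decF n (suc m) s >>= (just ∘ ∃S)
  decF n m _ = nothing

  dec-encF : ∀ {n m} (φ : Fm n m) → decF n m (encF φ) ≡ just φ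
  dec-encF (t ≤' s) rewrite dec-encT t | dec-encT s = refl
  dec-encF (t ≐ s) rewrite dec-encT t | dec-encT s = refl
  dec-encF (X ≐S Y) rewrite decFin-toℕ X | decFin-toℕ Y = refl
  dec-encF (t ∈' X) rewrite dec-encT t | decFin-toℕ X = refl
  dec-encF ⊥' = refl
  dec-encF (φ ⇒ ψ) rewrite dec-encF φ | dec-encF ψ = refl
  dec-encF (φ ∧' ψ) rewrite dec-encF φ | dec-encF ψ = refl
  dec-encF (φ ∨' ψ) rewrite dec-encF φ | dec-encF ψ = refl
  dec-encF (∀N φ) rewrite dec-encF φ = refl
  dec-encF (∃N φ) rewrite dec-encF φ = refl
  dec-encF (∀S φ) rewrite dec-encF φ = refl
  dec-encF (∃S φ) rewrite dec-encF φ = refl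

  encP : PT → Tree
  encP (par c) = nd (lf 0) (lf c)
  encP o       = nd (lf 1) (lf 0)
  encP i       = nd (lf 2) (lf 0)
  encP (s ⊕ t) = nd (lf 3) (nd (encP s) (encP t))
  encP (s ⊗ t) = nd (lf 4) (nd (encP s) (encP t))
  encP (ln c)  = nd (lf 5) (lf c)

  decP : Tree → Maybe PT
  decP (nd (lf 0) (lf k)) = just (par k)
  decP (nd (lf 1) _) = just o
  decP (nd (lf 2) _) = just i
  decP (nd (lf 3) (nd s t)) = decP s >>= λ a → decP t >>= λ b → just (a ⊕ b)
  decP (nd (lf 4) (nd s t)) = decP s >>= λ a → decP t >>= λ b → just (a ⊗ b)
  decP (nd (lf 5) (lf k)) = just (ln k)
  decP _ = nothing

  dec-encP : ∀ t → decP (encP t) ≡ just t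
  dec-encP (par _) = refl
  dec-encP o = refl
  dec-encP i = refl
  dec-encP (t ⊕ s) rewrite dec-encP t | dec-encP s = refl
  dec-encP (t ⊗ s) rewrite dec-encP t | dec-encP s = refl
  dec-encP (ln _) = refl

  encV : ∀ {n} {A : Set} → (A → Tree) → Vec A n → Tree
  encV f []       = lf 0
  encV f (x ∷ xs) = nd (f x) (encV f xs)

  decV : ∀ {A : Set} → (Tree → Maybe A) → ∀ n → Tree → Maybe (Vec A n)
  decV f zero    _        = just []
  decV f (suc n) (nd s t) = f s >>= λ a → decV f n t >>= λ b → just (a ∷ b)
  decV f (suc n) (lf _)   = nothing

  dec-encV : ∀ {n} {A : Set} (f : A → Tree) (g : Tree → Maybe A) → (∀ a → g (f a) ≡ just a) →
    (xs : Vec A n) → decV g n (encV f xs) ≡ just xs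
  dec-encV f g p [] = refl
  dec-encV f g p (x ∷ xs) rewrite p x | dec-encV f g p xs = refl

  declf : Tree → Maybe ℕ
  declf (lf n) = just n
  declf (nd _ _) = nothing

  encC : Clo → Tree
  encC (clo {n} {m} φ ρ τ) = nd (nd (lf n) (lf m)) (nd (encF φ) (nd (encV encP ρ) (encV lf τ)))

  decC : Tree → Maybe Clo
  decC (nd (nd (lf n) (lf m)) (nd s (nd t u))) =
    decF n m s >>= λ a → decV decP n t >>= λ b → decV declf m u >>= λ c → just (clo a b c)
  decC _ = nothing

  dec-encC : ∀ Φ → decC (encC Φ) ≡ just Φ
  dec-encC (clo φ ρ τ) rewrite dec-encF φ | dec-encV encP decP dec-encP ρ
    | dec-encV lf declf (λ _ → refl) τ = refl

  code : Clo → ℕ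
  code = # ∘ encC

  code-inj : ∀ Φ Ψ → code Φ ≡ code Ψ → Φ ≡ Ψ
  code-inj Φ Ψ e = just-injective (trans (sym (dec-encC Φ)) (trans (cong decC (#-inj _ _ e)) (dec-encC Ψ)))

  LtT-enc : ∀ t {d} → # (encP t) ≤ d → LtT d t
  LtT-enc (par c) p = lf< c (ℕ.≤-trans (#ʳ (lf 0) (lf c)) p)
  LtT-enc o p = tt
  LtT-enc i p = tt
  LtT-enc (s ⊕ t) p = let q = ℕ.≤-trans (#ʳ (lf 3) (nd (encP s) (encP t))) p in
    LtT-enc s (ℕ.≤-trans (#ˡ (encP s) (encP t)) q) , LtT-enc t (ℕ.≤-trans (#ʳ (encP s) (encP t)) q)
  LtT-enc (s ⊗ t) p = let q = ℕ.≤-trans (#ʳ (lf 4) (nd (encP s) (encP t))) p in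
    LtT-enc s (ℕ.≤-trans (#ˡ (encP s) (encP t)) q) , LtT-enc t (ℕ.≤-trans (#ʳ (encP s) (encP t)) q)
  LtT-enc (ln c) p = lf< c (ℕ.≤-trans (#ʳ (lf 5) (lf c)) p)

  encV-≤ : ∀ {n} {A : Set} (f : A → Tree) (xs : Vec A n) j → # (f (lookup xs j)) ≤ # (encV f xs)
  encV-≤ f (x ∷ xs) zero    = #ˡ (f x) (encV f xs)
  encV-≤ f (x ∷ xs) (suc j) = ℕ.≤-trans (encV-≤ f xs j) (#ʳ (f x) (encV f xs))

  LtC-code : ∀ Φ → LtC (code Φ) Φ
  LtC-code (clo {n} {m} φ ρ τ) =
      (λ j → LtT-enc (lookup ρ j) (ℕ.≤-trans (encV-≤ encP ρ j) (ℕ.≤-trans (#ˡ er et) up)))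
    , (λ j → lf< (lookup τ j) (ℕ.≤-trans (encV-≤ lf τ j) (ℕ.≤-trans (#ʳ er et) up)))
    where
    er = encV encP ρ
    et = encV lf τ
    up = ℕ.≤-trans (#ʳ (encF φ) (nd er et)) (#ʳ (nd (lf n) (lf m)) (nd (encF φ) (nd er et)))

  -- Maximal Henkin theory and its term model.

  module Henkin (Φ₀ : Fm 0 0) where

    -- One variable of each sort is kept in scope, so that every parameter has a realisation once
    -- only the root hypothesis is left.
    𝕆 : Set
    𝕆 = _⊢_ {1} {1} (¬' (emb Φ₀) ∷ []) ⊥'

    root : Clo
    root = clo (¬' Φ₀) [] []

    weak : ∀ {Γ Δ Φ} → Γ ⊆ Δ → Γ ⊩ Φ → Δ ⊩ Φ
    weak s d = deriv λ η κ → weaken (map⁺ (real η κ) s) (at d η κ)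

    data HenOf (s : ℕ) : Clo → Clo → Set where
      hN : ∀ {a b} {φ : Fm (suc a) b} {ρ τ} → HenOf s (clo (∃N φ) ρ τ) (clo φ (par s ∷ ρ) τ)
      hS : ∀ {a b} {φ : Fm a (suc b)} {ρ τ} → HenOf s (clo (∃S φ) ρ τ) (clo φ ρ (s ∷ τ))

    -- Stage s settles the unique closure Ψ of code s: it is adopted if refuting it would give 𝕆,
    -- and an adopted existential is adopted together with its witness named s.
    mutual
      T : ℕ → Clo → Set
      T zero    Φ = Φ ≡ root
      T (suc s) Φ = T s Φ ⊎ (Adopted s Φ ⊎ Σ Clo λ Ψ → Adopted s Ψ × HenOf s Ψ Φ)

      Adopted : ℕ → Clo → Set
      Adopted s Φ = code Φ ≡ s × (Bad s Φ → 𝕆)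

      Bad : ℕ → Clo → Set
      Bad s Φ = Σ (List Clo) λ Γ → All (T s) Γ × ((Φ ∷ Γ) ⊩ ⊥C)

    T-Lt : ∀ s {Φ} → T s Φ → LtC s Φ
    T-Lt zero refl = (λ ()) , (λ ())
    T-Lt (suc s) {Φ} (inj₁ x) = LtC-mono (ℕ.n≤1+n s) Φ (T-Lt s x)
    T-Lt (suc s) {Φ} (inj₂ (inj₁ (refl , _))) = LtC-mono (ℕ.n≤1+n s) Φ (LtC-code Φ)
    T-Lt (suc s) (inj₂ (inj₂ (Ψ , (refl , _) , hN))) with LtC-mono (ℕ.n≤1+n s) Ψ (LtC-code Ψ)
    ... | p , q = (λ { zero → ℕ.≤-refl ; (suc j) → p j }) , q
    T-Lt (suc s) (inj₂ (inj₂ (Ψ , (refl , _) , hS))) with LtC-mono (ℕ.n≤1+n s) Ψ (LtC-code Ψ)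
    ... | p , q = p , (λ { zero → ℕ.≤-refl ; (suc j) → q j })

    T-mono : ∀ {s s'} → s ≤ s' → ∀ {Φ} → T s Φ → T s' Φ
    T-mono {s} {s'} p x = go (ℕ.≤⇒≤′ p) x
      where
      open import Data.Nat using (_≤′_; ≤′-refl; ≤′-step)
      go : ∀ {s'} → s ≤′ s' → ∀ {Φ} → T s Φ → T s' Φ
      go ≤′-refl x = x
      go (≤′-step p) x = inj₁ (go p x)

    Split : ℕ → Clo → List Clo → Set
    Split s Ψ Γ = Σ (List Clo) λ Γ' → All (T s) Γ' ×
      (∀ {Φ} → Φ ∈ Γ → (Φ ∈ Γ') ⊎ ((Φ ≡ Ψ) ⊎ HenOf s Ψ Φ))

    -- Codes are injective, so a single closure is settled at stage `s`: a member of the next stage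
    -- is old, or is `Ψ`, or is the witness of `Ψ`.
    split : ∀ s Ψ Γ → code Ψ ≡ s → All (T (suc s)) Γ → Split s Ψ Γ
    split s Ψ [] e [] = [] , [] , λ ()
    split s Ψ (Φ ∷ Γ) e (x ∷ xs) with split s Ψ Γ e xs
    split s Ψ (Φ ∷ Γ) e (inj₁ t ∷ xs) | Γ' , ts , f = Φ ∷ Γ' , t ∷ ts ,
      λ { (here refl) → inj₁ (here refl) ; (there y) → [ inj₁ ∘ there , inj₂ ]′ (f y) }
    split s Ψ (Φ ∷ Γ) e (inj₂ (inj₁ (e' , _)) ∷ xs) | Γ' , ts , f = Γ' , ts ,
      λ { (here refl) → inj₂ (inj₁ (code-inj Φ Ψ (trans e' (sym e)))) ; (there y) → f y }
    split s Ψ (Φ ∷ Γ) e (inj₂ (inj₂ (Ψ' , (e' , _) , h)) ∷ xs) | Γ' , ts , f = Γ' , ts ,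
      λ { (here refl) → inj₂ (inj₂ (subst (λ z → HenOf s z Φ) (code-inj Ψ' Ψ (trans e' (sym e))) h)) ; (there y) → f y }

    dup : ∀ {Ψ : Clo} {Γ} → (Ψ ∷ Ψ ∷ Γ) ⊆ (Ψ ∷ Γ)
    dup (here p) = here p
    dup (there q) = q

    -- An inconsistency at the next stage is pushed back onto `Ψ` alone. The witness of an
    -- existential `Ψ` bears the name `s`, which occurs neither in `Ψ` nor in the earlier stages, so
    -- it can be eliminated.
    bad : ∀ s Ψ Γ → code Ψ ≡ s → All (T (suc s)) Γ → Γ ⊩ ⊥C → Bad s Ψ
    bad s Ψ Γ e xs d with split s Ψ Γ e xs
    ... | Γ' , ts , f = Γ' , ts , body Ψ e f
      where
      lts : All (LtC s) Γ'
      lts = All.map (T-Lt s) ts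
      body : ∀ Ψ → code Ψ ≡ s → (∀ {Φ} → Φ ∈ Γ → (Φ ∈ Γ') ⊎ ((Φ ≡ Ψ) ⊎ HenOf s Ψ Φ)) → (Ψ ∷ Γ') ⊩ ⊥C
      plain : ∀ Ψ → (∀ {Φ} → Φ ∈ Γ → (Φ ∈ Γ') ⊎ ((Φ ≡ Ψ) ⊎ HenOf s Ψ Φ)) → (∀ {Φ} → ¬ HenOf s Ψ Φ) → (Ψ ∷ Γ') ⊩ ⊥C
      plain Ψ f none = weak (λ y → [ there , [ here , (λ h → ⊥-elim (none h)) ]′ ]′ (f y)) d
      -- `Ψ` is used twice, as a hypothesis of its own and as the source of its witness; `dup`
      -- contracts the two copies.
      body Ψ@(clo (∃N φ) ρ τ) refl f = weak dup (fresh-N s φ ρ τ (Ψ ∷ Γ') (LtC-code Ψ) (LtC-code Ψ ∷ lts)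
        (weak (λ y → [ there ∘ there , [ there ∘ here , (λ { hN → here refl }) ]′ ]′ (f y)) d))
      body Ψ@(clo (∃S φ) ρ τ) refl f = weak dup (fresh-S s φ ρ τ (Ψ ∷ Γ') (LtC-code Ψ) (LtC-code Ψ ∷ lts)
        (weak (λ y → [ there ∘ there , [ there ∘ here , (λ { hS → here refl }) ]′ ]′ (f y)) d))
      body Ψ@(clo (_ ≤' _) ρ τ) e f = plain Ψ f λ ()
      body Ψ@(clo (_ ≐ _) ρ τ) e f = plain Ψ f λ ()
      body Ψ@(clo (_ ≐S _) ρ τ) e f = plain Ψ f λ ()
      body Ψ@(clo (_ ∈' _) ρ τ) e f = plain Ψ f λ ()
      body Ψ@(clo ⊥' ρ τ) e f = plain Ψ f λ ()
      body Ψ@(clo (_ ⇒ _) ρ τ) e f = plain Ψ f λ ()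
      body Ψ@(clo (_ ∧' _) ρ τ) e f = plain Ψ f λ ()
      body Ψ@(clo (_ ∨' _) ρ τ) e f = plain Ψ f λ ()
      body Ψ@(clo (∀N _) ρ τ) e f = plain Ψ f λ ()
      body Ψ@(clo (∀S _) ρ τ) e f = plain Ψ f λ ()

    -- Whether a closure has been adopted is undecidable, but membership carries its evidence. If a
    -- context contains anything new, that evidence includes a map from `Bad` to `𝕆`, and this is
    -- all that the consistency proof `con` needs.
    new? : ∀ s Γ → All (T (suc s)) Γ → All (T s) Γ ⊎ Σ Clo (Adopted s)
    new? s [] [] = inj₁ []
    new? s (Φ ∷ Γ) (inj₂ (inj₁ a) ∷ xs) = inj₂ (Φ , a)
    new? s (Φ ∷ Γ) (inj₂ (inj₂ (Ψ , a , _)) ∷ xs) = inj₂ (Ψ , a)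
    new? s (Φ ∷ Γ) (inj₁ t ∷ xs) with new? s Γ xs
    ... | inj₁ ts = inj₁ (t ∷ ts)
    ... | inj₂ a  = inj₂ a

    Prov : ℕ → Clo → Set
    Prov s Φ = Σ (List Clo) λ Γ → All (T s) Γ × (Γ ⊩ Φ)

    con : ∀ s → Prov s ⊥C → 𝕆
    con zero (Γ , ts , d) = subst (λ z → (z ∷ []) ⊢ ⊥') (cong (_⇒ ⊥') (subF-cong (λ ()) (λ ()) Φ₀))
      (at (weak {Δ = root ∷ []} (λ y → here (All.lookup ts y)) d) (λ _ → var zero) (λ _ → zero))
    con (suc s) (Γ , ts , d) with new? s Γ ts
    ... | inj₁ ts' = con s (Γ , ts' , d)
    ... | inj₂ (Ψ , e , ok) = ok (bad s Ψ Γ e ts d)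

    Th : Clo → Set
    Th Φ = Σ ℕ λ s → Prov s Φ

    join : ∀ {s s' Γ Γ'} → All (T s) Γ → All (T s') Γ' → All (T (s + s')) (Γ ++ Γ')
    join {s} {s'} p q = Allₚ.++⁺ (All.map (T-mono (ℕ.m≤m+n s s')) p) (All.map (T-mono (ℕ.m≤n+m s' s)) q)

    th1 : ∀ {Φ Ψ} → (∀ {n m} (η : ℕ → Tm n m) κ {Δ} → Δ ⊢ real η κ Φ → Δ ⊢ real η κ Ψ) → Th Φ → Th Ψ
    th1 f (s , Γ , ts , d) = s , Γ , ts , deriv λ η κ → f η κ (at d η κ)

    th2 : ∀ {Φ Ψ Ω} → (∀ {n m} (η : ℕ → Tm n m) κ {Δ} → Δ ⊢ real η κ Φ → Δ ⊢ real η κ Ψ → Δ ⊢ real η κ Ω) →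
      Th Φ → Th Ψ → Th Ω
    th2 f (s , Γ , ts , d) (s' , Γ' , ts' , d') = s + s' , Γ ++ Γ' , join ts ts' ,
      deriv λ η κ → f η κ (at (weak {Δ = Γ ++ Γ'} ∈-++⁺ˡ d) η κ) (at (weak {Δ = Γ ++ Γ'} (∈-++⁺ʳ Γ) d') η κ)

    th0 : ∀ {Φ} → (∀ {n m} (η : ℕ → Tm n m) κ {Δ} → Δ ⊢ real η κ Φ) → Th Φ
    th0 f = 0 , [] , [] , deriv λ η κ → f η κ

    -- Maximality: the stage given by the code of `Φ` adopts it, because refuting it there would
    -- give `𝕆`.
    max : ∀ {Φ} → (∀ s → Bad s Φ → 𝕆) → Th Φ
    max {Φ} h = suc (code Φ) , (Φ ∷ []) , (inj₂ (inj₁ (refl , h (code Φ))) ∷ []) , deriv λ η κ → hyp (here refl)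

    by-⊥ : Th ⊥C → 𝕆
    by-⊥ (s , p) = con s p

    refute : ∀ {Φ Ψ} → (∀ {n m} (η : ℕ → Tm n m) κ {Δ} → Δ ⊢ real η κ Φ ⇒ ⊥' → Δ ⊢ real η κ Ψ) →
      ∀ {s} → Bad s Φ → Th Ψ
    refute f {s} (Γ , ts , d) = s , Γ , ts , deriv λ η κ → f η κ (⇒I (at d η κ))

    cut : ∀ {Φ s} → Bad s Φ → Th Φ → 𝕆
    cut {Φ} b t = by-⊥ (th2 {clo (Clo.cφ Φ ⇒ ⊥') (Clo.cρ Φ) (Clo.cτ Φ)} (λ η κ → ⇒E)
      (refute {Φ} (λ η κ d → d) b) t)

    stabTh : ∀ {Φ} → ((Th Φ → 𝕆) → 𝕆) → Th Φ
    stabTh h = max λ s b → h (cut b)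

    notTh : ∀ {a b} {φ : Fm a b} {ρ τ} → (Th (clo φ ρ τ) → 𝕆) → Th (clo (¬' φ) ρ τ)
    notTh {φ = φ} {ρ} {τ} h = max λ s b → h (refute {clo (¬' φ) ρ τ} {clo φ ρ τ} (λ η κ d → raa (⇒E (weaken there d) (hyp (here refl)))) b)

    -- A derivable existential is adopted, since a refutation would be cut against its derivation.
    -- Its witness is then known by name, without any search; this is why ∃ can be interpreted
    -- strongly.
    exN : ∀ {a b} {φ : Fm (suc a) b} {ρ τ} → Th (clo (∃N φ) ρ τ) → Σ PT λ t → Th (clo φ (t ∷ ρ) τ)
    exN {φ = φ} {ρ} {τ} t = par s , suc s , (clo φ (par s ∷ ρ) τ ∷ []) ,
        (inj₂ (inj₂ (_ , (refl , (λ b → cut b t)) , hN)) ∷ []) , deriv λ η κ → hyp (here refl)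
      where s = code (clo (∃N φ) ρ τ)

    exS : ∀ {a b} {φ : Fm a (suc b)} {ρ τ} → Th (clo (∃S φ) ρ τ) → Σ ℕ λ c → Th (clo φ ρ (c ∷ τ))
    exS {φ = φ} {ρ} {τ} t = s , suc s , (clo φ ρ (s ∷ τ) ∷ []) ,
        (inj₂ (inj₂ (_ , (refl , (λ b → cut b t)) , hS)) ∷ []) , deriv λ η κ → hyp (here refl)
      where s = code (clo (∃S φ) ρ τ)

    -- A refuted universal has a counterexample among the named witnesses. Hence truth at all
    -- parameters is enough for derivability of a universal.
    notallN : ∀ {a b s} {φ : Fm (suc a) b} {ρ τ} → Bad s (clo (∀N φ) ρ τ) → Th (clo (∃N (¬' φ)) ρ τ)
    notallN {φ = φ} {ρ} {τ} = refute {clo (∀N φ) ρ τ} {clo (∃N (¬' φ)) ρ τ}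
      λ η κ d → raa (⇒E (weaken there d) (∀NI (raa (⇒E (hyp (there (here refl))) (∃NI (var zero)
        (castD (cong ¬' (sym (instN-v0 (subF (liftN (rT η κ ∘ lookup ρ)) (κ ∘ lookup τ) φ)))) (hyp (here refl))))))))

    notallS : ∀ {a b s} {φ : Fm a (suc b)} {ρ τ} → Bad s (clo (∀S φ) ρ τ) → Th (clo (∃S (¬' φ)) ρ τ)
    notallS {φ = φ} {ρ} {τ} = refute {clo (∀S φ) ρ τ} {clo (∃S (¬' φ)) ρ τ}
      λ η κ d → raa (⇒E (weaken there d) (∀SI (raa (⇒E (hyp (there (here refl))) (∃SI zero
        (castD (cong ¬' (sym (instS-0 (subF (renT (λ j → j) suc ∘ rT η κ ∘ lookup ρ) (liftS (κ ∘ lookup τ)) φ)))) (hyp (here refl))))))))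

    struct : Struct
    struct = record
      { M = PT ; S = ℕ ; 𝕆 = 𝕆 ; 0M = o ; 1M = i ; _+M_ = _⊕_ ; _*M_ = _⊗_ ; lenM = ln
      ; _≤M_ = λ s t → Th (clo (v0 ≤' v1) (s ∷ t ∷ []) [])
      ; _≈M_ = λ s t → Th (clo (v0 ≐ v1) (s ∷ t ∷ []) [])
      ; _∈M_ = λ t c → Th (clo (v0 ∈' zero) (t ∷ []) (c ∷ []))
      ; _≈S_ = λ c d → Th (clo (zero ≐S suc zero) [] (c ∷ d ∷ [])) }
    open Sem struct

    rT-ev : ∀ {n m a b} (η : ℕ → Tm n m) κ (t : Tm a b) ρ τ →
      subT (rT η κ ∘ lookup ρ) (κ ∘ lookup τ) t ≡ rT η κ (ev t ρ τ)
    rT-ev η κ (var j) ρ τ = refl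
    rT-ev η κ `0 ρ τ = refl
    rT-ev η κ `1 ρ τ = refl
    rT-ev η κ (t `+ s) ρ τ = cong₂ _`+_ (rT-ev η κ t ρ τ) (rT-ev η κ s ρ τ)
    rT-ev η κ (t `* s) ρ τ = cong₂ _`*_ (rT-ev η κ t ρ τ) (rT-ev η κ s ρ τ)
    rT-ev η κ (len X) ρ τ = refl

    same : ∀ {Φ Ψ} → (∀ {n m} (η : ℕ → Tm n m) κ → real η κ Φ ≡ real η κ Ψ) → Th Φ → Th Ψ
    same e = th1 λ η κ {Δ} → subst (Δ ⊢_) (e η κ)

    mutual
      -- Truth lemma. The two directions are mutual because an implication is contravariant in its
      -- premise.
      to : ∀ {n m} (φ : Fm n m) ρ τ → sat φ ρ τ → Th (clo φ ρ τ)
      to (t ≤' s) ρ τ = same λ η κ → cong₂ _≤'_ (sym (rT-ev η κ t ρ τ)) (sym (rT-ev η κ s ρ τ))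
      to (t ≐ s) ρ τ = same λ η κ → cong₂ _≐_ (sym (rT-ev η κ t ρ τ)) (sym (rT-ev η κ s ρ τ))
      to (X ≐S Y) ρ τ = same λ η κ → refl
      to (t ∈' X) ρ τ = same λ η κ → cong (_∈' _) (sym (rT-ev η κ t ρ τ))
      to ⊥' ρ τ x = max λ _ _ → x
      to (φ ⇒ ψ) ρ τ f = max λ s b → cut-⇒ s b
        where
        cut-⇒ : ∀ s → Bad s (clo (φ ⇒ ψ) ρ τ) → 𝕆
        cut-⇒ s b = by-⊥ (th2 {clo (ψ ⇒ ⊥') ρ τ} {clo ψ ρ τ} (λ η κ → ⇒E)
          (refute {clo (φ ⇒ ψ) ρ τ} {clo (ψ ⇒ ⊥') ρ τ}
            (λ η κ d → ⇒I (⇒E (weaken there d) (⇒I (hyp (there (here refl)))))) b)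
          (to ψ ρ τ (f (from φ ρ τ (refute {clo (φ ⇒ ψ) ρ τ} {clo φ ρ τ}
            (λ η κ d → raa (⇒E (weaken there d) (⇒I (raa (⇒E (hyp (there (there (here refl)))) (hyp (there (here refl)))))))) b)))))
      to (φ ∧' ψ) ρ τ (x , y) = th2 {clo φ ρ τ} {clo ψ ρ τ} (λ η κ → ∧I) (to φ ρ τ x) (to ψ ρ τ y)
      to (φ ∨' ψ) ρ τ f = max λ s b → f [ (λ x → cut b (th1 {clo φ ρ τ} (λ η κ → ∨I₁) (to φ ρ τ x)))
                                         , (λ x → cut b (th1 {clo ψ ρ τ} (λ η κ → ∨I₂) (to ψ ρ τ x))) ]′
      to (∀N φ) ρ τ f = max λ s b → case exN {φ = ¬' φ} {ρ} {τ} (notallN b) of λ { (t , h) →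
          by-⊥ (th2 {clo (¬' φ) (t ∷ ρ) τ} {clo φ (t ∷ ρ) τ} (λ η κ → ⇒E) h (to φ (t ∷ ρ) τ (f t))) }
      to (∃N φ) ρ τ (t , x) = th1 {clo φ (t ∷ ρ) τ} (λ η κ {Δ} d → ∃NI (rT η κ t)
        (subst (Δ ⊢_) (sym (instN-real η κ φ ρ τ t)) d)) (to φ (t ∷ ρ) τ x)
      to (∀S φ) ρ τ f = max λ s b → case exS {φ = ¬' φ} {ρ} {τ} (notallS b) of λ { (t , h) →
          by-⊥ (th2 {clo (¬' φ) ρ (t ∷ τ)} {clo φ ρ (t ∷ τ)} (λ η κ → ⇒E) h (to φ ρ (t ∷ τ) (f t))) }
      to (∃S φ) ρ τ (t , x) = th1 {clo φ ρ (t ∷ τ)} (λ η κ {Δ} d → ∃SI (κ t)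
        (subst (Δ ⊢_) (sym (instS-real η κ φ ρ τ t)) d)) (to φ ρ (t ∷ τ) x)

      from : ∀ {n m} (φ : Fm n m) ρ τ → Th (clo φ ρ τ) → sat φ ρ τ
      from (t ≤' s) ρ τ = same λ η κ → cong₂ _≤'_ (rT-ev η κ t ρ τ) (rT-ev η κ s ρ τ)
      from (t ≐ s) ρ τ = same λ η κ → cong₂ _≐_ (rT-ev η κ t ρ τ) (rT-ev η κ s ρ τ)
      from (X ≐S Y) ρ τ = same λ η κ → refl
      from (t ∈' X) ρ τ = same λ η κ → cong (_∈' _) (rT-ev η κ t ρ τ)
      from ⊥' ρ τ t = by-⊥ (th1 {clo ⊥' ρ τ} (λ η κ d → d) t)
      from (φ ⇒ ψ) ρ τ t x = from ψ ρ τ (th2 {clo (φ ⇒ ψ) ρ τ} {clo φ ρ τ} (λ η κ → ⇒E) t (to φ ρ τ x))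
      from (φ ∧' ψ) ρ τ t = from φ ρ τ (th1 {clo (φ ∧' ψ) ρ τ} (λ η κ → ∧E₁) t)
                          , from ψ ρ τ (th1 {clo (φ ∧' ψ) ρ τ} (λ η κ → ∧E₂) t)
      from (φ ∨' ψ) ρ τ t f = by-⊥ (th2 {clo (¬' φ ∧' ¬' ψ) ρ τ} {clo (φ ∨' ψ) ρ τ}
          (λ η κ c d → ∨E d (⇒E (∧E₁ (weaken there c)) (hyp (here refl))) (⇒E (∧E₂ (weaken there c)) (hyp (here refl))))
          (th2 {clo (¬' φ) ρ τ} {clo (¬' ψ) ρ τ} (λ η κ → ∧I) (notTh (λ x → f (inj₁ (from φ ρ τ x)))) (notTh (λ x → f (inj₂ (from ψ ρ τ x))))) t)
      from (∀N φ) ρ τ h t = from φ (t ∷ ρ) τ (th1 {clo (∀N φ) ρ τ} (λ η κ {Δ} d →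
        subst (Δ ⊢_) (instN-real η κ φ ρ τ t) (∀NE d (rT η κ t))) h)
      from (∃N φ) ρ τ h = let t , x = exN {φ = φ} {ρ} {τ} h in t , from φ (t ∷ ρ) τ x
      from (∀S φ) ρ τ h t = from φ ρ (t ∷ τ) (th1 {clo (∀S φ) ρ τ} (λ η κ {Δ} d →
        subst (Δ ⊢_) (instS-real η κ φ ρ τ t) (∀SE d (κ t))) h)
      from (∃S φ) ρ τ h = let t , x = exS {φ = φ} {ρ} {τ} h in t , from φ ρ (t ∷ τ) x

    soundTh : ∀ {n m} {φ : Fm n m} → Ax φ → ∀ ρ τ → Th (clo φ ρ τ)
    soundTh (basic {φ} x) ρ τ = th0 λ η κ {Δ} → subst (Δ ⊢_) (sym (emb-sub (rT η κ ∘ lookup ρ) (κ ∘ lookup τ) φ)) (ax (basic x))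
    soundTh (comp φ x) ρ τ = th0 λ η κ {Δ} → subst (Δ ⊢_) (sym (Comp-sub (rT η κ ∘ lookup ρ) (κ ∘ lookup τ) φ)) (ax (comp _ (Σ0-sub (liftN (rT η κ ∘ lookup ρ)) (κ ∘ lookup τ) x)))
    soundTh vl ρ τ = th0 λ η κ {Δ} → subst (Δ ⊢_) (sym (emb-sub (rT η κ ∘ lookup ρ) (κ ∘ lookup τ) VLAxiom)) (ax vl)

    model : Model
    model = record
      { struct = struct
      ; stab   = λ φ ρ τ h → from φ ρ τ (stabTh λ k → h (k ∘ to φ ρ τ))
      ; sound  = λ {_} {_} {φ} x ρ τ → from φ ρ τ (soundTh x ρ τ)
      ; leibN  = λ φ {x} {y} ρ τ e h → from φ (y ∷ ρ) τ (th2 {clo (v0 ≐ v1) (x ∷ y ∷ []) []} {clo φ (x ∷ ρ) τ}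
          (λ η κ {Δ} d d' → subst (Δ ⊢_) (instN-real η κ φ ρ τ y) (≐subst (subF (liftN (rT η κ ∘ lookup ρ)) (κ ∘ lookup τ) φ) d
             (subst (Δ ⊢_) (sym (instN-real η κ φ ρ τ x)) d'))) e (to φ (x ∷ ρ) τ h))
      ; reflN  = λ {x} → th0 λ η κ → ≐refl }

    finish : sat Φ₀ [] [] → VL⊢ Φ₀
    finish h = 1 , 1 , raa (by-⊥ (th2 {root} {clo Φ₀ [] []} (λ η κ → ⇒E)
      (0 , (root ∷ []) , (refl ∷ []) , deriv λ η κ → hyp (here refl)) (to Φ₀ [] [] h)))

  completeness : ∀ Φ → (∀ 𝓜 → Model.sat 𝓜 Φ [] []) → VL⊢ Φ
  completeness Φ h = Henkin.finish Φ (h (Henkin.model Φ))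

-- Expanding generators of F_2^k by derandomisation.

module Generators where
  open import Data.Nat using (ℕ; zero; suc; _+_; _*_; _^_; _≤_; _<_; z≤n; s≤s; _≤?_)
  open import Data.Nat.Properties
  open import Data.Bool using (Bool; true; false; _xor_; _∧_; if_then_else_)
  open import Data.Vec using (Vec; []; _∷_)
  open import Data.Product using (Σ; _,_; proj₁; proj₂)
  open import Relation.Nullary using (yes; no; ¬_)
  open import Relation.Binary.PropositionalEquality
  open import Data.Nat.Solver using (module +-*-Solver)
  open +-*-Solver using (solve; _:+_; _:*_; con; _:=_)

  Σℕ : ∀ n → (Vec Bool n → ℕ) → ℕ
  Σℕ zero    f = f []
  Σℕ (suc n) f = Σℕ n (λ x → f (false ∷ x)) + Σℕ n (λ x → f (true ∷ x))

  two^ : ℕ → ℕ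
  two^ zero    = 1
  two^ (suc n) = two^ n + two^ n

  dot : ∀ {n} → Vec Bool n → Vec Bool n → Bool
  dot []      []      = false
  dot (a ∷ x) (b ∷ y) = (a ∧ b) xor dot x y

  isZero : ∀ {n} → Vec Bool n → Bool
  isZero []          = true
  isZero (false ∷ x) = isZero x
  isZero (true ∷ x)  = false

  Σℕ-cong : ∀ n {f g : Vec Bool n → ℕ} → (∀ x → f x ≡ g x) → Σℕ n f ≡ Σℕ n g
  Σℕ-cong zero e    = e []
  Σℕ-cong (suc n) e = cong₂ _+_ (Σℕ-cong n λ x → e _) (Σℕ-cong n λ x → e _)

  Σℕ-* : ∀ n c (f : Vec Bool n → ℕ) → Σℕ n (λ x → c * f x) ≡ c * Σℕ n f
  Σℕ-* zero c f    = refl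
  Σℕ-* (suc n) c f = trans (cong₂ _+_ (Σℕ-* n c _) (Σℕ-* n c _)) (sym (*-distribˡ-+ c _ _))

  Σℕ-+ : ∀ n (f g : Vec Bool n → ℕ) → Σℕ n (λ x → f x + g x) ≡ Σℕ n f + Σℕ n g
  Σℕ-+ zero f g    = refl
  Σℕ-+ (suc n) f g = trans (cong₂ _+_ (Σℕ-+ n _ _) (Σℕ-+ n _ _))
    (solve 4 (λ a b c d → (a :+ b) :+ (c :+ d) := (a :+ c) :+ (b :+ d)) refl
      (Σℕ n (λ x → f (false ∷ x))) (Σℕ n (λ x → g (false ∷ x))) (Σℕ n (λ x → f (true ∷ x))) (Σℕ n (λ x → g (true ∷ x))))

  Σℕ-const : ∀ n c → Σℕ n (λ _ → c) ≡ two^ n * c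
  Σℕ-const zero c    = sym (+-identityʳ c)
  Σℕ-const (suc n) c = trans (cong₂ _+_ (Σℕ-const n c) (Σℕ-const n c)) (sym (*-distribʳ-+ c (two^ n) (two^ n)))

  Σℕ-swap : ∀ m n (f : Vec Bool m → Vec Bool n → ℕ) → Σℕ m (λ x → Σℕ n (f x)) ≡ Σℕ n (λ y → Σℕ m (λ x → f x y))
  Σℕ-swap zero n f    = refl
  Σℕ-swap (suc m) n f = trans (cong₂ _+_ (Σℕ-swap m n _) (Σℕ-swap m n _)) (sym (Σℕ-+ n _ _))

  term≤Σℕ : ∀ n (f : Vec Bool n → ℕ) x → f x ≤ Σℕ n f
  term≤Σℕ zero f [] = ≤-refl
  term≤Σℕ (suc n) f (false ∷ x) = ≤-trans (term≤Σℕ n _ x) (m≤m+n _ _)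
  term≤Σℕ (suc n) f (true ∷ x) = ≤-trans (term≤Σℕ n _ x) (m≤n+m _ _)

  below-average : ∀ n (f : Vec Bool n → ℕ) B → Σℕ n f ≤ two^ n * B → Σ (Vec Bool n) λ x → f x ≤ B
  below-average zero f B p = [] , subst (f [] ≤_) (+-identityʳ B) p
  below-average (suc n) f B p with Σℕ n (λ x → f (false ∷ x)) ≤? two^ n * B
  ... | yes q = let x , r = below-average n _ B q in false ∷ x , r
  ... | no q  = let x , r = below-average n (λ x → f (true ∷ x)) B (+-cancelˡ-≤ (two^ n * B) _ _ (≤-trans (+-monoˡ-≤ _ (<⇒≤ (≰⇒> q)))
                              (subst (Σℕ (suc n) f ≤_) (*-distribʳ-+ B (two^ n) (two^ n)) p))) in true ∷ x , r

  -- The weight 3 penalises a generator on which the functional vanishes. A nonzero functional takes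
  -- both values equally often, so its average weight is 2.
  wt : Bool → ℕ
  wt false = 3
  wt true  = 1

  wt-pair : ∀ b → wt b + wt (true xor b) ≡ 4
  wt-pair false = refl
  wt-pair true  = refl

  avg-wt : ∀ {n} (α : Vec Bool n) → isZero α ≡ false → Σℕ n (λ g → wt (dot α g)) ≡ two^ n * 2
  avg-wt {suc n} (false ∷ α) z = trans (cong₂ _+_ (avg-wt α z) (avg-wt α z)) (sym (*-distribʳ-+ 2 (two^ n) (two^ n)))
  avg-wt {suc n} (true ∷ α) z = trans (sym (Σℕ-+ n _ _)) (trans (Σℕ-cong n λ g → wt-pair (dot α g))
    (trans (Σℕ-const n 4) (solve 1 (λ a → a :* con 4 := (a :+ a) :* con 2) refl (two^ n))))

  zeros : ∀ {q k} → (Vec Bool q → Vec Bool k) → Vec Bool k → ℕ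
  zeros {q} g α = Σℕ q (λ j → if dot α (g j) then 0 else 1)

  ones : ∀ {q k} → (Vec Bool q → Vec Bool k) → Vec Bool k → ℕ
  ones {q} g α = Σℕ q (λ j → if dot α (g j) then 1 else 0)

  -- Method of conditional expectations for the potential Σ_α W(α) 3^{zeros(α)}.
  greedy : ∀ q k (W : Vec Bool k → ℕ) → (∀ α → isZero α ≡ true → W α ≡ 0) →
    Σ (Vec Bool q → Vec Bool k) λ g → Σℕ k (λ α → W α * 3 ^ zeros g α) ≤ 2 ^ two^ q * Σℕ k W
  greedy zero k W W0 = (λ _ → proj₁ pick) , subst (_≤ 2 * Σℕ k W) (Σℕ-cong k λ α → cong (W α *_) (pw (dot α (proj₁ pick)))) (proj₂ pick)
    where
    pw : ∀ b → wt b ≡ 3 ^ (if b then 0 else 1)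
    pw false = refl
    pw true  = refl
    inner : ∀ α b → isZero α ≡ b → Σℕ k (λ g → W α * wt (dot α g)) ≡ two^ k * (2 * W α)
    inner α true z rewrite W0 α z = trans (Σℕ-const k 0) (trans (*-zeroʳ (two^ k)) (sym (*-zeroʳ (two^ k))))
    inner α false z = trans (Σℕ-* k (W α) _) (trans (cong (W α *_) (avg-wt α z))
      (solve 2 (λ w a → w :* (a :* con 2) := a :* (con 2 :* w)) refl (W α) (two^ k)))
    tot : Σℕ k (λ g → Σℕ k (λ α → W α * wt (dot α g))) ≡ two^ k * (2 * Σℕ k W)
    tot = trans (Σℕ-swap k k _) (trans (Σℕ-cong k λ α → inner α (isZero α) refl)
      (trans (Σℕ-* k (two^ k) _) (cong (two^ k *_) (Σℕ-* k 2 W))))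
    pick = below-average k (λ g → Σℕ k (λ α → W α * wt (dot α g))) (2 * Σℕ k W) (≤-reflexive tot)
  greedy (suc q) k W W0 with greedy q k W W0
  ... | g₀ , p₀ with greedy q k (λ α → W α * 3 ^ zeros g₀ α) (λ α z → cong (_* 3 ^ zeros g₀ α) (W0 α z))
  ... | g₁ , p₁ = g , (begin
      Σℕ k (λ α → W α * 3 ^ zeros g α)                  ≡⟨ Σℕ-cong k (λ α → trans (cong (W α *_) (^-distribˡ-+-* 3 (zeros g₀ α) (zeros g₁ α))) (sym (*-assoc (W α) _ _))) ⟩
      Σℕ k (λ α → (W α * 3 ^ zeros g₀ α) * 3 ^ zeros g₁ α) ≤⟨ p₁ ⟩
      2 ^ two^ q * Σℕ k (λ α → W α * 3 ^ zeros g₀ α)    ≤⟨ *-monoʳ-≤ (2 ^ two^ q) p₀ ⟩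
      2 ^ two^ q * (2 ^ two^ q * Σℕ k W)                ≡⟨ sym (*-assoc (2 ^ two^ q) _ _) ⟩
      2 ^ two^ q * 2 ^ two^ q * Σℕ k W                  ≡⟨ cong (_* Σℕ k W) (sym (^-distribˡ-+-* 2 (two^ q) (two^ q))) ⟩
      2 ^ (two^ q + two^ q) * Σℕ k W                    ∎)
    where
    open ≤-Reasoning
    g : Vec Bool (suc q) → Vec Bool k
    g (false ∷ j) = g₀ j
    g (true ∷ j)  = g₁ j

  zeros+ones : ∀ {q k} (g : Vec Bool q → Vec Bool k) α → zeros g α + ones g α ≡ two^ q
  zeros+ones {q} g α = trans (sym (Σℕ-+ q _ _)) (trans (Σℕ-cong q λ j → one (dot α (g j))) (trans (Σℕ-const q 1) (*-identityʳ _)))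
    where
    one : ∀ b → (if b then 0 else 1) + (if b then 1 else 0) ≡ 1
    one true  = refl
    one false = refl

  two^-^ : ∀ n → two^ n ≡ 2 ^ n
  two^-^ zero    = refl
  two^-^ (suc n) = trans (cong₂ _+_ (two^-^ n) (two^-^ n)) (cong (2 ^ n +_) (sym (+-identityʳ (2 ^ n))))

  -- 2^(q+3) vectors of F_2^k, k ≤ 2^q, such that every nonzero functional is nonzero on a quarter of them.
  generators : ∀ q k → k ≤ two^ q → Σ (Vec Bool (3 + q) → Vec Bool k) λ g →
    ∀ α → isZero α ≡ false → two^ (3 + q) ≤ 4 * ones g α
  generators q k k≤ = g , λ α z → ≮⇒≥ (bad α z)
    where
    c = two^ q
    W : Vec Bool k → ℕ
    W α = if isZero α then 0 else 1
    gr = greedy (3 + q) k W (λ α z → cong (λ b → if b then 0 else 1) z)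
    g = proj₁ gr
    W≤ : Σℕ k W ≤ two^ k
    W≤ = subst (Σℕ k W ≤_) (trans (Σℕ-const k 1) (*-identityʳ _)) (mono k W λ α → le (isZero α))
      where
      le : ∀ b → (if b then 0 else 1) ≤ 1
      le true  = z≤n
      le false = ≤-refl
      mono : ∀ n (f : Vec Bool n → ℕ) → (∀ x → f x ≤ 1) → Σℕ n f ≤ Σℕ n (λ _ → 1)
      mono zero f h    = h []
      mono (suc n) f h = +-mono-≤ (mono n _ λ x → h _) (mono n _ λ x → h _)
    -- A bad `α` vanishes on more than `6 * c` of the `8 * c` generators, so it alone contributes
    -- more than `3 ^ (6 * c) = 729 ^ c` to the potential. The potential is at most
    -- `2 ^ (8 * c + k)`, and thus at most `512 ^ c` because `k ≤ c`.
    bad : ∀ α → isZero α ≡ false → ¬ (4 * ones g α < two^ (3 + q))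
    bad α z p = <-irrefl refl (begin-strict
        3 ^ (6 * c)                            <⟨ ^-monoʳ-< 3 (s≤s (s≤s z≤n)) zc ⟩
        3 ^ zeros g α                          ≡⟨ sym (trans (cong (λ b → (if b then 0 else 1) * 3 ^ zeros g α) z) (*-identityˡ _)) ⟩
        W α * 3 ^ zeros g α                    ≤⟨ term≤Σℕ k _ α ⟩
        Σℕ k (λ α → W α * 3 ^ zeros g α)       ≤⟨ proj₂ gr ⟩
        2 ^ two^ (3 + q) * Σℕ k W              ≤⟨ *-monoʳ-≤ (2 ^ two^ (3 + q)) (≤-trans W≤ (≤-reflexive (two^-^ k))) ⟩
        2 ^ two^ (3 + q) * 2 ^ k               ≡⟨ sym (^-distribˡ-+-* 2 (two^ (3 + q)) k) ⟩
        2 ^ (two^ (3 + q) + k)                 ≤⟨ ^-monoʳ-≤ 2 (+-monoʳ-≤ (two^ (3 + q)) k≤) ⟩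
        2 ^ (two^ (3 + q) + c)                 ≡⟨ cong (2 ^_) (solve 1 (λ c → (((c :+ c) :+ (c :+ c)) :+ ((c :+ c) :+ (c :+ c))) :+ c := con 9 :* c) refl c) ⟩
        2 ^ (9 * c)                            ≡⟨ sym (^-*-assoc 2 9 c) ⟩
        512 ^ c                                ≤⟨ ^-monoˡ-≤ c (m≤m+n 512 217) ⟩
        729 ^ c                                ≡⟨ ^-*-assoc 3 6 c ⟩
        3 ^ (6 * c)                            ∎)
      where
      open ≤-Reasoning
      zc : 6 * c < zeros g α
      zc = *-cancelˡ-< 4 _ _ (+-cancelʳ-< (4 * ones g α) _ _ (begin-strict
        4 * (6 * c) + 4 * ones g α    <⟨ +-monoʳ-< (4 * (6 * c)) p ⟩
        4 * (6 * c) + two^ (3 + q)    ≡⟨ solve 1 (λ c → con 4 :* (con 6 :* c) :+ (((c :+ c) :+ (c :+ c)) :+ ((c :+ c) :+ (c :+ c))) := con 4 :* ((((c :+ c) :+ (c :+ c)) :+ ((c :+ c) :+ (c :+ c))))) refl c ⟩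
        4 * two^ (3 + q)              ≡⟨ cong (4 *_) (sym (zeros+ones g α)) ⟩
        4 * (zeros g α + ones g α)    ≡⟨ *-distribˡ-+ 4 (zeros g α) (ones g α) ⟩
        4 * zeros g α + 4 * ones g α  ∎))

module Models (𝓜 : Model) where
  open import Data.Nat as ℕ using (ℕ; zero; suc)
  import Data.Nat.Properties as ℕ
  open import Data.Bool using (Bool; true; false)
  open import Data.Fin using (Fin; zero; suc)
  open import Data.Vec using (Vec; []; _∷_)
  open import Data.Product using (Σ; _×_; _,_; proj₁; proj₂)
  open import Data.Sum using (_⊎_; inj₁; inj₂)
  open import Function using (id; _∘_)
  import Relation.Binary.PropositionalEquality as ≡
  open ≡ using (_≡_)

  -- Stable reasoning and bounded formulas with parameters from a model.

  module Formulas where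
    open Model 𝓜 public
    open import Data.Fin using (_↑ˡ_; _↑ʳ_)
    open import Data.Vec using (lookup; _++_)
    open import Data.Vec.Properties using (lookup-++ˡ; lookup-++ʳ)
    open import Relation.Binary.PropositionalEquality using (_≡_; refl; trans; cong; cong₂)

    infix 3 ¬ₒ_
    ¬ₒ_ : Set → Set
    ¬ₒ A = A → 𝕆

    Stable : Set → Set
    Stable A = (¬ₒ ¬ₒ A) → A

    infix 2 _⇿_
    _⇿_ : Set → Set → Set
    A ⇿ B = (A → B) × (B → A)

    -- Nothing is decidable in the model, yet a case distinction is sound as long as the goal is
    -- stable, and every satisfied formula is a stable goal.
    by-em : ∀ {G : Set} (A : Set) → Stable G → (A → G) → ((¬ₒ A) → G) → G
    by-em A st f g = st λ k → k (g (λ a → k (f a)))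

    by-or : ∀ {A B G : Set} → Stable G → (¬ₒ ¬ₒ (A ⊎ B)) → (A → G) → (B → G) → G
    by-or st h f g = st λ k → h λ { (inj₁ a) → k (f a) ; (inj₂ b) → k (g b) }

    stable-¬ : ∀ {A : Set} → Stable (¬ₒ A)
    stable-¬ h a = h λ k → k a

    stable-𝕆 : Stable 𝕆
    stable-𝕆 h = h id

    stable-→ : ∀ {A B : Set} → Stable B → Stable (A → B)
    stable-→ s h a = s λ k → h λ f → k (f a)

    stable-× : ∀ {A B : Set} → Stable A → Stable B → Stable (A × B)
    stable-× s t h = s (λ k → h (λ p → k (proj₁ p))) , t (λ k → h (λ p → k (proj₂ p)))

    data Te (k : ℕ) : Set where
      𝕧         : Fin k → Te k
      𝕔         : M → Te k
      _+ᵗ_ _*ᵗ_ : Te k → Te k → Te k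

    infixl 6 _+ᵗ_
    infixl 7 _*ᵗ_
    infix 5 _≤ᶠ_ _≈ᶠ_ _∈ᶠ_
    infixr 4 _∧ᶠ_
    infixr 3 _⇒ᶠ_

    -- Numbers and strings of the model occur as constants, so no parameter list has to be
    -- maintained by hand. `trF` moves the constants into the environment of a genuine Σ0 formula.
    data PF (k : ℕ) : Set where
      _≤ᶠ_ _≈ᶠ_ : Te k → Te k → PF k
      _∈ᶠ_      : Te k → S → PF k
      ⊥ᶠ        : PF k
      _⇒ᶠ_ _∧ᶠ_ : PF k → PF k → PF k
      ∀ᶠ ∃ᶠ     : Te k → PF (suc k) → PF k

    ⟦_⟧ᵗ : ∀ {k} → Te k → Vec M k → M
    ⟦ 𝕧 i ⟧ᵗ x    = lookup x i
    ⟦ 𝕔 a ⟧ᵗ x    = a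
    ⟦ s +ᵗ t ⟧ᵗ x = ⟦ s ⟧ᵗ x +M ⟦ t ⟧ᵗ x
    ⟦ s *ᵗ t ⟧ᵗ x = ⟦ s ⟧ᵗ x *M ⟦ t ⟧ᵗ x

    ⟦_⟧ᶠ : ∀ {k} → PF k → Vec M k → Set
    ⟦ s ≤ᶠ t ⟧ᶠ x = ⟦ s ⟧ᵗ x ≤M ⟦ t ⟧ᵗ x
    ⟦ s ≈ᶠ t ⟧ᶠ x = ⟦ s ⟧ᵗ x ≈M ⟦ t ⟧ᵗ x
    ⟦ s ∈ᶠ X ⟧ᶠ x = ⟦ s ⟧ᵗ x ∈M X
    ⟦ ⊥ᶠ ⟧ᶠ x     = 𝕆
    ⟦ φ ⇒ᶠ ψ ⟧ᶠ x = ⟦ φ ⟧ᶠ x → ⟦ ψ ⟧ᶠ x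
    ⟦ φ ∧ᶠ ψ ⟧ᶠ x = ⟦ φ ⟧ᶠ x × ⟦ ψ ⟧ᶠ x
    ⟦ ∀ᶠ t φ ⟧ᶠ x = ∀ y → y ≤M ⟦ t ⟧ᵗ x → ⟦ φ ⟧ᶠ (y ∷ x)
    ⟦ ∃ᶠ t φ ⟧ᶠ x = Σ M λ y → y ≤M ⟦ t ⟧ᵗ x × ⟦ φ ⟧ᶠ (y ∷ x)

    nT : ∀ {k} → Te k → ℕ
    nT (𝕧 _)    = 0
    nT (𝕔 _)    = 1
    nT (s +ᵗ t) = nT s ℕ.+ nT t
    nT (s *ᵗ t) = nT s ℕ.+ nT t

    pT : ∀ {k} (t : Te k) → Vec M (nT t)
    pT (𝕧 _)    = []
    pT (𝕔 a)    = a ∷ []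
    pT (s +ᵗ t) = pT s ++ pT t
    pT (s *ᵗ t) = pT s ++ pT t

    nF : ∀ {k} → PF k → ℕ
    nF (s ≤ᶠ t) = nT s ℕ.+ nT t
    nF (s ≈ᶠ t) = nT s ℕ.+ nT t
    nF (s ∈ᶠ X) = nT s
    nF ⊥ᶠ       = 0
    nF (φ ⇒ᶠ ψ) = nF φ ℕ.+ nF ψ
    nF (φ ∧ᶠ ψ) = nF φ ℕ.+ nF ψ
    nF (∀ᶠ t φ) = nT t ℕ.+ nF φ
    nF (∃ᶠ t φ) = nT t ℕ.+ nF φ

    pF : ∀ {k} (φ : PF k) → Vec M (nF φ)
    pF (s ≤ᶠ t) = pT s ++ pT t
    pF (s ≈ᶠ t) = pT s ++ pT t
    pF (s ∈ᶠ X) = pT s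
    pF ⊥ᶠ       = []
    pF (φ ⇒ᶠ ψ) = pF φ ++ pF ψ
    pF (φ ∧ᶠ ψ) = pF φ ++ pF ψ
    pF (∀ᶠ t φ) = pT t ++ pF φ
    pF (∃ᶠ t φ) = pT t ++ pF φ

    mF : ∀ {k} → PF k → ℕ
    mF (s ∈ᶠ X) = 1
    mF (φ ⇒ᶠ ψ) = mF φ ℕ.+ mF ψ
    mF (φ ∧ᶠ ψ) = mF φ ℕ.+ mF ψ
    mF (∀ᶠ t φ) = mF φ
    mF (∃ᶠ t φ) = mF φ
    mF _        = 0

    qF : ∀ {k} (φ : PF k) → Vec S (mF φ)
    qF (s ∈ᶠ X) = X ∷ []
    qF (φ ⇒ᶠ ψ) = qF φ ++ qF ψ
    qF (φ ∧ᶠ ψ) = qF φ ++ qF ψ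
    qF (∀ᶠ t φ) = qF φ
    qF (∃ᶠ t φ) = qF φ
    qF (_ ≤ᶠ _) = []
    qF (_ ≈ᶠ _) = []
    qF ⊥ᶠ       = []

    module _ {n m : ℕ} where
      trT : ∀ {k} (t : Te k) → (Fin (nT t) → Fin n) → Tm (k ℕ.+ n) m
      trT (𝕧 i) e        = var (i ↑ˡ n)
      trT {k} (𝕔 a) e    = var (k ↑ʳ e zero)
      trT (s +ᵗ t) e = trT s (e ∘ (_↑ˡ nT t)) `+ trT t (e ∘ (nT s ↑ʳ_))
      trT (s *ᵗ t) e = trT s (e ∘ (_↑ˡ nT t)) `* trT t (e ∘ (nT s ↑ʳ_))

      trF : ∀ {k} (φ : PF k) → (Fin (nF φ) → Fin n) → (Fin (mF φ) → Fin m) → Fm (k ℕ.+ n) m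
      trF (s ≤ᶠ t) e f = trT s (e ∘ (_↑ˡ nT t)) ≤' trT t (e ∘ (nT s ↑ʳ_))
      trF (s ≈ᶠ t) e f = trT s (e ∘ (_↑ˡ nT t)) ≐ trT t (e ∘ (nT s ↑ʳ_))
      trF (s ∈ᶠ X) e f = trT s e ∈' f zero
      trF ⊥ᶠ e f       = ⊥'
      trF (φ ⇒ᶠ ψ) e f = trF φ (e ∘ (_↑ˡ nF ψ)) (f ∘ (_↑ˡ mF ψ)) ⇒ trF ψ (e ∘ (nF φ ↑ʳ_)) (f ∘ (mF φ ↑ʳ_))
      trF (φ ∧ᶠ ψ) e f = trF φ (e ∘ (_↑ˡ nF ψ)) (f ∘ (_↑ˡ mF ψ)) ∧' trF ψ (e ∘ (nF φ ↑ʳ_)) (f ∘ (mF φ ↑ʳ_))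
      trF (∀ᶠ t φ) e f = ∀≤ (trT t (e ∘ (_↑ˡ nF φ))) (trF φ (e ∘ (nT t ↑ʳ_)) f)
      trF (∃ᶠ t φ) e f = ∃≤ (trT t (e ∘ (_↑ˡ nF φ))) (trF φ (e ∘ (nT t ↑ʳ_)) f)

      trF-Σ0 : ∀ {k} (φ : PF k) e f → Σ0 (trF φ e f)
      trF-Σ0 (s ≤ᶠ t) e f = s≤
      trF-Σ0 (s ≈ᶠ t) e f = s≐
      trF-Σ0 (s ∈ᶠ X) e f = s∈
      trF-Σ0 ⊥ᶠ e f       = s⊥
      trF-Σ0 (φ ⇒ᶠ ψ) e f = s⇒ (trF-Σ0 φ _ _) (trF-Σ0 ψ _ _)
      trF-Σ0 (φ ∧ᶠ ψ) e f = s∧ (trF-Σ0 φ _ _) (trF-Σ0 ψ _ _)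
      trF-Σ0 (∀ᶠ t φ) e f = s∀≤ (trF-Σ0 φ _ _)
      trF-Σ0 (∃ᶠ t φ) e f = s∃≤ (trF-Σ0 φ _ _)

    ev-ren : ∀ {n m n' m'} {f : Fin n → Fin n'} {g : Fin m → Fin m'} {ρ ρ' τ τ'} →
      (∀ i → lookup ρ' (f i) ≡ lookup ρ i) → (∀ j → lookup τ' (g j) ≡ lookup τ j) →
      ∀ t → ev (renT f g t) ρ' τ' ≡ ev t ρ τ
    ev-ren p q (var i)  = p i
    ev-ren p q `0       = refl
    ev-ren p q `1       = refl
    ev-ren p q (t `+ s) = cong₂ _+M_ (ev-ren p q t) (ev-ren p q s)
    ev-ren p q (t `* s) = cong₂ _*M_ (ev-ren p q t) (ev-ren p q s)
    ev-ren p q (len X)  = cong lenM (q X)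

    ev-sub : ∀ {n m n' m'} {σ : Fin n → Tm n' m'} {g : Fin m → Fin m'} {ρ ρ' τ τ'} →
      (∀ i → ev (σ i) ρ' τ' ≡ lookup ρ i) → (∀ j → lookup τ' (g j) ≡ lookup τ j) →
      ∀ t → ev (subT σ g t) ρ' τ' ≡ ev t ρ τ
    ev-sub p q (var i)  = p i
    ev-sub p q `0       = refl
    ev-sub p q `1       = refl
    ev-sub p q (t `+ s) = cong₂ _+M_ (ev-sub p q t) (ev-sub p q s)
    ev-sub p q (t `* s) = cong₂ _*M_ (ev-sub p q t) (ev-sub p q s)
    ev-sub p q (len X)  = cong lenM (q X)

    coe : ∀ {A B : Set} → A ≡ B → A ⇿ B
    coe refl = id , id

    map-→ : ∀ {A A' B B' : Set} → A ⇿ A' → B ⇿ B' → (A → B) ⇿ (A' → B')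
    map-→ (f , g) (h , k) = (λ u → h ∘ u ∘ g) , (λ u → k ∘ u ∘ f)

    map-× : ∀ {A A' B B' : Set} → A ⇿ A' → B ⇿ B' → (A × B) ⇿ (A' × B')
    map-× (f , g) (h , k) = (λ (a , b) → f a , h b) , (λ (a , b) → g a , k b)

    map-Π : ∀ {X : Set} {A B : X → Set} → (∀ x → A x ⇿ B x) → ((x : X) → A x) ⇿ ((x : X) → B x)
    map-Π h = (λ u x → proj₁ (h x) (u x)) , (λ u x → proj₂ (h x) (u x))

    map-Σ : ∀ {X : Set} {A B : X → Set} → (∀ x → A x ⇿ B x) → Σ X A ⇿ Σ X B
    map-Σ h = (λ (x , a) → x , proj₁ (h x) a) , (λ (x , a) → x , proj₂ (h x) a)

    sat-sub : ∀ {n m n' m'} {σ : Fin n → Tm n' m'} {g : Fin m → Fin m'} {ρ ρ' τ τ'} →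
      (∀ i → ev (σ i) ρ' τ' ≡ lookup ρ i) → (∀ j → lookup τ' (g j) ≡ lookup τ j) →
      ∀ φ → sat (subF σ g φ) ρ' τ' ⇿ sat φ ρ τ
    sat-sub p q (t ≤' s) = coe (cong₂ _≤M_ (ev-sub p q t) (ev-sub p q s))
    sat-sub p q (t ≐ s)  = coe (cong₂ _≈M_ (ev-sub p q t) (ev-sub p q s))
    sat-sub p q (X ≐S Y) = coe (cong₂ _≈S_ (q X) (q Y))
    sat-sub p q (t ∈' X) = coe (cong₂ _∈M_ (ev-sub p q t) (q X))
    sat-sub p q ⊥'       = id , id
    sat-sub p q (φ ⇒ ψ)  = map-→ (sat-sub p q φ) (sat-sub p q ψ)
    sat-sub p q (φ ∧' ψ) = map-× (sat-sub p q φ) (sat-sub p q ψ)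
    sat-sub p q (φ ∨' ψ) = map-→ (map-→ ((λ { (inj₁ x) → inj₁ (proj₁ (sat-sub p q φ) x) ; (inj₂ x) → inj₂ (proj₁ (sat-sub p q ψ) x) })
      , (λ { (inj₁ x) → inj₁ (proj₂ (sat-sub p q φ) x) ; (inj₂ x) → inj₂ (proj₂ (sat-sub p q ψ) x) })) (id , id)) (id , id)
    sat-sub {σ = σ} p q (∀N φ) = map-Π λ x → sat-sub (λ { zero → refl ; (suc i) → trans (ev-ren (λ _ → refl) (λ _ → refl) (σ i)) (p i) }) q φ
    sat-sub {σ = σ} p q (∃N φ) = map-Σ λ x → sat-sub (λ { zero → refl ; (suc i) → trans (ev-ren (λ _ → refl) (λ _ → refl) (σ i)) (p i) }) q φ
    sat-sub {σ = σ} p q (∀S φ) = map-Π λ x → sat-sub (λ i → trans (ev-ren (λ _ → refl) (λ _ → refl) (σ i)) (p i)) (λ { zero → refl ; (suc i) → q i }) φ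
    sat-sub {σ = σ} p q (∃S φ) = map-Σ λ x → sat-sub (λ i → trans (ev-ren (λ _ → refl) (λ _ → refl) (σ i)) (p i)) (λ { zero → refl ; (suc i) → q i }) φ

    module _ {n m : ℕ} (ρ : Vec M n) (τ : Vec S m) where
      lo : ∀ {A : Set} {a b n} (ρ : Vec A n) (xs : Vec A a) (ys : Vec A b) (e : Fin (a ℕ.+ b) → Fin n) →
        (∀ j → lookup ρ (e j) ≡ lookup (xs ++ ys) j) → ∀ j → lookup ρ (e (j ↑ˡ b)) ≡ lookup xs j
      lo ρ xs ys e p j = trans (p _) (lookup-++ˡ xs ys j)
      hi : ∀ {A : Set} {a b n} (ρ : Vec A n) (xs : Vec A a) (ys : Vec A b) (e : Fin (a ℕ.+ b) → Fin n) →
        (∀ j → lookup ρ (e j) ≡ lookup (xs ++ ys) j) → ∀ j → lookup ρ (e (a ↑ʳ j)) ≡ lookup ys j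
      hi ρ xs ys e p j = trans (p _) (lookup-++ʳ xs ys j)

      evT-ok : ∀ {k} (t : Te k) e → (∀ j → lookup ρ (e j) ≡ lookup (pT t) j) → ∀ x →
        ev (trT t e) (x ++ ρ) τ ≡ ⟦ t ⟧ᵗ x
      evT-ok (𝕧 i) e p x = lookup-++ˡ x ρ i
      evT-ok (𝕔 a) e p x = trans (lookup-++ʳ x ρ (e zero)) (p zero)
      evT-ok (s +ᵗ t) e p x = cong₂ _+M_ (evT-ok s _ (lo ρ (pT s) (pT t) e p) x) (evT-ok t _ (hi ρ (pT s) (pT t) e p) x)
      evT-ok (s *ᵗ t) e p x = cong₂ _*M_ (evT-ok s _ (lo ρ (pT s) (pT t) e p) x) (evT-ok t _ (hi ρ (pT s) (pT t) e p) x)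

      satF-ok : ∀ {k} (φ : PF k) e f → (∀ j → lookup ρ (e j) ≡ lookup (pF φ) j) →
        (∀ j → lookup τ (f j) ≡ lookup (qF φ) j) → ∀ x → sat (trF φ e f) (x ++ ρ) τ ⇿ ⟦ φ ⟧ᶠ x
      satF-ok (s ≤ᶠ t) e f p q x = coe (cong₂ _≤M_ (evT-ok s _ (lo ρ (pT s) (pT t) e p) x) (evT-ok t _ (hi ρ (pT s) (pT t) e p) x))
      satF-ok (s ≈ᶠ t) e f p q x = coe (cong₂ _≈M_ (evT-ok s _ (lo ρ (pT s) (pT t) e p) x) (evT-ok t _ (hi ρ (pT s) (pT t) e p) x))
      satF-ok (s ∈ᶠ X) e f p q x = coe (cong₂ _∈M_ (evT-ok s _ p x) (q zero))
      satF-ok ⊥ᶠ e f p q x = id , id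
      satF-ok (φ ⇒ᶠ ψ) e f p q x = map-→ (satF-ok φ _ _ (lo ρ (pF φ) (pF ψ) e p) (lo τ (qF φ) (qF ψ) f q) x)
                                          (satF-ok ψ _ _ (hi ρ (pF φ) (pF ψ) e p) (hi τ (qF φ) (qF ψ) f q) x)
      satF-ok (φ ∧ᶠ ψ) e f p q x = map-× (satF-ok φ _ _ (lo ρ (pF φ) (pF ψ) e p) (lo τ (qF φ) (qF ψ) f q) x)
                                          (satF-ok ψ _ _ (hi ρ (pF φ) (pF ψ) e p) (hi τ (qF φ) (qF ψ) f q) x)
      satF-ok (∀ᶠ t φ) e f p q x = map-Π λ y → map-→
        (coe (cong (y ≤M_) (trans (ev-ren (λ _ → refl) (λ _ → refl) (trT t _)) (evT-ok t _ (lo ρ (pT t) (pF φ) e p) x))))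
        (satF-ok φ _ f (hi ρ (pT t) (pF φ) e p) q (y ∷ x))
      satF-ok (∃ᶠ t φ) e f p q x = map-Σ λ y → map-×
        (coe (cong (y ≤M_) (trans (ev-ren (λ _ → refl) (λ _ → refl) (trT t _)) (evT-ok t _ (lo ρ (pT t) (pF φ) e p) x))))
        (satF-ok φ _ f (hi ρ (pT t) (pF φ) e p) q (y ∷ x))

    ext : ∀ {k k'} → (Fin k → Fin k') → Fin (suc k) → Fin (suc k')
    ext f zero    = zero
    ext f (suc i) = suc (f i)

    rnT : ∀ {k k'} → (Fin k → Fin k') → Te k → Te k'
    rnT f (𝕧 i)    = 𝕧 (f i)
    rnT f (𝕔 a)    = 𝕔 a
    rnT f (s +ᵗ t) = rnT f s +ᵗ rnT f t
    rnT f (s *ᵗ t) = rnT f s *ᵗ rnT f t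

    rnF : ∀ {k k'} → (Fin k → Fin k') → PF k → PF k'
    rnF f (s ≤ᶠ t) = rnT f s ≤ᶠ rnT f t
    rnF f (s ≈ᶠ t) = rnT f s ≈ᶠ rnT f t
    rnF f (s ∈ᶠ X) = rnT f s ∈ᶠ X
    rnF f ⊥ᶠ       = ⊥ᶠ
    rnF f (φ ⇒ᶠ ψ) = rnF f φ ⇒ᶠ rnF f ψ
    rnF f (φ ∧ᶠ ψ) = rnF f φ ∧ᶠ rnF f ψ
    rnF f (∀ᶠ t φ) = ∀ᶠ (rnT f t) (rnF (ext f) φ)
    rnF f (∃ᶠ t φ) = ∃ᶠ (rnT f t) (rnF (ext f) φ)

    rnT-ok : ∀ {k k'} {f : Fin k → Fin k'} {x y} → (∀ i → lookup y (f i) ≡ lookup x i) → ∀ t → ⟦ rnT f t ⟧ᵗ y ≡ ⟦ t ⟧ᵗ x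
    rnT-ok p (𝕧 i)    = p i
    rnT-ok p (𝕔 a)    = refl
    rnT-ok p (s +ᵗ t) = cong₂ _+M_ (rnT-ok p s) (rnT-ok p t)
    rnT-ok p (s *ᵗ t) = cong₂ _*M_ (rnT-ok p s) (rnT-ok p t)

    rnF-ok : ∀ {k k'} {f : Fin k → Fin k'} {x y} → (∀ i → lookup y (f i) ≡ lookup x i) → ∀ φ → ⟦ rnF f φ ⟧ᶠ y ⇿ ⟦ φ ⟧ᶠ x
    rnF-ok p (s ≤ᶠ t) = coe (cong₂ _≤M_ (rnT-ok p s) (rnT-ok p t))
    rnF-ok p (s ≈ᶠ t) = coe (cong₂ _≈M_ (rnT-ok p s) (rnT-ok p t))
    rnF-ok p (s ∈ᶠ X) = coe (cong (_∈M X) (rnT-ok p s))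
    rnF-ok p ⊥ᶠ       = id , id
    rnF-ok p (φ ⇒ᶠ ψ) = map-→ (rnF-ok p φ) (rnF-ok p ψ)
    rnF-ok p (φ ∧ᶠ ψ) = map-× (rnF-ok p φ) (rnF-ok p ψ)
    rnF-ok p (∀ᶠ t φ) = map-Π λ y → map-→ (coe (cong (y ≤M_) (rnT-ok p t))) (rnF-ok (λ { zero → refl ; (suc i) → p i }) φ)
    rnF-ok p (∃ᶠ t φ) = map-Σ λ y → map-× (coe (cong (y ≤M_) (rnT-ok p t))) (rnF-ok (λ { zero → refl ; (suc i) → p i }) φ)

    sat-tr : ∀ {k} (φ : PF k) x → sat (trF φ id id) (x ++ pF φ) (qF φ) ⇿ ⟦ φ ⟧ᶠ x
    sat-tr φ = satF-ok (pF φ) (qF φ) φ id id (λ _ → refl) (λ _ → refl)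

    infix 4 _≤_ _<_ _≈_
    _≤_ _<_ _≈_ : M → M → Set
    _≤_ = _≤M_
    _≈_ = _≈M_
    x < y = x ≤ y × (¬ₒ x ≈ y)

    abstract
      stableF : ∀ {k} (φ : PF k) x → Stable (⟦ φ ⟧ᶠ x)
      stableF φ x h = proj₁ (sat-tr φ x) (stab (trF φ id id) _ _ λ k → h (k ∘ proj₂ (sat-tr φ x)))

      leibF : ∀ {k} (φ : PF (suc k)) {a b} x → a ≈ b → ⟦ φ ⟧ᶠ (a ∷ x) → ⟦ φ ⟧ᶠ (b ∷ x)
      leibF φ x e h = proj₁ (sat-tr φ (_ ∷ x)) (leibN (trF φ id id) _ _ e (proj₂ (sat-tr φ (_ ∷ x)) h))

      compF : (φ : PF 1) (b : M) → Σ S λ X → (lenM X ≤ b) × (∀ z → z < b → (z ∈M X) ⇿ ⟦ φ ⟧ᶠ (z ∷ []))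
      compF φ b with sound (comp (trF φ id id) (trF-Σ0 φ id id)) (pF φ) (qF φ) b
      ... | X , l , h = X , l , λ z p → let r = sat-sub (λ { zero → refl ; (suc i) → refl }) (λ _ → refl) (trF φ id id)
                                            f , g = h z p in
              (λ q → proj₁ (sat-tr φ (z ∷ [])) (proj₁ r (f q))) , (λ q → g (proj₂ r (proj₂ (sat-tr φ (z ∷ [])) q)))

  -- Induction and ordered semiring arithmetic in a model.

  module Arithmetic where
    open Formulas public
    open import Relation.Binary.Bundles using (Setoid)
    open import Algebra.Bundles using (CommutativeSemiring)

    infixl 6 _+_
    infixl 7 _*_
    _+_ _*_ : M → M → M
    _+_ = _+M_
    _*_ = _*M_

    x₀ : ∀ {k} → Te (suc k)
    x₀ = 𝕧 zero
    x₁ : ∀ {k} → Te (suc (suc k))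
    x₁ = 𝕧 (suc zero)

    stable-≈ : ∀ {x y} → Stable (x ≈ y)
    stable-≈ {x} {y} = stableF (𝕔 x ≈ᶠ 𝕔 y) []

    stable-≤ : ∀ {x y} → Stable (x ≤ y)
    stable-≤ {x} {y} = stableF (𝕔 x ≤ᶠ 𝕔 y) []

    stable-< : ∀ {x y} → Stable (x < y)
    stable-< = stable-× stable-≤ stable-¬

    abstract
      ≈-refl : ∀ {x} → x ≈ x
      ≈-refl = reflN

      ≈-sym : ∀ {x y} → x ≈ y → y ≈ x
      ≈-sym {x} {y} e = leibF {0} (x₀ ≈ᶠ 𝕔 x) [] e reflN

      ≈-trans : ∀ {x y z} → x ≈ y → y ≈ z → x ≈ z
      ≈-trans {x} {y} {z} e f = leibF {0} (𝕔 x ≈ᶠ x₀) [] f e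

      +-cong : ∀ {x y u v} → x ≈ y → u ≈ v → x + u ≈ y + v
      +-cong {x} {y} {u} {v} e f = leibF {0} (𝕔 (x + u) ≈ᶠ 𝕔 y +ᵗ x₀) [] f (leibF {0} (𝕔 (x + u) ≈ᶠ x₀ +ᵗ 𝕔 u) [] e reflN)

      *-cong : ∀ {x y u v} → x ≈ y → u ≈ v → x * u ≈ y * v
      *-cong {x} {y} {u} {v} e f = leibF {0} (𝕔 (x * u) ≈ᶠ 𝕔 y *ᵗ x₀) [] f (leibF {0} (𝕔 (x * u) ≈ᶠ x₀ *ᵗ 𝕔 u) [] e reflN)

      ≤-resp : ∀ {x y u v} → x ≈ y → u ≈ v → x ≤ u → y ≤ v
      ≤-resp {x} {y} {u} {v} e f p = leibF {0} (𝕔 y ≤ᶠ x₀) [] f (leibF {0} (x₀ ≤ᶠ 𝕔 u) [] e p)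

      ∈-resp : ∀ {x y X} → x ≈ y → x ∈M X → y ∈M X
      ∈-resp {X = X} e p = leibF {0} (x₀ ∈ᶠ X) [] e p

    ≡⇒≈ : ∀ {x y} → x ≡.≡ y → x ≈ y
    ≡⇒≈ ≡.refl = ≈-refl

    <-resp : ∀ {x y u v} → x ≈ y → u ≈ v → x < u → y < v
    <-resp e f (p , q) = ≤-resp e f p , λ h → q (≈-trans e (≈-trans h (≈-sym f)))

    stable-∈ : ∀ {x X} → Stable (x ∈M X)
    stable-∈ {x} {X} = stableF (𝕔 x ∈ᶠ X) []

    setoid : Setoid _ _
    setoid = record { Carrier = M ; _≈_ = _≈_ ; isEquivalence = record { refl = ≈-refl ; sym = ≈-sym ; trans = ≈-trans } }

    private
      b : ∀ {φ} → Defs.BasicAx φ → sat (Defs.emb φ) [] []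
      b x = sound (basic x) [] []

    abstract
      suc≉0 : ∀ x → ¬ₒ (x + 1M ≈ 0M)
      suc≉0 = b B1
      suc-inj : ∀ x y → x + 1M ≈ y + 1M → x ≈ y
      suc-inj = b B2
      +0 : ∀ x → x + 0M ≈ x
      +0 = b B3
      +suc : ∀ x y → x + (y + 1M) ≈ (x + y) + 1M
      +suc = b B4
      *0 : ∀ x → x * 0M ≈ 0M
      *0 = b B5
      *suc : ∀ x y → x * (y + 1M) ≈ (x * y) + x
      *suc = b B6
      ≤-antisym : ∀ {x y} → x ≤ y → y ≤ x → x ≈ y
      ≤-antisym p q = b B7 _ _ (p , q)
      ≤+ : ∀ x y → x ≤ x + y
      ≤+ = b B8
      0≤ : ∀ x → 0M ≤ x
      0≤ = b B9
      ≤-tot : ∀ x y → ¬ₒ ¬ₒ (x ≤ y ⊎ y ≤ x)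
      ≤-tot = b B10
      ≤⇒<suc : ∀ {x y} → x ≤ y → x < y + 1M
      ≤⇒<suc {x} {y} = proj₁ (b B11 x y)
      <suc⇒≤ : ∀ {x y} → x < y + 1M → x ≤ y
      <suc⇒≤ {x} {y} = proj₂ (b B11 x y)
      pred : ∀ x → (¬ₒ x ≈ 0M) → Σ M λ y → y + 1M ≈ x
      pred x p = let y , _ , e = b B12 x p in y , e
      mem<len : ∀ {x} X → x ∈M X → x < lenM X
      mem<len {x} X = b L1 x X
      last∈ : ∀ {x} X → x + 1M ≈ lenM X → x ∈M X
      last∈ {x} X = b L2 x X

      ≤-refl : ∀ {x} → x ≤ x
      ≤-refl {x} = ≤-resp ≈-refl (+0 x) (≤+ x 0M)

    -- The last element of {z ≤ a : φ holds up to z} has a successor that is again in the set.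
    ind′ : (φ : PF 1) → ⟦ φ ⟧ᶠ (0M ∷ []) → (∀ x → ⟦ φ ⟧ᶠ (x ∷ []) → ⟦ φ ⟧ᶠ (x + 1M ∷ [])) → ∀ x → ⟦ φ ⟧ᶠ (x ∷ [])
    ind′ φ base step a = stableF φ (a ∷ []) λ no →
        by-or stable-𝕆 (≤-tot (z + 1M) a)
          (λ p → proj₂ (mem<len X (proj₂ (h (z + 1M) (≤⇒<suc p)) λ y q → to'
                (by-em (y ≈ z + 1M) (stableF φ (y ∷ []))
                   (λ e' → resp (≈-sym e') (step z (below z ≤-refl)))
                   (λ ne → below y (<suc⇒≤ (q , ne))))))
                e)
          (λ q → by-em (a ≈ z + 1M) stable-𝕆
                   (λ e' → no (resp (≈-sym e') (step z (below z ≤-refl))))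
                   (λ ne → no (below a (<suc⇒≤ (q , ne)))))
      where
      φ' : PF 2
      φ' = rnF (λ _ → zero) φ
      ok : ∀ {x y} → ⟦ φ' ⟧ᶠ (y ∷ x ∷ []) ⇿ ⟦ φ ⟧ᶠ (y ∷ [])
      ok = rnF-ok (λ { zero → ≡.refl }) φ
      to' : ∀ {x y} → ⟦ φ ⟧ᶠ (y ∷ []) → ⟦ φ' ⟧ᶠ (y ∷ x ∷ [])
      to' = proj₂ ok
      resp : ∀ {x y} → x ≈ y → ⟦ φ ⟧ᶠ (x ∷ []) → ⟦ φ ⟧ᶠ (y ∷ [])
      resp e p = leibF φ [] e p
      cp = compF (∀ᶠ x₀ φ') (a + 1M)
      X = proj₁ cp
      h = proj₂ (proj₂ cp)
      0∈ : 0M ∈M X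
      0∈ = proj₂ (h 0M (≤⇒<suc (0≤ a))) λ y p → to' (resp (≤-antisym (0≤ y) p) base)
      pz = pred (lenM X) λ q → proj₂ (mem<len X 0∈) (≈-sym q)
      z = proj₁ pz
      e : z + 1M ≈ lenM X
      e = proj₂ pz
      z< : z < a + 1M
      z< = by-or stable-< (≤-tot z a) ≤⇒<suc λ a≤z → by-em (z + 1M ≈ a + 1M) stable-<
        (λ q → ≤⇒<suc (≤-resp ≈-refl (suc-inj _ _ q) ≤-refl))
        (λ ne → stable-< λ _ → proj₂ (≤⇒<suc a≤z) (≤-antisym (proj₁ (≤⇒<suc a≤z))
           (<suc⇒≤ (≤-resp (≈-sym e) ≈-refl (proj₁ (proj₂ cp)) , ne))))
      below : ∀ y → y ≤ z → ⟦ φ ⟧ᶠ (y ∷ [])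
      below y q = proj₁ ok (proj₁ (h z z<) (last∈ X e) y q)

    abstract
      ind : (φ : PF 1) → ⟦ φ ⟧ᶠ (0M ∷ []) → (∀ x → ⟦ φ ⟧ᶠ (x ∷ []) → ⟦ φ ⟧ᶠ (x + 1M ∷ [])) → ∀ x → ⟦ φ ⟧ᶠ (x ∷ [])
      ind = ind′

      0+ : ∀ x → 0M + x ≈ x
      0+ = ind (𝕔 0M +ᵗ x₀ ≈ᶠ x₀) (+0 0M) λ x p → ≈-trans (+suc 0M x) (+-cong p ≈-refl)

      suc+ : ∀ x y → (x + 1M) + y ≈ (x + y) + 1M
      suc+ x = ind ((𝕔 x +ᵗ 𝕔 1M) +ᵗ x₀ ≈ᶠ (𝕔 x +ᵗ x₀) +ᵗ 𝕔 1M)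
        (≈-trans (+0 _) (+-cong (≈-sym (+0 x)) ≈-refl))
        λ y p → ≈-trans (+suc _ y) (+-cong (≈-trans p (≈-sym (+suc x y))) ≈-refl)

      +-comm : ∀ x y → x + y ≈ y + x
      +-comm x = ind (𝕔 x +ᵗ x₀ ≈ᶠ x₀ +ᵗ 𝕔 x) (≈-trans (+0 x) (≈-sym (0+ x)))
        λ y p → ≈-trans (+suc x y) (≈-trans (+-cong p ≈-refl) (≈-sym (suc+ y x)))

      +-assoc : ∀ x y z → (x + y) + z ≈ x + (y + z)
      +-assoc x y = ind (𝕔 (x + y) +ᵗ x₀ ≈ᶠ 𝕔 x +ᵗ (𝕔 y +ᵗ x₀))
        (≈-trans (+0 _) (+-cong ≈-refl (≈-sym (+0 y))))
        λ z p → ≈-trans (+suc _ z) (≈-trans (+-cong p ≈-refl) (≈-trans (≈-sym (+suc x (y + z))) (+-cong ≈-refl (≈-sym (+suc y z)))))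

      0* : ∀ x → 0M * x ≈ 0M
      0* = ind (𝕔 0M *ᵗ x₀ ≈ᶠ 𝕔 0M) (*0 0M) λ x p → ≈-trans (*suc 0M x) (≈-trans (+0 _) p)

      suc* : ∀ x y → (x + 1M) * y ≈ x * y + y
      suc* x = ind ((𝕔 x +ᵗ 𝕔 1M) *ᵗ x₀ ≈ᶠ 𝕔 x *ᵗ x₀ +ᵗ x₀)
        (≈-trans (*0 _) (≈-sym (≈-trans (+0 _) (*0 x))))
        λ y p → ≈-trans (*suc _ y) (≈-trans (+suc _ x) (≈-trans (+-cong (≈-trans (+-cong p ≈-refl)
          (≈-trans (+-assoc _ y x) (≈-trans (+-cong ≈-refl (+-comm y x)) (≈-trans (≈-sym (+-assoc _ x y)) (+-cong (≈-sym (*suc x y)) ≈-refl))))) ≈-refl)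
          (≈-sym (+suc _ y))))

      *-comm : ∀ x y → x * y ≈ y * x
      *-comm x = ind (𝕔 x *ᵗ x₀ ≈ᶠ x₀ *ᵗ 𝕔 x) (≈-trans (*0 x) (≈-sym (0* x)))
        λ y p → ≈-trans (*suc x y) (≈-trans (+-cong p ≈-refl) (≈-sym (suc* y x)))

      *-distribˡ : ∀ x y z → x * (y + z) ≈ x * y + x * z
      *-distribˡ x y = ind (𝕔 x *ᵗ (𝕔 y +ᵗ x₀) ≈ᶠ 𝕔 (x * y) +ᵗ 𝕔 x *ᵗ x₀)
        (≈-trans (*-cong ≈-refl (+0 y)) (≈-sym (≈-trans (+-cong ≈-refl (*0 x)) (+0 _))))
        λ z p → ≈-trans (*-cong ≈-refl (+suc y z)) (≈-trans (*suc x _) (≈-trans (+-cong p ≈-refl)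
          (≈-trans (+-assoc _ _ x) (+-cong ≈-refl (≈-sym (*suc x z))))))

      *-distribʳ : ∀ x y z → (y + z) * x ≈ y * x + z * x
      *-distribʳ x y z = ≈-trans (*-comm _ x) (≈-trans (*-distribˡ x y z) (+-cong (*-comm x y) (*-comm x z)))

      *-assoc : ∀ x y z → (x * y) * z ≈ x * (y * z)
      *-assoc x y = ind (𝕔 (x * y) *ᵗ x₀ ≈ᶠ 𝕔 x *ᵗ (𝕔 y *ᵗ x₀))
        (≈-trans (*0 _) (≈-sym (≈-trans (*-cong ≈-refl (*0 y)) (*0 x))))
        λ z p → ≈-trans (*suc _ z) (≈-trans (+-cong p ≈-refl) (≈-trans (≈-sym (*-distribˡ x (y * z) y)) (*-cong ≈-refl (≈-sym (*suc y z)))))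

      *1 : ∀ x → x * 1M ≈ x
      *1 x = ≈-trans (*-cong ≈-refl (≈-sym (0+ 1M))) (≈-trans (*suc x 0M) (≈-trans (+-cong (*0 x) ≈-refl) (0+ x)))

      1* : ∀ x → 1M * x ≈ x
      1* x = ≈-trans (*-comm 1M x) (*1 x)

    semiring : CommutativeSemiring _ _
    semiring = record
      { Carrier = M ; _≈_ = _≈_ ; _+_ = _+_ ; _*_ = _*_ ; 0# = 0M ; 1# = 1M
      ; isCommutativeSemiring = record
        { isSemiring = record
          { isSemiringWithoutAnnihilatingZero = record
            { +-isCommutativeMonoid = record
              { isMonoid = record
                { isSemigroup = record
                  { isMagma = record { isEquivalence = Setoid.isEquivalence setoid ; ∙-cong = +-cong }
                  ; assoc = +-assoc }
                ; identity = 0+ , +0 }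
              ; comm = +-comm }
            ; *-cong = *-cong
            ; *-assoc = *-assoc
            ; *-identity = 1* , *1
            ; distrib = *-distribˡ , *-distribʳ }
          ; zero = 0* , *0 }
        ; *-comm = *-comm } }

    open import Algebra.Solver.Ring.NaturalCoefficients.Default semiring public
      using (solve; _:=_; _:+_; _:*_; con; Polynomial)

    abstract
      +-cancelʳ : ∀ x y z → x + z ≈ y + z → x ≈ y
      +-cancelʳ x y = ind ((𝕔 x +ᵗ x₀ ≈ᶠ 𝕔 y +ᵗ x₀) ⇒ᶠ 𝕔 x ≈ᶠ 𝕔 y)
        (λ e → ≈-trans (≈-sym (+0 x)) (≈-trans e (+0 y)))
        λ z p e → p (suc-inj _ _ (≈-trans (≈-sym (+suc x z)) (≈-trans e (+suc y z))))

      +-cancelˡ : ∀ z x y → z + x ≈ z + y → x ≈ y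
      +-cancelˡ z x y e = +-cancelʳ x y z (≈-trans (+-comm x z) (≈-trans e (+-comm z y)))

      -- The difference is obtained by induction as a strong existential. With it an inequality
      -- becomes an equation, and together with `mk≤` most estimates reduce to semiring identities.
      slack : ∀ {x y} → x ≤ y → Σ M λ d → x + d ≈ y
      slack {x} {y} p = drop (ind (𝕔 x ≤ᶠ x₀ ⇒ᶠ ∃ᶠ x₀ (𝕔 x +ᵗ x₀ ≈ᶠ x₁))
            (λ q → 0M , ≤-refl , ≈-trans (+0 x) (≤-antisym q (0≤ x)))
            (λ z ih q → stableF (∃ᶠ (𝕔 (z + 1M)) (𝕔 x +ᵗ x₀ ≈ᶠ 𝕔 (z + 1M))) [] λ k → by-em (x ≈ z + 1M) stable-𝕆
               (λ e → k (0M , 0≤ _ , ≈-trans (+0 x) e))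
               (λ ne → let d , _ , e = ih (<suc⇒≤ (q , ne)) ; e' = ≈-trans (+suc x d) (+-cong e ≈-refl) in
                 k (d + 1M , ≤-resp ≈-refl (≈-trans (+-comm _ x) e') (≤+ (d + 1M) x) , e')))
            y p)
        where drop : ∀ {A : Set} {B C : A → Set} → Σ A (λ a → B a × C a) → Σ A C
              drop (a , _ , c) = a , c

      mk≤ : ∀ {x y} d → x + d ≈ y → x ≤ y
      mk≤ d e = ≤-resp ≈-refl e (≤+ _ d)

      ≤-trans : ∀ {x y z} → x ≤ y → y ≤ z → x ≤ z
      ≤-trans p q = let d , e = slack p ; d' , e' = slack q in
        mk≤ (d + d') (≈-trans (≈-sym (+-assoc _ _ _)) (≈-trans (+-cong e ≈-refl) e'))

      ≤-reflexive : ∀ {x y} → x ≈ y → x ≤ y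
      ≤-reflexive e = ≤-resp ≈-refl e ≤-refl

      +-mono : ∀ {x y u v} → x ≤ y → u ≤ v → x + u ≤ y + v
      +-mono {x} {y} {u} {v} p q = let d , e = slack p ; d' , e' = slack q in
        mk≤ (d + d') (≈-trans (solve 4 (λ x u d d' → (x :+ u) :+ (d :+ d') := (x :+ d) :+ (u :+ d')) ≈-refl x u d d') (+-cong e e'))

      *-mono : ∀ {x y u v} → x ≤ y → u ≤ v → x * u ≤ y * v
      *-mono {x} {y} {u} {v} p q = let d , e = slack p ; d' , e' = slack q in
        mk≤ (x * d' + d * u + d * d') (≈-trans (solve 4 (λ x u d d' → x :* u :+ (x :* d' :+ d :* u :+ d :* d') := (x :+ d) :* (u :+ d')) ≈-refl x u d d') (*-cong e e'))

      +-cancel-≤ : ∀ z {x y} → z + x ≤ z + y → x ≤ y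
      +-cancel-≤ z {x} {y} p = let d , e = slack p in mk≤ d (+-cancelˡ z _ _ (≈-trans (≈-sym (+-assoc z x d)) e))

      <⇒suc≤ : ∀ {x y} → x < y → x + 1M ≤ y
      <⇒suc≤ {x} {y} (p , ne) = let d , e = slack p
                                    d' , e' = pred d (λ q → ne (≈-trans (≈-sym (+0 x)) (≈-trans (+-cong ≈-refl (≈-sym q)) e))) in
        mk≤ d' (≈-trans (solve 3 (λ x d o → (x :+ o) :+ d := x :+ (d :+ o)) ≈-refl x d' 1M) (≈-trans (+-cong ≈-refl e') e))

      suc≤⇒< : ∀ {x y} → x + 1M ≤ y → x < y
      suc≤⇒< {x} {y} p = ≤-trans (≤+ x 1M) p , λ e → let d , e' = slack p in
        suc≉0 d (+-cancelˡ x _ _ (≈-trans (solve 3 (λ x d o → x :+ (d :+ o) := (x :+ o) :+ d) ≈-refl x d 1M)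
          (≈-trans e' (≈-trans (≈-sym e) (≈-sym (+0 x))))))

      <-≤-trans : ∀ {x y z} → x < y → y ≤ z → x < z
      <-≤-trans p q = suc≤⇒< (≤-trans (<⇒suc≤ p) q)

      ≤-<-trans : ∀ {x y z} → x ≤ y → y < z → x < z
      ≤-<-trans p q = suc≤⇒< (≤-trans (+-mono p ≤-refl) (<⇒suc≤ q))

      <-irrefl : ∀ {x} → ¬ₒ (x < x)
      <-irrefl (_ , ne) = ne ≈-refl

      ≤⇒≯ : ∀ {x y} → x ≤ y → ¬ₒ (y < x)
      ≤⇒≯ p q = <-irrefl (≤-<-trans p q)

      ≰⇒> : ∀ {x y} → (¬ₒ x ≤ y) → y < x
      ≰⇒> {x} {y} n = by-or stable-< (≤-tot x y) (λ p → stable-< λ _ → n p) λ q → q , λ e → n (≤-reflexive (≈-sym e))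

      ≮⇒≥ : ∀ {x y} → (¬ₒ x < y) → y ≤ x
      ≮⇒≥ {x} {y} n = by-em (y ≤ x) stable-≤ id λ k → stable-≤ λ _ → n (≰⇒> k)

      by-< : ∀ {G : Set} → Stable G → ∀ x y → (x < y → G) → (y ≤ x → G) → G
      by-< st x y f g = by-em (x < y) st f λ n → g (≮⇒≥ n)

      0<suc : ∀ x → 0M < x + 1M
      0<suc x = ≤⇒<suc (0≤ x)

      ≉0⇒> : ∀ {x} → (¬ₒ x ≈ 0M) → 0M < x
      ≉0⇒> n = 0≤ _ , λ e → n (≈-sym e)

      ≤0 : ∀ {x} → x ≤ 0M → x ≈ 0M
      ≤0 p = ≤-antisym p (0≤ _)

      *-zero-or : ∀ {x y} → x * y ≈ 0M → 0M < y → x ≈ 0M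
      *-zero-or {x} {y} e p = let d , e' = slack (<⇒suc≤ p) in ≤0 (mk≤ (x * d)
        (≈-trans (+-cong (≈-sym (≈-trans (*-cong ≈-refl (0+ 1M)) (*1 x))) ≈-refl)
        (≈-trans (≈-sym (*-distribˡ x _ d)) (≈-trans (*-cong ≈-refl e') e))))

      *-cancel-≤ : ∀ {x y} z → 0M < z → x * z ≤ y * z → x ≤ y
      *-cancel-≤ {x} {y} z p q = by-< stable-≤ y x
        (λ r → stable-≤ λ _ → let d , e = slack (proj₁ r) in
           proj₂ r (≈-sym (≈-trans (≈-sym e) (≈-trans (+-cong ≈-refl (*-zero-or {d} {z} (≤0 (+-cancel-≤ (y * z)
             (≤-trans (≤-reflexive (≈-trans (≈-sym (*-distribʳ z y d)) (*-cong e ≈-refl))) (≤-trans q (≤-reflexive (≈-sym (+0 _))))))) p)) (+0 y)))))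
        id

      *-cancel-≈ : ∀ {x y} z → 0M < z → x * z ≈ y * z → x ≈ y
      *-cancel-≈ z p e = ≤-antisym (*-cancel-≤ z p (≤-reflexive e)) (*-cancel-≤ z p (≤-reflexive (≈-sym e)))

      *-pos : ∀ {x y} → 0M < x → 0M < y → 0M < x * y
      *-pos p q = ≉0⇒> λ e → proj₂ p (≈-sym (*-zero-or e q))

      *-mono-< : ∀ {x y} z → 0M < z → x < y → x * z < y * z
      *-mono-< z p (q , n) = *-mono q ≤-refl , λ e → n (*-cancel-≈ z p e)

    num : ℕ → M
    num zero    = 0M
    num (suc n) = num n + 1M

    abstract
      num-+ : ∀ m n → num (m ℕ.+ n) ≈ num m + num n
      num-+ zero n = ≈-sym (0+ _)
      num-+ (suc m) n = ≈-trans (+-cong (num-+ m n) ≈-refl) (≈-sym (suc+ _ _))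

      num-* : ∀ m n → num (m ℕ.* n) ≈ num m * num n
      num-* zero n = ≈-sym (0* _)
      num-* (suc m) n = ≈-trans (num-+ n (m ℕ.* n)) (≈-trans (+-comm _ _) (≈-trans (+-cong (num-* m n) ≈-refl) (≈-sym (suc* _ _))))

      num-≤ : ∀ {m n} → m ℕ.≤ n → num m ≤ num n
      num-≤ {n = n} ℕ.z≤n = 0≤ (num n)
      num-≤ (ℕ.s≤s p) = +-mono (num-≤ p) ≤-refl

      num-< : ∀ {m n} → m ℕ.< n → num m < num n
      num-< p = suc≤⇒< (num-≤ p)

  -- Definable functions and predicates.

  module Definable where
    open Arithmetic public
    open import Data.Fin using (_↑ˡ_; _↑ʳ_)
    open import Data.Vec using (lookup; _++_; map)
    open import Data.Vec.Properties using (lookup-++ˡ; lookup-++ʳ)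

    infix 4 _≈ᵛ_
    _≈ᵛ_ : ∀ {k} → Vec M k → Vec M k → Set
    x ≈ᵛ y = ∀ i → lookup x i ≈ lookup y i

    All≤ : ∀ {k} → M → Vec M k → Set
    All≤ b x = ∀ i → lookup x i ≤ b

    sumV : ∀ {k} → Vec M k → M
    sumV []      = 0M
    sumV (a ∷ x) = a + sumV x

    abstract
      ≤+ʳ : ∀ x y → y ≤ x + y
      ≤+ʳ x y = ≤-resp ≈-refl (+-comm y x) (≤+ y x)

      sumV-ok : ∀ {k} (x : Vec M k) → All≤ (sumV x) x
      sumV-ok (a ∷ x) zero    = ≤+ a _
      sumV-ok (a ∷ x) (suc i) = ≤-trans (sumV-ok x i) (≤+ʳ a _)

      All≤-mono : ∀ {k b c} {x : Vec M k} → b ≤ c → All≤ b x → All≤ c x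
      All≤-mono p h i = ≤-trans (h i) p

      All≤-∷ : ∀ {k b a} {x : Vec M k} → a ≤ b → All≤ b x → All≤ b (a ∷ x)
      All≤-∷ p h zero    = p
      All≤-∷ p h (suc i) = h i

      respT : ∀ {k} (t : Te k) {x y} → x ≈ᵛ y → ⟦ t ⟧ᵗ x ≈ ⟦ t ⟧ᵗ y
      respT (𝕧 i) e    = e i
      respT (𝕔 a) e    = ≈-refl
      respT (s +ᵗ t) e = +-cong (respT s e) (respT t e)
      respT (s *ᵗ t) e = *-cong (respT s e) (respT t e)

      ≈ᵛ-∷ : ∀ {k a b} {x y : Vec M k} → a ≈ b → x ≈ᵛ y → (a ∷ x) ≈ᵛ (b ∷ y)
      ≈ᵛ-∷ p h zero    = p
      ≈ᵛ-∷ p h (suc i) = h i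

      ≈ᵛ-sym : ∀ {k} {x y : Vec M k} → x ≈ᵛ y → y ≈ᵛ x
      ≈ᵛ-sym e i = ≈-sym (e i)

      respF : ∀ {k} (φ : PF k) {x y} → x ≈ᵛ y → ⟦ φ ⟧ᶠ x → ⟦ φ ⟧ᶠ y
      respF (s ≤ᶠ t) e h = ≤-resp (respT s e) (respT t e) h
      respF (s ≈ᶠ t) e h = ≈-trans (≈-sym (respT s e)) (≈-trans h (respT t e))
      respF (s ∈ᶠ X) e h = ∈-resp (respT s e) h
      respF ⊥ᶠ e h = h
      respF (φ ⇒ᶠ ψ) {x} {y} e h p = respF ψ e (h (respF φ (≈ᵛ-sym {x = x} {y = y} e) p))
      respF (φ ∧ᶠ ψ) e (h , h') = respF φ e h , respF ψ e h'
      respF (∀ᶠ t φ) e h y p = respF φ (≈ᵛ-∷ ≈-refl e) (h y (≤-resp ≈-refl (≈-sym (respT t e)) p))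
      respF (∃ᶠ t φ) e (y , p , h) = y , ≤-resp ≈-refl (respT t e) p , respF φ (≈ᵛ-∷ ≈-refl e) h

    -- Functions and predicates that are Σ0-definable on every initial segment; the
    -- defining formula (and the strings in it) may depend on the segment.

    record Fn (k : ℕ) : Set where
      no-eta-equality
      field
        fun    : Vec M k → M
        bnd    : M → M
        bnd-ok : ∀ b x → All≤ b x → fun x ≤ bnd b
        gr     : M → PF (suc k)
        gr-ok  : ∀ b x → All≤ b x → ∀ y → ⟦ gr b ⟧ᶠ (y ∷ x) ⇿ (y ≈ fun x)
    open Fn public

    record Pr (k : ℕ) : Set₁ where
      no-eta-equality
      field
        holds   : Vec M k → Set
        code    : M → PF k
        code-ok : ∀ b x → All≤ b x → ⟦ code b ⟧ᶠ x ⇿ holds x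
    open Pr public

    infixl 9 _$_
    _$_ : ∀ {k} → Fn k → Vec M k → M
    _$_ = fun

    abstract
      stableP : ∀ {k} (P : Pr k) x → Stable (holds P x)
      stableP P x h = let i = code-ok P (sumV x) x (sumV-ok x) in
        proj₁ i (stableF (code P (sumV x)) x λ k → h (k ∘ proj₂ i))

      respP : ∀ {k} (P : Pr k) {x y} → x ≈ᵛ y → holds P x → holds P y
      respP P {x} {y} e h = let b = sumV x + sumV y in
        proj₁ (code-ok P b y (All≤-mono {x = y} (≤+ʳ _ _) (sumV-ok y))) (respF (code P b) e
          (proj₂ (code-ok P b x (All≤-mono {x = x} (≤+ _ _) (sumV-ok x))) h))

      congF : ∀ {k} (f : Fn k) {x y} → x ≈ᵛ y → f $ x ≈ f $ y
      congF f {x} {y} e = let b = sumV x + sumV y in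
        proj₁ (gr-ok f b y (All≤-mono {x = y} (≤+ʳ _ _) (sumV-ok y)) _) (respF (gr f b) (≈ᵛ-∷ ≈-refl e)
          (proj₂ (gr-ok f b x (All≤-mono {x = x} (≤+ _ _) (sumV-ok x)) _) ≈-refl))

      cong1 : (f : Fn 1) → ∀ {x y} → x ≈ y → f $ (x ∷ []) ≈ f $ (y ∷ [])
      cong1 f e = congF f (≈ᵛ-∷ e λ ())

      cong2 : (f : Fn 2) → ∀ {x y u v} → x ≈ y → u ≈ v → f $ (x ∷ u ∷ []) ≈ f $ (y ∷ v ∷ [])
      cong2 f e e' = congF f (≈ᵛ-∷ e (≈ᵛ-∷ e' λ ()))

      cong3 : (f : Fn 3) → ∀ {x y u v s t} → x ≈ y → u ≈ v → s ≈ t → f $ (x ∷ u ∷ s ∷ []) ≈ f $ (y ∷ v ∷ t ∷ [])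
      cong3 f e e' e'' = congF f (≈ᵛ-∷ e (≈ᵛ-∷ e' (≈ᵛ-∷ e'' λ ())))

    -- Copatterns keep composite functions and predicates from unfolding during unification.
    varF : ∀ {k} → Fin k → Fn k
    varF i .fun x = lookup x i
    varF i .bnd b = b
    varF i .bnd-ok b x h = h i
    varF i .gr _ = x₀ ≈ᶠ 𝕧 (suc i)
    varF i .gr-ok _ _ _ _ = id , id

    conF : ∀ {k} → M → Fn k
    conF c .fun _ = c
    conF c .bnd _ = c
    conF c .bnd-ok _ _ _ = ≤-refl
    conF c .gr _ = x₀ ≈ᶠ 𝕔 c
    conF c .gr-ok _ _ _ _ = id , id

    x₂ : ∀ {k} → Te (suc (suc (suc k)))
    x₂ = 𝕧 (suc (suc zero))

    plusF timesF : Fn 2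
    plusF .fun (x ∷ y ∷ []) = x + y
    plusF .bnd b = b + b
    plusF .bnd-ok b (x ∷ y ∷ []) h = +-mono (h zero) (h (suc zero))
    plusF .gr _ = x₀ ≈ᶠ x₁ +ᵗ x₂
    plusF .gr-ok _ (x ∷ y ∷ []) _ _ = id , id
    timesF .fun (x ∷ y ∷ []) = x * y
    timesF .bnd b = b * b
    timesF .bnd-ok b (x ∷ y ∷ []) h = *-mono (h zero) (h (suc zero))
    timesF .gr _ = x₀ ≈ᶠ x₁ *ᵗ x₂
    timesF .gr-ok _ (x ∷ y ∷ []) _ _ = id , id

    vals : ∀ {k j} → Vec (Fn k) j → Vec M k → Vec M j
    vals fs x = map (λ f → fun f x) fs

    bnds : ∀ {k j} → Vec (Fn k) j → M → M
    bnds []       b = 0M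
    bnds (f ∷ fs) b = bnd f b + bnds fs b

    bnds-ok : ∀ {k j} (fs : Vec (Fn k) j) b x → All≤ b x → All≤ (bnds fs b) (vals fs x)
    bnds-ok (f ∷ fs) b x h zero    = ≤-trans (bnd-ok f b x h) (≤+ _ _)
    bnds-ok (f ∷ fs) b x h (suc i) = ≤-trans (bnds-ok fs b x h i) (≤+ʳ _ _)

    module _ {k k' : ℕ} (r : Fin k → Fin k') where
      place : ∀ j → Fin (suc k) → Fin (suc (j ℕ.+ k'))
      place j zero    = zero
      place j (suc i) = suc (j ↑ʳ r i)

      -- Composition binds the values of the inner functions by bounded existentials. On the segment
      -- up to `b` these values stay below `bnds fs b`, and this is the segment on which the outer
      -- formula is taken.
      letC : ∀ {j} → Vec (Fn k) j → M → PF (j ℕ.+ k') → PF k'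
      letC [] b φ = φ
      letC {suc j} (f ∷ fs) b φ = letC fs b (∃ᶠ (𝕔 (bnd f b)) (rnF (place j) (gr f b) ∧ᶠ φ))

      letC-ok : ∀ {j} (fs : Vec (Fn k) j) b φ x z → All≤ b x → (∀ i → lookup z (r i) ≡ lookup x i) →
        ⟦ letC fs b φ ⟧ᶠ z ⇿ ⟦ φ ⟧ᶠ (vals fs x ++ z)
      letC-ok [] b φ x z h e = id , id
      letC-ok {suc j} (f ∷ fs) b φ x z h e with letC-ok fs b (∃ᶠ (𝕔 (bnd f b)) (rnF (place j) (gr f b) ∧ᶠ φ)) x z h e
      ... | to , fr = (λ p → let y , _ , q , s = to p in
              respF φ (≈ᵛ-∷ (proj₁ (gr-ok f b x h y) (proj₁ (rn y) q)) (λ _ → ≈-refl)) s)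
          , λ s → fr (f $ x , bnd-ok f b x h , proj₂ (rn _) (proj₂ (gr-ok f b x h _) ≈-refl) , s)
        where
        rn : ∀ y → ⟦ rnF (place j) (gr f b) ⟧ᶠ (y ∷ (vals fs x ++ z)) ⇿ ⟦ gr f b ⟧ᶠ (y ∷ x)
        rn y = rnF-ok (λ { zero → ≡.refl ; (suc i) → ≡.trans (lookup-++ʳ (vals fs x) z (r i)) (e i) }) (gr f b)

    subP : ∀ {j k} → Pr j → Vec (Fn k) j → Pr k
    subP P fs .holds x = holds P (vals fs x)
    subP {j} {k} P fs .code b = letC id fs b (rnF (_↑ˡ k) (code P (bnds fs b)))
    subP {j} {k} P fs .code-ok b x h =
      let p , q = letC-ok id fs b (rnF (_↑ˡ k) (code P (bnds fs b))) x x h (λ _ → ≡.refl)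
          p' , q' = rnF-ok (λ i → lookup-++ˡ (vals fs x) x i) (code P (bnds fs b))
          p'' , q'' = code-ok P (bnds fs b) (vals fs x) (bnds-ok fs b x h) in
      p'' ∘ p' ∘ p , q ∘ q' ∘ q''

    infixl 8 _∘F_
    private
      pl : ∀ {j k} → Fin (suc j) → Fin (j ℕ.+ suc k)
      pl {j} zero        = j ↑ʳ zero
      pl {j} {k} (suc i) = i ↑ˡ suc k
      pl-ok : ∀ {j k} (fs : Vec (Fn k) j) y x i → lookup (vals fs x ++ (y ∷ x)) (pl i) ≡ lookup (y ∷ vals fs x) i
      pl-ok fs y x zero    = lookup-++ʳ (vals fs x) (y ∷ x) zero
      pl-ok fs y x (suc i) = lookup-++ˡ (vals fs x) (y ∷ x) i

    _∘F_ : ∀ {j k} → Fn j → Vec (Fn k) j → Fn k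
    (F ∘F fs) .fun x = fun F (vals fs x)
    (F ∘F fs) .bnd b = bnd F (bnds fs b)
    (F ∘F fs) .bnd-ok b x h = bnd-ok F _ _ (bnds-ok fs b x h)
    (F ∘F fs) .gr b = letC suc fs b (rnF pl (gr F (bnds fs b)))
    (F ∘F fs) .gr-ok b x h y =
      let p , q = letC-ok suc fs b (rnF pl (gr F (bnds fs b))) x (y ∷ x) h (λ _ → ≡.refl)
          p' , q' = rnF-ok (pl-ok fs y x) (gr F (bnds fs b))
          p'' , q'' = gr-ok F (bnds fs b) (vals fs x) (bnds-ok fs b x h) y in
      p'' ∘ p' ∘ p , q ∘ q' ∘ q''

    infixl 6 _⊕_
    infixl 7 _⊗_
    _⊕_ _⊗_ : ∀ {k} → Fn k → Fn k → Fn k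
    f ⊕ g = plusF ∘F (f ∷ g ∷ [])
    f ⊗ g = timesF ∘F (f ∷ g ∷ [])

    infix 5 _≤P_ _≈P_ _<P_
    infixr 4 _∧P_
    infixr 3 _⇒P_

    private
      le2 eq2 lt2 : Pr 2
      le2 .holds (x ∷ y ∷ []) = x ≤ y
      le2 .code _ = x₀ ≤ᶠ x₁
      le2 .code-ok _ (_ ∷ _ ∷ []) _ = id , id
      eq2 .holds (x ∷ y ∷ []) = x ≈ y
      eq2 .code _ = x₀ ≈ᶠ x₁
      eq2 .code-ok _ (_ ∷ _ ∷ []) _ = id , id
      lt2 .holds (x ∷ y ∷ []) = x < y
      lt2 .code _ = x₀ ≤ᶠ x₁ ∧ᶠ (x₀ ≈ᶠ x₁ ⇒ᶠ ⊥ᶠ)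
      lt2 .code-ok _ (_ ∷ _ ∷ []) _ = id , id

      mem1 : S → Pr 1
      mem1 X .holds (x ∷ []) = x ∈M X
      mem1 X .code _ = x₀ ∈ᶠ X
      mem1 X .code-ok _ (_ ∷ []) _ = id , id

    _≤P_ _≈P_ _<P_ : ∀ {k} → Fn k → Fn k → Pr k
    f ≤P g = subP le2 (f ∷ g ∷ [])
    f ≈P g = subP eq2 (f ∷ g ∷ [])
    f <P g = subP lt2 (f ∷ g ∷ [])

    _∈P_ : ∀ {k} → Fn k → S → Pr k
    f ∈P X = subP (mem1 X) (f ∷ [])

    ⊥P : ∀ {k} → Pr k
    ⊥P .holds _ = 𝕆
    ⊥P .code _ = ⊥ᶠ
    ⊥P .code-ok _ _ _ = id , id

    _∧P_ _⇒P_ : ∀ {k} → Pr k → Pr k → Pr k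
    (P ∧P Q) .holds x = holds P x × holds Q x
    (P ∧P Q) .code b = code P b ∧ᶠ code Q b
    (P ∧P Q) .code-ok b x h = map-× (code-ok P b x h) (code-ok Q b x h)
    (P ⇒P Q) .holds x = holds P x → holds Q x
    (P ⇒P Q) .code b = code P b ⇒ᶠ code Q b
    (P ⇒P Q) .code-ok b x h = map-→ (code-ok P b x h) (code-ok Q b x h)

    ¬P_ : ∀ {k} → Pr k → Pr k
    ¬P P = P ⇒P ⊥P

    private
      skip : ∀ {k} → Fin (suc k) → Fin (suc (suc k))
      skip zero    = zero
      skip (suc i) = suc (suc i)

    -- The bound is a function value and no term, so it is first fetched by a bounded existential.
    -- The bound variable may exceed `b`, hence the code of the body is taken on the segment
    -- `b + bnd f b`.
    ∀P ∃P : ∀ {k} → Fn k → Pr (suc k) → Pr k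
    ∀P f P .holds = λ x → ∀ y → y ≤ f $ x → holds P (y ∷ x)
    ∀P f P .code = λ b → ∃ᶠ (𝕔 (bnd f b)) (gr f b ∧ᶠ ∀ᶠ x₀ (rnF skip (code P (b + bnd f b))))
    ∀P f P .code-ok = λ b x h →
          (λ (z , _ , g , a) y p → let e = proj₁ (gr-ok f b x h z) g in
             proj₁ (code-ok P _ (y ∷ x) (All≤-∷ (≤-trans p (≤-trans (bnd-ok f b x h) (≤+ʳ b _))) (All≤-mono {x = x} (≤+ b _) h)))
               (proj₁ (rnF-ok (λ { zero → ≡.refl ; (suc i) → ≡.refl }) (code P (b + bnd f b))) (a y (≤-resp ≈-refl (≈-sym e) p))))
        , λ a → f $ x , bnd-ok f b x h , proj₂ (gr-ok f b x h _) ≈-refl , λ y p →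
             proj₂ (rnF-ok (λ { zero → ≡.refl ; (suc i) → ≡.refl }) (code P (b + bnd f b)))
              (proj₂ (code-ok P _ (y ∷ x) (All≤-∷ (≤-trans p (≤-trans (bnd-ok f b x h) (≤+ʳ b _))) (All≤-mono {x = x} (≤+ b _) h))) (a y p))
    ∃P f P .holds = λ x → Σ M λ y → y ≤ f $ x × holds P (y ∷ x)
    ∃P f P .code = λ b → ∃ᶠ (𝕔 (bnd f b)) (gr f b ∧ᶠ ∃ᶠ x₀ (rnF skip (code P (b + bnd f b))))
    ∃P f P .code-ok = λ b x h →
          (λ (z , _ , g , y , p , a) → let e = proj₁ (gr-ok f b x h z) g ; p' = ≤-resp ≈-refl e p in y , p' ,
             proj₁ (code-ok P _ (y ∷ x) (All≤-∷ (≤-trans p' (≤-trans (bnd-ok f b x h) (≤+ʳ b _))) (All≤-mono {x = x} (≤+ b _) h)))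
               (proj₁ (rnF-ok (λ { zero → ≡.refl ; (suc i) → ≡.refl }) (code P (b + bnd f b))) a))
        , λ (y , p , a) → f $ x , bnd-ok f b x h , proj₂ (gr-ok f b x h _) ≈-refl , y , p ,
             proj₂ (rnF-ok (λ { zero → ≡.refl ; (suc i) → ≡.refl }) (code P (b + bnd f b)))
              (proj₂ (code-ok P _ (y ∷ x) (All≤-∷ (≤-trans p (≤-trans (bnd-ok f b x h) (≤+ʳ b _))) (All≤-mono {x = x} (≤+ b _) h))) a)

    -- The strong existential supplies the value, and uniqueness makes `P` the graph of the
    -- resulting function.
    search : ∀ {k} (P : Pr (suc k)) (B : Fn k) → (∀ x → Σ M λ y → y ≤ B $ x × holds P (y ∷ x)) →
      (∀ x y z → holds P (y ∷ x) → holds P (z ∷ x) → y ≈ z) → Fn k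
    search P B ex un .fun = λ x → proj₁ (ex x)
    search P B ex un .bnd = bnd B
    search P B ex un .bnd-ok = λ b x h → ≤-trans (proj₁ (proj₂ (ex x))) (bnd-ok B b x h)
    search P B ex un .gr = λ b → x₀ ≤ᶠ 𝕔 (bnd B b) ∧ᶠ code P (b + bnd B b)
    search P B ex un .gr-ok = λ b x h y →
          (λ (p , c) → un x y _ (proj₁ (code-ok P _ (y ∷ x) (All≤-∷ (≤-trans p (≤+ʳ b _)) (All≤-mono {x = x} (≤+ b _) h))) c) (proj₂ (proj₂ (ex x))))
        , λ e → let p = ≤-resp (≈-sym e) ≈-refl (≤-trans (proj₁ (proj₂ (ex x))) (bnd-ok B b x h)) in
            p , proj₂ (code-ok P _ (y ∷ x) (All≤-∷ (≤-trans p (≤+ʳ b _)) (All≤-mono {x = x} (≤+ b _) h)))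
                  (respP P (≈ᵛ-∷ (≈-sym e) λ _ → ≈-refl) (proj₂ (proj₂ (ex x))))

    weakF : ∀ {k} → Fn k → Fn (suc k)
    weakF {k} f = f ∘F Data.Vec.tabulate (λ i → varF (suc i))
      where import Data.Vec

    -- A predicate has a formula only on each segment separately. Induction up to `a` therefore uses
    -- the formula for `a`, guarded by `x ≤ a`.
    indP : (P : Pr 1) → holds P (0M ∷ []) → (∀ x → holds P (x ∷ []) → holds P (x + 1M ∷ [])) → ∀ x → holds P (x ∷ [])
    indP P base step a = proj₁ (ok a ≤-refl) (ind (x₀ ≤ᶠ 𝕔 a ⇒ᶠ code P a)
        (λ p → proj₂ (ok 0M p) base)
        (λ x h p → let q = ≤-trans (≤+ x 1M) p in proj₂ (ok _ p) (step x (proj₁ (ok x q) (h q)))) a ≤-refl)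
      where
      ok : ∀ x → x ≤ a → ⟦ code P a ⟧ᶠ (x ∷ []) ⇿ holds P (x ∷ [])
      ok x p = code-ok P a (x ∷ []) λ { zero → p }

    indB : ∀ a (P : Pr 1) → holds P (0M ∷ []) → (∀ x → x < a → holds P (x ∷ []) → holds P (x + 1M ∷ [])) →
      ∀ x → x ≤ a → holds P (x ∷ [])
    indB a P base step = indP ((varF zero ≤P conF a) ⇒P P) (λ _ → base)
      λ x h p → let q = suc≤⇒< p in step x q (h (proj₁ q))

    private
      tl : ∀ {k} → Vec M (suc k) → Vec M k
      tl (_ ∷ x) = x

    weakP : ∀ {k} → Pr k → Pr (suc k)
    weakP P .holds x = holds P (tl x)
    weakP P .code b = rnF suc (code P b)
    weakP P .code-ok b (a ∷ x) h =
      let p , q = rnF-ok {f = suc} {x = x} {y = a ∷ x} (λ _ → ≡.refl) (code P b)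
          p' , q' = code-ok P b x (λ i → h (suc i)) in p' ∘ p , q ∘ q'

    grP : ∀ {k} → Fn k → Pr (suc k)
    grP f .holds (y ∷ x) = y ≈ f $ x
    grP f .code = gr f
    grP f .code-ok b (y ∷ x) h = gr-ok f b x (λ i → h (suc i)) y

    iteR : ∀ {k} → Pr k → Fn k → Fn k → Pr (suc k)
    iteR P f g = (weakP P ⇒P grP f) ∧P (¬P (weakP P) ⇒P grP g)

    abstract
      -- Which branch applies cannot be decided, but the existence of a value is itself a definable
      -- predicate and hence stable.
      ite-ex : ∀ {k} (P : Pr k) f g x → Σ M λ y → y ≤ (f ⊕ g) $ x × holds (iteR P f g) (y ∷ x)
      ite-ex P f g x = stableP (∃P (f ⊕ g) (iteR P f g)) x λ k → by-em (holds P x) stable-𝕆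
         (λ p → k (f $ x , ≤+ _ _ , (λ _ → ≈-refl) , λ n → stable-≈ λ _ → n p))
         (λ n → k (g $ x , ≤+ʳ _ _ , (λ p → stable-≈ λ _ → n p) , λ _ → ≈-refl))

      ite : ∀ {k} → Pr k → Fn k → Fn k → Fn k
      ite P f g = search (iteR P f g) (f ⊕ g) (ite-ex P f g)
        (λ x y z (a , b) (c , d) → by-em (holds P x) stable-≈
           (λ p → ≈-trans (a p) (≈-sym (c p))) (λ n → ≈-trans (b n) (≈-sym (d n))))

      ite-yes : ∀ {k} (P : Pr k) f g {x} → holds P x → ite P f g $ x ≈ f $ x
      ite-yes P f g {x} p = proj₁ (proj₂ (proj₂ (ite-ex P f g x))) p

      ite-no : ∀ {k} (P : Pr k) f g {x} → (¬ₒ holds P x) → ite P f g $ x ≈ g $ x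
      ite-no P f g {x} p = proj₂ (proj₂ (proj₂ (ite-ex P f g x))) p

    x0 : ∀ {k} → Fn (suc k)
    x0 = varF zero
    x1 : ∀ {k} → Fn (suc (suc k))
    x1 = varF (suc zero)
    x2 : ∀ {k} → Fn (suc (suc (suc k)))
    x2 = varF (suc (suc zero))
    x3 : ∀ {k} → Fn (suc (suc (suc (suc k))))
    x3 = varF (suc (suc (suc zero)))

    least : (P : Pr 1) → ∀ a → holds P (a ∷ []) → Σ M λ y → y ≤ a × holds P (y ∷ []) × (∀ z → z < y → ¬ₒ holds P (z ∷ []))
    least P a pa = let y , p , q , r = stableP (∃P x0 (P' ∧P ∀P x0 ((x0 <P x1) ⇒P (¬P (subP P (x0 ∷ []))))) ) (a ∷ []) λ none →
                          indP (∀P x0 (¬P subP P (x0 ∷ [])))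
                            (λ y p h → none (y , ≤-trans p (0≤ a) , h , λ z _ (q , ne) _ → ne (≤-antisym q (≤-trans p (0≤ z)))))
                            (λ x h y p hy → by-em (y ≤ a) stable-𝕆 (λ ya → none (y , ya , hy , λ z _ zy → h z (<suc⇒≤ (<-≤-trans zy p))))
                               λ na → h a (<suc⇒≤ (<-≤-trans (≰⇒> na) p)) pa)
                            a a ≤-refl pa
                   in y , p , q , λ z zy → r z (proj₁ zy) zy
      where P' : Pr 2
            P' = subP P (x0 ∷ [])

  -- Pairing, comprehension and orbits from the VL axiom.

  module Sequences where
    open Definable public

    pr : M → M → M
    pr x y = (x + y) * ((x + y) + 1M) + (1M + 1M) * y

    abstract
      pr-cong : ∀ {x y u v} → x ≈ y → u ≈ v → pr x u ≈ pr y v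
      pr-cong e f = +-cong (*-cong (+-cong e f) (+-cong (+-cong e f) ≈-refl)) (*-cong ≈-refl f)

      pr-mono : ∀ {x y u v} → x ≤ y → u ≤ v → pr x u ≤ pr y v
      pr-mono e f = +-mono (*-mono (+-mono e f) (+-mono (+-mono e f) ≤-refl)) (*-mono ≤-refl f)

      ≤prʳ : ∀ x y → y ≤ pr x y
      ≤prʳ x y = ≤-trans (≤-trans (≤+ y y) (≤-reflexive (solve 2 (λ y o → y :+ y := y :+ y) ≈-refl y 1M)))
        (≤-trans (≤-reflexive (≈-sym (≈-trans (*-distribʳ y 1M 1M) (+-cong (1* y) (1* y))))) (≤+ʳ _ _))

      ≤prˡ : ∀ x y → x ≤ pr x y
      ≤prˡ x y = ≤-trans (≤+ x y) (≤-trans (≤-trans (≤-reflexive (≈-sym (*1 _))) (*-mono ≤-refl (≤+ʳ (x + y) 1M))) (≤+ _ _))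

      pr-sum< : ∀ x y u v → x + y < u + v → pr x y < pr u v
      pr-sum< x y u v p = <-≤-trans (suc≤⇒< (≤-trans
          (+-mono (+-mono (≤-refl {s * (s + 1M)}) (*-mono (≤-refl {1M + 1M}) (≤+ʳ x y))) (≤+ 1M 1M))
          (≤-reflexive (≈-trans (+-cong (+-cong ≈-refl (*-cong ≈-refl ≈-refl)) ≈-refl)
            (solve 1 (λ s → (s :* (s :+ con 1) :+ (con 1 :+ con 1) :* s) :+ (con 1 :+ con 1) := (s :+ con 1) :* ((s :+ con 1) :+ con 1)) ≈-refl s)))))
          (≤-trans (*-mono (<⇒suc≤ p) (+-mono (<⇒suc≤ p) ≤-refl)) (≤+ _ _))
        where s : M
              s = x + y

      pr-inj : ∀ {x y u v} → pr x y ≈ pr u v → x ≈ u × y ≈ v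
      pr-inj {x} {y} {u} {v} e = by-< st (x + y) (u + v)
          (λ p → st λ _ → proj₂ (pr-sum< x y u v p) e)
          (λ q → by-< st (u + v) (x + y) (λ p → st λ _ → proj₂ (pr-sum< u v x y p) (≈-sym e)) λ q' → fin (≤-antisym q' q))
        where
        st : Stable (x ≈ u × y ≈ v)
        st = stable-× stable-≈ stable-≈
        fin : x + y ≈ u + v → x ≈ u × y ≈ v
        fin s = let yv = *-cancel-≈ (1M + 1M) (0<suc 1M) (≈-trans (*-comm y _) (≈-trans (+-cancelˡ _ _ _
                           (≈-trans e (+-cong (*-cong (≈-sym s) (+-cong (≈-sym s) ≈-refl)) ≈-refl))) (*-comm _ v)))
                in +-cancelʳ x u v (≈-trans (+-cong ≈-refl (≈-sym yv)) s) , yv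

    prF : ∀ {k} → Fn k → Fn k → Fn k
    prF f g = (f ⊕ g) ⊗ ((f ⊕ g) ⊕ conF 1M) ⊕ (conF (1M + 1M)) ⊗ g

    private
      -- The pairing function takes only even values, so it is not onto; numbers that are not pairs
      -- receive the projections 0.
      isPr : Pr 1
      isPr = ∃P x0 (∃P x1 (x2 ≈P prF x1 x0))
      fR sR : Pr 2
      fR = (weakP isPr ⇒P ∃P x1 (x2 ≈P prF x1 x0)) ∧P (¬P (weakP isPr) ⇒P x0 ≈P conF 0M)
      sR = (weakP isPr ⇒P ∃P x1 (x2 ≈P prF x0 x1)) ∧P (¬P (weakP isPr) ⇒P x0 ≈P conF 0M)

    private
      isPr-pr : ∀ {p} x y → p ≈ pr x y → holds isPr (p ∷ [])
      isPr-pr x y e = x , ≤-resp ≈-refl (≈-sym e) (≤prˡ x y) , y , ≤-resp ≈-refl (≈-sym e) (≤prʳ x y) , e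

    abstract
      fst-ex : ∀ x → Σ M λ y → y ≤ x0 $ x × holds fR (y ∷ x)
      fst-ex (p ∷ []) = stableP (∃P x0 fR) (p ∷ []) λ k → by-em (holds isPr (p ∷ [])) stable-𝕆
         (λ (u , _ , v , _ , e) → k (u , ≤-resp ≈-refl (≈-sym e) (≤prˡ u v) , (λ _ → v , ≤-resp ≈-refl (≈-sym e) (≤prʳ u v) , e) , λ n → stable-≈ λ _ → n (isPr-pr u v e)))
         (λ n → k (0M , 0≤ _ , (λ h → stableP (∃P x1 (x2 ≈P prF x1 x0)) (0M ∷ p ∷ []) λ _ → n h) , λ _ → ≈-refl))

      snd-ex : ∀ x → Σ M λ y → y ≤ x0 $ x × holds sR (y ∷ x)
      snd-ex (p ∷ []) = stableP (∃P x0 sR) (p ∷ []) λ k → by-em (holds isPr (p ∷ [])) stable-𝕆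
         (λ (u , _ , v , _ , e) → k (v , ≤-resp ≈-refl (≈-sym e) (≤prʳ u v) , (λ _ → u , ≤-resp ≈-refl (≈-sym e) (≤prˡ u v) , e) , λ n → stable-≈ λ _ → n (isPr-pr u v e)))
         (λ n → k (0M , 0≤ _ , (λ h → stableP (∃P x1 (x2 ≈P prF x0 x1)) (0M ∷ p ∷ []) λ _ → n h) , λ _ → ≈-refl))

      fstF sndF : Fn 1
      fstF = search fR x0 fst-ex
        (λ { (p ∷ []) y z (a , b) (c , d) → by-em (holds isPr (p ∷ [])) stable-≈
           (λ h → let _ , _ , e = a h ; _ , _ , e' = c h in proj₁ (pr-inj (≈-trans (≈-sym e) e')))
           (λ n → ≈-trans (b n) (≈-sym (d n))) })
      sndF = search sR x0 snd-ex
        (λ { (p ∷ []) y z (a , b) (c , d) → by-em (holds isPr (p ∷ [])) stable-≈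
           (λ h → let _ , _ , e = a h ; _ , _ , e' = c h in proj₂ (pr-inj (≈-trans (≈-sym e) e')))
           (λ n → ≈-trans (b n) (≈-sym (d n))) })

    fst snd : M → M
    fst p = fstF $ (p ∷ [])
    snd p = sndF $ (p ∷ [])

    abstract
      fst-pr : ∀ {p} x y → p ≈ pr x y → fst p ≈ x
      fst-pr {p} x y e = let _ , _ , e' = proj₁ (proj₂ (proj₂ (fst-ex (p ∷ [])))) (isPr-pr x y e) in
        proj₁ (pr-inj (≈-trans (≈-sym e') e))

      snd-pr : ∀ {p} x y → p ≈ pr x y → snd p ≈ y
      snd-pr {p} x y e = let _ , _ , e' = proj₁ (proj₂ (proj₂ (snd-ex (p ∷ [])))) (isPr-pr x y e) in
        proj₂ (pr-inj (≈-trans (≈-sym e') e))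

    private
      mR : Pr 3
      mR = (x1 ≤P x2 ⇒P x0 ≈P conF 0M) ∧P (x2 ≤P x1 ⇒P x2 ⊕ x0 ≈P x1)
    abstract
      monus-ex : ∀ x → Σ M λ y → y ≤ x0 $ x × holds mR (y ∷ x)
      monus-ex (x ∷ y ∷ []) = stableP (∃P x0 mR) (x ∷ y ∷ []) λ k → by-or stable-𝕆 (≤-tot x y)
          (λ p → k (0M , 0≤ _ , (λ _ → ≈-refl) , λ q → ≈-trans (+0 y) (≤-antisym q p)))
          (λ p → let d , e = slack p in k (d , ≤-resp ≈-refl e (≤+ʳ y d) ,
             (λ q → +-cancelˡ y d 0M (≈-trans e (≈-trans (≤-antisym q p) (≈-sym (+0 y))))) , λ _ → e))

      monusF : Fn 2
      monusF = search mR x0 monus-ex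
        (λ { (x ∷ y ∷ []) u v (a , b) (c , d) → by-or stable-≈ (≤-tot x y) (λ p → ≈-trans (a p) (≈-sym (c p)))
          (λ p → +-cancelˡ y u v (≈-trans (b p) (≈-sym (d p)))) })

    infixl 6 _∸_
    _∸_ : M → M → M
    x ∸ y = monusF $ (x ∷ y ∷ [])

    infixl 6 _∸F_
    _∸F_ : ∀ {k} → Fn k → Fn k → Fn k
    f ∸F g = monusF ∘F (f ∷ g ∷ [])

    abstract
      ∸-+ : ∀ {x y} → y ≤ x → y + (x ∸ y) ≈ x
      ∸-+ {x} {y} p = proj₂ (proj₂ (proj₂ (monus-ex (x ∷ y ∷ [])))) p

      ∸-0 : ∀ {x y} → x ≤ y → x ∸ y ≈ 0M
      ∸-0 {x} {y} p = proj₁ (proj₂ (proj₂ (monus-ex (x ∷ y ∷ [])))) p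

      ∸-of : ∀ {x y} z → y + z ≈ x → x ∸ y ≈ z
      ∸-of {x} {y} z e = +-cancelˡ y _ _ (≈-trans (∸-+ (mk≤ z e)) (≈-sym e))

      compP : (P : Pr 1) (b : M) → Σ S λ X → (lenM X ≤ b) × (∀ z → z < b → (z ∈M X) ⇿ holds P (z ∷ []))
      compP P b = let X , l , h = compF (code P b) b in X , l , λ z p →
        let f , g = h z p ; f' , g' = code-ok P b (z ∷ []) (λ { zero → proj₁ p }) in f' ∘ f , g ∘ g'

    -- The value (Z)^i of a coded sequence.
    ValM : S → M → M → Set
    ValM Z i t = ¬ₒ ¬ₒ ((t < lenM Z × pr i t ∈M Z × (∀ s → s < t → ¬ₒ (pr i s ∈M Z)))
                      ⊎ (t ≈ lenM Z × (∀ s → s < lenM Z → ¬ₒ (pr i s ∈M Z))))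

    abstract
      Val-uniq : ∀ {Z i j t u} → i ≈ j → ValM Z i t → ValM Z j u → t ≈ u
      Val-uniq {Z} {i} {j} {t} {u} e p q = by-or stable-≈ p
        (λ (a , b , c) → by-or stable-≈ q
           (λ (a' , b' , c') → by-< stable-≈ t u (λ l → stable-≈ λ _ → c' t l (tr b))
               λ l → by-< stable-≈ u t (λ l' → stable-≈ λ _ → c u l' (rt b')) λ l' → ≤-antisym l' l)
           (λ (a' , c') → stable-≈ λ _ → c' t a (tr b)))
        (λ (a , c) → by-or stable-≈ q
           (λ (a' , b' , c') → stable-≈ λ _ → c u a' (rt b'))
           (λ (a' , c') → ≈-trans a (≈-sym a')))
        where
        tr : ∀ {s} → pr i s ∈M Z → pr j s ∈M Z
        tr = ∈-resp (pr-cong e ≈-refl)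
        rt : ∀ {s} → pr j s ∈M Z → pr i s ∈M Z
        rt = ∈-resp (pr-cong (≈-sym e) ≈-refl)

    private
      -- The two cases of the value of a coded sequence. `Pr` offers no disjunction, so `Q` combines
      -- them by de Morgan.
      A B Q : S → Pr 2
      A Z = (x1 <P conF (lenM Z)) ∧P (prF x0 x1 ∈P Z) ∧P ∀P x1 ((x0 <P x2) ⇒P (¬P (prF x1 x0 ∈P Z)))
      B Z = (x1 ≈P conF (lenM Z)) ∧P ∀P (conF (lenM Z)) ((x0 <P conF (lenM Z)) ⇒P (¬P (prF x1 x0 ∈P Z)))
      Q Z = ¬P ((¬P (A Z)) ∧P (¬P (B Z)))
      to : ∀ Z {i t} → holds (Q Z) (i ∷ t ∷ []) → ValM Z i t
      to Z q k = q ((λ (a , b , c) → k (inj₁ (a , b , λ s p → c s (proj₁ p) p))) , λ (a , c) → k (inj₂ (a , λ s p → c s (proj₁ p) p)))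
      fr : ∀ Z {i t} → ValM Z i t → holds (Q Z) (i ∷ t ∷ [])
      fr Z p (na , nb) = p λ { (inj₁ (a , b , c)) → na (a , b , λ s _ → c s) ; (inj₂ (a , c)) → nb (a , λ s _ → c s) }

    ValP : S → Pr 2
    ValP Z .holds (i ∷ t ∷ []) = ValM Z i t
    ValP Z .code b = code (Q Z) b
    ValP Z .code-ok b (i ∷ t ∷ []) h = let f , g = code-ok (Q Z) b (i ∷ t ∷ []) h in
      (λ q → to Z {i} {t} (f q)) , λ p → g (fr Z {i} {t} p)

    abstract
      vlax : ∀ a X → (∀ x → x ≤ a → Σ M λ y → y ≤ a × (pr x y ∈M X × (∀ y' → y' ≤ a → pr x y' ∈M X → y' ≈ y))) →
        Σ S λ Z → (∀ i → i ≤ a → Σ M λ y → y ≤ lenM Z × ValM Z i y × y ≤ a)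
                × (∀ i → i < a → Σ M λ y → y ≤ lenM Z × ValM Z i y × Σ M λ y' → y' ≤ lenM Z × ValM Z (i + 1M) y' × pr y y' ∈M X)
                × (Σ M λ y → y ≤ lenM Z × ValM Z 0M y × y ≈ 0M)
      vlax = sound vl [] []

      -- Comprehension turns the graph of `h` on `[0,a]` into a string that satisfies `Unique`. The
      -- path supplied by the axiom is then forced to be the orbit of 0 under `h`.
      vlfun : ∀ a (h : Fn 1) → (∀ x → x ≤ a → h $ (x ∷ []) ≤ a) → Σ S λ Z →
        (∀ i → i ≤ a → Σ M λ y → ValM Z i y × y ≤ a) × (∀ i → i < a → ∀ y y' → ValM Z i y → ValM Z (i + 1M) y' → y' ≈ h $ (y ∷ []))
        × (∀ y → ValM Z 0M y → y ≈ 0M)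
      vlfun a h cl =
        let X , _ , ok = compP (∃P x0 (∃P x1 ((x2 ≈P prF x1 x0) ∧P x0 ≈P h ∘F (x1 ∷ [])))) (pr a a + 1M)
            inX = λ x y → x ≤ a → y ≤ a → pr x y ∈M X ⇿ y ≈ h $ (x ∷ [])
            inX-ok : ∀ x y → inX x y
            inX-ok x y p q = (λ m → let u , _ , v , _ , e , e' = proj₁ (ok _ (≤⇒<suc (pr-mono p q))) m ; e1 , e2 = pr-inj e in
                                ≈-trans e2 (≈-trans e' (cong1 h (≈-sym e1))))
                           , λ e → proj₂ (ok _ (≤⇒<suc (pr-mono p q))) (x , ≤prˡ x y , y , ≤prʳ x y , ≈-refl , e)
            Z , p1 , p2 , p3 = vlax a X λ x p → h $ (x ∷ []) , cl x p , proj₂ (inX-ok x _ p (cl x p)) ≈-refl ,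
                                  λ y' q m → proj₁ (inX-ok x y' p q) m
        in Z , (λ i p → let y , _ , v , q = p1 i p in y , v , q)
             , (λ i p y y' v v' → let u , _ , w , u' , _ , w' , m = p2 i p
                                      e = Val-uniq ≈-refl w v ; e' = Val-uniq ≈-refl w' v'
                                      ya : y ≤ a
                                      ya = let t , _ , vt , q = p1 i (proj₁ p) in ≤-resp (Val-uniq ≈-refl vt v) ≈-refl q
                                      ya' : y' ≤ a
                                      ya' = let t , _ , vt , q = p1 (i + 1M) (<⇒suc≤ p) in ≤-resp (Val-uniq ≈-refl vt v') ≈-refl q
                                  in proj₁ (inX-ok y y' ya ya') (∈-resp (pr-cong e e') m))
             , λ y v → let u , _ , w , e = p3 in ≈-trans (Val-uniq ≈-refl v w) e

    private
      sqR : M → S → Pr 2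
      sqR a Z = (x1 ≤P conF a ⇒P subP (ValP Z) (x1 ∷ x0 ∷ [])) ∧P (¬P (x1 ≤P conF a) ⇒P x0 ≈P conF 0M)

    abstract
      sq-ex : ∀ a Z → (∀ i → i ≤ a → Σ M λ y → ValM Z i y × y ≤ a) → ∀ x → Σ M λ y → y ≤ a × holds (sqR a Z) (y ∷ x)
      sq-ex a Z val (i ∷ []) = stableP (∃P (conF a) (sqR a Z)) (i ∷ []) λ k → by-em (i ≤ a) stable-𝕆
        (λ p → let y , v , q = val i p in k (y , q , (λ _ → v) , λ n → stable-≈ λ _ → n p))
        (λ n → k (0M , 0≤ a , (λ p → stableP (ValP Z) (i ∷ 0M ∷ []) λ _ → n p) , λ _ → ≈-refl))

      vlseq : ∀ a (h : Fn 1) → (∀ x → x ≤ a → h $ (x ∷ []) ≤ a) → Σ (Fn 1) λ q →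
        (q $ (0M ∷ []) ≈ 0M) × (∀ i → i < a → q $ (i + 1M ∷ []) ≈ h $ (q $ (i ∷ []) ∷ []))
      vlseq a h cl =
        let Z , val , stp , zer = vlfun a h cl
            at : ∀ i → i ≤ a → ValM Z i (proj₁ (sq-ex a Z val (i ∷ [])))
            at i p = proj₁ (proj₂ (proj₂ (sq-ex a Z val (i ∷ [])))) p
        in search (sqR a Z) (conF a) (sq-ex a Z val)
             (λ { (i ∷ []) y z (p , q) (p' , q') → by-em (i ≤ a) stable-≈ (λ h → Val-uniq {Z} {i} {i} {y} {z} ≈-refl (p h) (p' h))
                λ n → ≈-trans (q n) (≈-sym (q' n)) })
           , zer _ (at 0M (0≤ a)) , λ i p → stp i p _ _ (at i (proj₁ p)) (at (i + 1M) (<⇒suc≤ p))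

    module Raw (g : Fn 1) (C s T : M) (s≤ : s ≤ C) (g≤ : ∀ y → y ≤ C → g $ (y ∷ []) ≤ C) where
      -- Vertex 0 is the start and y + 1 stands for the state y.
      private
        a : M
        -- In the axiom one number bounds both the vertices and the length of the path. Here it has
        -- to hold the shifted states up to `C + 1M` and `T + 1M` steps, one of them spent on
        -- leaving vertex 0.
        a = (C + 1M) + (T + 1M)
        P1 P2 : Pr 1
        P1 = x0 ≈P conF 0M
        P2 = x0 ≤P conF (C + 1M)
        k1 h2 k2 k3 h : Fn 1
        k1 = conF (s + 1M)
        k2 = g ∘F ((x0 ∸F conF 1M) ∷ []) ⊕ conF 1M
        k3 = conF 0M
        h2 = ite P2 k2 k3
        h = ite P1 k1 h2
        abstract
          h0 : ∀ {y} → y ≈ 0M → h $ (y ∷ []) ≈ s + 1M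
          h0 e = ite-yes P1 k1 h2 e
          hs : ∀ {y z} → z ≤ C → y ≈ z + 1M → h $ (y ∷ []) ≈ g $ (z ∷ []) + 1M
          hs {y} {z} p e = ≈-trans (ite-no P1 k1 h2 λ q → suc≉0 z (≈-trans (≈-sym e) q))
            (≈-trans (ite-yes P2 k2 k3 (≤-resp (≈-sym e) ≈-refl (+-mono p ≤-refl)))
              (+-cong (cong1 g (∸-of z (≈-trans (+-comm 1M z) (≈-sym e)))) ≈-refl))
          hC : ∀ y → y ≤ a → h $ (y ∷ []) ≤ a
          hC y _ = by-em (y ≈ 0M) stable-≤ (λ e → ≤-trans (≤-reflexive (h0 e)) (≤-trans (+-mono s≤ ≤-refl) (≤+ _ _)))
            λ n → by-em (y ≤ C + 1M) stable-≤
              (λ p → let z , e = pred y n ; z≤ = <suc⇒≤ (suc≤⇒< (≤-resp (≈-sym e) ≈-refl p)) in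
                 ≤-trans (≤-reflexive (hs z≤ (≈-sym e))) (≤-trans (+-mono (g≤ z z≤) ≤-refl) (≤+ _ _)))
              (λ q → ≤-trans (≤-reflexive (≈-trans (ite-no P1 k1 h2 n) (ite-no P2 k2 k3 q))) (0≤ a))
          inr : ∀ {i} → i ≤ T → i < a
          inr p = <-≤-trans (≤⇒<suc p) (≤+ʳ _ _)
          sq : Fn 1
          sq = proj₁ (vlseq a h hC)
          sq0 : sq $ (0M ∷ []) ≈ 0M
          sq0 = proj₁ (proj₂ (vlseq a h hC))
          sqS : ∀ i → i < a → sq $ (i + 1M ∷ []) ≈ h $ (sq $ (i ∷ []) ∷ [])
          sqS = proj₂ (proj₂ (vlseq a h hC))
      abstract
       seqF : Fn 1
       seqF = sq ∘F (x0 ⊕ conF 1M ∷ []) ∸F conF 1M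
       private
          both : ∀ i → i ≤ T → (sq $ (i + 1M ∷ []) ≈ seqF $ (i ∷ []) + 1M) × seqF $ (i ∷ []) ≤ C
          both = indB T ((sq ∘F (x0 ⊕ conF 1M ∷ []) ≈P seqF ⊕ conF 1M) ∧P (seqF ≤P conF C))
            (fin s≤ (≈-trans (sqS 0M (inr (0≤ T))) (h0 sq0)))
            (λ i p (e , q) → fin (g≤ _ q) (≈-trans (sqS (i + 1M) (≤-<-trans (<⇒suc≤ p) (inr ≤-refl))) (hs q e)))
            where
            fin : ∀ {i y} → y ≤ C → sq $ (i + 1M ∷ []) ≈ y + 1M →
              (sq $ (i + 1M ∷ []) ≈ seqF $ (i ∷ []) + 1M) × seqF $ (i ∷ []) ≤ C
            fin {i} {y} p e = let e' = ∸-of y (≈-trans (+-comm 1M y) (≈-sym e)) in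
              ≈-trans e (+-cong (≈-sym e') ≈-refl) , ≤-resp (≈-sym e') ≈-refl p
       seq0 : seqF $ (0M ∷ []) ≈ s
       seq0 = ∸-of s (≈-trans (+-comm 1M s) (≈-sym (≈-trans (sqS 0M (inr (0≤ T))) (h0 sq0))))

       seqS : ∀ i → i < T → seqF $ (i + 1M ∷ []) ≈ g $ (seqF $ (i ∷ []) ∷ [])
       seqS i p = let e , q = both i (proj₁ p) in ∸-of _ (≈-trans (+-comm 1M _)
          (≈-sym (≈-trans (sqS (i + 1M) (≤-<-trans (<⇒suc≤ p) (inr ≤-refl))) (hs q e))))

  -- Bounded iteration of definable functions.

  module Iteration where
    open Sequences public

    -- Bounded iteration with a parameter: the runs for all p ≤ b are concatenated into one run on states ⟨p, i, y⟩.
    module Iter (s : Fn 1) (G : Fn 3) (β : M → Te 1)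
      (h0 : ∀ b p → p ≤ b → s $ (p ∷ []) ≤ ⟦ β b ⟧ᵗ (0M ∷ []))
      (h1 : ∀ b p i y → p ≤ b → i < b → y ≤ ⟦ β b ⟧ᵗ (i ∷ []) → G $ (p ∷ i ∷ y ∷ []) ≤ ⟦ β b ⟧ᵗ (i + 1M ∷ [])) where

      private
        teF : Te 1 → Fn 1
        teF (𝕧 i)    = varF i
        teF (𝕔 a)    = conF a
        teF (t +ᵗ u) = teF t ⊕ teF u
        teF (t *ᵗ u) = teF t ⊗ teF u
        teF-ok : ∀ t x → teF t $ x ≈ ⟦ t ⟧ᵗ x
        teF-ok (𝕧 i) x    = ≈-refl
        teF-ok (𝕔 a) x    = ≈-refl
        teF-ok (t +ᵗ u) x = +-cong (teF-ok t x) (teF-ok u x)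
        teF-ok (t *ᵗ u) x = *-cong (teF-ok t x) (teF-ok u x)
        monoT : ∀ (t : Te 1) {x y} → x ≤ y → ⟦ t ⟧ᵗ (x ∷ []) ≤ ⟦ t ⟧ᵗ (y ∷ [])
        monoT (𝕧 zero) p = p
        monoT (𝕔 a) p    = ≤-refl
        monoT (t +ᵗ u) p = +-mono (monoT t p) (monoT u p)
        monoT (t *ᵗ u) p = *-mono (monoT t p) (monoT u p)

        module At (b : M) where
          B C T : M
          B = ⟦ β b ⟧ᵗ (b ∷ [])
          C = pr b (pr b B)
          T = (b + 1M) * (b + 1M)
          ip iy ii goI goP st g : Fn 1
          ip = fstF
          ii = fstF ∘F (sndF ∷ [])
          iy = sndF ∘F (sndF ∷ [])
          goI = prF ip (prF (ii ⊕ conF 1M) (G ∘F (ip ∷ ii ∷ iy ∷ [])))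
          goP = prF (ip ⊕ conF 1M) (prF (conF 0M) (s ∘F ((ip ⊕ conF 1M) ∷ [])))
          st = ite (ii <P conF b) goI goP
          -- The guard makes `[0,C]` closed under `g`, as the orbit construction demands; the runs
          -- themselves stay below `C` and never trigger it.
          g = ite (st ≤P conF C) st (conF 0M)
          abstract
            g≤ : ∀ y → y ≤ C → g $ (y ∷ []) ≤ C
            g≤ y _ = by-em (st $ (y ∷ []) ≤ C) stable-≤
              (λ p → ≤-resp (≈-sym (ite-yes (st ≤P conF C) st (conF 0M) p)) ≈-refl p)
              (λ n → ≤-resp (≈-sym (ite-no (st ≤P conF C) st (conF 0M) n)) ≈-refl (0≤ C))
            s0≤ : pr 0M (pr 0M (s $ (0M ∷ []))) ≤ C
            s0≤ = pr-mono (0≤ b) (pr-mono (0≤ b) (≤-trans (h0 b 0M (0≤ b)) (monoT (β b) (0≤ b))))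
            dec : ∀ {q p i y} → q ≈ pr p (pr i y) → fst q ≈ p × fst (snd q) ≈ i × snd (snd q) ≈ y
            dec {q} {p} {i} {y} e = let e1 = snd-pr p (pr i y) e in fst-pr p _ e , fst-pr i y e1 , snd-pr i y e1
            gst : ∀ {q r} → st $ (q ∷ []) ≈ r → r ≤ C → g $ (q ∷ []) ≈ r
            gst e p = ≈-trans (ite-yes (st ≤P conF C) st (conF 0M) (≤-resp (≈-sym e) ≈-refl p)) e
            gI : ∀ {q p i y} → p ≤ b → i < b → y ≤ ⟦ β b ⟧ᵗ (i ∷ []) → q ≈ pr p (pr i y) →
              g $ (q ∷ []) ≈ pr p (pr (i + 1M) (G $ (p ∷ i ∷ y ∷ [])))
            gI {q} {p} {i} {y} pb ib yb e = let e1 , e2 , e3 = dec e in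
              gst (≈-trans (ite-yes (ii <P conF b) goI goP (<-resp (≈-sym e2) ≈-refl ib))
                 (pr-cong e1 (pr-cong (+-cong e2 ≈-refl) (cong3 G e1 e2 e3))))
               (pr-mono pb (pr-mono (<⇒suc≤ ib) (≤-trans (h1 b p i y pb ib yb) (monoT (β b) (<⇒suc≤ ib)))))
            gP : ∀ {q p y} → p < b → q ≈ pr p (pr b y) → g $ (q ∷ []) ≈ pr (p + 1M) (pr 0M (s $ (p + 1M ∷ [])))
            gP {q} {p} {y} pb e = let e1 , e2 , e3 = dec e ; e4 = +-cong e1 ≈-refl in
               gst (≈-trans (ite-no (ii <P conF b) goI goP λ q → proj₂ q e2)
                   (pr-cong e4 (pr-cong ≈-refl (cong1 s e4))))
                 (pr-mono (<⇒suc≤ pb) (pr-mono (0≤ b) (≤-trans (h0 b _ (<⇒suc≤ pb)) (monoT (β b) (0≤ b)))))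
          open Raw g C (pr 0M (pr 0M (s $ (0M ∷ [])))) T s0≤ g≤
          tm : M → M → M
          tm p i = p * (b + 1M) + i
          St : M → M → M
          St p i = seqF $ (tm p i ∷ [])
          bF : Fn 1
          bF = teF (β b)
          Ip : M → Pr 1
          Ip p = ∃P (conF B) ((seqF ∘F (conF p ⊗ conF (b + 1M) ⊕ x1 ∷ []) ≈P prF (conF p) (prF x1 x0)) ∧P (x0 ≤P bF ∘F (x1 ∷ [])))
          Is : Pr 1
          Is = seqF ∘F (x0 ⊗ conF (b + 1M) ⊕ conF 0M ∷ []) ≈P prF x0 (prF (conF 0M) (s ∘F (x0 ∷ [])))
          abstract
            tm<T : ∀ {p i} → p ≤ b → i ≤ b → tm p i < T
            tm<T {p} {i} pb ib = suc≤⇒< (≤-trans (≤-reflexive (+-assoc _ i 1M)) (≤-trans (+-mono (*-mono pb ≤-refl) (+-mono ib ≤-refl))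
              (≤-reflexive (≈-sym (suc* b _)))))
            Y : Fn 2
            Y = sndF ∘F (sndF ∘F (seqF ∘F (x0 ⊗ conF (b + 1M) ⊕ x1 ∷ []) ∷ []) ∷ [])
            atY : ∀ p i {y} → St p i ≈ pr p (pr i y) → Y $ (p ∷ i ∷ []) ≈ y
            atY p i e = proj₂ (proj₂ (dec e))
            nextI : ∀ p i y → p ≤ b → i < b → y ≤ ⟦ β b ⟧ᵗ (i ∷ []) → St p i ≈ pr p (pr i y) →
              St p (i + 1M) ≈ pr p (pr (i + 1M) (G $ (p ∷ i ∷ y ∷ [])))
            nextI p i y pb ib yb e =
              ≈-trans (cong1 seqF (≈-sym (+-assoc _ i 1M))) (≈-trans (seqS (tm p i) (tm<T pb (proj₁ ib))) (gI pb ib yb e))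
            row : ∀ p → p ≤ b → St p 0M ≈ pr p (pr 0M (s $ (p ∷ []))) → ∀ i → i ≤ b → holds (Ip p) (i ∷ [])
            row p pb e = indB b (Ip p)
              (s $ (p ∷ []) , ≤-trans (h0 b p pb) (monoT (β b) (0≤ b)) , e , ≤-trans (h0 b p pb) (≤-reflexive (≈-sym (teF-ok (β b) (0M ∷ [])))))
              (λ i ib (y , yB , e' , yb) → let yb' = ≤-trans yb (≤-reflexive (teF-ok (β b) (i ∷ []))) ; G≤ = h1 b p i y pb ib yb' in
                 G $ (p ∷ i ∷ y ∷ []) , ≤-trans G≤ (monoT (β b) (<⇒suc≤ ib)) , nextI p i y pb ib yb' e'
                 , ≤-trans G≤ (≤-reflexive (≈-sym (teF-ok (β b) (i + 1M ∷ [])))))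
            start : ∀ p → p ≤ b → St p 0M ≈ pr p (pr 0M (s $ (p ∷ [])))
            start = indB b Is
              (≈-trans (cong1 seqF (≈-trans (+0 _) (0* _))) seq0)
              (λ p pb e → let y , _ , e' , _ = row p (proj₁ pb) e b ≤-refl in
                ≈-trans (cong1 seqF (≈-trans (+0 _) (≈-trans (suc* p _) (≈-sym (+-assoc _ b 1M)))))
                  (≈-trans (seqS (tm p b) (tm<T (proj₁ pb) ≤-refl)) (gP pb e')))
            Y0 : ∀ p → p ≤ b → Y $ (p ∷ 0M ∷ []) ≈ s $ (p ∷ [])
            Y0 p pb = atY p 0M (start p pb)
            YS : ∀ p i → p ≤ b → i < b → Y $ (p ∷ i + 1M ∷ []) ≈ G $ (p ∷ i ∷ Y $ (p ∷ i ∷ []) ∷ [])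
            YS p i pb ib = let y , _ , e , yb = row p pb (start p pb) i (proj₁ ib) in
              ≈-trans (atY p (i + 1M) (nextI p i y pb ib (≤-trans yb (≤-reflexive (teF-ok (β b) (i ∷ [])))) e)) (cong3 G ≈-refl ≈-refl (≈-sym (atY p i e)))

        open At using (Y; Y0; YS)
        -- The concatenated run depends on the segment `b`, its values do not. Hence a function
        -- defined through the run for `p + i` has, on each segment, the formula of the run for that
        -- segment.
        agree : ∀ b c p → p ≤ b → p ≤ c → ∀ i → i ≤ b → i ≤ c → Y b $ (p ∷ i ∷ []) ≈ Y c $ (p ∷ i ∷ [])
        agree b c p pb pc = indP ((x0 ≤P conF b) ⇒P (x0 ≤P conF c) ⇒P Y b ∘F (conF p ∷ x0 ∷ []) ≈P Y c ∘F (conF p ∷ x0 ∷ []))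
          (λ _ _ → ≈-trans (Y0 b p pb) (≈-sym (Y0 c p pc)))
          (λ i ih ib ic → let ib' = suc≤⇒< ib ; ic' = suc≤⇒< ic in
            ≈-trans (YS b p i pb ib') (≈-trans (cong3 G ≈-refl ≈-refl (ih (proj₁ ib') (proj₁ ic'))) (≈-sym (YS c p i pc ic'))))

      abstract
        itF : Fn 2
        itF = record
          { fun = λ { (p ∷ i ∷ []) → Y (p + i) $ (p ∷ i ∷ []) }
          ; bnd = λ b → bnd (Y b) b
          ; bnd-ok = λ { b (p ∷ i ∷ []) h → ≤-resp (agree b _ p (h zero) (≤+ _ _) i (h (suc zero)) (≤+ʳ _ _)) ≈-refl (bnd-ok (Y b) b (p ∷ i ∷ []) h) }
          ; gr = λ b → gr (Y b) b
          ; gr-ok = λ { b (p ∷ i ∷ []) h y → let f , g = gr-ok (Y b) b (p ∷ i ∷ []) h y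
                                                 e = agree b _ p (h zero) (≤+ _ _) i (h (suc zero)) (≤+ʳ _ _) in
              (λ q → ≈-trans (f q) e) , λ q → g (≈-trans q (≈-sym e)) } }

        it0 : ∀ p → itF $ (p ∷ 0M ∷ []) ≈ s $ (p ∷ [])
        it0 p = Y0 _ p (≤+ _ _)

        itS : ∀ p i → itF $ (p ∷ i + 1M ∷ []) ≈ G $ (p ∷ i ∷ itF $ (p ∷ i ∷ []) ∷ [])
        itS p i = ≈-trans (YS _ p i (≤+ _ _) (suc≤⇒< (≤+ʳ p _)))
          (cong3 G ≈-refl ≈-refl (agree (p + (i + 1M)) (p + i) p (≤+ _ _) (≤+ _ _) i (≤-trans (≤+ i 1M) (≤+ʳ p _)) (≤+ʳ p i)))

  -- Sums with a length in the model.

  module Summation where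
    open Iteration public

    module _ (f : Fn 2) where
      private
        β : M → Te 1
        β b = x₀ *ᵗ 𝕔 (bnd f b)
        step : Fn 3
        step = x2 ⊕ f ∘F (x0 ∷ x1 ∷ [])
        step≤ : ∀ b p i y → p ≤ b → i < b → y ≤ ⟦ β b ⟧ᵗ (i ∷ []) → step $ (p ∷ i ∷ y ∷ []) ≤ ⟦ β b ⟧ᵗ (i + 1M ∷ [])
        step≤ b p i y pb ib yb = ≤-trans (+-mono yb (bnd-ok f b (p ∷ i ∷ []) (λ { zero → pb ; (suc zero) → proj₁ ib })))
          (≤-reflexive (≈-sym (suc* i _)))
        open Iter (conF 0M) step β (λ b p _ → 0≤ _) step≤
      abstract
        -- sumF f (p , n) is the sum of f (p , v) over v < n.
        sumF : Fn 2
        sumF = itF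

        sum0 : ∀ p → sumF $ (p ∷ 0M ∷ []) ≈ 0M
        sum0 = it0

        sumS : ∀ p n → sumF $ (p ∷ n + 1M ∷ []) ≈ sumF $ (p ∷ n ∷ []) + f $ (p ∷ n ∷ [])
        sumS = itS

  -- Laws of sums, and sums of standard size.

  module Sums where
    open Summation public
    open Generators using (two^)

    ∑ : M → Fn 1 → M
    ∑ n h = sumF (h ∘F (x1 ∷ [])) $ (0M ∷ n ∷ [])

    ∑F : Fn 1 → Fn 1
    ∑F h = sumF (h ∘F (x1 ∷ [])) ∘F (conF 0M ∷ x0 ∷ [])

    abstract
      ∑0 : ∀ h → ∑ 0M h ≈ 0M
      ∑0 h = sum0 (h ∘F (x1 ∷ [])) 0M

      ∑S : ∀ n h → ∑ (n + 1M) h ≈ ∑ n h + h $ (n ∷ [])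
      ∑S n h = sumS (h ∘F (x1 ∷ [])) 0M n

      ∑n-cong : ∀ {m n} h → m ≈ n → ∑ m h ≈ ∑ n h
      ∑n-cong h e = cong1 (∑F h) e

      -- Sums are characterised by their recursion, so most laws reduce to a base case and a step
      -- for a suitable `F`.
      ∑-uniq : (F h : Fn 1) (n : M) → F $ (0M ∷ []) ≈ 0M → (∀ v → v < n → F $ (v + 1M ∷ []) ≈ F $ (v ∷ []) + h $ (v ∷ [])) →
        F $ (n ∷ []) ≈ ∑ n h
      ∑-uniq F h n base step = indB n (F ≈P ∑F h) (≈-trans base (≈-sym (∑0 h)))
        (λ v p e → ≈-trans (step v p) (≈-trans (+-cong e ≈-refl) (≈-sym (∑S v h)))) n ≤-refl

      ∑-cong : ∀ n (h h' : Fn 1) → (∀ v → v < n → h $ (v ∷ []) ≈ h' $ (v ∷ [])) → ∑ n h ≈ ∑ n h'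
      ∑-cong n h h' e = ∑-uniq (∑F h) h' n (∑0 h) λ v p → ≈-trans (∑S v h) (+-cong ≈-refl (e v p))

      ∑-param : ∀ (f : Fn 2) p n → sumF f $ (p ∷ n ∷ []) ≈ ∑ n (f ∘F (conF p ∷ x0 ∷ []))
      ∑-param f p n = ∑-uniq (sumF f ∘F (conF p ∷ x0 ∷ [])) (f ∘F (conF p ∷ x0 ∷ [])) n (sum0 f p) λ v _ → sumS f p v

      ∑-⊕ : ∀ n (h k : Fn 1) → ∑ n (h ⊕ k) ≈ ∑ n h + ∑ n k
      ∑-⊕ n h k = ≈-sym (∑-uniq (∑F h ⊕ ∑F k) (h ⊕ k) n (≈-trans (+-cong (∑0 h) (∑0 k)) (+0 0M))
        λ v _ → ≈-trans (+-cong (∑S v h) (∑S v k))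
          (solve 4 (λ a b c d → (a :+ b) :+ (c :+ d) := (a :+ c) :+ (b :+ d)) ≈-refl (∑ v h) (h $ (v ∷ [])) (∑ v k) (k $ (v ∷ []))))

      ∑-⊗ : ∀ n c (h : Fn 1) → ∑ n (conF c ⊗ h) ≈ c * ∑ n h
      ∑-⊗ n c h = ≈-sym (∑-uniq (conF c ⊗ ∑F h) (conF c ⊗ h) n (≈-trans (*-cong ≈-refl (∑0 h)) (*0 c))
        λ v _ → ≈-trans (*-cong ≈-refl (∑S v h)) (*-distribˡ c _ _))

      ∑-const : ∀ n c → ∑ n (conF c) ≈ n * c
      ∑-const n c = ≈-sym (∑-uniq (x0 ⊗ conF c) (conF c) n (0* c) λ v _ → suc* v c)

      ∑-mono : ∀ n (h h' : Fn 1) → (∀ v → v < n → h $ (v ∷ []) ≤ h' $ (v ∷ [])) → ∑ n h ≤ ∑ n h'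
      ∑-mono n h h' e = indB n (∑F h ≤P ∑F h') (≤-reflexive (≈-trans (∑0 h) (≈-sym (∑0 h'))))
        (λ v p q → ≤-resp (≈-sym (∑S v h)) (≈-sym (∑S v h')) (+-mono q (e v p))) n ≤-refl

      ∑-split : ∀ a b (h : Fn 1) → ∑ (a + b) h ≈ ∑ a h + ∑ b (h ∘F (conF a ⊕ x0 ∷ []))
      ∑-split a b h = indP (∑F h ∘F (conF a ⊕ x0 ∷ []) ≈P conF (∑ a h) ⊕ ∑F (h ∘F (conF a ⊕ x0 ∷ [])))
        (≈-trans (∑n-cong h (+0 a)) (≈-sym (≈-trans (+-cong ≈-refl (∑0 _)) (+0 _))))
        (λ v e → ≈-trans (∑n-cong h (+suc a v)) (≈-trans (∑S _ h) (≈-trans (+-cong e ≈-refl)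
          (≈-trans (+-assoc _ _ _) (+-cong ≈-refl (≈-sym (∑S v (h ∘F (conF a ⊕ x0 ∷ []))))))))) b

      term≤∑ : ∀ n (h : Fn 1) v → v < n → h $ (v ∷ []) ≤ ∑ n h
      term≤∑ n h v p = let d , e = slack (<⇒suc≤ p) in ≤-trans (≤-trans (≤-trans (≤+ʳ (∑ v h) _) (≤-reflexive (≈-sym (∑S v h))))
        (≤-trans (≤+ _ _) (≤-reflexive (≈-sym (∑-split (v + 1M) d h))))) (≤-reflexive (∑n-cong h e))

      -- The right side, as a function of the length `m`, satisfies the recursion that characterises
      -- the left side.
      ∑-swap : ∀ m n (a : Fn 2) → ∑ m (sumF a ∘F (x0 ∷ conF n ∷ [])) ≈ ∑ n (sumF (a ∘F (x1 ∷ x0 ∷ [])) ∘F (x0 ∷ conF m ∷ []))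
      ∑-swap m n a = ≈-trans (≈-sym (∑-uniq F (sumF a ∘F (x0 ∷ conF n ∷ [])) m base step)) (asSum m)
        where
        a' : Fn 2
        a' = a ∘F (x1 ∷ x0 ∷ [])
        F : Fn 1
        F = sumF (sumF a' ∘F (x1 ∷ x0 ∷ [])) ∘F (x0 ∷ conF n ∷ [])
        inner : M → Fn 1
        inner v = sumF a' ∘F (x0 ∷ conF v ∷ [])
        asSum : ∀ v → F $ (v ∷ []) ≈ ∑ n (inner v)
        asSum v = ≈-trans (∑-param (sumF a' ∘F (x1 ∷ x0 ∷ [])) v n) (∑-cong n _ (inner v) λ _ _ → ≈-refl)
        base : F $ (0M ∷ []) ≈ 0M
        base = ≈-trans (asSum 0M) (≈-trans (∑-cong n (inner 0M) (conF 0M) (λ w _ → sum0 a' w)) (≈-trans (∑-const n 0M) (*0 n)))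
        step : ∀ v → v < m → F $ (v + 1M ∷ []) ≈ F $ (v ∷ []) + sumF a $ (v ∷ n ∷ [])
        step v _ = ≈-trans (asSum (v + 1M)) (≈-trans (∑-cong n (inner (v + 1M)) (inner v ⊕ a ∘F (conF v ∷ x0 ∷ [])) λ w _ → sumS a' w v)
          (≈-trans (∑-⊕ n (inner v) (a ∘F (conF v ∷ x0 ∷ []))) (+-cong (≈-sym (asSum v)) (≈-sym (∑-param a v n)))))

    abstract
      eqF : Fn 2
      eqF = ite (x0 ≈P x1) (conF 1M) (conF 0M)

      eq-yes : ∀ {x y} → x ≈ y → eqF $ (x ∷ y ∷ []) ≈ 1M
      eq-yes e = ite-yes (x0 ≈P x1) (conF 1M) (conF 0M) e

      eq-no : ∀ {x y} → (¬ₒ x ≈ y) → eqF $ (x ∷ y ∷ []) ≈ 0M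
      eq-no e = ite-no (x0 ≈P x1) (conF 1M) (conF 0M) e

      ∑-eq : ∀ n c (h : Fn 1) → c < n → ∑ n (eqF ∘F (x0 ∷ conF c ∷ []) ⊗ h) ≈ h $ (c ∷ [])
      ∑-eq n c h p = let d , e = slack (<⇒suc≤ p) in
          ≈-trans (∑n-cong g (≈-sym e)) (≈-trans (∑-split (c + 1M) d g) (≈-trans (+-cong (≈-trans (∑S c g)
            (+-cong (≈-trans (∑-cong c g (conF 0M) (λ v q → ≈-trans (*-cong (eq-no (proj₂ q)) ≈-refl) (0* _))) (≈-trans (∑-const c 0M) (*0 c)))
                    (≈-trans (*-cong (eq-yes ≈-refl) ≈-refl) (1* _))))
            (≈-trans (∑-cong d (g ∘F (conF (c + 1M) ⊕ x0 ∷ [])) (conF 0M)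
                 (λ v _ → ≈-trans (*-cong (eq-no λ q → proj₂ (<-≤-trans (≤⇒<suc (≤-refl {c})) (≤+ (c + 1M) v)) (≈-sym q)) ≈-refl) (0* _)))
               (≈-trans (∑-const d 0M) (*0 d))))
            (≈-trans (+0 _) (0+ _))))
        where g : Fn 1
              g = eqF ∘F (x0 ∷ conF c ∷ []) ⊗ h

      -- A sum cannot be rearranged directly. Each term is expanded by a Kronecker delta and the
      -- double sum is exchanged; an involution has a symmetric permutation matrix, so the same kind
      -- of delta sum results.
      ∑-invol : ∀ n (π h : Fn 1) → (∀ v → v < n → π $ (v ∷ []) < n) → (∀ v → v < n → π $ (π $ (v ∷ []) ∷ []) ≈ v) →
        ∑ n (h ∘F (π ∷ [])) ≈ ∑ n h
      ∑-invol n π h π< ππ = ≈-trans (∑-cong n (h ∘F (π ∷ [])) (sumF a ∘F (x0 ∷ conF n ∷ [])) λ v p →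
          ≈-sym (≈-trans (∑-param a v n) (≈-trans (∑-cong n _ (eqF ∘F (x0 ∷ conF (π $ (v ∷ [])) ∷ []) ⊗ h) (λ _ _ → ≈-refl)) (∑-eq n _ h (π< v p)))))
        (≈-trans (∑-swap n n a) (∑-cong n (sumF a' ∘F (x0 ∷ conF n ∷ [])) h λ w p →
          ≈-trans (∑-param a' w n) (≈-trans (∑-cong n _ (eqF ∘F (x0 ∷ conF (π $ (w ∷ [])) ∷ []) ⊗ conF (h $ (w ∷ []))) (λ v q → *-cong (flip w v p q) ≈-refl))
             (∑-eq n (π $ (w ∷ [])) (conF (h $ (w ∷ []))) (π< w p)))))
        where
        a a' : Fn 2
        a = eqF ∘F (x1 ∷ π ∘F (x0 ∷ []) ∷ []) ⊗ h ∘F (x1 ∷ [])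
        a' = a ∘F (x1 ∷ x0 ∷ [])
        flip : ∀ w v → w < n → v < n → eqF $ (w ∷ π $ (v ∷ []) ∷ []) ≈ eqF $ (v ∷ π $ (w ∷ []) ∷ [])
        flip w v p q = by-em (w ≈ π $ (v ∷ [])) stable-≈
          (λ e → ≈-trans (eq-yes e) (≈-sym (eq-yes (≈-trans (≈-sym (ππ v q)) (cong1 π (≈-sym e))))))
          (λ ne → ≈-trans (eq-no ne) (≈-sym (eq-no λ e → ne (≈-trans (≈-sym (ππ w p)) (cong1 π (≈-sym e))))))

    Bits : ℕ → Set
    Bits = Vec Bool

    -- Sums of standard size are formed by recursion outside the model, unlike `∑`, whose length is
    -- an element of it.
    ΣB : ∀ n → (Bits n → M) → M
    ΣB zero    f = f []
    ΣB (suc n) f = ΣB n (λ x → f (false ∷ x)) + ΣB n (λ x → f (true ∷ x))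

    ΣBF : ∀ {k} n → (Bits n → Fn k) → Fn k
    ΣBF zero    f = f []
    ΣBF (suc n) f = ΣBF n (λ x → f (false ∷ x)) ⊕ ΣBF n (λ x → f (true ∷ x))

    2^_ : ℕ → ℕ
    2^_ = two^

    pow : M → ℕ → M
    pow x zero    = 1M
    pow x (suc n) = x * pow x n

    bval : ∀ {n} → Bits n → ℕ
    bval []                = 0
    bval (false ∷ x)       = bval x
    bval {suc n} (true ∷ x) = 2^ n ℕ.+ bval x

    abstract
      ΣB-cong : ∀ n {f g : Bits n → M} → (∀ x → f x ≈ g x) → ΣB n f ≈ ΣB n g
      ΣB-cong zero e    = e []
      ΣB-cong (suc n) e = +-cong (ΣB-cong n λ x → e _) (ΣB-cong n λ x → e _)

      ΣB-mono : ∀ n {f g : Bits n → M} → (∀ x → f x ≤ g x) → ΣB n f ≤ ΣB n g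
      ΣB-mono zero e    = e []
      ΣB-mono (suc n) e = +-mono (ΣB-mono n λ x → e _) (ΣB-mono n λ x → e _)

      ΣB-+ : ∀ n (f g : Bits n → M) → ΣB n (λ x → f x + g x) ≈ ΣB n f + ΣB n g
      ΣB-+ zero f g    = ≈-refl
      ΣB-+ (suc n) f g = ≈-trans (+-cong (ΣB-+ n _ _) (ΣB-+ n _ _))
        (solve 4 (λ a b c d → (a :+ b) :+ (c :+ d) := (a :+ c) :+ (b :+ d)) ≈-refl _ _ _ _)

      ΣB-* : ∀ n c (f : Bits n → M) → ΣB n (λ x → c * f x) ≈ c * ΣB n f
      ΣB-* zero c f    = ≈-refl
      ΣB-* (suc n) c f = ≈-trans (+-cong (ΣB-* n c _) (ΣB-* n c _)) (≈-sym (*-distribˡ c _ _))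

      ΣB-const : ∀ n c → ΣB n (λ _ → c) ≈ num (2^ n) * c
      ΣB-const zero c    = ≈-sym (≈-trans (*-cong (0+ 1M) ≈-refl) (1* c))
      ΣB-const (suc n) c = ≈-trans (+-cong (ΣB-const n c) (ΣB-const n c)) (≈-sym (≈-trans (*-cong (num-+ (2^ n) (2^ n)) ≈-refl) (*-distribʳ c _ _)))

      ΣB-swap : ∀ m n (f : Bits m → Bits n → M) → ΣB m (λ x → ΣB n (f x)) ≈ ΣB n (λ y → ΣB m (λ x → f x y))
      ΣB-swap zero n f    = ≈-refl
      ΣB-swap (suc m) n f = ≈-trans (+-cong (ΣB-swap m n _) (ΣB-swap m n _)) (≈-sym (ΣB-+ n _ _))

      ΣBF-ok : ∀ {k} n (f : Bits n → Fn k) x → ΣBF n f $ x ≈ ΣB n (λ a → f a $ x)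
      ΣBF-ok zero f x    = ≈-refl
      ΣBF-ok (suc n) f x = +-cong (ΣBF-ok n _ x) (ΣBF-ok n _ x)

      ∑-ΣBF : ∀ n m (f : Bits m → Fn 1) → ∑ n (ΣBF m f) ≈ ΣB m (λ a → ∑ n (f a))
      ∑-ΣBF n zero f    = ≈-refl
      ∑-ΣBF n (suc m) f = ≈-trans (∑-⊕ n _ _) (+-cong (∑-ΣBF n m _) (∑-ΣBF n m _))

      bval< : ∀ {n} (x : Bits n) → bval x ℕ.< 2^ n
      bval< [] = ℕ.s≤s ℕ.z≤n
      bval< {suc n} (false ∷ x) = ℕ.<-≤-trans (bval< x) (ℕ.m≤m+n _ _)
      bval< {suc n} (true ∷ x) = ℕ.+-monoʳ-< (2^ n) (bval< x)

      bval-inj : ∀ {n} (x y : Bits n) → bval x ≡ bval y → x ≡ y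
      bval-inj [] [] e = ≡.refl
      bval-inj (false ∷ x) (false ∷ y) e = ≡.cong (false ∷_) (bval-inj x y e)
      bval-inj {suc n} (true ∷ x) (true ∷ y) e = ≡.cong (true ∷_) (bval-inj x y (ℕ.+-cancelˡ-≡ (2^ n) _ _ e))
      bval-inj {suc n} (false ∷ x) (true ∷ y) e with ℕ.<⇒≱ (bval< x) (≡.subst (2^ n ℕ.≤_) (≡.sym e) (ℕ.m≤m+n _ _))
      ... | ()
      bval-inj {suc n} (true ∷ x) (false ∷ y) e with ℕ.<⇒≱ (bval< y) (≡.subst (2^ n ℕ.≤_) e (ℕ.m≤m+n _ _))
      ... | ()

      -- Most significant bit first.
      ∑-bits : ∀ n (h : Fn 1) → ∑ (num (2^ n)) h ≈ ΣB n (λ x → h $ (num (bval x) ∷ []))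
      ∑-bits zero h = ≈-trans (∑S 0M h) (≈-trans (+-cong (∑0 h) ≈-refl) (0+ _))
      ∑-bits (suc n) h = ≈-trans (∑n-cong h (num-+ (2^ n) (2^ n))) (≈-trans (∑-split _ _ h)
        (+-cong (∑-bits n h) (≈-trans (∑-bits n (h ∘F (conF (num (2^ n)) ⊕ x0 ∷ [])))
          (ΣB-cong n λ x → cong1 h (≈-sym (num-+ (2^ n) (bval x)))))))

      ∑-blocks : ∀ k n (h : Fn 1) → ∑ (n * num (2^ k)) h
        ≈ ∑ n (ΣBF k (λ a → h ∘F (x0 ⊗ conF (num (2^ k)) ⊕ conF (num (bval a)) ∷ [])))
      ∑-blocks k n h = ∑-uniq (∑F h ∘F (x0 ⊗ conF N ∷ [])) (ΣBF k bl) n (≈-trans (∑n-cong h (0* N)) (∑0 h))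
        λ v _ → ≈-trans (∑n-cong h (suc* v N)) (≈-trans (∑-split (v * N) N h) (+-cong ≈-refl
          (≈-trans (∑-bits k (h ∘F (conF (v * N) ⊕ x0 ∷ []))) (≈-sym (ΣBF-ok k bl (v ∷ []))))))
        where
        N : M
        N = num (2^ k)
        bl : Bits k → Fn 1
        bl a = h ∘F (x0 ⊗ conF N ⊕ conF (num (bval a)) ∷ [])

  -- Squared differences, Walsh-Hadamard transform and Poincaré inequality.

  module Fourier where
    open Sums public
    open Generators
    open import Data.Bool using (_xor_; if_then_else_)
    open import Data.Vec using (zipWith; replicate)

    abstract
      -- The square of `x - y` without negative numbers: at least one of the two truncated
      -- differences is 0.
      dsqF : Fn 2
      dsqF = (x0 ∸F x1) ⊗ (x0 ∸F x1) ⊕ (x1 ∸F x0) ⊗ (x1 ∸F x0)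

    dsq : M → M → M
    dsq x y = dsqF $ (x ∷ y ∷ [])

    2M : M
    2M = 1M + 1M

    dsqE : ∀ {k} → Fn k → Fn k → Fn k
    dsqE f g = dsqF ∘F (f ∷ g ∷ [])

    abstract
      -- With e = |x - y|.
      dsq-root : ∀ x y → ¬ₒ ¬ₒ (Σ M λ e → x ≤ y + e × y ≤ x + e × e * e ≈ dsq x y × e * e + 2M * (x * y) ≈ x * x + y * y)
      dsq-root x y k = by-or stable-𝕆 (≤-tot x y)
          (λ p → let d , e = slack p ; x∸y = ∸-0 p ; y∸x = ∸-of d e in
            k (d , ≤-trans p (≤+ _ _) , ≤-reflexive (≈-sym e)
              , ≈-sym (≈-trans (+-cong (≈-trans (*-cong x∸y x∸y) (0* _)) (*-cong y∸x y∸x)) (0+ _))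
              , ≈-trans (+-cong ≈-refl (*-cong ≈-refl (*-cong ≈-refl (≈-sym e)))) (≈-trans (sq x d) (+-cong ≈-refl (*-cong e e)))))
          (λ p → let d , e = slack p ; y∸x = ∸-0 p ; x∸y = ∸-of d e in
            k (d , ≤-reflexive (≈-sym e) , ≤-trans p (≤+ _ _)
              , ≈-sym (≈-trans (+-cong (*-cong x∸y x∸y) (≈-trans (*-cong y∸x y∸x) (0* _))) (+0 _))
              , ≈-trans (+-cong ≈-refl (*-cong ≈-refl (≈-trans (*-comm x y) (*-cong ≈-refl (≈-sym e)))))
                  (≈-trans (sq y d) (≈-trans (+-comm _ _) (+-cong (*-cong e e) ≈-refl)))))
        where
        sq : ∀ x d → d * d + 2M * (x * (x + d)) ≈ x * x + (x + d) * (x + d)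
        sq x d = solve 2 (λ x d → d :* d :+ (con 1 :+ con 1) :* (x :* (x :+ d)) := x :* x :+ (x :+ d) :* (x :+ d)) ≈-refl x d

      -- This equation determines `dsq x y` by cancellation. Identities for squared differences are
      -- derived from it alone, with no case distinction on the order.
      dsq-law : ∀ x y → dsq x y + 2M * (x * y) ≈ x * x + y * y
      dsq-law x y = stable-≈ λ k → dsq-root x y λ (e , _ , _ , p , q) → k (≈-trans (+-cong (≈-sym p) ≈-refl) q)

      dsq-cong : ∀ {x y u v} → x ≈ y → u ≈ v → dsq x u ≈ dsq y v
      dsq-cong = cong2 dsqF

      dsq-uniq : ∀ {x y} d → d + 2M * (x * y) ≈ x * x + y * y → dsq x y ≈ d
      dsq-uniq {x} {y} d e = +-cancelʳ _ _ _ (≈-trans (dsq-law x y) (≈-sym e))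

      dsq-sym : ∀ x y → dsq x y ≈ dsq y x
      dsq-sym x y = dsq-uniq _ (≈-trans (+-cong ≈-refl (*-cong ≈-refl (*-comm x y))) (≈-trans (dsq-law y x) (+-comm _ _)))

      dsq-refl : ∀ {x y} → x ≈ y → dsq x y ≈ 0M
      dsq-refl {x} {y} e = dsq-uniq _ (≈-trans (+-cong ≈-refl (*-cong ≈-refl (*-cong ≈-refl (≈-sym e))))
        (≈-trans (solve 1 (λ x → con 0 :+ (con 1 :+ con 1) :* (x :* x) := x :* x :+ x :* x) ≈-refl x) (+-cong ≈-refl (*-cong e e))))

      dsq-0 : ∀ x → dsq x 0M ≈ x * x
      dsq-0 x = dsq-uniq _ (solve 1 (λ x → x :* x :+ (con 1 :+ con 1) :* (x :* con 0) := x :* x :+ con 0 :* con 0) ≈-refl x)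

      dsq-scale : ∀ c x y → dsq (c * x) (c * y) ≈ (c * c) * dsq x y
      dsq-scale c x y = dsq-uniq _ (≈-trans (solve 4 (λ c x y d → (c :* c) :* d :+ (con 1 :+ con 1) :* ((c :* x) :* (c :* y)) := (c :* c) :* (d :+ (con 1 :+ con 1) :* (x :* y))) ≈-refl c x y (dsq x y))
        (≈-trans (*-cong ≈-refl (dsq-law x y)) (solve 3 (λ c x y → (c :* c) :* (x :* x :+ y :* y) := (c :* x) :* (c :* x) :+ (c :* y) :* (c :* y)) ≈-refl c x y)))

      2xy≤ : ∀ x y → 2M * (x * y) ≤ x * x + y * y
      2xy≤ x y = mk≤ (dsq x y) (≈-trans (+-comm _ _) (dsq-law x y))

      dsq≤ : ∀ {x y} e → x ≤ y + e → y ≤ x + e → dsq x y ≤ e * e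
      dsq≤ {x} {y} e p q = by-or stable-≤ (≤-tot x y)
          (λ r → let d , h = slack r ; de = +-cancel-≤ x (≤-resp (≈-sym h) ≈-refl q) in
             ≤-resp (≈-sym (dsq-uniq (d * d) (≈-trans (+-cong ≈-refl (*-cong ≈-refl (*-cong ≈-refl (≈-sym h)))) (≈-trans (sq x d) (+-cong ≈-refl (*-cong h h)))))) ≈-refl (*-mono de de))
          (λ r → let d , h = slack r ; de = +-cancel-≤ y (≤-resp (≈-sym h) ≈-refl p) in
             ≤-resp (≈-sym (≈-trans (dsq-sym x y) (dsq-uniq (d * d) (≈-trans (+-cong ≈-refl (*-cong ≈-refl (*-cong ≈-refl (≈-sym h)))) (≈-trans (sq y d) (+-cong ≈-refl (*-cong h h))))))) ≈-refl (*-mono de de))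
        where
        sq : ∀ x d → d * d + 2M * (x * (x + d)) ≈ x * x + (x + d) * (x + d)
        sq x d = solve 2 (λ x d → d :* d :+ (con 1 :+ con 1) :* (x :* (x :+ d)) := x :* x :+ (x :+ d) :* (x :+ d)) ≈-refl x d

      -- For the three absolute differences `a`, `b`, `c` this is `(a + b + c)² ≤ 3 (a² + b² + c²)`;
      -- the deficit is `dsq a b + dsq b c + dsq a c`.
      dsq-triangle : ∀ x y z w → dsq x w ≤ num 3 * (dsq x y + dsq y z + dsq z w)
      dsq-triangle x y z w = stable-≤ λ k → dsq-root x y λ (a , p , p' , pa , _) → dsq-root y z λ (b , q , q' , qb , _) →
        dsq-root z w λ (c , r , r' , rc , _) → k (≤-trans
          (dsq≤ (a + b + c)
            (≤-trans p (≤-trans (+-mono q (≤-refl {a})) (≤-trans (+-mono (+-mono r (≤-refl {b})) (≤-refl {a})) (≤-reflexive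
               (solve 4 (λ w a b c → ((w :+ c) :+ b) :+ a := w :+ (a :+ b :+ c)) ≈-refl w a b c)))))
            (≤-trans r' (≤-trans (+-mono q' (≤-refl {c})) (≤-trans (+-mono (+-mono p' (≤-refl {b})) (≤-refl {c})) (≤-reflexive
               (solve 4 (λ x a b c → ((x :+ a) :+ b) :+ c := x :+ (a :+ b :+ c)) ≈-refl x a b c))))))
          (≤-trans (mk≤ (dsq a b + dsq b c + dsq a c) (≈-trans
              (solve 6 (λ a b c u v w → (a :+ b :+ c) :* (a :+ b :+ c) :+ (u :+ v :+ w) :=
                 (a :* a :+ b :* b :+ c :* c) :+ ((u :+ (con 1 :+ con 1) :* (a :* b)) :+ (v :+ (con 1 :+ con 1) :* (b :* c)) :+ (w :+ (con 1 :+ con 1) :* (a :* c)))) ≈-refl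
                 a b c (dsq a b) (dsq b c) (dsq a c))
              (≈-trans (+-cong ≈-refl (+-cong (+-cong (dsq-law a b) (dsq-law b c)) (dsq-law a c)))
                (solve 3 (λ a b c → (a :* a :+ b :* b :+ c :* c) :+ ((a :* a :+ b :* b) :+ (b :* b :+ c :* c) :+ (a :* a :+ c :* c)) := con 3 :* (a :* a :+ b :* b :+ c :* c)) ≈-refl a b c))))
            (≤-reflexive (*-cong 3≈ (+-cong (+-cong pa qb) rc)))))
        where
        3≈ : 1M + 1M + 1M ≈ num 3
        3≈ = solve 0 (con 3 := con 0 :+ con 1 :+ con 1 :+ con 1) ≈-refl

      parallelogram : ∀ a b c d → dsq (a + c) (b + d) + dsq (a + d) (b + c) ≈ 2M * (dsq a b + dsq c d)
      parallelogram a b c d = +-cancelʳ _ _ (2M * ((a + c) * (b + d)) + 2M * ((a + d) * (b + c))) (≈-trans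
        (solve 4 (λ p q x y → (p :+ q) :+ (x :+ y) := (p :+ x) :+ (q :+ y)) ≈-refl _ _ _ _)
        (≈-trans (+-cong (dsq-law (a + c) (b + d)) (dsq-law (a + d) (b + c)))
        (≈-sym (≈-trans (solve 6 (λ a b c d p q → (con 1 :+ con 1) :* (p :+ q) :+ ((con 1 :+ con 1) :* ((a :+ c) :* (b :+ d)) :+ (con 1 :+ con 1) :* ((a :+ d) :* (b :+ c)))
            := (con 1 :+ con 1) :* ((p :+ (con 1 :+ con 1) :* (a :* b)) :+ (q :+ (con 1 :+ con 1) :* (c :* d)) :+ (a :* d :+ c :* b :+ a :* c :+ d :* b))) ≈-refl a b c d (dsq a b) (dsq c d))
          (≈-trans (*-cong ≈-refl (+-cong (+-cong (dsq-law a b) (dsq-law c d)) ≈-refl))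
            (solve 4 (λ a b c d → (con 1 :+ con 1) :* ((a :* a :+ b :* b) :+ (c :* c :+ d :* d) :+ (a :* d :+ c :* b :+ a :* c :+ d :* b))
              := ((a :+ c) :* (a :+ c) :+ (b :+ d) :* (b :+ d)) :+ ((a :+ d) :* (a :+ d) :+ (b :+ c) :* (b :+ c))) ≈-refl a b c d))))))

    -- Walsh-Hadamard transform; (a , b) stands for a - b.
    ℤM : Set
    ℤM = M × M

    infix 4 _≋_
    _≋_ : ℤM → ℤM → Set
    (a , b) ≋ (c , d) = (a ≈ c) × (b ≈ d)

    infixl 6 _⊞_ _⊟_
    _⊞_ _⊟_ : ℤM → ℤM → ℤM
    (a , b) ⊞ (c , d) = a + c , b + d
    (a , b) ⊟ (c , d) = a + d , b + c

    sq : ℤM → M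
    sq (a , b) = dsq a b

    flip : Bool → ℤM → ℤM
    flip false z       = z
    flip true  (a , b) = b , a

    FT : ∀ k → (Bits k → ℤM) → Bits k → ℤM
    FT zero    F []          = F []
    FT (suc k) F (false ∷ α) = FT k (F ∘ (false ∷_)) α ⊞ FT k (F ∘ (true ∷_)) α
    FT (suc k) F (true ∷ α)  = FT k (F ∘ (false ∷_)) α ⊟ FT k (F ∘ (true ∷_)) α

    xorV : ∀ {k} → Bits k → Bits k → Bits k
    xorV = zipWith _xor_

    abstract
      ⊞-cong : ∀ {z z' w w'} → z ≋ z' → w ≋ w' → z ⊞ w ≋ z' ⊞ w'
      ⊞-cong (p , q) (r , s) = +-cong p r , +-cong q s
      ⊟-cong : ∀ {z z' w w'} → z ≋ z' → w ≋ w' → z ⊟ w ≋ z' ⊟ w'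
      ⊟-cong (p , q) (r , s) = +-cong p s , +-cong q r
      ≋-trans : ∀ {x y z} → x ≋ y → y ≋ z → x ≋ z
      ≋-trans (p , q) (r , s) = ≈-trans p r , ≈-trans q s

      -- One application of the parallelogram law for each coordinate of the cube.
      parseval : ∀ k F → ΣB k (sq ∘ FT k F) ≈ num (2^ k) * ΣB k (sq ∘ F)
      parseval zero F    = ≈-sym (≈-trans (*-cong (0+ 1M) ≈-refl) (1* _))
      parseval (suc k) F = ≈-trans (≈-sym (ΣB-+ k _ _)) (≈-trans (ΣB-cong k λ α → parallelogram _ _ _ _)
        (≈-trans (ΣB-* k 2M _) (≈-trans (*-cong ≈-refl (≈-trans (ΣB-+ k _ _) (+-cong (parseval k (F ∘ (false ∷_))) (parseval k (F ∘ (true ∷_))))))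
          (≈-trans (solve 3 (λ n a b → (con 1 :+ con 1) :* (n :* a :+ n :* b) := (n :+ n) :* (a :+ b)) ≈-refl (num (2^ k)) _ _)
            (*-cong (≈-sym (num-+ (2^ k) (2^ k))) ≈-refl)))))

      FT-⊟ : ∀ k F G α → FT k (λ a → F a ⊟ G a) α ≋ FT k F α ⊟ FT k G α
      FT-⊟ zero F G [] = ≈-refl , ≈-refl
      FT-⊟ (suc k) F G (false ∷ α) = ≋-trans (⊞-cong (FT-⊟ k _ _ α) (FT-⊟ k _ _ α)) (mid _ _ _ _ , mid _ _ _ _)
        where mid : ∀ a b c d → (a + b) + (c + d) ≈ (a + c) + (b + d)
              mid = solve 4 (λ a b c d → (a :+ b) :+ (c :+ d) := (a :+ c) :+ (b :+ d)) ≈-refl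
      FT-⊟ (suc k) F G (true ∷ α) = ≋-trans (⊟-cong (FT-⊟ k _ _ α) (FT-⊟ k _ _ α)) (mid _ _ _ _ , mid _ _ _ _)
        where mid : ∀ a b c d → (a + b) + (c + d) ≈ (a + c) + (b + d)
              mid = solve 4 (λ a b c d → (a :+ b) :+ (c :+ d) := (a :+ c) :+ (b :+ d)) ≈-refl

      flip-⊞ : ∀ b z w → flip b z ⊞ flip b w ≋ flip b (z ⊞ w)
      flip-⊞ false z w = ≈-refl , ≈-refl
      flip-⊞ true z w  = ≈-refl , ≈-refl
      flip-⊟ : ∀ b z w → flip b z ⊟ flip b w ≋ flip b (z ⊟ w)
      flip-⊟ false z w = ≈-refl , ≈-refl
      flip-⊟ true z w  = ≈-refl , ≈-refl
      flip-⊞′ : ∀ b z w → flip b z ⊞ flip b w ≋ flip b (w ⊞ z)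
      flip-⊞′ false z w = +-comm _ _ , +-comm _ _
      flip-⊞′ true z w  = +-comm _ _ , +-comm _ _
      flip-⊟′ : ∀ b z w → flip b z ⊟ flip b w ≋ flip (true xor b) (w ⊟ z)
      flip-⊟′ false z w = +-comm _ _ , +-comm _ _
      flip-⊟′ true z w  = +-comm _ _ , +-comm _ _

      -- A translation multiplies the coefficient at `α` by a character value. The value is a sign,
      -- so it exchanges the two halves of a formal difference or leaves them alone.
      FT-shift : ∀ k F g α → FT k (λ a → F (xorV g a)) α ≋ flip (dot α g) (FT k F α)
      FT-shift zero F [] [] = ≈-refl , ≈-refl
      FT-shift (suc k) F (false ∷ g) (false ∷ α) = ≋-trans (⊞-cong (FT-shift k _ g α) (FT-shift k _ g α)) (flip-⊞ (dot α g) _ _)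
      FT-shift (suc k) F (false ∷ g) (true ∷ α)  = ≋-trans (⊟-cong (FT-shift k _ g α) (FT-shift k _ g α)) (flip-⊟ (dot α g) _ _)
      FT-shift (suc k) F (true ∷ g) (false ∷ α)  = ≋-trans (⊞-cong (FT-shift k _ g α) (FT-shift k _ g α)) (flip-⊞′ (dot α g) _ _)
      FT-shift (suc k) F (true ∷ g) (true ∷ α)   = ≋-trans (⊟-cong (FT-shift k _ g α) (FT-shift k _ g α)) (flip-⊟′ (dot α g) _ _)

    bit : Bool → M
    bit b = num (if b then 1 else 0)

    nz : Bool → M → M
    nz z x = if z then 0M else x

    zeroV : ∀ k → Bits k
    zeroV k = replicate k false

    abstract
      ΣB-nz : ∀ k (X : Bits k → M) → ΣB k X ≈ X (zeroV k) + ΣB k (λ α → nz (isZero α) (X α))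
      ΣB-nz zero X = ≈-sym (+0 _)
      ΣB-nz (suc k) X = ≈-trans (+-cong (ΣB-nz k (X ∘ (false ∷_))) ≈-refl) (+-assoc _ _ _)

      FT-0 : ∀ k (f : Bits k → M) → FT k (λ a → f a , 0M) (zeroV k) ≋ (ΣB k f , 0M)
      FT-0 zero f = ≈-refl , ≈-refl
      FT-0 (suc k) f = ≋-trans (⊞-cong (FT-0 k (f ∘ (false ∷_))) (FT-0 k (f ∘ (true ∷_)))) (≈-refl , +0 0M)

      num-Σℕ : ∀ n (f : Bits n → ℕ) → num (Σℕ n f) ≈ ΣB n (num ∘ f)
      num-Σℕ zero f = ≈-refl
      num-Σℕ (suc n) f = ≈-trans (num-+ (Σℕ n _) (Σℕ n _)) (+-cong (num-Σℕ n _) (num-Σℕ n _))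

    module _ {q k : ℕ} (g : Bits q → Bits k) (ok : ∀ α → isZero α ≡ false → two^ q ℕ.≤ 4 ℕ.* ones g α) (f : Bits k → M) where
      private
        N d : M
        N = num (2^ k)
        d = num (2^ q)
        F : Bits k → ℤM
        F a = f a , 0M
        X : Bits k → M
        X α = sq (FT k F α)
        rest E : M
        rest = ΣB k (λ α → nz (isZero α) (X α))
        E = ΣB q (λ j → ΣB k (λ a → dsq (f a) (f (xorV (g j) a))))
        fs : M
        fs = ΣB k f
        abstract
          sqd : ∀ b z → sq (z ⊟ flip b z) ≈ (num 4 * bit b) * sq z
          sqd false (x , y) = ≈-trans (dsq-refl (+-comm x y)) (≈-sym (≈-trans (*-cong (*0 (num 4)) ≈-refl) (0* _)))
          sqd true (x , y) = ≈-trans (dsq-cong (dbl x) (dbl y)) (≈-trans (dsq-scale 2M x y)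
              (*-cong (solve 0 ((con 1 :+ con 1) :* (con 1 :+ con 1) := (con 0 :+ con 1 :+ con 1 :+ con 1 :+ con 1) :* (con 0 :+ con 1)) ≈-refl) ≈-refl))
            where dbl : ∀ x → x + x ≈ 2M * x
                  dbl = solve 1 (λ x → x :+ x := (con 1 :+ con 1) :* x) ≈-refl
          one : ∀ j → N * ΣB k (λ a → dsq (f a) (f (xorV (g j) a))) ≈ ΣB k (λ α → X α * (num 4 * bit (dot α (g j))))
          one j = ≈-trans (*-cong ≈-refl (ΣB-cong k λ a → ≈-sym (dsq-cong (+0 (f a)) (0+ _))))
            (≈-trans (≈-sym (parseval k H)) (ΣB-cong k λ α → ≈-trans (dsq-cong (proj₁ (FTH α)) (proj₂ (FTH α)))
               (≈-trans (sqd (dot α (g j)) (FT k F α)) (*-comm _ _))))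
            where
            H : Bits k → ℤM
            H a = F a ⊟ F (xorV (g j) a)
            FTH : ∀ α → FT k H α ≋ FT k F α ⊟ flip (dot α (g j)) (FT k F α)
            FTH α = ≋-trans (FT-⊟ k F _ α) (⊟-cong (≈-refl , ≈-refl) (FT-shift k F (g j) α))
          d≤ : ∀ α b → isZero α ≡ b → d * nz b (X α) ≤ X α * (num 4 * num (ones g α))
          d≤ α true z  = ≤-trans (≤-reflexive (*0 d)) (0≤ _)
          d≤ α false z = ≤-trans (≤-reflexive (*-comm d _)) (*-mono ≤-refl (≤-trans (num-≤ (ok α z)) (≤-reflexive (num-* 4 (ones g α)))))
          drest : d * rest ≤ N * E
          drest = ≤-trans (≤-reflexive (≈-sym (ΣB-* k d _))) (≤-trans (ΣB-mono k λ α → d≤ α (isZero α) ≡.refl)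
            (≤-reflexive (≈-sym (≈-trans (≈-sym (ΣB-* q N _)) (≈-trans (ΣB-cong q one) (≈-trans (ΣB-swap q k _)
              (ΣB-cong k λ α → ≈-trans (ΣB-* q (X α) _) (*-cong ≈-refl (≈-trans (ΣB-* q (num 4) _) (*-cong ≈-refl (≈-sym (num-Σℕ q _))))))))))))
          -- The squares around the mean are expanded. By Parseval `N * sqs` is `fs * fs + rest`,
          -- because the coefficient at 0 is the sum `fs`.
          variance : ΣB k (λ a → dsq (N * f a) fs) ≈ N * rest
          variance = +-cancelʳ _ _ (2M * (N * (fs * fs))) (≈-trans lhs (≈-sym rhs))
            where
            sqs : M
            sqs = ΣB k (λ a → f a * f a)
            par : N * sqs ≈ fs * fs + rest
            par = ≈-trans (*-cong ≈-refl (ΣB-cong k λ a → ≈-sym (dsq-0 (f a)))) (≈-trans (≈-sym (parseval k F)) (≈-trans (ΣB-nz k X)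
              (+-cong (≈-trans (dsq-cong (proj₁ (FT-0 k f)) (proj₂ (FT-0 k f))) (dsq-0 fs)) ≈-refl)))
            lhs : ΣB k (λ a → dsq (N * f a) fs) + 2M * (N * (fs * fs)) ≈ N * (N * sqs) + N * (fs * fs)
            lhs = ≈-trans (+-cong ≈-refl (≈-trans (solve 3 (λ t n s → t :* (n :* (s :* s)) := (t :* (n :* s)) :* s) ≈-refl 2M N fs) (≈-sym (ΣB-* k ((2M * (N * fs))) f))))
              (≈-trans (≈-sym (ΣB-+ k _ _)) (≈-trans (ΣB-cong k λ a → ≈-trans (+-cong ≈-refl (solve 4 (λ t n s x → (t :* (n :* s)) :* x := t :* ((n :* x) :* s)) ≈-refl 2M N fs (f a)))
                  (≈-trans (dsq-law (N * f a) fs) (+-cong (solve 2 (λ n x → (n :* x) :* (n :* x) := (n :* n) :* (x :* x)) ≈-refl N (f a)) ≈-refl)))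
                (≈-trans (ΣB-+ k _ _) (+-cong (≈-trans (ΣB-* k (N * N) _) (*-assoc N N _)) (ΣB-const k (fs * fs))))))
            rhs : N * rest + 2M * (N * (fs * fs)) ≈ N * (N * sqs) + N * (fs * fs)
            rhs = ≈-sym (≈-trans (+-cong (*-cong ≈-refl par) ≈-refl)
              (solve 3 (λ n r s → n :* (s :+ r) :+ n :* s := n :* r :+ (con 1 :+ con 1) :* (n :* s)) ≈-refl N rest (fs * fs)))
      abstract
        -- In Fourier coordinates the variance is the weight off the coefficient 0. Subtracting the
        -- shift by `g j` doubles or kills the coefficient at `α` according to `dot α (g j)`. A
        -- quarter of the generators double a given nonzero `α`, and the factor 4 of the squared
        -- doubling makes up for this quarter.
        poincare : num (2^ q) * ΣB k (λ a → dsq (num (2^ k) * f a) (ΣB k f))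
                 ≤ (num (2^ k) * num (2^ k)) * ΣB q (λ j → ΣB k (λ a → dsq (f a) (f (xorV (g j) a))))
        poincare = ≤-trans (≤-reflexive (≈-trans (*-cong ≈-refl variance) (solve 3 (λ d n r → d :* (n :* r) := n :* (d :* r)) ≈-refl d N rest)))
          (≤-trans (*-mono (≤-refl {N}) drest) (≤-reflexive (≈-sym (*-assoc N N E))))

  -- Walk operators, Dirichlet energies and convexity.

  module Energy where
    open Fourier public
    open import Data.Vec using (_++_; concat; _∷ʳ_)

    ΣW : ∀ {l} j → (Vec (Bits l) j → M) → M
    ΣW     zero    f = f []
    ΣW {l} (suc j) f = ΣB l (λ e → ΣW j (λ w → f (e ∷ w)))

    ΣWF : ∀ {l k} j → (Vec (Bits l) j → Fn k) → Fn k
    ΣWF     zero    f = f []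
    ΣWF {l} (suc j) f = ΣBF l (λ e → ΣWF j (λ w → f (e ∷ w)))

    rev : ∀ {A : Set} {n} → Vec A n → Vec A n
    rev []      = []
    rev (x ∷ w) = rev w ∷ʳ x

    abstract
      ΣW-cong : ∀ {l} j {f g : Vec (Bits l) j → M} → (∀ w → f w ≈ g w) → ΣW j f ≈ ΣW j g
      ΣW-cong zero e = e []
      ΣW-cong {l} (suc j) e = ΣB-cong l λ a → ΣW-cong j λ w → e _

      ΣW-mono : ∀ {l} j {f g : Vec (Bits l) j → M} → (∀ w → f w ≤ g w) → ΣW j f ≤ ΣW j g
      ΣW-mono zero e = e []
      ΣW-mono {l} (suc j) e = ΣB-mono l λ a → ΣW-mono j λ w → e _

      ΣW-+ : ∀ {l} j (f g : Vec (Bits l) j → M) → ΣW j (λ w → f w + g w) ≈ ΣW j f + ΣW j g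
      ΣW-+ zero f g = ≈-refl
      ΣW-+ {l} (suc j) f g = ≈-trans (ΣB-cong l λ a → ΣW-+ j _ _) (ΣB-+ l _ _)

      ΣW-* : ∀ {l} j c (f : Vec (Bits l) j → M) → ΣW j (λ w → c * f w) ≈ c * ΣW j f
      ΣW-* zero c f = ≈-refl
      ΣW-* {l} (suc j) c f = ≈-trans (ΣB-cong l λ a → ΣW-* j c _) (ΣB-* l c _)

      ΣW-const : ∀ l j c → ΣW {l} j (λ _ → c) ≈ pow (num (2^ l)) j * c
      ΣW-const l zero c = ≈-sym (1* c)
      ΣW-const l (suc j) c = ≈-trans (ΣB-cong l λ a → ΣW-const l j c) (≈-trans (ΣB-const l _) (≈-sym (*-assoc _ _ c)))

      ΣW-snoc : ∀ {l} j (f : Vec (Bits l) (suc j) → M) → ΣB l (λ e → ΣW j (λ w → f (w ∷ʳ e))) ≈ ΣW (suc j) f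
      ΣW-snoc zero f = ≈-refl
      ΣW-snoc {l} (suc j) f = ≈-trans (ΣB-swap l l _) (ΣB-cong l λ e → ΣW-snoc j (f ∘ (e ∷_)))

      ΣW-rev : ∀ {l} j (f : Vec (Bits l) j → M) → ΣW j (f ∘ rev) ≈ ΣW j f
      ΣW-rev zero f = ≈-refl
      ΣW-rev {l} (suc j) f = ≈-trans (ΣB-cong l λ e → ΣW-rev j (λ w → f (w ∷ʳ e))) (ΣW-snoc j f)

      ΣB-++ : ∀ a b (f : Bits (a ℕ.+ b) → M) → ΣB (a ℕ.+ b) f ≈ ΣB a (λ x → ΣB b (λ y → f (x ++ y)))
      ΣB-++ zero b f = ≈-refl
      ΣB-++ (suc a) b f = +-cong (ΣB-++ a b _) (ΣB-++ a b _)

      ΣB-concat : ∀ l j (f : Bits (j ℕ.* l) → M) → ΣB (j ℕ.* l) f ≈ ΣW {l} j (f ∘ concat)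
      ΣB-concat l zero f = ≈-refl
      ΣB-concat l (suc j) f = ≈-trans (ΣB-++ l (j ℕ.* l) f) (ΣB-cong l λ e → ΣB-concat l j (λ y → f (e ++ y)))

      ΣWF-ok : ∀ {l k} j (f : Vec (Bits l) j → Fn k) x → ΣWF j f $ x ≈ ΣW j (λ w → f w $ x)
      ΣWF-ok zero f x = ≈-refl
      ΣWF-ok {l} (suc j) f x = ≈-trans (ΣBF-ok l _ x) (ΣB-cong l λ e → ΣWF-ok j _ x)

      ∑-ΣWF : ∀ {l} n j (f : Vec (Bits l) j → Fn 1) → ∑ n (ΣWF j f) ≈ ΣW j (λ w → ∑ n (f w))
      ∑-ΣWF n zero f = ≈-refl
      ∑-ΣWF {l} n (suc j) f = ≈-trans (∑-ΣBF n l _) (ΣB-cong l λ e → ∑-ΣWF n j _)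

      -- For `b j = B j / (D * D) ^ j` the hypothesis says that `b` is convex, and the claim is `(m
      -- + 1) (b m - b (m + 1)) ≤ b 0 - b (m + 1)`: the last of `m + 1` drops is at most their
      -- average. Divisions and subtractions have been cleared.
      convex-bound : ∀ (D : M) (B : ℕ → M) → (∀ j → 2M * ((D * D) * B (suc j)) ≤ ((D * D) * (D * D)) * B j + B (suc (suc j))) →
        ∀ m → num (suc m) * ((D * D) * B m) + B (suc m) ≤ pow (D * D) (suc m) * B 0 + num (suc m) * B (suc m)
      convex-bound D B cv zero = ≤-reflexive (solve 4 (λ e b0 b1 o → (con 0 :+ con 1) :* (e :* b0) :+ b1 := (e :* con 1) :* b0 :+ (con 0 :+ con 1) :* b1) ≈-refl (D * D) (B 0) (B 1) 1M)
      convex-bound D B cv (suc m) =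
        ≤-trans (+-mono (+-cancel-≤ ((num (suc m) * (D₂ * D₂)) * B m + (num (suc m) * D₂) * b1) (≤-trans (≤-reflexive
            (solve 5 (λ u e x y z → (u :* (e :* e)) :* x :+ (u :* e) :* y :+ (u :+ con 1) :* (e :* y)
                    := e :* (u :* (e :* x) :+ y) :+ u :* ((con 1 :+ con 1) :* (e :* y))) ≈-refl (num (suc m)) D₂ (B m) b1 b2))
          (≤-trans (+-mono (*-mono (≤-refl {D₂}) (convex-bound D B cv m)) (*-mono (≤-refl {num (suc m)}) (cv m)))
            (≤-reflexive (solve 6 (λ u e x y z p → e :* (p :+ u :* y) :+ u :* ((e :* e) :* x :+ z)
                    := (u :* (e :* e)) :* x :+ (u :* e) :* y :+ (e :* p :+ u :* z)) ≈-refl (num (suc m)) D₂ (B m) b1 b2 (pow D₂ (suc m) * B 0))))))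
          (≤-refl {b2}))
          (≤-reflexive (solve 5 (λ u e z p b0 → (e :* (p :* b0) :+ u :* z) :+ z := (e :* p) :* b0 :+ (u :+ con 1) :* z) ≈-refl (num (suc m)) D₂ b2 (pow D₂ (suc m)) (B 0)))
        where
        D₂ b1 b2 : M
        D₂ = D * D
        b1 = B (suc m)
        b2 = B (suc (suc m))

    -- A graph on [0,n) whose edges are given by involutions; labels true ∷ _ are loops.
    record Graph (l : ℕ) (n : M) : Set where
      no-eta-equality
      field
        π    : Bits (suc l) → Fn 1
        π<   : ∀ e v → v < n → π e $ (v ∷ []) < n
        ππ   : ∀ e v → v < n → π e $ (π e $ (v ∷ []) ∷ []) ≈ v
        loop : ∀ e v → v < n → π (true ∷ e) $ (v ∷ []) ≈ v

    module GraphOps {l : ℕ} {n : M} (Gr : Graph l n) where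
      open Graph Gr public
      D ℓ : M
      D = num (2^ (suc l))
      ℓ = num (2^ l)

      act : ∀ {j} → Vec (Bits (suc l)) j → Fn 1
      act []      = x0
      act (e ∷ w) = act w ∘F (π e ∷ [])

      P : Fn 1 → Fn 1
      P h = ΣBF (suc l) (λ e → h ∘F (π e ∷ []))

      PW : ℕ → Fn 1 → Fn 1
      PW zero    h = h
      PW (suc j) h = P (PW j h)

      En : Fn 1 → M
      En h = ΣB (suc l) (λ e → ∑ n (dsqE h (h ∘F (π e ∷ []))))

      EW : ℕ → Fn 1 → M
      EW j h = ΣW j (λ w → ∑ n (dsqE h (h ∘F (act w ∷ []))))

      norm : Fn 1 → M
      norm h = ∑ n (h ⊗ h)

      abstract
        act< : ∀ {j} (w : Vec (Bits (suc l)) j) v → v < n → act w $ (v ∷ []) < n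
        act< [] v p = p
        act< (e ∷ w) v p = act< w _ (π< e v p)

        ∑-π : ∀ e (h : Fn 1) → ∑ n (h ∘F (π e ∷ [])) ≈ ∑ n h
        ∑-π e h = ∑-invol n (π e) h (π< e) (ππ e)

        ∑-act : ∀ {j} (w : Vec (Bits (suc l)) j) (h : Fn 1) → ∑ n (h ∘F (act w ∷ [])) ≈ ∑ n h
        ∑-act [] h = ∑-cong n _ h λ _ _ → ≈-refl
        ∑-act (e ∷ w) h = ≈-trans (∑-cong n (h ∘F (act w ∘F (π e ∷ []) ∷ [])) (h ∘F (act w ∷ []) ∘F (π e ∷ [])) λ _ _ → ≈-refl)
          (≈-trans (∑-π e (h ∘F (act w ∷ []))) (∑-act w h))

        act-snoc : ∀ {j} (w : Vec (Bits (suc l)) j) e v → act (w ∷ʳ e) $ (v ∷ []) ≈ π e $ (act w $ (v ∷ []) ∷ [])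
        act-snoc [] e v = ≈-refl
        act-snoc (a ∷ w) e v = act-snoc w e _

        act-rev : ∀ {j} (w : Vec (Bits (suc l)) j) v → v < n → act (rev w) $ (act w $ (v ∷ []) ∷ []) ≈ v
        act-rev [] v p = ≈-refl
        act-rev (e ∷ w) v p = ≈-trans (act-snoc (rev w) e _) (≈-trans (cong1 (π e) (act-rev w _ (π< e v p))) (ππ e v p))

        P-ok : ∀ h v → P h $ (v ∷ []) ≈ ΣB (suc l) (λ e → h $ (π e $ (v ∷ []) ∷ []))
        P-ok h v = ΣBF-ok (suc l) (λ e → h ∘F (π e ∷ [])) (v ∷ [])

        PW-ok : ∀ j h v → PW j h $ (v ∷ []) ≈ ΣW j (λ w → h $ (act w $ (v ∷ []) ∷ []))
        PW-ok zero h v = ≈-refl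
        PW-ok (suc j) h v = ≈-trans (P-ok (PW j h) v) (ΣB-cong (suc l) {λ e → PW j h $ (π e $ (v ∷ []) ∷ [])}
          {λ e → ΣW j (λ w → h $ (act w $ (π e $ (v ∷ []) ∷ []) ∷ []))} λ e → PW-ok j h _)

        -- Each label acts as an involution, so its permutation matrix is symmetric.
        self-adjoint : ∀ f g → ∑ n (f ⊗ P g) ≈ ∑ n (P f ⊗ g)
        self-adjoint f g = ≈-trans (∑-cong n (f ⊗ P g) (ΣBF (suc l) A) λ v _ → ≈-trans (*-cong ≈-refl (P-ok g v))
            (≈-trans (≈-sym (ΣB-* (suc l) (f $ (v ∷ [])) (λ e → g $ (π e $ (v ∷ []) ∷ [])))) (≈-sym (ΣBF-ok (suc l) A (v ∷ [])))))
          (≈-trans (∑-ΣBF n (suc l) A) (≈-trans (ΣB-cong (suc l) {λ e → ∑ n (A e)} {λ e → ∑ n (B e)} λ e → ≈-trans (≈-sym (∑-π e (A e)))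
              (∑-cong n (A e ∘F (π e ∷ [])) (B e) λ v p → *-cong ≈-refl (cong1 g (ππ e v p))))
            (≈-sym (≈-trans (∑-cong n (P f ⊗ g) (ΣBF (suc l) B) λ v _ → ≈-trans (*-cong (P-ok f v) ≈-refl)
              (≈-trans (*-comm _ _) (≈-trans (≈-sym (ΣB-* (suc l) (g $ (v ∷ [])) (λ e → f $ (π e $ (v ∷ []) ∷ [])))) (≈-trans (ΣB-cong (suc l) {λ e → g $ (v ∷ []) * f $ (π e $ (v ∷ []) ∷ [])} {λ e → B e $ (v ∷ [])} λ e → *-comm _ _) (≈-sym (ΣBF-ok (suc l) B (v ∷ [])))))))
              (∑-ΣBF n (suc l) B)))))
          where
          A B : Bits (suc l) → Fn 1
          A e = f ⊗ g ∘F (π e ∷ [])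
          B e = f ∘F (π e ∷ []) ⊗ g

        shift : ∀ i j f → ∑ n (PW i f ⊗ PW j f) ≈ ∑ n (f ⊗ PW (i ℕ.+ j) f)
        shift zero j f = ≈-refl
        shift (suc i) j f = ≈-trans (≈-sym (self-adjoint (PW i f) (PW j f))) (≈-trans (shift i (suc j) f) (≡⇒≈ (≡.cong (λ a → ∑ n (f ⊗ PW a f)) (ℕ.+-suc i j))))

        -- Each word permutes the vertices, so the shifted function has the same norm as `h`;
        -- expanding the squares word by word leaves only the mixed terms.
        energy-identity : ∀ j h → EW j h + 2M * ∑ n (h ⊗ PW j h) ≈ 2M * (pow D j * norm h)
        energy-identity j h = ≈-trans (+-cong ≈-refl (≈-trans (*-cong ≈-refl inner) (≈-sym (ΣW-* j 2M _))))
          (≈-trans (≈-sym (ΣW-+ j _ _)) (≈-trans (ΣW-cong j each) (≈-trans (ΣW-const (suc l) j (2M * norm h))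
            (solve 3 (λ p t x → p :* (t :* x) := t :* (p :* x)) ≈-refl (pow D j) 2M (norm h)))))
          where
          C : Vec (Bits (suc l)) j → Fn 1
          C w = h ⊗ h ∘F (act w ∷ [])
          inner : ∑ n (h ⊗ PW j h) ≈ ΣW j (λ w → ∑ n (C w))
          inner = ≈-trans (∑-cong n (h ⊗ PW j h) (ΣWF j C) λ v _ → ≈-trans (*-cong ≈-refl (PW-ok j h v))
            (≈-trans (≈-sym (ΣW-* j (h $ (v ∷ [])) (λ w → h $ (act w $ (v ∷ []) ∷ [])))) (≈-sym (ΣWF-ok j C (v ∷ []))))) (∑-ΣWF n j C)
          each : ∀ w → ∑ n (dsqE h (h ∘F (act w ∷ []))) + 2M * ∑ n (C w) ≈ 2M * norm h
          each w = ≈-trans (+-cong ≈-refl (≈-sym (∑-⊗ n 2M (C w)))) (≈-trans (≈-sym (∑-⊕ n dd (conF 2M ⊗ C w)))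
            (≈-trans (∑-cong n (dd ⊕ conF 2M ⊗ C w) (h ⊗ h ⊕ (h ⊗ h) ∘F (act w ∷ [])) λ v _ → dsq-law _ _)
            (≈-trans (∑-⊕ n (h ⊗ h) ((h ⊗ h) ∘F (act w ∷ []))) (≈-trans (+-cong ≈-refl (∑-act w (h ⊗ h)))
              (solve 1 (λ x → x :+ x := (con 1 :+ con 1) :* x) ≈-refl (norm h))))))
            where dd : Fn 1
                  dd = dsqE h (h ∘F (act w ∷ []))

        -- Only the two-step walks whose second step is a loop are counted.
        energy₂ : ∀ h → ℓ * En h ≤ EW 2 h
        energy₂ h = ≤-trans (≤-reflexive (≈-sym (ΣB-* (suc l) ℓ (λ e → ∑ n (dsqE h (h ∘F (π e ∷ []))))))) (ΣB-mono (suc l)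
          {λ e → ℓ * ∑ n (dsqE h (h ∘F (π e ∷ [])))} {λ e → ΣB (suc l) (λ e' → ∑ n (dsqE h (h ∘F (act (e ∷ e' ∷ []) ∷ []))))} λ e →
          ≤-trans (≤-reflexive (≈-trans (≈-sym (ΣB-const l _)) (ΣB-cong l λ e' →
            ∑-cong n _ (dsqE h (h ∘F (act (e ∷ (true ∷ e') ∷ []) ∷ []))) λ v p → dsq-cong ≈-refl (cong1 h (≈-sym (loop e' _ (π< e v p)))))))
          (≤+ʳ _ _))

        -- This replaces the eigenvalue argument. Let `b j` be the norm of `PW j f` over
        -- `(D * D) ^ j`. Up to that scaling, the two-step energy of `PW m f` is twice the last drop
        -- of `b`, and the energy of `f` along walks of length `2 (m + 1)` is twice the whole drop
        -- from `b 0`; `convex-bound` compares the two.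
        energy-gain : ∀ m f → (num (suc m) * ℓ) * En (PW m f) ≤ EW (suc m ℕ.+ suc m) f
        energy-gain m f = +-cancel-≤ ((num (suc m) * (2M * Bm)) + 2M * Bm) (≤-trans (≤-reflexive
            (solve 5 (λ u l e b t → u :* (t :* b) :+ t :* b :+ (u :* l) :* e := u :* (l :* e :+ t :* b) :+ t :* b) ≈-refl (num (suc m)) ℓ (En g) Bm 2M))
          (≤-trans (+-mono (*-mono (≤-refl {num (suc m)}) e2) ≤-refl)
          (≤-trans (≤-reflexive (solve 5 (λ u t d b b' → u :* (t :* (d :* b)) :+ t :* b' := t :* (u :* (d :* b) :+ b')) ≈-refl (num (suc m)) 2M (D * D) (B m) Bm))
          (≤-trans (*-mono (≤-refl {2M}) (convex-bound D B cv m))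
            (≤-reflexive (≈-trans (solve 4 (λ t p u b → t :* (p :+ u :* b) := u :* (t :* b) :+ t :* p) ≈-refl 2M (pow (D * D) (suc m) * B 0) (num (suc m)) Bm)
              (≈-trans (+-cong ≈-refl (≈-sym tot)) (solve 4 (λ u t b e → u :+ (e :+ t :* b) := u :+ t :* b :+ e) ≈-refl (num (suc m) * (2M * Bm)) 2M Bm (EW (suc m ℕ.+ suc m) f)))))))))
          where
          B : ℕ → M
          B j = norm (PW j f)
          g : Fn 1
          g = PW m f
          Bm : M
          Bm = B (suc m)
          e2 : ℓ * En g + 2M * Bm ≤ 2M * ((D * D) * B m)
          e2 = ≤-trans (+-mono (energy₂ g) (≤-refl {2M * Bm})) (≤-reflexive (≈-trans (+-cong ≈-refl (*-cong ≈-refl (≈-sym (self-adjoint g (P g)))))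
            (≈-trans (energy-identity 2 g) (*-cong ≈-refl (*-cong (*-cong ≈-refl (*1 D)) ≈-refl)))))
          pow2 : ∀ j → pow (D * D) j ≈ pow D (j ℕ.+ j)
          pow2 zero = ≈-refl
          pow2 (suc j) = ≈-trans (*-cong ≈-refl (pow2 j)) (≈-trans (*-assoc D D _) (*-cong ≈-refl (≡⇒≈ (≡.cong (pow D) (≡.sym (ℕ.+-suc j j))))))
          tot : EW (suc m ℕ.+ suc m) f + 2M * Bm ≈ 2M * (pow (D * D) (suc m) * B 0)
          tot = ≈-trans (+-cong ≈-refl (*-cong ≈-refl (shift (suc m) (suc m) f)))
            (≈-trans (energy-identity (suc m ℕ.+ suc m) f) (*-cong ≈-refl (*-cong (≈-sym (pow2 (suc m))) ≈-refl)))
          -- Self-adjointness rewrites `B (suc j)` as the product of `u` with `P (P u)`; convexity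
          -- is then `2 x y ≤ x² + y²` for `D * D` times `u` and `P (P u)`.
          cv : ∀ j → 2M * ((D * D) * B (suc j)) ≤ ((D * D) * (D * D)) * B j + B (suc (suc j))
          cv j = ≤-trans (≤-reflexive (*-cong ≈-refl (≈-trans (*-cong ≈-refl (≈-sym (self-adjoint u (P u)))) (≈-sym (∑-⊗ n (D * D) (u ⊗ P (P u)))))))
            (≤-trans (≤-reflexive (≈-sym (∑-⊗ n 2M (conF (D * D) ⊗ (u ⊗ P (P u))))))
            (≤-trans (∑-mono n (conF 2M ⊗ (conF (D * D) ⊗ (u ⊗ P (P u)))) ((conF (D * D) ⊗ u) ⊗ (conF (D * D) ⊗ u) ⊕ P (P u) ⊗ P (P u))
              λ v _ → ≤-trans (≤-reflexive (*-cong ≈-refl (≈-sym (*-assoc _ _ _)))) (2xy≤ _ _))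
            (≤-reflexive (≈-trans (∑-⊕ n _ (P (P u) ⊗ P (P u))) (+-cong (≈-trans (∑-cong n _ (conF ((D * D) * (D * D)) ⊗ (u ⊗ u)) λ v _ →
              solve 2 (λ d x → (d :* x) :* (d :* x) := (d :* d) :* (x :* x)) ≈-refl (D * D) (u $ (v ∷ []))) (∑-⊗ n _ (u ⊗ u))) ≈-refl)))))
            where u : Fn 1
                  u = PW j f

  -- Replacement of vertices by clouds, and the gain of one level.

  module Clouds where
    open Energy public
    open Generators
    open import Data.Vec using (concat; group)

    module Cloud (q t : ℕ) (g : Bits q → Bits (t ℕ.* suc (suc q)))
                 (g-ok : ∀ α → isZero α ≡ false → two^ q ℕ.≤ 4 ℕ.* ones g α) where

      -- A cloud vertex has two readings: as a word of `t` labels it is a walk below, and its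
      -- concatenation is the vector on which the generators act.
      Word : Set
      Word = Vec (Bits (suc (suc q))) t

      k : ℕ
      k = t ℕ.* suc (suc q)

      N d : M
      N = num (2^ k)
      d = num (2^ q)

      code# : Word → M
      code# a = num (bval (concat a))

      gen : Bits q → Word → Word
      gen j a = proj₁ (group t (suc (suc q)) (xorV (g j) (concat a)))

      concat-gen : ∀ j a → concat (gen j a) ≡ xorV (g j) (concat a)
      concat-gen j a = ≡.sym (proj₂ (group t (suc (suc q)) (xorV (g j) (concat a))))

      cell : Word → Fn 1
      cell a = x0 ⊗ conF N ⊕ conF (code# a)

      abstract
        blocksW : ∀ n (h : Fn 1) → ∑ (n * N) h ≈ ΣW t (λ a → ∑ n (h ∘F (cell a ∷ [])))
        blocksW n h = ≈-trans (∑-blocks k n h) (≈-trans (∑-ΣBF n k _) (ΣB-concat (suc (suc q)) t (λ b → ∑ n (h ∘F (x0 ⊗ conF N ⊕ conF (num (bval b)) ∷ [])))))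

      -- Gr' is the replacement of the t-th power of Gr by clouds.
      record IsCloud {n : M} (Gr : Graph (suc q) n) (Gr' : Graph (suc q) (n * N)) : Set where
        no-eta-equality
        open GraphOps Gr using (act)
        open Graph Gr' using () renaming (π to π')
        field
          on-gen   : ∀ j a v → v < n → π' (false ∷ false ∷ j) $ (v * N + code# a ∷ []) ≈ v * N + code# (gen j a)
          on-inter : ∀ j a v → v < n → π' (false ∷ true ∷ j) $ (v * N + code# a ∷ []) ≈ act a $ (v ∷ []) * N + code# (rev a)

      module Step {n : M} {Gr : Graph (suc q) n} {Gr' : Graph (suc q) (n * N)} (ic : IsCloud Gr Gr') (f' : Fn 1) where
        open GraphOps Gr
        open IsCloud ic
        module G' = GraphOps Gr'

        fa : Word → Fn 1
        fa a = f' ∘F (cell a ∷ [])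

        f̄ : Fn 1
        f̄ = ΣWF t fa

        private
          H : Bits q → M
          H j = ΣW t (λ a → ∑ n (dsqE (fa a) (fa (gen j a))))
          EI X : M
          EI = ΣW t (λ a → ∑ n (dsqE (fa a) (fa (rev a) ∘F (act a ∷ []))))
          X = ΣW t (λ a → ∑ n (dsqE (conF N ⊗ fa a) f̄))
          NN : M
          NN = N * N

          abstract
            at-v : ∀ v → d * ΣW t (λ a → dsq (N * fa a $ (v ∷ [])) (f̄ $ (v ∷ [])))
                       ≤ NN * ΣB q (λ j → ΣW t (λ a → dsq (fa a $ (v ∷ [])) (fa (gen j a) $ (v ∷ []))))
            at-v v = ≤-trans (≤-reflexive (*-cong ≈-refl (≈-trans (ΣW-cong t λ a → dsq-cong ≈-refl (≈-trans (ΣWF-ok t fa (v ∷ [])) (≈-sym (ΣB-concat (suc (suc q)) t f))))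
                  (≈-sym (ΣB-concat (suc (suc q)) t (λ b → dsq (N * f b) (ΣB k f)))))))
              (≤-trans (poincare g g-ok f) (≤-reflexive (*-cong ≈-refl (ΣB-cong q λ j → ≈-trans (ΣB-concat (suc (suc q)) t (λ b → dsq (f b) (f (xorV (g j) b))))
                (ΣW-cong t λ a → dsq-cong ≈-refl (≡⇒≈ (≡.cong f (≡.sym (concat-gen j a)))))))))
              where
              f : Bits k → M
              f b = f' $ (v * N + num (bval b) ∷ [])

            dX : d * X ≤ NN * ΣB q H
            dX = ≤-trans (≤-reflexive (≈-trans (*-cong ≈-refl (≈-sym (∑-ΣWF n t A))) (≈-sym (∑-⊗ n d (ΣWF t A)))))
              (≤-trans (∑-mono n (conF d ⊗ ΣWF t A) (conF NN ⊗ ΣBF q (λ j → ΣWF t (B j))) λ v _ →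
                ≤-trans (≤-reflexive (*-cong ≈-refl (ΣWF-ok t A (v ∷ [])))) (≤-trans (at-v v) (≤-reflexive (*-cong ≈-refl
                  (≈-sym (≈-trans (ΣBF-ok q _ (v ∷ [])) (ΣB-cong q λ j → ΣWF-ok t (B j) (v ∷ []))))))))
              (≤-reflexive (≈-trans (∑-⊗ n NN (ΣBF q (λ j → ΣWF t (B j)))) (*-cong ≈-refl (≈-trans (∑-ΣBF n q _) (ΣB-cong q λ j → ∑-ΣWF n t (B j)))))))
              where
              A : Word → Fn 1
              A a = dsqE (conF N ⊗ fa a) f̄
              B : Bits q → Word → Fn 1
              B j a = dsqE (fa a) (fa (gen j a))

            H≈ : ∀ j → ∑ (n * N) (dsqE f' (f' ∘F (G'.π (false ∷ false ∷ j) ∷ []))) ≈ H j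
            H≈ j = ≈-trans (blocksW n _) (ΣW-cong t λ a → ∑-cong n (dsqE f' (f' ∘F (G'.π (false ∷ false ∷ j) ∷ [])) ∘F (cell a ∷ []))
              (dsqE (fa a) (fa (gen j a))) λ v p → dsq-cong ≈-refl (cong1 f' (on-gen j a v p)))

            I≈ : ∀ j → ∑ (n * N) (dsqE f' (f' ∘F (G'.π (false ∷ true ∷ j) ∷ []))) ≈ EI
            I≈ j = ≈-trans (blocksW n _) (ΣW-cong t λ a → ∑-cong n (dsqE f' (f' ∘F (G'.π (false ∷ true ∷ j) ∷ [])) ∘F (cell a ∷ []))
              (dsqE (fa a) (fa (rev a) ∘F (act a ∷ []))) λ v p → dsq-cong ≈-refl (cong1 f' (on-inter j a v p)))

            -- The edge between clouds is repeated under all labels `false ∷ true ∷ j`, which gives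
            -- its energy the weight `d`. The loops are merely dropped.
            HI≤ : ΣB q H + d * EI ≤ G'.En f'
            HI≤ = ≤-trans (≤-reflexive (≈-sym (+-cong (ΣB-cong q H≈) (≈-trans (ΣB-cong q I≈) (ΣB-const q EI))))) (≤+ _ _)

            EW≤ : EW t f̄ ≤ num 3 * (2M * X + NN * EI)
            EW≤ = ≤-trans (ΣW-mono t λ a → ≤-trans (∑-mono n (dsqE f̄ (f̄ ∘F (act a ∷ []))) (conF (num 3) ⊗ (A a ⊕ B a ⊕ C a)) λ v _ →
                   ≤-trans (dsq-triangle _ (N * fa a $ (v ∷ [])) (N * fa (rev a) $ (act a $ (v ∷ []) ∷ [])) _) (*-mono (≤-refl {num 3}) ≤-refl))
                 (≤-reflexive (≈-trans (∑-⊗ n (num 3) (A a ⊕ B a ⊕ C a)) (*-cong ≈-refl (≈-trans (∑-⊕ n (A a ⊕ B a) (C a)) (+-cong (∑-⊕ n (A a) (B a)) ≈-refl))))))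
              (≤-reflexive (≈-trans (ΣW-* t (num 3) _) (*-cong ≈-refl (≈-trans (ΣW-+ t _ _) (≈-trans (+-cong (ΣW-+ t _ _) ≈-refl)
                (≈-trans (+-cong (+-cong A≈ B≈) C≈) (solve 2 (λ x y → (x :+ y) :+ x := (con 1 :+ con 1) :* x :+ y) ≈-refl X (NN * EI))))))))
              where
              A B C : Word → Fn 1
              A a = dsqE f̄ (conF N ⊗ fa a)
              B a = dsqE (conF N ⊗ fa a) (conF N ⊗ (fa (rev a) ∘F (act a ∷ [])))
              C a = dsqE (conF N ⊗ (fa (rev a) ∘F (act a ∷ []))) (f̄ ∘F (act a ∷ []))
              A≈ : ΣW t (λ a → ∑ n (A a)) ≈ X
              A≈ = ΣW-cong t λ a → ∑-cong n (A a) (dsqE (conF N ⊗ fa a) f̄) λ v _ → dsq-sym _ _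
              B≈ : ΣW t (λ a → ∑ n (B a)) ≈ NN * EI
              B≈ = ≈-trans (ΣW-cong t λ a → ≈-trans (∑-cong n (B a) (conF NN ⊗ dsqE (fa a) (fa (rev a) ∘F (act a ∷ []))) λ v _ → dsq-scale N _ _)
                     (∑-⊗ n NN (dsqE (fa a) (fa (rev a) ∘F (act a ∷ []))))) (ΣW-* t NN _)
              C≈ : ΣW t (λ a → ∑ n (C a)) ≈ X
              C≈ = ≈-trans (ΣW-cong t λ a → ≈-trans (∑-cong n (C a) (dsqE (conF N ⊗ fa (rev a)) f̄ ∘F (act a ∷ [])) λ v _ → ≈-refl)
                     (∑-act a (dsqE (conF N ⊗ fa (rev a)) f̄))) (ΣW-rev t (λ a → ∑ n (dsqE (conF N ⊗ fa a) f̄)))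

        abstract
          -- From `f̄` at `v` one passes to `N` times `f'` in a cell over `v`, across the edge
          -- between clouds, and from there to `f̄` at the end of the word. The outer passages are
          -- variances inside clouds, controlled by `poincare`; the middle one is an edge energy.
          -- The constant is 3 from `dsq-triangle` times 2 for the two outer passages.
          cloud-bound : d * EW t f̄ ≤ num 6 * (NN * G'.En f')
          cloud-bound = ≤-trans (*-mono (≤-refl {d}) EW≤) (≤-trans (≤-reflexive
              (solve 4 (λ d x n e → d :* ((con 0 :+ con 1 :+ con 1 :+ con 1) :* ((con 1 :+ con 1) :* x :+ n :* e)) := (con 0 :+ con 1 :+ con 1 :+ con 1) :* ((con 1 :+ con 1) :* (d :* x) :+ n :* (d :* e))) ≈-refl d X NN EI))
            (≤-trans (*-mono (≤-refl {num 3}) (+-mono (*-mono (≤-refl {2M}) dX) (≤-trans (≤+ (NN * (d * EI)) (NN * (d * EI))) (≤-reflexive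
                 (solve 1 (λ x → x :+ x := (con 1 :+ con 1) :* x) ≈-refl (NN * (d * EI)))))))
            (≤-trans (≤-reflexive (solve 3 (λ n h e → (con 0 :+ con 1 :+ con 1 :+ con 1) :* ((con 1 :+ con 1) :* (n :* h) :+ (con 1 :+ con 1) :* (n :* e))
                  := (con 0 :+ con 1 :+ con 1 :+ con 1 :+ con 1 :+ con 1 :+ con 1) :* (n :* (h :+ e))) ≈-refl NN (ΣB q H) (d * EI)))
              (*-mono (≤-refl {num 6}) (*-mono (≤-refl {NN}) HI≤)))))

    -- The spectral gap grows by a factor 4 when the power is t = 2 · 192.
    module Gain (q m : ℕ) (m≡ : suc m ≡ 24 ℕ.* 8) (g : Bits q → Bits ((suc m ℕ.+ suc m) ℕ.* suc (suc q)))
                (g-ok : ∀ α → isZero α ≡ false → two^ q ℕ.≤ 4 ℕ.* ones g α) where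
      open Cloud q (suc m ℕ.+ suc m) g g-ok
      private
        abstract
          c≈ : (num 4 * num 6) * num 8 ≈ num (suc m)
          c≈ = ≈-trans (*-cong (≈-sym (num-* 4 6)) ≈-refl) (≈-trans (≈-sym (num-* 24 8)) (≡⇒≈ (≡.cong num (≡.sym m≡))))
          8≈ : num 8 ≈ 2M * (2M * 2M)
          8≈ = solve 0 (con 0 :+ con 1 :+ con 1 :+ con 1 :+ con 1 :+ con 1 :+ con 1 :+ con 1 :+ con 1 := (con 1 :+ con 1) :* ((con 1 :+ con 1) :* (con 1 :+ con 1))) ≈-refl
          dbl : ∀ j → num (2^ (suc j)) ≈ 2M * num (2^ j)
          dbl j = ≈-trans (num-+ (2^ j) (2^ j)) (solve 1 (λ x → x :+ x := (con 1 :+ con 1) :* x) ≈-refl (num (2^ j)))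
          arrange : ∀ f s t d e → (f * (((t * (t * d)) * (t * (t * d))) * e)) * s ≈ d * ((((f * s) * (t * (t * t))) * (t * d)) * e)
          arrange = solve 5 (λ f s t d e → (f :* (((t :* (t :* d)) :* (t :* (t :* d))) :* e)) :* s := d :* ((((f :* s) :* (t :* (t :* t))) :* (t :* d)) :* e)) ≈-refl
      abstract
        -- `energy-gain` and `cloud-bound` combine to a bound with constant 6, and `D * D` is
        -- `8 * (d * ℓ)`, since `D = 4 * d` and `ℓ = 2 * d`. Thus `suc m = 4 * 6 * 8 = 192` is what
        -- leaves the factor 4.
        level-step : ∀ {n} {Gr : Graph (suc q) n} {Gr' : Graph (suc q) (n * N)} (ic : IsCloud Gr Gr') (f' : Fn 1) →
          let D = num (2^ (suc (suc q))) in
          num 4 * ((D * D) * GraphOps.En Gr (GraphOps.PW Gr m (Step.f̄ ic f'))) ≤ (N * N) * GraphOps.En Gr' f'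
        level-step {n} {Gr} {Gr'} ic f' = *-cancel-≤ (num 6) (num-< {0} {6} (ℕ.s≤s ℕ.z≤n)) (≤-trans (≤-reflexive
            (≈-trans (*-cong (*-cong ≈-refl (*-cong (*-cong D≈ D≈) ≈-refl)) ≈-refl)
             (≈-trans (arrange (num 4) (num 6) 2M d e)
               (*-cong ≈-refl (*-cong (*-cong (≈-trans (*-cong ≈-refl (≈-sym 8≈)) c≈) (≈-sym (dbl q))) ≈-refl)))))
          (≤-trans (*-mono (≤-refl {d}) (energy-gain m f̄)) (≤-trans cloud-bound (≤-reflexive (*-comm (num 6) _)))))
          where
          open Step ic f'
          open GraphOps Gr using (energy-gain; En; PW; ℓ)
          e : M
          e = En (PW m f̄)
          D≈ : num (2^ (suc (suc q))) ≈ 2M * (2M * d)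
          D≈ = ≈-trans (dbl (suc q)) (*-cong ≈-refl (dbl q))

  -- Division, finite tables, truncated runs and powers of two.

  module Toolkit where
    open Clouds public
    open import Data.List as List using (List; []; _∷_)
    open import Data.List.Membership.Propositional using (_∈_)
    open import Data.List.Membership.Propositional.Properties using (∈-++⁺ˡ; ∈-++⁺ʳ; ∈-map⁺)
    open import Data.List.Relation.Unary.Any using (here; there)
    open import Relation.Nullary using (yes; no)
    open import Relation.Binary.Definitions using (tri<; tri≈; tri>)

    ⋀B : ∀ {k} n → (Bits n → Pr k) → Pr k
    ⋀B zero    P = P []
    ⋀B (suc n) P = ⋀B n (λ x → P (false ∷ x)) ∧P ⋀B n (λ x → P (true ∷ x))

    ⋀I : ∀ {k} n (P : Bits n → Pr k) {x} → (∀ b → holds (P b) x) → holds (⋀B n P) x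
    ⋀I zero P h    = h []
    ⋀I (suc n) P h = ⋀I n _ (λ b → h _) , ⋀I n _ (λ b → h _)

    ⋀E : ∀ {k} n (P : Bits n → Pr k) {x} → holds (⋀B n P) x → ∀ b → holds (P b) x
    ⋀E zero P h []                = h
    ⋀E (suc n) P (h , _) (false ∷ b) = ⋀E n _ h b
    ⋀E (suc n) P (_ , h) (true ∷ b)  = ⋀E n _ h b

    module Div (C : M) (C>0 : 0M < C) where
      private
        R : Pr 2
        R = (x0 ⊗ conF C ≤P x1) ∧P (x1 <P (x0 ⊕ conF 1M) ⊗ conF C)
        abstract
          ex : ∀ x → Σ M λ y → y ≤ x0 $ x × holds R (y ∷ x)
          ex (x ∷ []) = indP (∃P x0 R) (0M , ≤-refl , ≤-reflexive (0* C) , <-resp ≈-refl (≈-sym (≈-trans (*-cong (0+ 1M) ≈-refl) (1* C))) C>0)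
            (λ x (y , p , a , b) → stableP (∃P x0 R) (x + 1M ∷ []) λ k → by-< stable-𝕆 (x + 1M) ((y + 1M) * C)
              (λ q → k (y , ≤-trans p (≤+ x 1M) , ≤-trans a (≤+ x 1M) , q))
              (λ q → k (y + 1M , +-mono p ≤-refl , q , ≤-<-trans (<⇒suc≤ b) (*-mono-< C C>0 (≤⇒<suc ≤-refl))))) x
          un : ∀ x y z → holds R (y ∷ x) → holds R (z ∷ x) → y ≈ z
          un (x ∷ []) y z (a , b) (c , d) = by-< stable-≈ y z
            (λ p → stable-≈ λ _ → ≤⇒≯ (≤-trans (*-mono (<⇒suc≤ p) ≤-refl) c) b)
            (λ p → by-< stable-≈ z y (λ p' → stable-≈ λ _ → ≤⇒≯ (≤-trans (*-mono (<⇒suc≤ p') ≤-refl) a) d) λ p' → ≤-antisym p' p)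
      abstract
        divF modF : Fn 1
        divF = search R x0 ex un
        modF = x0 ∸F (divF ⊗ conF C)

        div-of : ∀ {x} v a → a < C → x ≈ v * C + a → divF $ (x ∷ []) ≈ v
        div-of {x} v a p e = un (x ∷ []) _ v (proj₂ (proj₂ (ex (x ∷ [])))) (≤-resp ≈-refl (≈-sym e) (≤+ _ a) ,
          <-resp (≈-sym e) (≈-sym (suc* v C)) (suc≤⇒< (≤-trans (≤-reflexive (+-assoc _ a 1M)) (+-mono ≤-refl (<⇒suc≤ p)))))

        mod-of : ∀ {x} v a → a < C → x ≈ v * C + a → modF $ (x ∷ []) ≈ a
        mod-of {x} v a p e = ∸-of a (≈-trans (+-cong (*-cong (div-of v a p e) ≈-refl) ≈-refl) (≈-sym e))

        divmod : ∀ x → Σ M λ v → Σ M λ a → a < C × x ≈ v * C + a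
        divmod x = let y , _ , a , b = ex (x ∷ []) ; r , e = slack a in
          y , r , suc≤⇒< (+-cancel-≤ (y * C) (≤-trans (≤-reflexive (≈-trans (≈-sym (+-assoc _ r 1M)) (+-cong e ≈-refl))) (≤-trans (<⇒suc≤ b) (≤-reflexive (suc* y C)))))
          , ≈-sym e

    -- The quotient by 0 is 0.
    private
      quR : Pr 3
      quR = ((conF 0M <P x2) ⇒P ((x0 ⊗ x2 ≤P x1) ∧P (x1 <P (x0 ⊕ conF 1M) ⊗ x2))) ∧P ((x2 ≈P conF 0M) ⇒P (x0 ≈P conF 0M))
    abstract
      quo-ex : ∀ x → Σ M λ y → y ≤ x0 $ x × holds quR (y ∷ x)
      quo-ex (x ∷ c ∷ []) = stableP (∃P x0 quR) (x ∷ c ∷ []) λ k → by-em (c ≈ 0M) stable-𝕆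
        (λ e → k (0M , 0≤ _ , (λ p → stable-× stable-≤ stable-< λ _ → proj₂ p (≈-sym e)) , λ _ → ≈-refl))
        (λ n → let y , r , r< , e = Div.divmod c (≉0⇒> n) x in
          k (y , ≤-trans (≤-trans (≤-reflexive (≈-sym (*1 y))) (*-mono ≤-refl (≤-trans (≤-reflexive (≈-sym (0+ 1M))) (<⇒suc≤ (≉0⇒> n))))) (≤-trans (≤+ _ r) (≤-reflexive (≈-sym e)))
            , (λ _ → ≤-trans (≤+ _ r) (≤-reflexive (≈-sym e)) , <-resp (≈-sym e) (≈-sym (suc* y c)) (suc≤⇒< (≤-trans (≤-reflexive (+-assoc _ r 1M)) (+-mono ≤-refl (<⇒suc≤ r<)))))
            , λ z → stable-≈ λ _ → n z))

      quo-un : ∀ x y z → holds quR (y ∷ x) → holds quR (z ∷ x) → y ≈ z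
      quo-un (x ∷ c ∷ []) y z (a , b) (a' , b') = by-em (c ≈ 0M) stable-≈ (λ e → ≈-trans (b e) (≈-sym (b' e))) λ n →
        let p , p' = a (≉0⇒> n) ; r , r' = a' (≉0⇒> n) in by-< stable-≈ y z
          (λ l → stable-≈ λ _ → ≤⇒≯ (≤-trans (*-mono (<⇒suc≤ l) ≤-refl) r) p')
          (λ l → by-< stable-≈ z y (λ l' → stable-≈ λ _ → ≤⇒≯ (≤-trans (*-mono (<⇒suc≤ l') ≤-refl) p) r') λ l' → ≤-antisym l' l)

      quoF : Fn 2
      quoF = search quR x0 quo-ex quo-un

      quo-of : ∀ {x c} v → 0M < c → v * c ≤ x → x < (v + 1M) * c → quoF $ (x ∷ c ∷ []) ≈ v
      quo-of {x} {c} v c>0 p q = quo-un (x ∷ c ∷ []) _ v (proj₂ (proj₂ (quo-ex (x ∷ c ∷ [])))) ((λ _ → p , q) , λ z → stable-≈ λ _ → proj₂ c>0 (≈-sym z))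

      quo-spec : ∀ x {c} → 0M < c → quoF $ (x ∷ c ∷ []) * c ≤ x × x < (quoF $ (x ∷ c ∷ []) + 1M) * c
      quo-spec x {c} c>0 = proj₁ (proj₂ (proj₂ (quo-ex (x ∷ c ∷ [])))) c>0

    abstract
      num-inj : ∀ {m n} → num m ≈ num n → ¬ₒ ¬ₒ (m ≡ n)
      num-inj {m} {n} e k with m ℕ.≟ n
      ... | yes p = k p
      ... | no p with ℕ.<-cmp m n
      ...   | tri< l _ _ = proj₂ (num-< l) e
      ...   | tri≈ _ q _ = k q
      ...   | tri> _ _ l = proj₂ (num-< l) (≈-sym e)

      bits-of : ∀ k {x} → x < num (2^ k) → ¬ₒ ¬ₒ (Σ (Bits k) λ a → x ≈ num (bval a))
      bits-of zero {x} p h = h ([] , ≤0 (<suc⇒≤ (<-resp ≈-refl ≈-refl p)))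
      bits-of (suc k) {x} p h = by-< stable-𝕆 x (num (2^ k))
        (λ q → bits-of k q λ (a , e) → h (false ∷ a , e))
        (λ q → let d , e = slack q in bits-of k (suc≤⇒< (+-cancel-≤ (num (2^ k)) (≤-trans (≤-reflexive (≈-trans (≈-sym (+-assoc _ d 1M)) (+-cong e ≈-refl)))
            (≤-trans (<⇒suc≤ p) (≤-reflexive (num-+ (2^ k) (2^ k)))))))
          λ (a , e') → h (true ∷ a , ≈-trans (≈-sym e) (≈-trans (+-cong ≈-refl e') (≈-sym (num-+ (2^ k) (bval a))))))

    module _ {Z : Set} (key : Z → M) where
      tabF : ∀ {k} → List Z → (Z → Fn k) → Fn (suc k)
      tabF [] f       = conF 0M
      tabF (z ∷ zs) f = ite (x0 ≈P conF (key z)) (weakF (f z)) (tabF zs f)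

      abstract
        weakF-ok : ∀ {k} (f : Fn k) y x → weakF f $ (y ∷ x) ≈ f $ x
        weakF-ok {k} f y x = congF f λ i → ≡⇒≈ (≡.trans (lookup-map i _ (Data.Vec.tabulate (λ i → varF (suc i)))) (≡.cong (λ h → fun h (y ∷ x)) (lookup∘tabulate _ i)))
          where
          import Data.Vec
          open import Data.Vec.Properties using (lookup-map; lookup∘tabulate)

        -- Keys that agree in the model belong to equal entries only up to double negation.
        -- Therefore the entries are required to respect equality of keys, and no injectivity is
        -- assumed.
        tab-ok : ∀ {k} (zs : List Z) (f : Z → Fn k) x → (∀ z z' → key z ≈ key z' → f z $ x ≈ f z' $ x) →
          ∀ {z y} → z ∈ zs → y ≈ key z → tabF zs f $ (y ∷ x) ≈ f z $ x
        tab-ok (z' ∷ zs) f x un {z} {y} m e = by-em (y ≈ key z') stable-≈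
          (λ p → ≈-trans (ite-yes (x0 ≈P conF (key z')) (weakF (f z')) (tabF zs f) p) (≈-trans (weakF-ok (f z') y x) (un z' z (≈-trans (≈-sym p) e))))
          (λ n → ≈-trans (ite-no (x0 ≈P conF (key z')) (weakF (f z')) (tabF zs f) n) (rest m n))
          where
          rest : z ∈ (z' ∷ zs) → (¬ₒ (y ≈ key z')) → tabF zs f $ (y ∷ x) ≈ f z $ x
          rest (here ≡.refl) n = stable-≈ λ _ → n e
          rest (there q) n = tab-ok zs f x un q e

      abstract
        tab-range : (val : Z → M) (zs : List Z) (y : M) →
          ¬ₒ ¬ₒ ((tabF zs (λ z → conF (val z)) $ (y ∷ []) ≈ 0M) ⊎ Σ Z λ z → tabF zs (λ z → conF (val z)) $ (y ∷ []) ≈ val z)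
        tab-range val [] y k = k (inj₁ ≈-refl)
        tab-range val (z ∷ zs) y k = by-em (y ≈ key z) stable-𝕆
          (λ e → k (inj₂ (z , ite-yes (x0 ≈P conF (key z)) (weakF (conF (val z))) (tabF zs (λ z → conF (val z))) e)))
          (λ n → let e = ite-no (x0 ≈P conF (key z)) (weakF (conF (val z))) (tabF zs (λ z → conF (val z))) n in
            tab-range val zs y λ { (inj₁ h) → k (inj₁ (≈-trans e h)) ; (inj₂ (z' , h)) → k (inj₂ (z' , ≈-trans e h)) })

    allBits : ∀ n → List (Bits n)
    allBits zero    = [] ∷ []
    allBits (suc n) = List.map (false ∷_) (allBits n) List.++ List.map (true ∷_) (allBits n)

    allWords : ∀ l j → List (Vec (Bits l) j)
    allWords l zero    = [] ∷ []
    allWords l (suc j) = List.concatMap (λ e → List.map (e ∷_) (allWords l j)) (allBits l)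

    abstract
      ∈-allBits : ∀ {n} (b : Bits n) → b ∈ allBits n
      ∈-allBits [] = here ≡.refl
      ∈-allBits (false ∷ b) = ∈-++⁺ˡ (∈-map⁺ (false ∷_) (∈-allBits b))
      ∈-allBits {suc n} (true ∷ b) = ∈-++⁺ʳ (List.map (false ∷_) (allBits n)) (∈-map⁺ (true ∷_) (∈-allBits b))

      ∈-allWords : ∀ {l j} (w : Vec (Bits l) j) → w ∈ allWords l j
      ∈-allWords [] = here ≡.refl
      ∈-allWords {l} {suc j} (e ∷ w) = Memₚ.∈-concatMap⁺ (λ e → List.map (e ∷_) (allWords l j)) (Anyₚ.lose (∈-allBits e) (∈-map⁺ (e ∷_) (∈-allWords w)))
        where
        import Data.List.Membership.Propositional.Properties as Memₚ
        import Data.List.Membership.Propositional as Anyₚ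

    powF : ∀ {k} → Fn k → ℕ → Fn k
    powF f zero    = conF 1M
    powF f (suc n) = f ⊗ powF f n

    abstract
      powF-ok : ∀ {k} (f : Fn k) n x → powF f n $ x ≈ pow (f $ x) n
      powF-ok f zero x = ≈-refl
      powF-ok f (suc n) x = *-cong ≈-refl (powF-ok f n x)

      pow-cong : ∀ n {x y} → x ≈ y → pow x n ≈ pow y n
      pow-cong zero e = ≈-refl
      pow-cong (suc n) e = *-cong e (pow-cong n e)

      pow-mono : ∀ n {x y} → x ≤ y → pow x n ≤ pow y n
      pow-mono zero e = ≤-refl
      pow-mono (suc n) e = *-mono e (pow-mono n e)

      pow-2* : ∀ n x → pow (x + x) n ≈ pow x n * num (2^ n)
      pow-2* zero x = ≈-sym (≈-trans (*-cong ≈-refl (0+ 1M)) (*1 1M))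
      pow-2* (suc n) x = ≈-trans (*-cong ≈-refl (pow-2* n x)) (≈-trans
        (solve 3 (λ x p m → (x :+ x) :* (p :* m) := (x :* p) :* (m :+ m)) ≈-refl x (pow x n) (num (2^ n))) (*-cong ≈-refl (≈-sym (num-+ (2^ n) (2^ n)))))

      pow-1 : ∀ n → pow 1M n ≈ 1M
      pow-1 zero = ≈-refl
      pow-1 (suc n) = ≈-trans (1* _) (pow-1 n)

      pow-+ : ∀ m n x → pow x (m ℕ.+ n) ≈ pow x m * pow x n
      pow-+ zero n x = ≈-sym (1* _)
      pow-+ (suc m) n x = ≈-trans (*-cong ≈-refl (pow-+ m n x)) (≈-sym (*-assoc _ _ _))

      pow-pos : ∀ n {x} → 0M < x → 0M < pow x n
      pow-pos zero p = <-resp ≈-refl (0+ 1M) (0<suc 0M)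
      pow-pos (suc n) p = *-pos p (pow-pos n p)

    -- A step that would exceed `C` is replaced by standing still, so any `g` can be iterated;
    -- `runS` recovers the true step once its result is known to be at most `C`.
    module Trunc (s g : Fn 1) (C : M) where
      private
        tr : Fn 1
        tr = ite (g ≤P conF C) g x0
        abstract
          tr≤ : ∀ {b} y → y ≤ b + C → tr $ (y ∷ []) ≤ b + C
          tr≤ y h = by-em (g $ (y ∷ []) ≤ C) stable-≤ (λ p → ≤-trans (≤-reflexive (ite-yes (g ≤P conF C) g x0 p)) (≤-trans p (≤+ʳ _ _)))
            (λ n → ≤-trans (≤-reflexive (ite-no (g ≤P conF C) g x0 n)) h)
        start≤ : ∀ b p → p ≤ b → s $ (p ∷ []) ≤ bnd s b + C
        start≤ b p q = ≤-trans (bnd-ok s b (p ∷ []) (λ { zero → q })) (≤+ _ _)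
        open Iter s (tr ∘F (x2 ∷ [])) (λ b → 𝕔 (bnd s b + C)) start≤
          (λ b p i y _ _ h → tr≤ {bnd s b} y h)
      abstract
        runF : Fn 2
        runF = itF

        run0 : ∀ p → runF $ (p ∷ 0M ∷ []) ≈ s $ (p ∷ [])
        run0 = it0

        runS : ∀ p i {y z} → runF $ (p ∷ i ∷ []) ≈ y → g $ (y ∷ []) ≈ z → z ≤ C → runF $ (p ∷ i + 1M ∷ []) ≈ z
        runS p i {y} {z} e e' q = ≈-trans (itS p i) (≈-trans (cong1 tr e) (≈-trans (ite-yes (g ≤P conF C) g x0 (≤-resp (≈-sym e') ≈-refl q)) e'))

        run-or : ∀ p i → ¬ₒ ¬ₒ ((runF $ (p ∷ i + 1M ∷ []) ≈ runF $ (p ∷ i ∷ [])) ⊎ (runF $ (p ∷ i + 1M ∷ []) ≈ g $ (runF $ (p ∷ i ∷ []) ∷ [])))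
        run-or p i k = by-em (g $ (runF $ (p ∷ i ∷ []) ∷ []) ≤ C) stable-𝕆 (λ h → k (inj₂ (≈-trans (itS p i) (ite-yes (g ≤P conF C) g x0 h))))
          (λ h → k (inj₁ (≈-trans (itS p i) (ite-no (g ≤P conF C) g x0 h))))

        runS-cong : ∀ p p' i i' → runF $ (p ∷ i ∷ []) ≈ runF $ (p' ∷ i' ∷ []) → runF $ (p ∷ i + 1M ∷ []) ≈ runF $ (p' ∷ i' + 1M ∷ [])
        runS-cong p p' i i' e = ≈-trans (itS p i) (≈-trans (cong1 tr e) (≈-sym (itS p' i')))

    -- Powers of two up to the first one that is at least C.
    module Pow2 (C : M) where
      private
        g : Fn 1
        g = ite (x0 <P conF C) (x0 ⊕ x0) x0
        module T = Trunc (conF 1M) g (C + C + 1M)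
      abstract
        twoF : Fn 1
        twoF = T.runF ∘F (conF 0M ∷ x0 ∷ [])

      two : M → M
      two i = twoF $ (i ∷ [])

      private
        abstract
          two0′ : two 0M ≈ 1M
          two0′ = T.run0 0M
          -- No logarithm is given in advance. As long as the doubling is below `C` it satisfies
          -- `i + 1M ≤ two i`, so `C` is reached no later than `i = C` and a least exponent exists.
          inv : ∀ i → two i ≤ C + C + 1M × 1M ≤ two i × (¬ₒ ¬ₒ (i + 1M ≤ two i ⊎ C ≤ two i))
            × (two i < C → two (i + 1M) ≈ two i + two i)
          inv i = let a , b , c = indP ((twoF ≤P conF (C + C + 1M)) ∧P (conF 1M ≤P twoF) ∧P ((¬P (x0 ⊕ conF 1M ≤P twoF)) ⇒P (conF C ≤P twoF)))
                        (≤-trans (≤-reflexive two0′) (≤+ʳ _ _) , ≤-reflexive (≈-sym two0′) , λ n → stable-≤ λ _ → n (≤-reflexive (≈-trans (0+ 1M) (≈-sym two0′))))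
                        step i
                  in a , b , (λ k → by-em (i + 1M ≤ two i) stable-𝕆 (λ p → k (inj₁ p)) (λ n → k (inj₂ (c n)))) , λ p → dbl i p
            where
            dbl : ∀ i → two i < C → two (i + 1M) ≈ two i + two i
            dbl i p = T.runS 0M i ≈-refl (ite-yes (x0 <P conF C) (x0 ⊕ x0) x0 p) (≤-trans (+-mono (proj₁ p) (proj₁ p)) (≤+ _ _))
            step : ∀ i → (two i ≤ C + C + 1M × 1M ≤ two i × ((¬ₒ (i + 1M ≤ two i)) → C ≤ two i)) →
              (two (i + 1M) ≤ C + C + 1M × 1M ≤ two (i + 1M) × ((¬ₒ (i + 1M + 1M ≤ two (i + 1M))) → C ≤ two (i + 1M)))
            step i (a , b , c) = by-< (stable-× stable-≤ (stable-× stable-≤ (stable-→ stable-≤))) (two i) C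
              (λ p → let e = dbl i p in ≤-trans (≤-reflexive e) (≤-trans (+-mono (proj₁ p) (proj₁ p)) (≤+ _ _)) , ≤-trans b (≤-trans (≤+ _ _) (≤-reflexive (≈-sym e)))
                 , λ n → stable-≤ λ _ → n (by-em (i + 1M ≤ two i) stable-≤ (λ q → ≤-trans (+-mono q b) (≤-reflexive (≈-sym e))) λ n' → stable-≤ λ _ → ≤⇒≯ (c n') p))
              (λ p → let e = T.runS 0M i {z = two i} ≈-refl (ite-no (x0 <P conF C) (x0 ⊕ x0) x0 (≤⇒≯ p)) a in
                 ≤-trans (≤-reflexive e) a , ≤-trans b (≤-reflexive (≈-sym e)) , λ _ → ≤-trans p (≤-reflexive (≈-sym e)))
      private
        kk : Σ M λ y → y ≤ C × C ≤ two y × (∀ z → z < y → ¬ₒ (C ≤ two z))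
        kk = least (conF C ≤P twoF) C (by-or stable-≤ (proj₁ (proj₂ (proj₂ (inv C)))) (λ p → ≤-trans (≤+ C 1M) p) id)
      abstract
        K : M
        K = proj₁ kk
        two0 : two 0M ≈ 1M
        two0 = two0′
        two≥1 : ∀ i → 1M ≤ two i
        two≥1 i = proj₁ (proj₂ (inv i))
        twoS : ∀ i → i < K → two (i + 1M) ≈ two i + two i
        twoS i p = proj₂ (proj₂ (proj₂ (inv i))) (≰⇒> (proj₂ (proj₂ (proj₂ kk)) i p))
        twoK : C ≤ two K
        twoK = proj₁ (proj₂ (proj₂ kk))
        two≤ : ∀ i j → i + j ≤ K → two i ≤ two (i + j)
        two≤ i = indP ((conF i ⊕ x0 ≤P conF K) ⇒P (conF (two i) ≤P twoF ∘F (conF i ⊕ x0 ∷ [])))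
          (λ _ → ≤-reflexive (cong1 twoF (≈-sym (+0 i))))
          (λ j ih p → let q = ≤-trans (≤-reflexive (≈-sym (+suc i j))) p in ≤-trans (ih (proj₁ (suc≤⇒< q))) (≤-trans (≤+ _ _)
             (≤-reflexive (≈-sym (≈-trans (cong1 twoF (+suc i j)) (twoS (i + j) (suc≤⇒< q)))))))

  -- The stack machine and its single steps.

  module Machine where
    open Toolkit public
    open Generators
    open Numbering using (⟨_,_⟩; ⟨⟩-inj)
    open import Data.Vec using (concat; replicate; toList; take; drop)
    open import Data.Vec.Properties using (++-injective)
    open import Data.Nat.ListAction using (sum)
    open import Data.List as List using (List; []; _∷_)
    open import Data.List.Membership.Propositional using (_∈_; lose)
    open import Data.List.Membership.Propositional.Properties using (∈-map⁺; ∈-concatMap⁺; ∈-cartesianProduct⁺)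
    open import Data.List.Relation.Unary.Any using (here; there)

    -- States of the stack machine that walks in the iterated cloud graphs: S j c x s a is at level j
    -- and vertex x with stack s and remaining address a; c is 0, or the code of a label to be followed.
    S⟨_,_,_,_,_⟩ : M → M → M → M → M → M
    S⟨ j , c , x , s , a ⟩ = pr j (pr c (pr x (pr s a)))

    SF : ∀ {k} → Fn k → Fn k → Fn k → Fn k → Fn k → Fn k
    SF j c x s a = prF j (prF c (prF x (prF s a)))

    jF cF xF sF aF : Fn 1
    jF = fstF
    cF = fstF ∘F (sndF ∷ [])
    xF = fstF ∘F (sndF ∘F (sndF ∷ []) ∷ [])
    sF = fstF ∘F (sndF ∘F (sndF ∘F (sndF ∷ []) ∷ []) ∷ [])
    aF = sndF ∘F (sndF ∘F (sndF ∘F (sndF ∷ []) ∷ []) ∷ [])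

    abstract
      S-cong : ∀ {j j' c c' x x' s s' a a'} → j ≈ j' → c ≈ c' → x ≈ x' → s ≈ s' → a ≈ a' →
        S⟨ j , c , x , s , a ⟩ ≈ S⟨ j' , c' , x' , s' , a' ⟩
      S-cong p q r t u = pr-cong p (pr-cong q (pr-cong r (pr-cong t u)))

      S-mono : ∀ {j j' c c' x x' s s' a a'} → j ≤ j' → c ≤ c' → x ≤ x' → s ≤ s' → a ≤ a' →
        S⟨ j , c , x , s , a ⟩ ≤ S⟨ j' , c' , x' , s' , a' ⟩
      S-mono p q r t u = pr-mono p (pr-mono q (pr-mono r (pr-mono t u)))

      S-dec : ∀ {p j c x s a} → p ≈ S⟨ j , c , x , s , a ⟩ →
        (jF $ (p ∷ []) ≈ j) × (cF $ (p ∷ []) ≈ c) × (xF $ (p ∷ []) ≈ x) × (sF $ (p ∷ []) ≈ s) × (aF $ (p ∷ []) ≈ a)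
      S-dec {p} {j} {c} {x} {s} {a} e = let e1 = snd-pr j _ e ; e2 = snd-pr c _ e1 ; e3 = snd-pr x _ e2 in
        fst-pr j _ e , fst-pr c _ e1 , fst-pr x _ e2 , fst-pr s a e3 , snd-pr s a e3

    module Mach (q t r : ℕ) (g : Bits q → Bits (t ℕ.* suc (suc q)))
                (g-ok : ∀ α → isZero α ≡ false → two^ q ℕ.≤ 4 ℕ.* ones g α)
                (n₀ : M) (Gr₀ : Graph (suc q) n₀) (K : M) where
      open Cloud q t g g-ok public
      open Graph Gr₀ using () renaming (π to π₀)

      L : ℕ
      L = suc (suc q)

      -- One digit of an address: `r` labels to be followed on the current level, then a word of `t`
      -- labels that selects the cell of the cloud entered above.
      Addr : Set
      Addr = Vec (Bits L) (r ℕ.+ t)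

      -- The labels still to be followed on the lower level, and the cloud vertex that is attached
      -- when the frame returns.
      Frame : Set
      Frame = List (Bits L) × Word

      lab : Bits L → M
      lab e = num (suc (bval e))

      lcode : List (Bits L) → ℕ
      lcode []      = 0
      lcode (e ∷ w) = suc ⟨ bval e , lcode w ⟩

      -- The code of a frame is a digit in base `Q` of the stack. It is positive even for an
      -- exhausted frame, so the stack 0 is the empty one.
      fcode : Frame → ℕ
      fcode (w , a) = suc ⟨ lcode w , bval (concat a) ⟩

      fkey : Frame → M
      fkey f = num (fcode f)

      ucode : Addr → M
      ucode u = num (bval (concat u))

      -- A label that stays over the same vertex follows a word of loops, so that all calls from one
      -- level take equally long.
      word : Bits L → Word → Word
      word (false ∷ true ∷ _) a = a
      word _                  a = replicate t (replicate L true)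

      -- After a walk the word is reversed: following it once more leads back, which makes the label
      -- an involution.
      dig : Bits L → Word → Word
      dig (false ∷ false ∷ j) a = gen j a
      dig (false ∷ true ∷ j)  a = rev a
      dig (true ∷ _)          a = a

      frame : Bits L × Word → Frame
      frame (e , a) = toList (word e a) , dig e a

      uframe : Addr → Frame
      uframe u = toList (take r u) , drop r u

      lists : ℕ → List (List (Bits L))
      lists zero    = [] ∷ []
      lists (suc n) = [] ∷ List.concatMap (λ e → List.map (e ∷_) (lists n)) (allBits L)

      frames : List Frame
      frames = List.cartesianProduct (lists (r ℕ.+ t)) (allWords L t)

      -- The sum of all frame codes bounds each of them. The base `Q` is a power of two, so its
      -- powers up to `K` are fixed powers of `two`.
      Q₀ : ℕ
      Q₀ = sum (List.map fcode frames)

      Q R : M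
      Q = num (2^ Q₀)
      R = num (2^ ((r ℕ.+ t) ℕ.* L))

      abstract
        lists-∈ : ∀ n w → List.length w ℕ.≤ n → w ∈ lists n
        lists-∈ zero [] p = here ≡.refl
        lists-∈ (suc n) [] p = here ≡.refl
        lists-∈ (suc n) (e ∷ w) (ℕ.s≤s p) = there (∈-concatMap⁺ (λ e → List.map (e ∷_) (lists n)) (lose (∈-allBits e) (∈-map⁺ (e ∷_) (lists-∈ n w p))))

        frames-∈ : ∀ w a → List.length w ℕ.≤ r ℕ.+ t → (w , a) ∈ frames
        frames-∈ w a p = ∈-cartesianProduct⁺ (lists-∈ _ w p) (∈-allWords a)

        n<2^n : ∀ n → n ℕ.< two^ n
        n<2^n zero = ℕ.s≤s ℕ.z≤n
        n<2^n (suc n) = ℕ.+-mono-≤-< (ℕ.≤-trans (ℕ.s≤s ℕ.z≤n) (n<2^n n)) (n<2^n n)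

        sum-∈ : ∀ (fs : List Frame) {f} → f ∈ fs → fcode f ℕ.≤ sum (List.map fcode fs)
        sum-∈ (f ∷ fs) (here ≡.refl) = ℕ.m≤m+n _ _
        sum-∈ (f ∷ fs) (there p) = ℕ.≤-trans (sum-∈ fs p) (ℕ.m≤n+m _ _)

        fkey<Q : ∀ {f} → f ∈ frames → fkey f < Q
        fkey<Q p = num-< (ℕ.≤-<-trans (sum-∈ frames p) (n<2^n Q₀))

        num>0 : ∀ k → 0M < num (2^ k)
        num>0 k = ≤-<-trans (0≤ _) (num-< (n<2^n k))

        code#<N : ∀ a → code# a < N
        code#<N a = num-< (bval< (concat a))

        ucode<R : ∀ u → ucode u < R
        ucode<R u = num-< (bval< (concat u))

        concat-inj : ∀ {n l} (a b : Vec (Bits l) n) → concat a ≡ concat b → a ≡ b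
        concat-inj [] [] e = ≡.refl
        concat-inj (x ∷ a) (y ∷ b) e with ++-injective x y e
        ... | ≡.refl , e' = ≡.cong (x ∷_) (concat-inj a b e')

        lab-inj : ∀ {e e'} → lab e ≈ lab e' → ¬ₒ ¬ₒ (e ≡ e')
        lab-inj {e} {e'} p k = num-inj {suc (bval e)} {suc (bval e')} p λ h → k (bval-inj e e' (ℕ.suc-injective h))

        code#-inj : ∀ {a b} → code# a ≈ code# b → ¬ₒ ¬ₒ (a ≡ b)
        code#-inj {a} {b} p k = num-inj {bval (concat a)} {bval (concat b)} p λ h → k (concat-inj a b (bval-inj _ _ h))

        ucode-inj : ∀ {a b} → ucode a ≈ ucode b → ¬ₒ ¬ₒ (a ≡ b)
        ucode-inj {a} {b} p k = num-inj {bval (concat a)} {bval (concat b)} p λ h → k (concat-inj a b (bval-inj _ _ h))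

        lcode-inj : ∀ w w' → lcode w ≡ lcode w' → w ≡ w'
        lcode-inj [] [] e = ≡.refl
        lcode-inj (a ∷ w) (b ∷ w') e with ⟨⟩-inj (bval a) (lcode w) (bval b) (lcode w') (ℕ.suc-injective e)
        ... | p , p' = ≡.cong₂ _∷_ (bval-inj a b p) (lcode-inj w w' p')

        fkey-inj : ∀ {f f'} → fkey f ≈ fkey f' → ¬ₒ ¬ₒ (f ≡ f')
        fkey-inj {w , a} {w' , a'} p k = num-inj {fcode (w , a)} {fcode (w' , a')} p λ h →
          let e1 , e2 = ⟨⟩-inj (lcode w) (bval (concat a)) (lcode w') (bval (concat a')) (ℕ.suc-injective h) in
          k (≡.cong₂ _,_ (lcode-inj w w' e1) (concat-inj a a' (bval-inj _ _ e2)))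

        lab≉0 : ∀ e → ¬ₒ (lab e ≈ 0M)
        lab≉0 e = suc≉0 _

      hd : Frame → M
      hd (e ∷ w , a) = lab e
      hd ([] , a)    = 0M

      tlk : Frame → M
      tlk (e ∷ w , a) = fkey (w , a)
      tlk ([] , a)    = 0M

      dg : Frame → M
      dg (w , a) = code# a

      private
        module DN = Div N (num>0 k)
        module DQ = Div Q (num>0 Q₀)
        module DR = Div R (num>0 ((r ℕ.+ t) ℕ.* L))
        ckey : Bits L × Word → M
        ckey (e , a) = pr (lab e) (code# a)
        calls : List (Bits L × Word)
        calls = List.cartesianProduct (allBits L) (allWords L t)
        callT hdT tlT dgT addrT : Fn 1
        callT = tabF ckey calls (λ z → conF (fkey (frame z)))
        hdT   = tabF fkey frames (λ f → conF (hd f))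
        tlT   = tabF fkey frames (λ f → conF (tlk f))
        dgT   = tabF fkey frames (λ f → conF (dg f))
        addrT = tabF ucode (allWords L (r ℕ.+ t)) (λ u → conF (fkey (uframe u)))
        baseT : Fn 2
        baseT = tabF lab (allBits L) π₀
        resp : ∀ {Z : Set} (key : Z → M) (val : Z → M) → (∀ {z z'} → key z ≈ key z' → ¬ₒ ¬ₒ (z ≡ z')) →
          ∀ z z' → key z ≈ key z' → val z ≈ val z'
        resp key val inj z z' e = stable-≈ λ k → inj e λ h → k (≡⇒≈ (≡.cong val h))
        abstract
          call-ok : ∀ e a {y} → y ≈ pr (lab e) (code# a) → callT $ (y ∷ []) ≈ fkey (frame (e , a))
          call-ok e a h = tab-ok ckey calls (λ z → conF (fkey (frame z))) [] (resp ckey (fkey ∘ frame) inj)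
              (∈-cartesianProduct⁺ (∈-allBits e) (∈-allWords a)) h
            where
            inj : ∀ {z z'} → ckey z ≈ ckey z' → ¬ₒ ¬ₒ (z ≡ z')
            inj {e , a} {e' , a'} p k = let p1 , p2 = pr-inj p in lab-inj p1 λ h1 → code#-inj p2 λ h2 → k (≡.cong₂ _,_ h1 h2)
          fr-ok : ∀ (val : Frame → M) {f y} → f ∈ frames → y ≈ fkey f → tabF fkey frames (λ f → conF (val f)) $ (y ∷ []) ≈ val f
          fr-ok val p h = tab-ok fkey frames (λ f → conF (val f)) [] (resp fkey val (λ {z} {z'} → fkey-inj {z} {z'})) p h
          addr-ok : ∀ u {y} → y ≈ ucode u → addrT $ (y ∷ []) ≈ fkey (uframe u)
          addr-ok u h = tab-ok ucode (allWords L (r ℕ.+ t)) (λ u → conF (fkey (uframe u))) [] (resp ucode (fkey ∘ uframe) (λ {z} {z'} → ucode-inj {z} {z'})) (∈-allWords u) h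
          base-ok : ∀ e {y} x → y ≈ lab e → baseT $ (y ∷ x ∷ []) ≈ π₀ e $ (x ∷ [])
          base-ok e x h = tab-ok lab (allBits L) π₀ (x ∷ []) (resp lab (λ e → π₀ e $ (x ∷ [])) (λ {z} {z'} → lab-inj {z} {z'})) (∈-allBits e) h

        frF restF : Fn 1
        frF   = DQ.modF ∘F (sF ∷ [])
        restF = DQ.divF ∘F (sF ∷ [])
        -- `A1` crosses an edge of the base graph, `A2` calls the level below, `A3a` takes the next
        -- label of the top frame, `A3b` returns from an exhausted frame to the level above, and
        -- `A4` loads the next digit of the address.
        A1 A2 A3a A3b A4 D0 D1 D2 D3 D4 : Fn 1
        A1  = SF (conF 0M) (conF 0M) (baseT ∘F (cF ∷ xF ∷ [])) sF aF
        A2  = SF (jF ∸F conF 1M) (conF 0M) (DN.divF ∘F (xF ∷ [])) (sF ⊗ conF Q ⊕ callT ∘F (prF cF (DN.modF ∘F (xF ∷ [])) ∷ [])) aF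
        A3a = SF jF (hdT ∘F (frF ∷ [])) xF (restF ⊗ conF Q ⊕ tlT ∘F (frF ∷ [])) aF
        A3b = SF (jF ⊕ conF 1M) (conF 0M) (xF ⊗ conF N ⊕ dgT ∘F (frF ∷ [])) restF aF
        A4  = SF jF (conF 0M) xF (addrT ∘F (DR.modF ∘F (aF ∷ []) ∷ [])) (DR.divF ∘F (aF ∷ []))
        c=0 s=0 j=0 h=0 j<K : Pr 1
        c=0 = cF ≈P conF 0M
        s=0 = sF ≈P conF 0M
        j=0 = jF ≈P conF 0M
        j<K = jF <P conF K
        h=0 = hdT ∘F (frF ∷ []) ≈P conF 0M
        D0 = ite j=0 A1 A2
        D1 = ite j<K A4 x0
        D4 = ite j<K A3b x0
        D2 = ite h=0 D4 A3a
        D3 = ite s=0 D1 D2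

      abstract
        stepF : Fn 1
        stepF = ite c=0 D3 D0

        step-base : ∀ e {p x s a} → p ≈ S⟨ 0M , lab e , x , s , a ⟩ → stepF $ (p ∷ []) ≈ S⟨ 0M , 0M , π₀ e $ (x ∷ []) , s , a ⟩
        step-base e {p} {x} {s} {a} h = let ej , ec , ex , es , ea = S-dec h in
          ≈-trans (ite-no c=0 D3 D0 λ z → lab≉0 e (≈-trans (≈-sym ec) z)) (≈-trans (ite-yes j=0 A1 A2 ej)
            (S-cong ≈-refl ≈-refl (≈-trans (cong2 baseT ec ex) (base-ok e x ≈-refl)) es ea))

        step-call : ∀ e b {p j v s a} → p ≈ S⟨ j + 1M , lab e , v * N + code# b , s , a ⟩ →
          stepF $ (p ∷ []) ≈ S⟨ j , 0M , v , s * Q + fkey (frame (e , b)) , a ⟩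
        step-call e b {p} {j} {v} {s} {a} h = let ej , ec , ex , es , ea = S-dec h in
          ≈-trans (ite-no c=0 D3 D0 λ z → lab≉0 e (≈-trans (≈-sym ec) z)) (≈-trans (ite-no j=0 A1 A2 λ z → suc≉0 j (≈-trans (≈-sym ej) z))
            (S-cong (∸-of j (≈-trans (+-comm 1M j) (≈-sym ej))) ≈-refl (DN.div-of v _ (code#<N b) ex)
              (+-cong (*-cong es ≈-refl) (call-ok e b (pr-cong ec (DN.mod-of v _ (code#<N b) ex)))) ea))

        private
          stack≉0 : ∀ f s → ¬ₒ (s * Q + fkey f ≈ 0M)
          stack≉0 f s z = suc≉0 (num ⟨ lcode (proj₁ f) , bval (concat (proj₂ f)) ⟩) (≤0 (≤-trans (≤+ʳ (s * Q) (fkey f)) (≤-reflexive z)))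

        step-next : ∀ e w b {p j x s a} → (e ∷ w , b) ∈ frames → p ≈ S⟨ j , 0M , x , s * Q + fkey (e ∷ w , b) , a ⟩ →
          stepF $ (p ∷ []) ≈ S⟨ j , lab e , x , s * Q + fkey (w , b) , a ⟩
        step-next e w b {p} {j} {x} {s} {a} m h = let ej , ec , ex , es , ea = S-dec h
                                                      ef = DQ.mod-of s _ (fkey<Q m) es ; er = DQ.div-of s _ (fkey<Q m) es in
          ≈-trans (ite-yes c=0 D3 D0 ec) (≈-trans (ite-no s=0 D1 D2 λ z → stack≉0 (e ∷ w , b) s (≈-trans (≈-sym es) z))
            (≈-trans (ite-no h=0 D4 A3a λ z → lab≉0 e (≈-trans (≈-sym (fr-ok hd m ef)) z))
              (S-cong ej (fr-ok hd m ef) ex (+-cong (*-cong er ≈-refl) (fr-ok tlk m ef)) ea)))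

        step-pop : ∀ b {p j x s a} → j < K → ([] , b) ∈ frames → p ≈ S⟨ j , 0M , x , s * Q + fkey ([] , b) , a ⟩ →
          stepF $ (p ∷ []) ≈ S⟨ j + 1M , 0M , x * N + code# b , s , a ⟩
        step-pop b {p} {j} {x} {s} {a} jk m h = let ej , ec , ex , es , ea = S-dec h
                                                    ef = DQ.mod-of s _ (fkey<Q m) es ; er = DQ.div-of s _ (fkey<Q m) es in
          ≈-trans (ite-yes c=0 D3 D0 ec) (≈-trans (ite-no s=0 D1 D2 λ z → stack≉0 ([] , b) s (≈-trans (≈-sym es) z))
            (≈-trans (ite-yes h=0 D4 A3a (fr-ok hd m ef)) (≈-trans (ite-yes j<K A3b x0 (<-resp (≈-sym ej) ≈-refl jk))
              (S-cong (+-cong ej ≈-refl) ≈-refl (+-cong (*-cong ex ≈-refl) (fr-ok dg m ef)) er ea))))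

        step-addr : ∀ u {p j x a} → j < K → p ≈ S⟨ j , 0M , x , 0M , a * R + ucode u ⟩ →
          stepF $ (p ∷ []) ≈ S⟨ j , 0M , x , 0M * Q + fkey (uframe u) , a ⟩
        step-addr u {p} {j} {x} {a} jk h = let ej , ec , ex , es , ea = S-dec h in
          ≈-trans (ite-yes c=0 D3 D0 ec) (≈-trans (ite-yes s=0 D1 D2 es) (≈-trans (ite-yes j<K A4 x0 (<-resp (≈-sym ej) ≈-refl jk))
            (S-cong ej ≈-refl ex (≈-trans (addr-ok u (DR.mod-of a _ (ucode<R u) ea)) (≈-sym (≈-trans (+-cong (0* Q) ≈-refl) (0+ _)))) (DR.div-of a _ (ucode<R u) ea))))

      isLab : M → Set
      isLab c = (c ≈ 0M) ⊎ Σ (Bits L) λ e → c ≈ lab e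

      -- The effect of a step on level and vertex, with stack and address forgotten. It suffices for
      -- seeing that the base vertex changes along edges only.
      data Move (p : M) : Set where
        stay : stepF $ (p ∷ []) ≈ p → Move p
        keep : ∀ {j c x s a} → stepF $ (p ∷ []) ≈ S⟨ j , c , x , s , a ⟩ → isLab c → j ≈ jF $ (p ∷ []) → x ≈ xF $ (p ∷ []) → Move p
        down : ∀ {j c x s a b} → stepF $ (p ∷ []) ≈ S⟨ j , c , x , s , a ⟩ → isLab c → j + 1M ≈ jF $ (p ∷ []) →
               b < N → xF $ (p ∷ []) ≈ x * N + b → Move p
        up   : ∀ {j c x s a b} → stepF $ (p ∷ []) ≈ S⟨ j , c , x , s , a ⟩ → isLab c → jF $ (p ∷ []) < K → j ≈ jF $ (p ∷ []) + 1M →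
               b < N → x ≈ xF $ (p ∷ []) * N + b → Move p
        walk : ∀ {c x s a} e → stepF $ (p ∷ []) ≈ S⟨ 0M , c , x , s , a ⟩ → isLab c → jF $ (p ∷ []) ≈ 0M → x ≈ π₀ e $ (xF $ (p ∷ []) ∷ []) → Move p

      abstract
        -- Unlike the lemmas on single steps, this presupposes nothing about the stack, so it also
        -- covers runs whose correctness is not known.
        moves : ∀ p → isLab (cF $ (p ∷ [])) → ¬ₒ ¬ₒ Move p
        moves p (inj₂ (e , ec)) k = by-em (jF $ (p ∷ []) ≈ 0M) stable-𝕆
            (λ j0 → k (walk e (≈-trans e1 (ite-yes j=0 A1 A2 j0)) (inj₁ ≈-refl) j0 (≈-trans (cong2 baseT ec ≈-refl) (base-ok e _ ≈-refl))))
            (λ j≠ → let v , b , b< , ex = DN.divmod (xF $ (p ∷ [])) in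
              k (down (≈-trans e1 (ite-no j=0 A1 A2 j≠)) (inj₁ ≈-refl) (≈-trans (+-comm _ 1M) (∸-+ (≤-trans (≤-reflexive (≈-sym (0+ 1M))) (<⇒suc≤ (≉0⇒> j≠)))))
                 b< (≈-trans ex (+-cong (*-cong (≈-sym (DN.div-of v b b< ex)) ≈-refl) ≈-refl))))
          where
          e1 : stepF $ (p ∷ []) ≈ D0 $ (p ∷ [])
          e1 = ite-no c=0 D3 D0 λ z → lab≉0 e (≈-trans (≈-sym ec) z)
        moves p (inj₁ c0) k = by-em (sF $ (p ∷ []) ≈ 0M) stable-𝕆
            (λ s0 → by-em (jF $ (p ∷ []) < K) stable-𝕆
               (λ jk → k (keep (≈-trans e1 (≈-trans (ite-yes s=0 D1 D2 s0) (ite-yes j<K A4 x0 jk))) (inj₁ ≈-refl) ≈-refl ≈-refl))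
               (λ jk → k (stay (≈-trans e1 (≈-trans (ite-yes s=0 D1 D2 s0) (ite-no j<K A4 x0 jk))))))
            (λ s≠ → let e2 = ≈-trans e1 (ite-no s=0 D1 D2 s≠) in by-em (hdT $ (fr ∷ []) ≈ 0M) stable-𝕆
               (λ h0 → by-em (jF $ (p ∷ []) < K) stable-𝕆
                  (λ jk → k (up (≈-trans e2 (≈-trans (ite-yes h=0 D4 A3a h0) (ite-yes j<K A3b x0 jk))) (inj₁ ≈-refl) jk ≈-refl dg<N ≈-refl))
                  (λ jk → k (stay (≈-trans e2 (≈-trans (ite-yes h=0 D4 A3a h0) (ite-no j<K A3b x0 jk))))))
               (λ h≠ → tab-range fkey hd frames fr λ { (inj₁ h) → h≠ h ; (inj₂ (([] , a) , h)) → h≠ h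
                  ; (inj₂ ((e ∷ w , a) , h)) → k (keep (≈-trans e2 (ite-no h=0 D4 A3a h≠)) (inj₂ (e , h)) ≈-refl ≈-refl) }))
          where
          fr : M
          fr = frF $ (p ∷ [])
          e1 : stepF $ (p ∷ []) ≈ D3 $ (p ∷ [])
          e1 = ite-yes c=0 D3 D0 c0
          dg<N : dgT $ (fr ∷ []) < N
          dg<N = stable-< λ k → tab-range fkey dg frames fr λ { (inj₁ h) → k (<-resp (≈-sym h) ≈-refl (num>0 (t ℕ.* L))) ; (inj₂ ((w , a) , h)) → k (<-resp (≈-sym h) ≈-refl (code#<N a)) }

  -- Correctness and running time of the machine.

  module Runs where
    open Machine public
    open Generators
    open import Data.Bool using (_xor_)
    open import Data.Vec using (concat; replicate; toList; group; _∷ʳ_)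
    open import Data.Vec.Properties using (length-toList)
    open import Data.List as List using ([]; _∷_)
    open import Data.List.Membership.Propositional using (_∈_)

    abstract
      rev-snoc : ∀ {A : Set} {n} (w : Vec A n) x → rev (w ∷ʳ x) ≡ x ∷ rev w
      rev-snoc [] x = ≡.refl
      rev-snoc (y ∷ w) x = ≡.cong (_∷ʳ y) (rev-snoc w x)

      rev-rev : ∀ {A : Set} {n} (w : Vec A n) → rev (rev w) ≡ w
      rev-rev [] = ≡.refl
      rev-rev (x ∷ w) = ≡.trans (rev-snoc (rev w) x) (≡.cong (x ∷_) (rev-rev w))

      xorV-xorV : ∀ {n} (x y : Bits n) → xorV x (xorV x y) ≡ y
      xorV-xorV [] [] = ≡.refl
      xorV-xorV (a ∷ x) (b ∷ y) = ≡.cong₂ _∷_ (xx a b) (xorV-xorV x y)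
        where
        xx : ∀ a b → a xor (a xor b) ≡ b
        xx false b = ≡.refl
        xx true false = ≡.refl
        xx true true = ≡.refl

    module Run (q t r : ℕ) (g : Bits q → Bits (t ℕ.* suc (suc q)))
               (g-ok : ∀ α → isZero α ≡ false → two^ q ℕ.≤ 4 ℕ.* ones g α)
               (n₀ : M) (Gr₀ : Graph (suc q) n₀) (Cc : M) (t≥4 : 4 ℕ.≤ t) where
      open Pow2 Cc public
      open Mach q t r g g-ok n₀ Gr₀ K public
      open Graph Gr₀ using () renaming (π to π₀; π< to π₀<; ππ to ππ₀; loop to loop₀)

      -- Exponentials exist only as fixed powers of `two`. Up to `K` these are the `i`-th powers of
      -- `N`, `Q` and `R`.
      Np Qp Rp : Fn 1
      Np = powF twoF k
      Qp = powF twoF Q₀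
      Rp = powF twoF ((r ℕ.+ t) ℕ.* L)

      nnF : Fn 1
      nnF = conF n₀ ⊗ Np

      nn : M → M
      nn i = nnF $ (i ∷ [])

      abstract
        two-pow : ∀ (m : ℕ) i → i < K → powF twoF m $ (i + 1M ∷ []) ≈ powF twoF m $ (i ∷ []) * num (2^ m)
        two-pow m i p = ≈-trans (powF-ok twoF m _) (≈-trans (pow-cong m (twoS i p)) (≈-trans (pow-2* m (two i)) (*-cong (≈-sym (powF-ok twoF m (i ∷ []))) ≈-refl)))

        two-pow≤ : ∀ m i → i ≤ K → powF twoF m $ (i ∷ []) ≤ powF twoF m $ (K ∷ [])
        two-pow≤ m i p = let d , e = slack p in ≤-trans (≤-reflexive (powF-ok twoF m (i ∷ []))) (≤-trans (pow-mono m
          (≤-trans (two≤ i d (≤-reflexive e)) (≤-reflexive (cong1 twoF e)))) (≤-reflexive (≈-sym (powF-ok twoF m (K ∷ [])))))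

        two-pow>0 : ∀ m i → 0M < powF twoF m $ (i ∷ [])
        two-pow>0 m i = <-resp ≈-refl (≈-sym (powF-ok twoF m (i ∷ []))) (pow-pos m (<-≤-trans (<-resp ≈-refl (0+ 1M) (0<suc 0M)) (two≥1 i)))

        two-pow0 : ∀ m → powF twoF m $ (0M ∷ []) ≈ 1M
        two-pow0 m = ≈-trans (powF-ok twoF m (0M ∷ [])) (≈-trans (pow-cong m two0) (pow-1 m))

        nn0 : nn 0M ≈ n₀
        nn0 = ≈-trans (*-cong ≈-refl (two-pow0 k)) (*1 n₀)

        nnS : ∀ i → i < K → nn (i + 1M) ≈ nn i * N
        nnS i p = ≈-trans (*-cong ≈-refl (two-pow k i p)) (≈-sym (*-assoc _ _ _))

        nn≤ : ∀ i → i ≤ K → nn i ≤ nn K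
        nn≤ i p = *-mono ≤-refl (two-pow≤ k i p)

      X Smax Amax Lmax Cmax Tmax : M
      X = nn K
      Smax = Qp $ (K ∷ [])
      Amax = Rp $ (K ∷ [])
      Lmax = num (2^ L)
      Cmax = S⟨ K , Lmax , X , Smax , Amax ⟩
      Tmax = num 3 * (powF twoF t $ (K ∷ []))

      abstract
        lab≤ : ∀ e → lab e ≤ Lmax
        lab≤ e = num-≤ (bval< e)

      private
        module RM = Trunc x0 stepF Cmax
        module TM = Trunc (conF 1M) (conF (num t) ⊗ (x0 ⊕ conF 1M) ⊕ conF (num 2)) Tmax

      abstract
        runF : Fn 2
        runF = RM.runF

        TF : Fn 1
        TF = TM.runF ∘F (conF 0M ∷ x0 ∷ [])

      run : M → M → M
      run p τ = runF $ (p ∷ τ ∷ [])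

      T : M → M
      T i = TF $ (i ∷ [])

      abstract
        run-0 : ∀ p → run p 0M ≈ p
        run-0 = RM.run0

        run-suc : ∀ p i {y z} → run p i ≈ y → stepF $ (y ∷ []) ≈ z → z ≤ Cmax → run p (i + 1M) ≈ z
        run-suc = RM.runS

        run-next : ∀ p i → ¬ₒ ¬ₒ ((run p (i + 1M) ≈ run p i) ⊎ (run p (i + 1M) ≈ stepF $ (run p i ∷ [])))
        run-next = RM.run-or

        run-1 : ∀ {p z} → stepF $ (p ∷ []) ≈ z → z ≤ Cmax → run p 1M ≈ z
        run-1 {p} e q = ≈-trans (cong2 runF ≈-refl (≈-sym (0+ 1M))) (run-suc p 0M (run-0 p) e q)

        run-+ : ∀ p τ σ → run p (τ + σ) ≈ run (run p τ) σ
        run-+ p τ = indP (runF ∘F (conF p ∷ conF τ ⊕ x0 ∷ []) ≈P runF ∘F (conF (run p τ) ∷ x0 ∷ []))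
          (≈-trans (cong2 runF ≈-refl (+0 τ)) (≈-sym (run-0 _)))
          (λ σ e → ≈-trans (cong2 runF ≈-refl (+suc τ σ)) (RM.runS-cong p (run p τ) (τ + σ) σ e))

        run-trans : ∀ {p y z} τ σ → run p τ ≈ y → run y σ ≈ z → run p (τ + σ) ≈ z
        run-trans τ σ e e' = ≈-trans (run-+ _ τ σ) (≈-trans (cong2 runF e ≈-refl) e')

        run-cong : ∀ {p p' τ τ'} → p ≈ p' → τ ≈ τ' → run p τ ≈ run p' τ'
        run-cong = cong2 runF

        T0 : T 0M ≈ 1M
        T0 = TM.run0 0M

        private
          -- A call costs `t` calls below and little more, so the time is at most `3 * 2 ^ (t i)`.
          -- Adding 2 to it makes the induction close: the surplus of 4 is absorbed by `t ≥ 4`.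
          Tinv : ∀ i → i ≤ K → T i + num 2 ≤ num 3 * (powF twoF t $ (i ∷ []))
          tstep : ∀ i → i < K → T i + num 2 ≤ num 3 * (powF twoF t $ (i ∷ [])) →
            (num t * (T i + 1M) + num 2) + num 2 ≤ num 3 * (powF twoF t $ (i + 1M ∷ []))
          tstep i p h = ≤-trans (≤-trans (≤-reflexive (≈-trans (+-assoc _ _ _) (+-cong ≈-refl (≈-sym (num-+ 2 2)))))
              (≤-trans (+-mono (≤-refl {num t * (T i + 1M)}) (num-≤ t≥4)) (≤-reflexive (solve 2 (λ t y → t :* (y :+ con 1) :+ t := t :* (y :+ (con 0 :+ con 1 :+ con 1))) ≈-refl (num t) (T i)))))
            (≤-trans (*-mono (num-≤ (ℕ.<⇒≤ (n<2^n t))) h) (≤-reflexive (≈-trans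
               (solve 3 (λ a b c → a :* (b :* c) := b :* (c :* a)) ≈-refl (num (2^ t)) (num 3) (powF twoF t $ (i ∷ []))) (*-cong ≈-refl (≈-sym (two-pow t i p))))))
          TS′ : ∀ i → i < K → T i + num 2 ≤ num 3 * (powF twoF t $ (i ∷ [])) → T (i + 1M) ≈ num t * (T i + 1M) + num 2
          TS′ i p h = TM.runS 0M i ≈-refl ≈-refl (≤-trans (≤+ _ (num 2)) (≤-trans (tstep i p h) (*-mono (≤-refl {num 3}) (two-pow≤ t (i + 1M) (<⇒suc≤ p)))))
          Tinv = indB K (TF ⊕ conF (num 2) ≤P conF (num 3) ⊗ powF twoF t)
            (≤-trans (+-mono (≤-reflexive T0) ≤-refl) (≤-reflexive (≈-trans (solve 0 (con 1 :+ (con 0 :+ con 1 :+ con 1) := (con 0 :+ con 1 :+ con 1 :+ con 1) :* con 1) ≈-refl) (*-cong ≈-refl (≈-sym (two-pow0 t))))))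
            (λ i p h → ≤-trans (+-mono (≤-reflexive (TS′ i p h)) ≤-refl) (tstep i p h))

        TS : ∀ i → i < K → T (i + 1M) ≈ num t * (T i + 1M) + num 2
        TS i p = TS′ i p (Tinv i (proj₁ p))

        state≤ : ∀ {j c x s a} → j ≤ K → c ≤ Lmax → x ≤ X → s ≤ Smax → a ≤ Amax → S⟨ j , c , x , s , a ⟩ ≤ Cmax
        state≤ = S-mono

        -- The neighbour of x along the label e at level i.
        piF : Bits L → Fn 2
        piF e = xF ∘F (runF ∘F (SF x0 (conF (lab e)) x1 (conF 0M) (conF 0M) ∷ TF ∘F (x0 ∷ []) ∷ []) ∷ [])

        pi-def : ∀ e i x {y} → run S⟨ i , lab e , x , 0M , 0M ⟩ (T i) ≈ S⟨ i , 0M , y , 0M , 0M ⟩ → piF e $ (i ∷ x ∷ []) ≈ y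
        pi-def e i x h = proj₁ (proj₂ (proj₂ (S-dec h)))

      π⟨_,_⟩ : M → Bits L → Fn 1
      π⟨ i , e ⟩ = piF e ∘F (conF i ∷ x0 ∷ [])

      -- The vertex of the base graph below the current vertex.
      baseF : Fn 1
      baseF = quoF ∘F (xF ∷ Np ∘F (jF ∷ []) ∷ [])

      record GP (i : M) : Set where
        field
          <nn   : ∀ e v → v < nn i → π⟨ i , e ⟩ $ (v ∷ []) < nn i
          invol : ∀ e v → v < nn i → π⟨ i , e ⟩ $ (π⟨ i , e ⟩ $ (v ∷ []) ∷ []) ≈ v
          lp    : ∀ e v → v < nn i → π⟨ i , true ∷ e ⟩ $ (v ∷ []) ≈ v

      graph : ∀ {i} → GP i → Graph (suc q) (nn i)
      graph {i} gp = record { π = π⟨ i ,_⟩ ; π< = GP.<nn gp ; ππ = GP.invol gp ; loop = GP.lp gp }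

      -- A call must work above an arbitrary stack and with an arbitrary remaining address. The
      -- hypothesis on `s` reserves room for `i` further frames, as `Qp` at `i` is the `i`-th power
      -- of `Q`.
      RP : M → Set
      RP i = ∀ x → x < nn i → ∀ s → (s + 1M) * (Qp $ (i ∷ [])) ≤ Smax → ∀ a → a ≤ Amax → ∀ e →
        run S⟨ i , lab e , x , s , a ⟩ (T i) ≈ S⟨ i , 0M , π⟨ i , e ⟩ $ (x ∷ []) , s , a ⟩

      -- One step fetches a label, `T i` steps carry out its call, and one last step returns.
      tw : M → ∀ {n} → Vec (Bits L) n → M
      tw i []      = 1M
      tw i (e ∷ w) = (1M + T i) + tw i w

      abstract
        tw≈ : ∀ i {n} (w : Vec (Bits L) n) → tw i w ≈ num n * (T i + 1M) + 1M
        tw≈ i [] = ≈-sym (≈-trans (+-cong (0* _) ≈-refl) (0+ 1M))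
        tw≈ i {suc n} (e ∷ w) = ≈-trans (+-cong ≈-refl (tw≈ i w)) (solve 2 (λ y n → (con 1 :+ y) :+ (n :* (y :+ con 1) :+ con 1) := (n :+ con 1) :* (y :+ con 1) :+ con 1) ≈-refl (T i) (num n))

        s≤Smax : ∀ {i s} → (s + 1M) * (Qp $ (i ∷ [])) ≤ Smax → s ≤ Smax
        s≤Smax {i} {s} h = ≤-trans (≤-trans (≤+ s 1M) (≤-trans (≤-reflexive (≈-sym (*1 _))) (*-mono ≤-refl (≤-trans (≤-reflexive (≈-sym (0+ 1M))) (<⇒suc≤ (two-pow>0 Q₀ i)))))) h

        push≤ : ∀ {i s f} → i < K → f ∈ frames → (s + 1M) * (Qp $ (i + 1M ∷ [])) ≤ Smax → ((s * Q + fkey f) + 1M) * (Qp $ (i ∷ [])) ≤ Smax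
        push≤ {i} {s} {f} p m h = ≤-trans (*-mono (≤-trans (≤-reflexive (+-assoc _ _ _)) (≤-trans (+-mono (≤-refl {s * Q}) (<⇒suc≤ (fkey<Q m))) (≤-reflexive (≈-sym (suc* s Q))))) ≤-refl)
          (≤-trans (≤-reflexive (≈-trans (*-assoc _ _ _) (*-cong ≈-refl (≈-trans (*-comm _ _) (≈-sym (two-pow Q₀ i p)))))) h)

        word-run : ∀ i → i < K → (gp : GP i) → RP i → ∀ {n} (w : Vec (Bits L) n) b → n ℕ.≤ r ℕ.+ t → ∀ v → v < nn i →
          ∀ s → (s + 1M) * (Qp $ (i + 1M ∷ [])) ≤ Smax → ∀ a → a ≤ Amax →
          run S⟨ i , 0M , v , s * Q + fkey (toList w , b) , a ⟩ (tw i w) ≈ S⟨ i + 1M , 0M , GraphOps.act (graph gp) w $ (v ∷ []) * N + code# b , s , a ⟩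
        word-run i p gp rp [] b n≤ v v< s sQ≤ a a≤ = run-1 (step-pop b p (frames-∈ [] b ℕ.z≤n) ≈-refl)
          (state≤ (<⇒suc≤ p) (0≤ _) (≤-trans (proj₁ (cell< v<)) (≤-trans (≤-reflexive (≈-sym (nnS i p))) (nn≤ _ (<⇒suc≤ p)))) (s≤Smax sQ≤) a≤)
          where
          cell< : ∀ {v n} → v < n → v * N + code# b < n * N
          cell< {v} {n} v< = suc≤⇒< (≤-trans (≤-reflexive (+-assoc _ _ _)) (≤-trans (+-mono ≤-refl (<⇒suc≤ (code#<N b))) (≤-trans (≤-reflexive (≈-sym (suc* v N))) (*-mono (<⇒suc≤ v<) ≤-refl))))
        word-run i p gp rp {suc n} (e ∷ w) b n≤ v v< s sQ≤ a a≤ =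
          run-trans (1M + T i) (tw i w) (run-trans 1M (T i)
              (run-1 (step-next e (toList w) b (mem (e ∷ w) n≤) ≈-refl) (state≤ (proj₁ p) (lab≤ e) (≤-trans (proj₁ v<) (nn≤ i (proj₁ p))) (s≤Smax st≤) a≤))
              (rp v v< (s * Q + fkey (toList w , b)) st≤ a a≤ e))
            (word-run i p gp rp w b (ℕ.≤-trans (ℕ.n≤1+n n) n≤) _ (GP.<nn gp e v v<) s sQ≤ a a≤)
          where
          mem : ∀ {m} (w : Vec (Bits L) m) → m ℕ.≤ r ℕ.+ t → (toList w , b) ∈ frames
          mem w h = frames-∈ (toList w) b (≡.subst (ℕ._≤ r ℕ.+ t) (≡.sym (length-toList w)) h)
          st≤ : ((s * Q + fkey (toList w , b)) + 1M) * (Qp $ (i ∷ [])) ≤ Smax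
          st≤ = push≤ {i} {s} p (mem w (ℕ.≤-trans (ℕ.n≤1+n n) n≤)) sQ≤

        cell< : ∀ {v n} b → v < n → v * N + code# b < n * N
        cell< {v} {n} b v< = suc≤⇒< (≤-trans (≤-reflexive (+-assoc _ _ _)) (≤-trans (+-mono ≤-refl (<⇒suc≤ (code#<N b))) (≤-trans (≤-reflexive (≈-sym (suc* v N))) (*-mono (<⇒suc≤ v<) ≤-refl))))

        decompose : ∀ {n x} → x < n * N → ¬ₒ ¬ₒ (Σ M λ v → Σ Word λ a → v < n × x ≈ v * N + code# a)
        decompose {n} {x} p h = let v , a , a< , e = Div.divmod N (num>0 k) x in bits-of k a< λ (b , e') →
          let w , ew = group t L b in
          h (v , w , by-< stable-< v n id (λ q → stable-< λ _ → ≤⇒≯ (≤-trans (*-mono q ≤-refl) (≤-trans (≤+ _ a) (≤-reflexive (≈-sym e)))) p)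
            , ≈-trans e (+-cong ≈-refl (≈-trans e' (≡⇒≈ (≡.cong (num ∘ bval) ew)))))

      module Up (i : M) (p : i < K) (gp : GP i) (rp : RP i) where
        open GraphOps (graph gp) using (act; act<; act-rev; loop)

        abstract
          act-loops : ∀ n v → v < nn i → act (replicate n (replicate L true)) $ (v ∷ []) ≈ v
          act-loops zero v h = ≈-refl
          act-loops (suc n) v h = ≈-trans (congF (act (replicate n (replicate L true))) λ { zero → loop (replicate (suc q) true) v h }) (act-loops n v h)

          up-run : ∀ e b v → v < nn i → ∀ s → (s + 1M) * (Qp $ (i + 1M ∷ [])) ≤ Smax → ∀ a → a ≤ Amax →
            run S⟨ i + 1M , lab e , v * N + code# b , s , a ⟩ (T (i + 1M)) ≈ S⟨ i + 1M , 0M , act (word e b) $ (v ∷ []) * N + code# (dig e b) , s , a ⟩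
          up-run e b v v< s sQ≤ a a≤ = ≈-trans (run-cong ≈-refl time) (run-trans 1M (tw i (word e b))
            (run-1 (step-call e b ≈-refl) (state≤ (proj₁ p) (0≤ _) (≤-trans (proj₁ v<) (nn≤ i (proj₁ p)))
               (s≤Smax (push≤ {i} {s} p (frames-∈ (toList (word e b)) (dig e b) (≡.subst (ℕ._≤ r ℕ.+ t) (≡.sym (length-toList (word e b))) (ℕ.m≤n+m t r))) sQ≤)) a≤))
            (word-run i p gp rp (word e b) (dig e b) (ℕ.m≤n+m t r) v v< s sQ≤ a a≤))
            where
            time : T (i + 1M) ≈ 1M + tw i (word e b)
            time = ≈-trans (TS i p) (≈-sym (≈-trans (+-cong ≈-refl (tw≈ i (word e b))) (solve 1 (λ y → con 1 :+ (y :+ con 1) := y :+ (con 0 :+ con 1 :+ con 1)) ≈-refl (num t * (T i + 1M)))))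

          Smax1 : (0M + 1M) * (Qp $ (i + 1M ∷ [])) ≤ Smax
          Smax1 = ≤-trans (≤-reflexive (≈-trans (*-cong (0+ 1M) ≈-refl) (1* _))) (two-pow≤ Q₀ _ (<⇒suc≤ p))

          pi-up : ∀ e b v → v < nn i → ∀ {x} → x ≈ v * N + code# b → π⟨ i + 1M , e ⟩ $ (x ∷ []) ≈ act (word e b) $ (v ∷ []) * N + code# (dig e b)
          pi-up e b v v< {x} h = ≈-trans (cong1 π⟨ i + 1M , e ⟩ h) (pi-def e (i + 1M) _ (up-run e b v v< 0M Smax1 0M (0≤ _)))

          gen-gen : ∀ j a → gen j (gen j a) ≡ a
          gen-gen j a = concat-inj _ _ (≡.trans (concat-gen j (gen j a)) (≡.trans (≡.cong (xorV (g j)) (concat-gen j a)) (xorV-xorV (g j) (concat a))))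

          dig-dig : ∀ e a → dig e (dig e a) ≡ a
          dig-dig (false ∷ false ∷ j) a = gen-gen j a
          dig-dig (false ∷ true ∷ j) a  = rev-rev a
          dig-dig (true ∷ _) a          = ≡.refl

          word-back : ∀ e a v → v < nn i → act (word e (dig e a)) $ (act (word e a) $ (v ∷ []) ∷ []) ≈ v
          word-back (false ∷ true ∷ j) a v h  = act-rev a v h
          word-back (false ∷ false ∷ j) a v h = ≈-trans (act-loops t _ (act< (replicate t (replicate L true)) v h)) (act-loops t v h)
          word-back (true ∷ _) a v h          = ≈-trans (act-loops t _ (act< (replicate t (replicate L true)) v h)) (act-loops t v h)

          gpS : GP (i + 1M)
          gpS = record
            { <nn = λ e x h → stable-< λ k → decompose (<-resp ≈-refl (nnS i p) h) λ (v , a , v< , ex) →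
                k (<-resp (≈-sym (pi-up e a v v< ex)) (≈-sym (nnS i p)) (cell< (dig e a) (act< (word e a) v v<)))
            ; invol = λ e x h → stable-≈ λ k → decompose (<-resp ≈-refl (nnS i p) h) λ (v , a , v< , ex) →
                k (≈-trans (pi-up e (dig e a) _ (act< (word e a) v v<) (pi-up e a v v< ex))
                  (≈-trans (+-cong (*-cong (word-back e a v v<) ≈-refl) (≡⇒≈ (≡.cong code# (dig-dig e a)))) (≈-sym ex)))
            ; lp = λ e x h → stable-≈ λ k → decompose (<-resp ≈-refl (nnS i p) h) λ (v , a , v< , ex) →
                k (≈-trans (pi-up (true ∷ e) a v v< ex) (≈-trans (+-cong (*-cong (act-loops t v v<) ≈-refl) ≈-refl) (≈-sym ex))) }

          rpS : RP (i + 1M)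
          rpS x h s sQ≤ a a≤ e = stable-≈ λ k → decompose (<-resp ≈-refl (nnS i p) h) λ (v , b , v< , ex) →
            k (≈-trans (run-cong (S-cong ≈-refl ≈-refl ex ≈-refl ≈-refl) ≈-refl) (≈-trans (up-run e b v v< s sQ≤ a a≤)
              (S-cong ≈-refl ≈-refl (≈-sym (pi-up e b v v< ex)) ≈-refl ≈-refl)))

          cloudS : (gp' : Graph (suc q) (nn i * N)) → (∀ e → Graph.π gp' e ≡ π⟨ i + 1M , e ⟩) → IsCloud (graph gp) gp'
          cloudS gp' h = record
            { on-gen = λ j a v v< → ≈-trans (≡⇒≈ (≡.cong (λ f → f $ (v * N + code# a ∷ [])) (h (false ∷ false ∷ j))))
                (≈-trans (pi-up (false ∷ false ∷ j) a v v< ≈-refl) (+-cong (*-cong (act-loops t v v<) ≈-refl) ≈-refl))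
            ; on-inter = λ j a v v< → ≈-trans (≡⇒≈ (≡.cong (λ f → f $ (v * N + code# a ∷ [])) (h (false ∷ true ∷ j)))) (pi-up (false ∷ true ∷ j) a v v< ≈-refl) }

      private
        -- `GP` and `RP` are not predicates of the model. For the induction on the level they are
        -- recast as definable ones: vertices, stacks and addresses under bounded quantifiers,
        -- labels as finite conjunctions.
        GE : Bits L → Pr 2
        GE e = (piF e ∘F (x1 ∷ x0 ∷ []) <P nnF ∘F (x1 ∷ [])) ∧P (piF e ∘F (x1 ∷ piF e ∘F (x1 ∷ x0 ∷ []) ∷ []) ≈P x0)
        GL : Bits (suc q) → Pr 2
        GL e = piF (true ∷ e) ∘F (x1 ∷ x0 ∷ []) ≈P x0
        RE : Bits L → Pr 4
        RE e = runF ∘F (SF x3 (conF (lab e)) x2 x1 x0 ∷ TF ∘F (x3 ∷ []) ∷ []) ≈P SF x3 (conF 0M) (piF e ∘F (x3 ∷ x2 ∷ [])) x1 x0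
        GPp RPp : Pr 1
        GPp = ∀P (conF X) ((x0 <P nnF ∘F (x1 ∷ [])) ⇒P ⋀B L GE ∧P ⋀B (suc q) GL)
        RPp = ∀P (conF X) (∀P (conF Smax) (∀P (conF Amax) ((x2 <P nnF ∘F (x3 ∷ [])) ⇒P ((x1 ⊕ conF 1M) ⊗ Qp ∘F (x3 ∷ []) ≤P conF Smax) ⇒P
                ⋀B L RE)))
        abstract
          toGP : ∀ i → i ≤ K → holds GPp (i ∷ []) → GP i
          toGP i p h = record
            { <nn = λ e v l → proj₁ (⋀E L GE (proj₁ (h v (≤-trans (proj₁ l) (nn≤ i p)) l)) e)
            ; invol = λ e v l → proj₂ (⋀E L GE (proj₁ (h v (≤-trans (proj₁ l) (nn≤ i p)) l)) e)
            ; lp = λ e v l → ⋀E (suc q) GL (proj₂ (h v (≤-trans (proj₁ l) (nn≤ i p)) l)) e }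
          frGP : ∀ i → GP i → holds GPp (i ∷ [])
          frGP i gp v _ l = ⋀I L GE (λ e → GP.<nn gp e v l , GP.invol gp e v l) , ⋀I (suc q) GL (λ e → GP.lp gp e v l)
          toRP : ∀ i → i ≤ K → holds RPp (i ∷ []) → RP i
          toRP i p h x l s sQ≤ a a≤ e = ⋀E L RE (h x (≤-trans (proj₁ l) (nn≤ i p)) s (s≤Smax {i} sQ≤) a a≤ l sQ≤) e
          frRP : ∀ i → RP i → holds RPp (i ∷ [])
          frRP i rp x _ s _ a a≤ l sQ≤ = ⋀I L RE λ e → rp x l s sQ≤ a a≤ e

          base-run : ∀ x → x < nn 0M → ∀ s → (s + 1M) * (Qp $ (0M ∷ [])) ≤ Smax → ∀ a → a ≤ Amax → ∀ e →
            run S⟨ 0M , lab e , x , s , a ⟩ (T 0M) ≈ S⟨ 0M , 0M , π₀ e $ (x ∷ []) , s , a ⟩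
          base-run x l s sQ≤ a a≤ e = ≈-trans (run-cong ≈-refl T0) (run-1 (step-base e ≈-refl)
            (state≤ (0≤ K) (0≤ _) (≤-trans (proj₁ (π₀< e x (<-resp ≈-refl nn0 l))) (≤-trans (≤-reflexive (≈-sym nn0)) (nn≤ 0M (0≤ K)))) (s≤Smax {0M} sQ≤) a≤))

      abstract
        pi0 : ∀ e x → x < nn 0M → π⟨ 0M , e ⟩ $ (x ∷ []) ≈ π₀ e $ (x ∷ [])
        pi0 e x l = pi-def e 0M x (base-run x l 0M (≤-trans (≤-reflexive (≈-trans (*-cong (0+ 1M) ≈-refl) (1* _))) (two-pow≤ Q₀ 0M (0≤ K))) 0M (0≤ _) e)

        private
          gp0 : GP 0M
          gp0 = record
            { <nn = λ e v l → <-resp (≈-sym (pi0 e v l)) (≈-sym nn0) (π₀< e v (<-resp ≈-refl nn0 l))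
            ; invol = λ e v l → ≈-trans (cong1 π⟨ 0M , e ⟩ (pi0 e v l)) (≈-trans (pi0 e _ (<-resp ≈-refl (≈-sym nn0) (π₀< e v (<-resp ≈-refl nn0 l)))) (ππ₀ e v (<-resp ≈-refl nn0 l)))
            ; lp = λ e v l → ≈-trans (pi0 (true ∷ e) v l) (loop₀ e v (<-resp ≈-refl nn0 l)) }
          rp0 : RP 0M
          rp0 x l s sQ≤ a a≤ e = ≈-trans (base-run x l s sQ≤ a a≤ e) (S-cong ≈-refl ≈-refl (≈-sym (pi0 e x l)) ≈-refl ≈-refl)

        -- The two go together: a run one level up iterates the neighbour functions of the lower
        -- level, and the graph properties of the upper neighbour functions are read off from such
        -- runs.
        both : ∀ i → i ≤ K → GP i × RP i
        both i p = let a , b = indB K (GPp ∧P RPp) (frGP 0M gp0 , frRP 0M rp0)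
                         (λ i p (a , b) → let gp = toGP i (proj₁ p) a ; rp = toRP i (proj₁ p) b in
                            frGP (i + 1M) (Up.gpS i p gp rp) , frRP (i + 1M) (Up.rpS i p gp rp)) i p
                   in toGP i p a , toRP i p b

  -- Counts of addresses: mass and energy over all levels.

  module Masses where
    open Runs public
    open Generators
    open import Data.Vec using (toList; take; drop; _++_)
    open import Data.Vec.Properties using (length-toList; take++drop≡id; ++-injective)

    abstract
      ΣW-++ : ∀ {l} a b (f : Vec (Bits l) (a ℕ.+ b) → M) → ΣW (a ℕ.+ b) f ≈ ΣW a (λ w → ΣW b (λ z → f (w ++ z)))
      ΣW-++ zero b f = ≈-refl
      ΣW-++ {l} (suc a) b f = ΣB-cong l λ e → ΣW-++ a b (λ w → f (e ∷ w))

      num-2^+ : ∀ a b → num (2^ (a ℕ.+ b)) ≈ num (2^ a) * num (2^ b)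
      num-2^+ zero b = ≈-sym (≈-trans (*-cong (0+ 1M) ≈-refl) (1* _))
      num-2^+ (suc a) b = ≈-trans (num-+ (2^ (a ℕ.+ b)) (2^ (a ℕ.+ b))) (≈-trans (+-cong (num-2^+ a b) (num-2^+ a b))
        (≈-trans (≈-sym (*-distribʳ _ _ _)) (*-cong (≈-sym (num-+ (2^ a) (2^ a))) ≈-refl)))

      num-2^* : ∀ m l → num (2^ (m ℕ.* l)) ≈ pow (num (2^ l)) m
      num-2^* zero l = 0+ 1M
      num-2^* (suc m) l = ≈-trans (num-2^+ l (m ℕ.* l)) (*-cong ≈-refl (num-2^* m l))

      take-++ : ∀ {A : Set} a {b} (w : Vec A a) (z : Vec A b) → (take a (w ++ z) ≡ w) × (drop a (w ++ z) ≡ z)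
      take-++ a w z = ++-injective (take a (w ++ z)) w (take++drop≡id a (w ++ z))

      En-cong : ∀ {l n} (G : Graph l n) (h h' : Fn 1) → (∀ v → v < n → h $ (v ∷ []) ≈ h' $ (v ∷ [])) → GraphOps.En G h ≈ GraphOps.En G h'
      En-cong {l} {n} G h h' e = ΣB-cong (suc l) {λ a → ∑ n (dsqE h (h ∘F (π a ∷ [])))} {λ a → ∑ n (dsqE h' (h' ∘F (π a ∷ [])))} λ a →
          ∑-cong n (dsqE h (h ∘F (π a ∷ []))) (dsqE h' (h' ∘F (π a ∷ []))) λ v p → dsq-cong (e v p) (e _ (π< a v p))
        where open Graph G

      ∑-PW : ∀ {l n} (G : Graph l n) j h → ∑ n (GraphOps.PW G j h) ≈ pow (num (2^ (suc l))) j * ∑ n h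
      ∑-PW G zero h = ≈-sym (1* _)
      ∑-PW {l} {n} G (suc j) h = ≈-trans (∑-ΣBF n (suc l) (λ e → PW j h ∘F (π e ∷ [])))
          (≈-trans (ΣB-cong (suc l) {λ e → ∑ n (PW j h ∘F (π e ∷ []))} {λ _ → ∑ n (PW j h)} λ e → ∑-π e (PW j h))
          (≈-trans (ΣB-const (suc l) (∑ n (PW j h))) (≈-trans (*-cong ≈-refl (∑-PW G j h)) (≈-sym (*-assoc _ _ _)))))
        where open GraphOps G

    module Mass (q m : ℕ) (m≡ : suc m ≡ 24 ℕ.* 8) (t≥4 : 4 ℕ.≤ suc m ℕ.+ suc m)
                (g : Bits q → Bits ((suc m ℕ.+ suc m) ℕ.* suc (suc q)))
                (g-ok : ∀ α → isZero α ≡ false → two^ q ℕ.≤ 4 ℕ.* ones g α)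
                (n₀ : M) (Gr₀ : Graph (suc q) n₀) (Cc : M) (x₀′ : M) (x₀< : x₀′ < n₀) where
      t : ℕ
      t = suc m ℕ.+ suc m
      open Run q t m g g-ok n₀ Gr₀ Cc t≥4 public
      open Gain q m m≡ g g-ok public
      D : M
      D = num (2^ L)

      GPi : ∀ i → i ≤ K → GP i
      GPi i p = proj₁ (both i p)
      RPi : ∀ i → i ≤ K → RP i
      RPi i p = proj₂ (both i p)

      -- `UF` is the time for one address digit: a step to load it, `m` labels with their calls, and
      -- a step up. `WF` is the time that remains from a level to the top, as a difference of
      -- partial sums.
      UF preF WF : Fn 1
      UF = conF 1M ⊕ (conF (num m) ⊗ (TF ⊕ conF 1M) ⊕ conF 1M)
      preF = ∑F UF
      WF = conF (∑ K UF) ∸F preF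

      W : M → M
      W i = WF $ (i ∷ [])

      abstract
        WK : W K ≈ 0M
        WK = ∸-0 ≤-refl

        WS : ∀ i → i < K → W i ≈ UF $ (i ∷ []) + W (i + 1M)
        WS i p = let d , e = slack (<⇒suc≤ p)
                     le : ∑ (i + 1M) UF ≤ ∑ K UF
                     le = ≤-trans (≤+ _ _) (≤-reflexive (≈-trans (≈-sym (∑-split (i + 1M) d UF)) (∑n-cong UF e)))
                 in ∸-of _ (≈-trans (≈-sym (+-assoc _ _ _)) (≈-trans (+-cong (≈-sym (∑S i UF)) ≈-refl) (∸-+ le)))

      NK : M
      NK = Np $ (K ∷ [])

      hitP : Pr 1
      hitP = x0 ≈P conF x₀′

      abstract
        hitF : Fn 1
        hitF = ite hitP (conF 1M) (conF 0M)
        hit-yes : ∀ {y} → holds hitP (y ∷ []) → hitF $ (y ∷ []) ≈ 1M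
        hit-yes h = ite-yes hitP (conF 1M) (conF 0M) h
        hit-no : ∀ {y} → (¬ₒ holds hitP (y ∷ [])) → hitF $ (y ∷ []) ≈ 0M
        hit-no h = ite-no hitP (conF 1M) (conF 0M) h
        hit≤1 : ∀ y → hitF $ (y ∷ []) ≤ 1M
        hit≤1 y = by-em (holds hitP (y ∷ [])) stable-≤ (λ h → ≤-reflexive (hit-yes h)) (λ n → ≤-trans (≤-reflexive (hit-no n)) (0≤ _))

        endF : Fn 3
        endF = baseF ∘F (runF ∘F (SF x0 (conF 0M) x1 (conF 0M) x2 ∷ WF ∘F (x0 ∷ []) ∷ []) ∷ [])

        end-def : ∀ i v α → endF $ (i ∷ v ∷ α ∷ []) ≈ baseF $ (run S⟨ i , 0M , v , 0M , α ⟩ (W i) ∷ [])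
        end-def i v α = ≈-refl

        -- Sums carry one parameter, so level and vertex travel as a pair.
        countF : Fn 2
        countF = sumF (hitF ∘F (endF ∘F (fstF ∘F (x0 ∷ []) ∷ sndF ∘F (x0 ∷ []) ∷ x1 ∷ []) ∷ []))

        fF : Fn 2
        fF = countF ∘F (prF x0 x1 ∷ Rp ∘F (conF K ∸F x0 ∷ []) ∷ [])

      RK : M → M
      RK i = Rp $ (K ∸ i ∷ [])

      f : M → M → M
      f i v = fF $ (i ∷ v ∷ [])

      hE : M → M → Fn 1
      hE i v = hitF ∘F (endF ∘F (conF i ∷ conF v ∷ x0 ∷ []) ∷ [])

      abstract
        f-∑ : ∀ i v → f i v ≈ ∑ (RK i) (hE i v)
        f-∑ i v = ≈-trans (∑-param _ (pr i v) (RK i)) (∑-cong (RK i) _ (hE i v) λ α _ → cong1 hitF (cong3 endF (fst-pr i v ≈-refl) (snd-pr i v ≈-refl) ≈-refl))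

        endK : ∀ v α → endF $ (K ∷ v ∷ α ∷ []) ≈ quoF $ (v ∷ NK ∷ [])
        endK v α = let ej , _ , ex , _ = S-dec (≈-trans (run-cong ≈-refl WK) (run-0 _)) in ≈-trans (end-def K v α) (cong2 quoF ex (cong1 Np ej))

        fK : ∀ v → f K v ≈ hitF $ (quoF $ (v ∷ NK ∷ []) ∷ [])
        fK v = ≈-trans (f-∑ K v) (≈-trans (∑n-cong (hE K v) (≈-trans (cong1 Rp (∸-0 ≤-refl)) (≈-trans (two-pow0 ((m ℕ.+ t) ℕ.* L)) (≈-sym (0+ 1M)))))
          (≈-trans (∑S 0M (hE K v)) (≈-trans (+-cong (∑0 (hE K v)) (cong1 hitF (endK v 0M))) (0+ _))))

        K∸ : ∀ i → i < K → K ∸ i ≈ (K ∸ (i + 1M)) + 1M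
        K∸ i p = ∸-of _ (≈-trans (solve 2 (λ i d → i :+ (d :+ con 1) := (i :+ con 1) :+ d) ≈-refl i (K ∸ (i + 1M))) (∸-+ (<⇒suc≤ p)))

        RKS : ∀ i → i < K → RK i ≈ RK (i + 1M) * R
        RKS i p = ≈-trans (cong1 Rp (K∸ i p)) (two-pow ((m ℕ.+ t) ℕ.* L) (K ∸ (i + 1M)) (suc≤⇒< (≤-trans (≤-reflexive (≈-sym (K∸ i p))) (≤-trans (≤+ʳ i _) (≤-reflexive (∸-+ (proj₁ p)))))))

        RK≤ : ∀ i → i ≤ K → RK i ≤ Amax
        RK≤ i p = two-pow≤ ((m ℕ.+ t) ℕ.* L) (K ∸ i) (≤-trans (≤+ʳ i _) (≤-reflexive (∸-+ p)))

      module At (i : M) (p : i < K) where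
        gp : GP i
        gp = GPi i (proj₁ p)
        open GraphOps (graph gp) using (act; act<; PW; PW-ok; En)

        nxt : Addr → M → M
        nxt u v = act (take m u) $ (v ∷ []) * N + code# (drop m u)

        abstract
          end-step : ∀ u v a → v < nn i → a * R + ucode u ≤ Amax → endF $ (i ∷ v ∷ a * R + ucode u ∷ []) ≈ endF $ (i + 1M ∷ nxt u v ∷ a ∷ [])
          end-step u v a v< a≤ = ≈-trans (end-def i v _) (≈-trans (cong1 baseF (≈-trans (run-cong ≈-refl (WS i p)) (≈-trans (run-+ _ _ _) (run-cong
              (≈-trans (run-cong ≈-refl (+-cong ≈-refl (≈-sym (tw≈ i (take m u))))) (run-trans 1M (tw i (take m u)) r1 r2)) ≈-refl)))) (≈-sym (end-def (i + 1M) _ a)))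
            where
            aA : a ≤ Amax
            aA = ≤-trans (≤-trans (≤-trans (≤-reflexive (≈-sym (*1 a))) (*-mono ≤-refl (≤-trans (≤-reflexive (≈-sym (0+ 1M))) (<⇒suc≤ (num>0 ((m ℕ.+ t) ℕ.* L)))))) (≤+ _ _)) a≤
            S1 : (0M + 1M) * (Qp $ (i + 1M ∷ [])) ≤ Smax
            S1 = Up.Smax1 i p gp (RPi i (proj₁ p))
            r1 : run S⟨ i , 0M , v , 0M , a * R + ucode u ⟩ 1M ≈ S⟨ i , 0M , v , 0M * Q + fkey (uframe u) , a ⟩
            r1 = run-1 (step-addr u p ≈-refl) (state≤ (proj₁ p) (0≤ _) (≤-trans (proj₁ v<) (nn≤ i (proj₁ p)))
              (s≤Smax {i} (push≤ {i} {0M} p (frames-∈ (toList (take m u)) (drop m u) (≡.subst (ℕ._≤ m ℕ.+ t) (≡.sym (length-toList (take m u))) (ℕ.m≤m+n m t))) S1)) aA)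
            r2 : run S⟨ i , 0M , v , 0M * Q + fkey (uframe u) , a ⟩ (tw i (take m u)) ≈ S⟨ i + 1M , 0M , nxt u v , 0M , a ⟩
            r2 = word-run i p gp (RPi i (proj₁ p)) (take m u) (drop m u) (ℕ.m≤m+n m t) v v< 0M S1 a aA

        f' : Fn 1
        f' = fF ∘F (conF (i + 1M) ∷ x0 ∷ [])

        abstract
          -- The machine consumes the lowest digit of the address first; cutting the sum over
          -- addresses into blocks of length `R` isolates this digit.
          f-rec : ∀ v → v < nn i → f i v ≈ ΣW (m ℕ.+ t) (λ u → f (i + 1M) (nxt u v))
          f-rec v v< = ≈-trans (f-∑ i v) (≈-trans (∑n-cong (hE i v) (RKS i p)) (≈-trans (∑-blocks ((m ℕ.+ t) ℕ.* L) (RK (i + 1M)) (hE i v))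
            (≈-trans (∑-ΣBF (RK (i + 1M)) ((m ℕ.+ t) ℕ.* L) _) (≈-trans (ΣB-concat L (m ℕ.+ t) (λ b → ∑ (RK (i + 1M)) (hE i v ∘F (x0 ⊗ conF R ⊕ conF (num (bval b)) ∷ []))))
            (ΣW-cong (m ℕ.+ t) λ u → ≈-trans (∑-cong (RK (i + 1M)) (hE i v ∘F (x0 ⊗ conF R ⊕ conF (ucode u) ∷ [])) (hE (i + 1M) (nxt u v)) λ β β< →
                cong1 hitF (end-step u v β v< (β≤ u β β<))) (≈-sym (f-∑ (i + 1M) (nxt u v))))))))
            where
            β≤ : ∀ u β → β < RK (i + 1M) → β * R + ucode u ≤ Amax
            β≤ u β h = ≤-trans (≤-trans (+-mono ≤-refl (proj₁ (ucode<R u))) (≤-trans (≤-reflexive (≈-sym (suc* β R))) (*-mono (<⇒suc≤ h) ≤-refl)))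
              (≤-trans (≤-reflexive (≈-sym (RKS i p))) (RK≤ i (proj₁ p)))

          -- Summing over the last `t` labels of a digit gives the cloud sum `f̄`, and summing over
          -- the first `m` labels applies the walk operator `m` times. This is the shape that
          -- `level-step` requires.
          f-PW : ∀ (f̄ : Fn 1) → (∀ v → f̄ $ (v ∷ []) ≈ ΣW t (λ a → f (i + 1M) (v * N + code# a))) → ∀ v → v < nn i → f i v ≈ PW m f̄ $ (v ∷ [])
          f-PW f̄ h v v< = ≈-trans (f-rec v v<) (≈-trans (ΣW-++ m t (λ u → f (i + 1M) (nxt u v))) (≈-sym (≈-trans (PW-ok m f̄ v) (ΣW-cong m λ w → ≈-trans (h _)
            (ΣW-cong t λ a → ≡⇒≈ (≡.cong₂ (λ w' a' → f (i + 1M) (act w' $ (v ∷ []) * N + code# a')) (≡.sym (proj₁ (take-++ m w a))) (≡.sym (proj₂ (take-++ m w a)))))))))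

        G' : Graph (suc q) (nn i * N)
        G' = record { π = π⟨ i + 1M ,_⟩
                    ; π< = λ e v h → <-resp ≈-refl (nnS i p) (GP.<nn gp' e v (<-resp ≈-refl (≈-sym (nnS i p)) h))
                    ; ππ = λ e v h → GP.invol gp' e v (<-resp ≈-refl (≈-sym (nnS i p)) h)
                    ; loop = λ e v h → GP.lp gp' e v (<-resp ≈-refl (≈-sym (nnS i p)) h) }
          where gp' : GP (i + 1M)
                gp' = GPi (i + 1M) (<⇒suc≤ p)

        ic : IsCloud (graph gp) G'
        ic = Up.cloudS i p gp (RPi i (proj₁ p)) G' (λ _ → ≡.refl)

        open Step ic f' using (f̄; fa)
        fi : Fn 1
        fi = fF ∘F (conF i ∷ x0 ∷ [])

        abstract
          f̄-ok : ∀ v → f̄ $ (v ∷ []) ≈ ΣW t (λ a → f (i + 1M) (v * N + code# a))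
          f̄-ok v = ΣWF-ok t fa (v ∷ [])

          energy-step : num 4 * ((D * D) * En fi) ≤ (N * N) * GraphOps.En G' f'
          energy-step = ≤-trans (≤-reflexive (*-cong ≈-refl (*-cong ≈-refl (En-cong (graph gp) fi (PW m f̄) (f-PW f̄ f̄-ok))))) (level-step ic f')

          -- Walks permute the vertices and the clouds partition the graph above, so only the number
          -- of walks of length `m` enters.
          mass-step : ∑ (nn i) fi ≈ pow D m * ∑ (nn (i + 1M)) f'
          mass-step = ≈-trans (∑-cong (nn i) fi (PW m f̄) (f-PW f̄ f̄-ok)) (≈-trans (∑-PW (graph gp) m f̄) (*-cong ≈-refl
            (≈-trans (∑-ΣWF (nn i) t fa) (≈-trans (≈-sym (blocksW (nn i) f')) (∑n-cong f' (≈-sym (nnS i p)))))))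

      EF massF : Fn 1
      EF = ΣBF L (λ e → sumF (dsqE (fF ∘F (x0 ∷ x1 ∷ [])) (fF ∘F (x0 ∷ piF e ∘F (x0 ∷ x1 ∷ []) ∷ []))) ∘F (x0 ∷ nnF ∷ []))
      massF = sumF fF ∘F (x0 ∷ nnF ∷ [])

      fi : M → Fn 1
      fi i = fF ∘F (conF i ∷ x0 ∷ [])

      private
        -- The factors of one level as powers of two: `4 * D²`, `N²` and `D ^ m`. Over `i` levels
        -- they become the powers of `two i` with these exponents.
        pL pK pM : ℕ
        pL = 2 ℕ.+ (L ℕ.+ L)
        pK = k ℕ.+ k
        pM = m ℕ.* L
        tp : ℕ → Fn 1
        tp = powF twoF
        abstract
          E-at : ∀ i → EF $ (i ∷ []) ≈ ΣB L (λ e → ∑ (nn i) (dsqE (fi i) (fi i ∘F (π⟨ i , e ⟩ ∷ []))))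
          E-at i = ≈-trans (ΣBF-ok L F (i ∷ [])) (ΣB-cong L {λ e → F e $ (i ∷ [])} {λ e → ∑ (nn i) (dsqE (fi i) (fi i ∘F (π⟨ i , e ⟩ ∷ [])))} λ e →
            ≈-trans (∑-param _ i (nn i)) (∑-cong (nn i) _ (dsqE (fi i) (fi i ∘F (π⟨ i , e ⟩ ∷ []))) λ v _ → ≈-refl))
            where
            F : Bits L → Fn 1
            F e = sumF (dsqE (fF ∘F (x0 ∷ x1 ∷ [])) (fF ∘F (x0 ∷ piF e ∘F (x0 ∷ x1 ∷ []) ∷ []))) ∘F (x0 ∷ nnF ∷ [])
          mass-at : ∀ i → massF $ (i ∷ []) ≈ ∑ (nn i) (fi i)
          mass-at i = ∑-param fF i (nn i)

          E-step : ∀ i → i < K → num 4 * ((D * D) * EF $ (i ∷ [])) ≤ (N * N) * EF $ (i + 1M ∷ [])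
          E-step i p = ≤-trans (≤-reflexive (*-cong ≈-refl (*-cong ≈-refl (E-at i)))) (≤-trans (At.energy-step i p)
            (≤-reflexive (*-cong ≈-refl (≈-sym (≈-trans (E-at (i + 1M)) (ΣB-cong L {λ e → ∑ (nn (i + 1M)) (dd e)} {λ e → ∑ (nn i * N) (dd e)} λ e → ∑n-cong (dd e) (nnS i p)))))))
            where
            dd : Bits L → Fn 1
            dd e = dsqE (fi (i + 1M)) (fi (i + 1M) ∘F (π⟨ i + 1M , e ⟩ ∷ []))

          E-all : ∀ i → i ≤ K → tp pL $ (i ∷ []) * EF $ (0M ∷ []) ≤ tp pK $ (i ∷ []) * EF $ (i ∷ [])
          E-all = indB K (tp pL ⊗ conF (EF $ (0M ∷ [])) ≤P tp pK ⊗ EF)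
            (*-mono (≤-reflexive (≈-trans (two-pow0 pL) (≈-sym (two-pow0 pK)))) ≤-refl)
            (λ i p h → ≤-trans (≤-reflexive (≈-trans (*-cong (≈-trans (two-pow pL i p) (*-cong ≈-refl n4)) ≈-refl)
                  (solve 3 (λ a c e → (a :* c) :* e := c :* (a :* e)) ≈-refl (tp pL $ (i ∷ [])) (num 4 * (D * D)) (EF $ (0M ∷ [])))))
               (≤-trans (*-mono (≤-refl {num 4 * (D * D)}) h) (≤-trans (≤-reflexive
                   (solve 4 (λ f d b e → (f :* d) :* (b :* e) := b :* (f :* (d :* e))) ≈-refl (num 4) (D * D) (tp pK $ (i ∷ [])) (EF $ (i ∷ []))))
                 (≤-trans (*-mono (≤-refl {tp pK $ (i ∷ [])}) (E-step i p)) (≤-reflexive (≈-trans (≈-sym (*-assoc _ _ _)) (*-cong (≈-sym (≈-trans (two-pow pK i p) (*-cong ≈-refl (num-2^+ k k)))) ≈-refl)))))))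
            where
            n4 : num (2^ pL) ≈ num 4 * (D * D)
            n4 = ≈-trans (num-2^+ 2 (L ℕ.+ L)) (*-cong ≈-refl (num-2^+ L L))

          E-top : EF $ (K ∷ []) ≤ D * nn K
          E-top = ≤-trans (≤-reflexive (E-at K)) (≤-trans (ΣB-mono L {λ e → ∑ (nn K) (dsqE (fi K) (fi K ∘F (π⟨ K , e ⟩ ∷ [])))} {λ _ → nn K * 1M} λ e →
              ≤-trans (∑-mono (nn K) (dsqE (fi K) (fi K ∘F (π⟨ K , e ⟩ ∷ []))) (conF 1M) λ v _ → ≤-trans (dsq≤ 1M (le v _) (le _ v)) (≤-reflexive (*1 1M))) (≤-reflexive (∑-const (nn K) 1M)))
            (≤-reflexive (≈-trans (ΣB-const L (nn K * 1M)) (*-cong ≈-refl (*1 _)))))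
            where
            le : ∀ v w → f K v ≤ f K w + 1M
            le v w = ≤-trans (≤-trans (≤-reflexive (fK v)) (hit≤1 _)) (≤+ʳ _ _)

          mass-all : ∀ i → i ≤ K → massF $ (0M ∷ []) ≈ tp pM $ (i ∷ []) * massF $ (i ∷ [])
          mass-all = indB K (conF (massF $ (0M ∷ [])) ≈P tp pM ⊗ massF)
            (≈-sym (≈-trans (*-cong (two-pow0 pM) ≈-refl) (1* _)))
            (λ i p h → ≈-trans h (≈-trans (*-cong ≈-refl (≈-trans (mass-at i) (≈-trans (At.mass-step i p) (*-cong (≈-sym (num-2^* m L)) (≈-sym (mass-at (i + 1M)))))))
              (≈-trans (≈-sym (*-assoc _ _ _)) (*-cong (≈-sym (two-pow pM i p)) ≈-refl))))

          -- The vertices of the top graph that lie over `x₀′` form an interval of length `NK`; the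
          -- sum is cut before and after it.
          mass-top : massF $ (K ∷ []) ≈ NK
          mass-top = ≈-trans (mass-at K) (≈-trans (∑-cong (nn K) (fi K) hq λ v _ → fK v) (≈-trans (∑n-cong hq tot) (≈-trans (∑-split a b' hq)
              (≈-trans (+-cong (≈-trans (∑-cong a hq (conF 0M) λ v h → hit-no λ e → ≤⇒≯ (≤-trans (≤-reflexive (*-cong (≈-sym e) ≈-refl)) (proj₁ (quo-spec v (two-pow>0 k K)))) h) (≈-trans (∑-const a 0M) (*0 a)))
                (≈-trans (∑-split NK (rr * NK) h1) (+-cong
                   (≈-trans (∑-cong NK h1 (conF 1M) λ v h → hit-yes (quo-of x₀′ (two-pow>0 k K) (≤+ a v) (<-resp ≈-refl (≈-sym (suc* x₀′ NK)) (suc≤⇒< (≤-trans (≤-reflexive (+-assoc a v 1M)) (+-mono ≤-refl (<⇒suc≤ h))))))) (≈-trans (∑-const NK 1M) (*1 NK)))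
                   (≈-trans (∑-cong (rr * NK) h2 (conF 0M) λ v h → hit-no λ e → ≤⇒≯ (≤-trans (≤-reflexive (suc* x₀′ NK)) (+-mono ≤-refl (≤+ NK v))) (<-≤-trans (proj₂ (quo-spec (a + (NK + v)) (two-pow>0 k K))) (≤-reflexive (*-cong (+-cong e ≈-refl) ≈-refl)))) (≈-trans (∑-const (rr * NK) 0M) (*0 _))))))
                (≈-trans (0+ _) (+0 NK))))))
            where
            a rr b' : M
            a = x₀′ * NK
            rr = proj₁ (slack (<⇒suc≤ x₀<))
            b' = NK + rr * NK
            hq h1 h2 : Fn 1
            hq = hitF ∘F (quoF ∘F (x0 ∷ conF NK ∷ []) ∷ [])
            h1 = hq ∘F (conF a ⊕ x0 ∷ [])
            h2 = h1 ∘F (conF NK ⊕ x0 ∷ [])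
            tot : nn K ≈ a + b'
            tot = ≈-trans (*-cong (≈-sym (proj₂ (slack (<⇒suc≤ x₀<)))) ≈-refl) (solve 3 (λ x d n → ((x :+ con 1) :+ d) :* n := x :* n :+ (n :+ d :* n)) ≈-refl x₀′ rr NK)

      f0 : Fn 1
      f0 = fi 0M

      mass : M
      mass = ∑ n₀ f0

      E0 : M
      E0 = EF $ (0M ∷ [])

      abstract
        private
          t2 DK MK : M
          t2 = two K
          DK = pow t2 L
          MK = pow t2 pM
          mass≈ : mass ≈ MK * NK
          mass≈ = ≈-trans (∑n-cong f0 (≈-sym nn0)) (≈-trans (≈-sym (mass-at 0M)) (≈-trans (mass-all K ≤-refl) (*-cong (powF-ok twoF pM (K ∷ [])) mass-top)))
          NK≈ : NK ≈ (MK * MK) * (DK * DK)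
          NK≈ = ≈-trans (powF-ok twoF k (K ∷ [])) (≈-trans (≡⇒≈ (≡.cong (pow t2) k≡)) (≈-trans (pow-+ (pM ℕ.+ pM) (L ℕ.+ L) t2) (*-cong (pow-+ pM pM t2) (pow-+ L L t2))))
            where
            k≡ : k ≡ (pM ℕ.+ pM) ℕ.+ (L ℕ.+ L)
            k≡ = ℕsolve 2 (λ m l → ((ℕcon 1 :+ℕ m) :+ℕ (ℕcon 1 :+ℕ m)) :*ℕ l :=ℕ (m :*ℕ l :+ℕ m :*ℕ l) :+ℕ (l :+ℕ l)) ≡.refl m L
              where open import Data.Nat.Solver using (module +-*-Solver)
                    open +-*-Solver renaming (solve to ℕsolve; con to ℕcon; _:+_ to _:+ℕ_; _:*_ to _:*ℕ_; _:=_ to _:=ℕ_)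

        mass>0 : 0M < mass
        mass>0 = <-resp ≈-refl (≈-sym mass≈) (*-pos (pow-pos pM (<-≤-trans (<-resp ≈-refl (0+ 1M) (0<suc 0M)) (two≥1 K))) (two-pow>0 k K))

        -- Over all levels `(4 D²)^K * E0 ≤ N^(2K) * E_K`, where `E_K ≤ D * n₀ * N^K` because the
        -- top function is 0 or 1, and `mass = D^(m K) * N^K`. Since `N = D ^ (2 m + 2)`, the powers
        -- of `D` cancel exactly and `4^K` remains.
        energy-bound : (two K * two K) * E0 ≤ (mass * mass) * (n₀ * D)
        energy-bound = *-cancel-≤ (DK * DK) (*-pos DK>0 DK>0) (≤-trans (≤-reflexive
            (≈-trans (solve 3 (λ t e d → ((t :* t) :* e) :* (d :* d) := ((t :* (t :* con 1)) :* (d :* d)) :* e) ≈-refl t2 E0 DK)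
              (*-cong (≈-sym (≈-trans (powF-ok twoF pL (K ∷ [])) (≈-trans (pow-+ 2 (L ℕ.+ L) t2) (*-cong ≈-refl (pow-+ L L t2))))) ≈-refl)))
          (≤-trans (E-all K ≤-refl) (≤-trans (*-mono (≤-refl {tp pK $ (K ∷ [])}) E-top) (≤-reflexive
            (≈-trans (*-cong (≈-trans (powF-ok twoF pK (K ∷ [])) (≈-trans (pow-+ k k t2) (*-cong (≈-sym (powF-ok twoF k (K ∷ []))) (≈-sym (powF-ok twoF k (K ∷ [])))))) ≈-refl)
            (≈-trans (solve 4 (λ n d s r → (n :* n) :* (d :* (s :* r)) := r :* ((n :* n) :* (d :* s))) ≈-refl NK D n₀ NK)
            (≈-trans (*-cong NK≈ ≈-refl) (≈-trans (solve 5 (λ m k n d s → ((m :* m) :* (k :* k)) :* ((n :* n) :* (d :* s)) := (((m :* n) :* (m :* n)) :* (s :* d)) :* (k :* k)) ≈-refl MK DK NK D n₀)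
              (*-cong (*-cong (*-cong (≈-sym mass≈) (≈-sym mass≈)) ≈-refl) ≈-refl)))))))))
          where
          DK>0 : 0M < DK
          DK>0 = pow-pos L (<-≤-trans (<-resp ≈-refl (0+ 1M) (0<suc 0M)) (two≥1 K))

        smooth : ∀ e u → u < n₀ → two K * f0 $ (u ∷ []) ≤ two K * f0 $ (Graph.π Gr₀ e $ (u ∷ []) ∷ []) + mass * (n₀ * D)
        smooth e u u< = stable-≤ λ kk → dsq-root a b λ (δ , a≤ , _ , δδ , _) →
            kk (≤-trans (*-mono (≤-refl {two K}) a≤) (≤-trans (≤-reflexive (*-distribˡ (two K) b δ)) (+-mono ≤-refl
              (sqrt-mono (≤-trans (≤-reflexive (solve 2 (λ t d → (t :* d) :* (t :* d) := (t :* t) :* (d :* d)) ≈-refl (two K) δ))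
                (≤-trans (*-mono ≤-refl (≤-trans (≤-reflexive δδ) term)) (≤-trans energy-bound nD)))))))
          where
          a b : M
          a = f0 $ (u ∷ [])
          b = f0 $ (Graph.π Gr₀ e $ (u ∷ []) ∷ [])
          u<' : u < nn 0M
          u<' = <-resp ≈-refl (≈-sym nn0) u<
          ΣB-term : ∀ n (F : Bits n → M) c → F c ≤ ΣB n F
          ΣB-term zero F [] = ≤-refl
          ΣB-term (suc n) F (false ∷ c) = ≤-trans (ΣB-term n _ c) (≤+ _ _)
          ΣB-term (suc n) F (true ∷ c) = ≤-trans (ΣB-term n _ c) (≤+ʳ _ _)
          term : dsq a b ≤ E0
          term = ≤-trans (≤-reflexive (dsq-cong ≈-refl (cong1 f0 (≈-sym (pi0 e u u<'))))) (≤-trans (term≤∑ (nn 0M) (dsqE (fi 0M) (fi 0M ∘F (π⟨ 0M , e ⟩ ∷ []))) u u<')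
            (≤-trans (ΣB-term L (λ e → ∑ (nn 0M) (dsqE (fi 0M) (fi 0M ∘F (π⟨ 0M , e ⟩ ∷ [])))) e) (≤-reflexive (≈-sym (E-at 0M)))))
          nD≥1 : 1M ≤ n₀ * D
          nD≥1 = ≤-trans (≤-reflexive (≈-sym (0+ 1M))) (<⇒suc≤ (*-pos (≤-<-trans (0≤ _) x₀<) (num>0 L)))
          -- No square root is taken: `n₀ * D` is at least 1 and may be replaced by its square.
          nD : (mass * mass) * (n₀ * D) ≤ (mass * (n₀ * D)) * (mass * (n₀ * D))
          nD = ≤-trans (*-mono ≤-refl (≤-trans (≤-reflexive (≈-sym (*1 _))) (*-mono ≤-refl nD≥1))) (≤-reflexive
            (solve 2 (λ m d → (m :* m) :* (d :* d) := (m :* d) :* (m :* d)) ≈-refl mass (n₀ * D)))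
          sqrt-mono : ∀ {x y} → x * x ≤ y * y → x ≤ y
          sqrt-mono {x} {y} h = by-< stable-≤ y x (λ l → stable-≤ λ _ → ≤⇒≯ h (≤-<-trans (*-mono ≤-refl (proj₁ l)) (*-mono-< x (≤-<-trans (0≤ y) l) l))) id

  -- Walks in the base graph traced by the machine.

  module Walks where
    open Masses public
    open Generators

    resp1 : (P : Pr 1) → ∀ {x y} → x ≈ y → holds P (x ∷ []) → holds P (y ∷ [])
    resp1 P {x} {y} e = respP P {x ∷ []} {y ∷ []} (≈ᵛ-∷ {x = []} {y = []} e λ ())

    abstract
      -- Entering a cell of the cloud appends a digit in base `N`, which the quotient by the larger
      -- power removes again.
      quo-cell : ∀ {x b c} N → 0M < N → 0M < c → b < N → quoF $ (x * N + b ∷ c * N ∷ []) ≈ quoF $ (x ∷ c ∷ [])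
      quo-cell {x} {b} {c} N N>0 c>0 b< = let v = quoF $ (x ∷ c ∷ []) ; p , q = quo-spec x c>0 in
        quo-of v (*-pos c>0 N>0)
          (≤-trans (≤-reflexive (≈-sym (*-assoc v c N))) (≤-trans (*-mono p ≤-refl) (≤+ _ b)))
          (suc≤⇒< (≤-trans (≤-reflexive (+-assoc _ b 1M)) (≤-trans (+-mono ≤-refl (<⇒suc≤ b<)) (≤-trans (≤-reflexive (≈-sym (suc* x N)))
            (≤-trans (*-mono (<⇒suc≤ q) ≤-refl) (≤-reflexive (*-assoc _ c N)))))))

      quo-1 : ∀ x {c} → c ≈ 1M → quoF $ (x ∷ c ∷ []) ≈ x
      quo-1 x e = quo-of x (<-resp (≈-refl) (≈-sym e) (<-resp ≈-refl (0+ 1M) (0<suc 0M))) (≤-reflexive (≈-trans (*-cong ≈-refl e) (*1 x)))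
        (<-resp ≈-refl (≈-sym (≈-trans (*-cong ≈-refl e) (*1 _))) (≤⇒<suc ≤-refl))

      quo< : ∀ {x c n} → 0M < c → x < n * c → quoF $ (x ∷ c ∷ []) < n
      quo< {x} {c} {n} c>0 h = by-< stable-< (quoF $ (x ∷ c ∷ [])) n id λ l → stable-< λ _ → ≤⇒≯ (≤-trans (*-mono l ≤-refl) (proj₁ (quo-spec x c>0))) h

      cell-cancel : ∀ {x b n} N → x * N + b < n * N → x < n
      cell-cancel {x} {b} {n} N h = by-< stable-< x n id λ l → stable-< λ _ → ≤⇒≯ (≤-trans (*-mono l ≤-refl) (≤+ _ b)) h

    module Reach (q m : ℕ) (m≡ : suc m ≡ 24 ℕ.* 8) (t≥4 : 4 ℕ.≤ suc m ℕ.+ suc m)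
                 (g : Bits q → Bits ((suc m ℕ.+ suc m) ℕ.* suc (suc q)))
                 (g-ok : ∀ α → isZero α ≡ false → two^ q ℕ.≤ 4 ℕ.* ones g α)
                 (n₀ : M) (Gr₀ : Graph (suc q) n₀) (x₀′ : M) (x₀< : x₀′ < n₀) where

      Cc : M
      -- `two K` has to exceed `n₀³ * D`: one factor `n₀ * D` is the variation along an edge
      -- relative to the mass, one `n₀` counts the levels and one the vertices in an average.
      Cc = (n₀ * (n₀ * (n₀ * num (2^ (suc (suc q)))))) + 1M
      open Mass q m m≡ t≥4 g g-ok n₀ Gr₀ Cc x₀′ x₀< public
      open Graph Gr₀ using () renaming (π to π₀; π< to π₀<; ππ to ππ₀)

      private
        -- Invariant of all runs, correct or not. That the pending code is 0 or a label is a
        -- disjunction, stated by de Morgan.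
        okP : Pr 1
        okP = (jF ≤P conF K) ∧P (xF <P nnF ∘F (jF ∷ [])) ∧P (¬P ((¬P (cF ≈P conF 0M)) ∧P ⋀B L (λ e → ¬P (cF ≈P conF (lab e)))))
        Ok : M → Set
        Ok p = holds okP (p ∷ [])
        abstract
          toLab : ∀ p → holds (¬P ((¬P (cF ≈P conF 0M)) ∧P ⋀B L (λ e → ¬P (cF ≈P conF (lab e))))) (p ∷ []) → ¬ₒ ¬ₒ isLab (cF $ (p ∷ []))
          toLab p h k = h ((λ z → k (inj₁ z)) , ⋀I L (λ e → ¬P (cF ≈P conF (lab e))) λ e z → k (inj₂ (e , z)))
          ok-of : ∀ {p j c x s a} → p ≈ S⟨ j , c , x , s , a ⟩ → j ≤ K → x < nn j → isLab c → Ok p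
          ok-of {p} h jk xn l = let ej , ec , ex , _ = S-dec h in ≤-resp (≈-sym ej) ≈-refl jk , <-resp (≈-sym ex) (cong1 nnF (≈-sym ej)) xn ,
            λ (n0 , nl) → go n0 nl l ec
            where
            go : ∀ {c} → (¬ₒ (cF $ (p ∷ []) ≈ 0M)) → holds (⋀B L (λ e → ¬P (cF ≈P conF (lab e)))) (p ∷ []) → isLab c → cF $ (p ∷ []) ≈ c → 𝕆
            go n0 nl (inj₁ z) ec = n0 (≈-trans ec z)
            go n0 nl (inj₂ (e , z)) ec = ⋀E L (λ e → ¬P (cF ≈P conF (lab e))) nl e (≈-trans ec z)
          base-of : ∀ {p j c x s a} → p ≈ S⟨ j , c , x , s , a ⟩ → baseF $ (p ∷ []) ≈ quoF $ (x ∷ Np $ (j ∷ []) ∷ [])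
          base-of h = let ej , _ , ex , _ = S-dec h in cong2 quoF ex (cong1 Np ej)

          base0 : ∀ {x j} → j ≈ 0M → quoF $ (x ∷ Np $ (j ∷ []) ∷ []) ≈ x
          base0 e = quo-1 _ (≈-trans (cong1 Np e) (two-pow0 k))

          cell-base : ∀ {x b j} → j < K → b < N → quoF $ (x * N + b ∷ Np $ (j + 1M ∷ []) ∷ []) ≈ quoF $ (x ∷ Np $ (j ∷ []) ∷ [])
          cell-base {x} {b} {j} jk b< = ≈-trans (cong2 quoF ≈-refl (two-pow k j jk)) (quo-cell N (num>0 k) (two-pow>0 k j) b<)

        Near : M → M → Set
        Near v w = ¬ₒ ¬ₒ ((w ≈ v) ⊎ Σ (Bits L) λ e → w ≈ π₀ e $ (v ∷ []))

        abstract
          -- Changing the level passes between a vertex and one of its cells, and the quotient by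
          -- the power of `N` of the level does not notice it; only `walk` touches the base vertex.
          move-ok : ∀ p p' → Ok p → Move p → p' ≈ stepF $ (p ∷ []) → Ok p' × Near (baseF $ (p ∷ [])) (baseF $ (p' ∷ []))
          move-ok p p' o (stay h) e = resp1 okP (≈-sym (≈-trans e h)) o , λ k → k (inj₁ (cong1 baseF (≈-trans e h)))
          move-ok p p' (jk , xn , _) (keep h l ej ex) e = ok-of (≈-trans e h) (≤-resp (≈-sym ej) ≈-refl jk) (<-resp (≈-sym ex) (cong1 nnF (≈-sym ej)) xn) l ,
            λ k → k (inj₁ (≈-trans (base-of (≈-trans e h)) (cong2 quoF ex (cong1 Np ej))))
          move-ok p p' (jk , xn , _) (down {j} {c} {x} {s} {a} {b} h l ej b< ex) e = ok-of (≈-trans e h) (proj₁ j<) (cell-cancel N (<-resp ex (≈-trans (cong1 nnF (≈-sym ej)) (nnS j j<)) xn)) l ,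
            λ k → k (inj₁ (≈-trans (base-of (≈-trans e h)) (≈-sym (≈-trans (cong2 quoF ex (cong1 Np (≈-sym ej))) (cell-base j< b<)))))
            where
            j< : j < K
            j< = suc≤⇒< (≤-resp (≈-sym ej) ≈-refl jk)
          move-ok p p' (jk , xn , _) (up {j} {c} {x} {s} {a} {b} h l j< ej b< ex) e = ok-of (≈-trans e h) (≤-resp (≈-sym ej) ≈-refl (<⇒suc≤ j<))
              (<-resp (≈-sym ex) (≈-trans (≈-sym (nnS _ j<)) (cong1 nnF (≈-sym ej))) (suc≤⇒< (≤-trans (≤-reflexive (+-assoc _ b 1M)) (≤-trans (+-mono ≤-refl (<⇒suc≤ b<)) (≤-trans (≤-reflexive (≈-sym (suc* _ N))) (*-mono (<⇒suc≤ xn) ≤-refl)))))) l ,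
            λ k → k (inj₁ (≈-trans (base-of (≈-trans e h)) (≈-trans (cong2 quoF ex (cong1 Np ej)) (cell-base j< b<))))
          move-ok p p' (jk , xn , _) (walk {c} {x} e₁ h l j0 ex) e = ok-of (≈-trans e h) (0≤ K) (<-resp (≈-sym ex) (≈-sym nn0) (π₀< e₁ _ (<-resp ≈-refl (≈-trans (cong1 nnF j0) nn0) xn))) l ,
            λ k → k (inj₂ (e₁ , ≈-trans (base-of (≈-trans e h)) (≈-trans (base0 ≈-refl) (≈-trans ex (cong1 (π₀ e₁) (≈-sym (base0 j0)))))))

      -- The lazy walk in the base graph traced by the machine on the address α.
      posF : Fn 3
      posF = baseF ∘F (runF ∘F (SF (conF 0M) (conF 0M) x0 (conF 0M) x1 ∷ x2 ∷ []) ∷ [])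

      pos : M → M → M → M
      pos u α τ = posF $ (u ∷ α ∷ τ ∷ [])

      private
        start : M → M → M
        start u α = S⟨ 0M , 0M , u , 0M , α ⟩
        abstract
          ok-run : ∀ u α → u < n₀ → ∀ τ → Ok (run (start u α) τ)
          ok-run u α u< = indP (subP okP (runF ∘F (conF (start u α) ∷ x0 ∷ []) ∷ []))
            (ok-of (run-0 _) (0≤ K) (<-resp ≈-refl (≈-sym nn0) u<) (inj₁ ≈-refl))
            (λ τ o → stableP okP (run (start u α) (τ + 1M) ∷ []) λ k → run-next (start u α) τ λ
              { (inj₁ e) → k (resp1 okP (≈-sym e) o)
              ; (inj₂ e) → toLab _ (proj₂ (proj₂ o)) λ l → moves _ l λ mv → k (proj₁ (move-ok _ _ o mv e)) })

      abstract
        pos-0 : ∀ u α → u < n₀ → pos u α 0M ≈ u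
        pos-0 u α u< = ≈-trans (base-of (run-0 (start u α))) (base0 ≈-refl)

        pos< : ∀ u α τ → u < n₀ → pos u α τ < n₀
        pos< u α τ u< = quo< (two-pow>0 k _) (proj₁ (proj₂ (ok-run u α u< τ)))

        pos-step : ∀ u α τ → u < n₀ → ¬ₒ ¬ₒ ((pos u α (τ + 1M) ≈ pos u α τ) ⊎ Σ (Bits L) λ e → pos u α (τ + 1M) ≈ π₀ e $ (pos u α τ ∷ []))
        pos-step u α τ u< k = run-next (start u α) τ λ
          { (inj₁ e) → k (inj₁ (cong1 baseF e))
          ; (inj₂ e) → toLab _ (proj₂ (proj₂ (ok-run u α u< τ))) λ l → moves _ l λ mv → proj₂ (move-ok _ _ (ok-run u α u< τ) mv e) k }

        -- The equivalence goes in both directions because every step is undone by the same label.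
        pos-closed : ∀ (P : Pr 1) → (∀ v → v < n₀ → holds P (v ∷ []) → ∀ e → holds P (π₀ e $ (v ∷ []) ∷ [])) →
          ∀ u α → u < n₀ → ∀ τ → holds P (u ∷ []) ⇿ holds P (pos u α τ ∷ [])
        pos-closed P cl u α u< = indP PP (resp1 P (≈-sym (pos-0 u α u<)) , resp1 P (pos-0 u α u<))
          (λ τ (a , b) → stableP PP (τ + 1M ∷ []) λ k → pos-step u α τ u< λ
            { (inj₁ e) → k ((λ h → resp1 P (≈-sym e) (a h)) , (λ h → b (resp1 P e h)))
            ; (inj₂ (e₁ , e)) → k ((λ h → resp1 P (≈-sym e) (cl _ (pos< u α τ u<) (a h) e₁))
                , (λ h → b (resp1 P (≈-trans (cong1 (π₀ e₁) e) (ππ₀ e₁ _ (pos< u α τ u<))) (cl _ (pos< u α _ u<) h e₁)))) })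
          where
          Pτ PP : Pr 1
          Pτ = subP P (posF ∘F (conF u ∷ conF α ∷ x0 ∷ []) ∷ [])
          PP = (subP P (conF u ∷ []) ⇒P Pτ) ∧P (Pτ ⇒P subP P (conF u ∷ []))

        -- If no address led to `x₀′`, all terms of the count would vanish.
        reaches : ∀ u → u < n₀ → 0M < f0 $ (u ∷ []) → Σ M λ α → α ≤ RK 0M × (pos u α (W 0M) ≈ x₀′)
        reaches u u< h = stableP (∃P (conF (RK 0M)) (posF ∘F (conF u ∷ x0 ∷ conF (W 0M) ∷ []) ≈P conF x₀′)) [] λ none →
          proj₂ h (≈-sym (≈-trans (f-∑ 0M u) (≈-trans (∑-cong (RK 0M) (hE 0M u) (conF 0M) λ α α< → hit-no λ e → none (α , proj₁ α< , ≈-trans (≈-sym (end-def 0M u α)) e))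
            (≈-trans (∑-const (RK 0M) 0M) (*0 _)))))

  -- Level sets, and closure of the support under edges.

  module Supports where
    open Walks public
    open Generators

    module Support (q m : ℕ) (m≡ : suc m ≡ 24 ℕ.* 8) (t≥4 : 4 ℕ.≤ suc m ℕ.+ suc m)
                   (g : Bits q → Bits ((suc m ℕ.+ suc m) ℕ.* suc (suc q)))
                   (g-ok : ∀ α → isZero α ≡ false → two^ q ℕ.≤ 4 ℕ.* ones g α)
                   (n₀ : M) (Gr₀ : Graph (suc q) n₀) (x₀′ : M) (x₀< : x₀′ < n₀) where
      open Reach q m m≡ t≥4 g g-ok n₀ Gr₀ x₀′ x₀< public
      open Graph Gr₀ using () renaming (π to π₀; π< to π₀<; ππ to ππ₀)

      private
        Δ : M
        Δ = mass * (n₀ * D)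
        lev : M → Pr 1
        lev j = conF (j * Δ) <P conF (two K) ⊗ f0
        levF : Fn 2
        levF = ite (x0 ⊗ conF Δ <P conF (two K) ⊗ f0 ∘F (x1 ∷ [])) (conF 1M) (conF 0M)
        levP : Pr 2
        levP = x0 ⊗ conF Δ <P conF (two K) ⊗ f0 ∘F (x1 ∷ [])
        cntF : Fn 1
        cntF = sumF levF ∘F (x0 ∷ conF n₀ ∷ [])
        rowF : M → Fn 1
        rowF j = levF ∘F (conF j ∷ x0 ∷ [])
        -- No vertex has `two K * f0` above `j * Δ` and at most `(j + 1M) * Δ`. By `smooth` an edge
        -- cannot lower the value by more than `Δ`, so the level set at a gap cannot be left.
        Gap : M → Set
        Gap j = ∀ u → u < n₀ → holds (lev j) (u ∷ []) → holds (lev (j + 1M)) (u ∷ [])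
        abstract
          lev1 : ∀ {j u} → holds levP (j ∷ u ∷ []) → levF $ (j ∷ u ∷ []) ≈ 1M
          lev1 h = ite-yes levP (conF 1M) (conF 0M) h
          lev0 : ∀ {j u} → (¬ₒ holds levP (j ∷ u ∷ [])) → levF $ (j ∷ u ∷ []) ≈ 0M
          lev0 h = ite-no levP (conF 1M) (conF 0M) h
          cnt≈ : ∀ j → cntF $ (j ∷ []) ≈ ∑ n₀ (rowF j)
          cnt≈ j = ∑-param levF j n₀

          lev-dec : ∀ {j u} → holds levP (j + 1M ∷ u ∷ []) → holds levP (j ∷ u ∷ [])
          lev-dec {j} h = ≤-<-trans (*-mono (≤+ j 1M) ≤-refl) h

          drop : ∀ j u → u < n₀ → holds (lev j) (u ∷ []) → (¬ₒ holds (lev (j + 1M)) (u ∷ [])) → cntF $ (j + 1M ∷ []) + 1M ≤ cntF $ (j ∷ [])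
          drop j u u< h n = ≤-trans (+-mono (≤-reflexive (cnt≈ (j + 1M))) (≤-reflexive (≈-sym (∑-eq n₀ u (conF 1M) u<))))
            (≤-trans (≤-reflexive (≈-sym (∑-⊕ n₀ (rowF (j + 1M)) ind1))) (≤-trans (∑-mono n₀ (rowF (j + 1M) ⊕ ind1) (rowF j) le) (≤-reflexive (≈-sym (cnt≈ j)))))
            where
            ind1 : Fn 1
            ind1 = eqF ∘F (x0 ∷ conF u ∷ []) ⊗ conF 1M
            le : ∀ v → v < n₀ → levF $ (j + 1M ∷ v ∷ []) + eqF $ (v ∷ u ∷ []) * 1M ≤ levF $ (j ∷ v ∷ [])
            le v _ = by-em (v ≈ u) stable-≤
              (λ e → ≤-reflexive (≈-trans (+-cong (≈-trans (cong2 levF ≈-refl e) (lev0 n)) (≈-trans (*1 _) (eq-yes e))) (≈-trans (0+ 1M) (≈-sym (≈-trans (cong2 levF ≈-refl e) (lev1 h))))))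
              (λ ne → ≤-trans (≤-reflexive (≈-trans (+-cong ≈-refl (≈-trans (*1 _) (eq-no ne))) (+0 _)))
                 (by-em (holds levP (j + 1M ∷ v ∷ [])) stable-≤ (λ y → ≤-reflexive (≈-trans (lev1 y) (≈-sym (lev1 (lev-dec y))))) (λ y → ≤-trans (≤-reflexive (lev0 y)) (0≤ _))))

          -- Otherwise `two K * mass` would be at most `n₀ * (n₀ * Δ)`, which is `n₀³ * D * mass`;
          -- the choice of `Cc` excludes this.
          big : Σ M λ u → u ≤ n₀ × u < n₀ × (n₀ * Δ < two K * f0 $ (u ∷ []))
          big = stableP (∃P (conF n₀) ((x0 <P conF n₀) ∧P (conF (n₀ * Δ) <P conF (two K) ⊗ f0))) [] λ none →
            ≤⇒≯ (≤-trans (≤-reflexive (≈-sym (∑-⊗ n₀ (two K) f0))) (≤-trans (∑-mono n₀ (conF (two K) ⊗ f0) (conF (n₀ * Δ)) λ u u< → ≮⇒≥ λ h → none (u , proj₁ u< , u< , h))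
              (≤-reflexive (≈-trans (∑-const n₀ (n₀ * Δ)) (solve 3 (λ n m d → n :* (n :* (m :* (n :* d))) := (n :* (n :* (n :* d))) :* m) ≈-refl n₀ mass D)))))
              (*-mono-< mass mass>0 (<-≤-trans (≤⇒<suc ≤-refl) twoK))

          no-gap : ∀ j → (¬ₒ Gap j) → cntF $ (j + 1M ∷ []) + 1M ≤ cntF $ (j ∷ [])
          no-gap j ng = stable-≤ λ k → ng λ u u< h → stableP (lev (j + 1M)) (u ∷ []) λ n → k (drop j u u< h n)

          cnt0≤ : cntF $ (0M ∷ []) ≤ n₀
          cnt0≤ = ≤-trans (≤-reflexive (cnt≈ 0M)) (≤-trans (∑-mono n₀ (rowF 0M) (conF 1M) le1) (≤-reflexive (≈-trans (∑-const n₀ 1M) (*1 n₀))))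
            where
            le1 : ∀ v → v < n₀ → levF $ (0M ∷ v ∷ []) ≤ 1M
            le1 v _ = by-em (holds levP (0M ∷ v ∷ [])) stable-≤ (λ y → ≤-reflexive (lev1 y)) (λ y → ≤-trans (≤-reflexive (lev0 y)) (0≤ _))

          cnt-n≥ : 1M ≤ cntF $ (n₀ ∷ [])
          cnt-n≥ = let u , _ , u< , h = big in ≤-trans (≤-reflexive (≈-sym (lev1 {n₀} {u} h))) (≤-trans (term≤∑ n₀ (rowF n₀) u u<) (≤-reflexive (≈-sym (cnt≈ n₀))))

          move1 : ∀ c j → c + (j + 1M) ≈ (c + 1M) + j
          move1 = solve 2 (λ c j → c :+ (j :+ con 1) := (c :+ con 1) :+ j) ≈-refl

          steps : (∀ j → j ≤ n₀ → ¬ₒ Gap j) → ∀ j → j ≤ n₀ → cntF $ (j ∷ []) + j ≤ cntF $ (0M ∷ [])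
          steps ng = indB n₀ (cntF ⊕ x0 ≤P conF (cntF $ (0M ∷ []))) (≤-reflexive (+0 (cntF $ (0M ∷ []))))
            (λ j p ih → ≤-trans (≤-reflexive (move1 (cntF $ (j + 1M ∷ [])) j)) (≤-trans (+-mono (no-gap j (ng j (proj₁ p))) (≤-refl {j})) ih))

          -- Some level below n₀ is not the value of any vertex up to Δ: the n₀ + 1 level sets cannot all be distinct.
          gap : ¬ₒ ¬ₒ (Σ M λ j → j ≤ n₀ × Gap j)
          gap none = ≤⇒≯ (≤-trans (steps (λ j p h → none (j , p , h)) n₀ ≤-refl) cnt0≤)
            (suc≤⇒< (≤-trans (≤-reflexive (+-comm n₀ 1M)) (+-mono cnt-n≥ (≤-refl {n₀}))))

          gap-closed : ∀ j → Gap j → ∀ v → v < n₀ → holds (lev j) (v ∷ []) → ∀ e → holds (lev j) (π₀ e $ (v ∷ []) ∷ [])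
          gap-closed j gp v v< h e = suc≤⇒< (+-cancel-≤ Δ (≤-trans (≤-reflexive (≈-trans (solve 3 (λ d j o → d :+ (j :* d :+ o) := (j :* d :+ d) :+ o) ≈-refl Δ j 1M) (+-cong (≈-sym (suc* j Δ)) ≈-refl)))
            (≤-trans (<⇒suc≤ (gp v v< h)) (≤-trans (smooth e v v<) (≤-reflexive (+-comm _ Δ))))))

          pos-lev : ∀ {j u} → holds (lev j) (u ∷ []) → 0M < f0 $ (u ∷ [])
          pos-lev {j} {u} h = ≉0⇒> λ z → ≤⇒≯ (0≤ _) (<-resp ≈-refl (≈-trans (*-cong ≈-refl z) (*0 _)) h)

          -- Both walks end at `x₀′`. A closed set is carried along the first walk to `x₀′` and back
          -- along the second.
          meet : ∀ j → Gap j → ∀ u α w β → u < n₀ → w < n₀ → pos u α (W 0M) ≈ x₀′ → pos w β (W 0M) ≈ x₀′ →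
            holds (lev j) (w ∷ []) → holds (lev j) (u ∷ [])
          meet j gp u α w β u< w< eα eβ h = proj₂ (pos-closed (lev j) (gap-closed j gp) u α u< (W 0M))
            (resp1 (lev j) (≈-trans eβ (≈-sym eα)) (proj₁ (pos-closed (lev j) (gap-closed j gp) w β w< (W 0M)) h))

          BigLev : M → Set
          BigLev j = Σ M λ w → w < n₀ × holds (lev j) (w ∷ []) × Σ M λ β → pos w β (W 0M) ≈ x₀′

          bigLev : ∀ j → j ≤ n₀ → BigLev j
          bigLev j jn = let w , _ , w< , hw = big ; β , _ , eβ = reaches w w< (pos-lev {n₀} {w} hw) in
            w , w< , ≤-<-trans (*-mono jn ≤-refl) hw , β , eβ

          -- At a gap the level set is closed and, by `big`, inhabited. Every vertex of the support
          -- is joined to it through `x₀′`, so the level set is the whole support.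
          lev-pos : ∀ j → BigLev j → Gap j → ∀ u → u < n₀ → 0M < f0 $ (u ∷ []) → holds (lev j) (u ∷ [])
          lev-pos j (w , w< , hw , β , eβ) gp u u< h = let α , _ , eα = reaches u u< h in meet j gp u α w β u< w< eα eβ hw

          x₀-pos : ∀ j → BigLev j → Gap j → 0M < f0 $ (x₀′ ∷ [])
          x₀-pos j (w , w< , hw , β , eβ) gp = pos-lev {j} {x₀′} (resp1 (lev j) eβ (proj₁ (pos-closed (lev j) (gap-closed j gp) w β w< (W 0M)) hw))

      abstract
        support-closed : ∀ u → u < n₀ → 0M < f0 $ (u ∷ []) → ∀ e → 0M < f0 $ (π₀ e $ (u ∷ []) ∷ [])
        support-closed u u< h e = stable-< λ k → gap λ (j , jn , gp) → k (pos-lev {j} {π₀ e $ (u ∷ [])} (gap-closed j gp u u< (lev-pos j (bigLev j jn) gp u u< h) e))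

        support-x₀ : 0M < f0 $ (x₀′ ∷ [])
        support-x₀ = stable-< λ k → gap λ (j , jn , gp) → k (x₀-pos j (bigLev j jn) gp)

  -- The base graph of constant degree.

  module BaseGraph where
    open Supports public

    -- The vertex u of G on [0,a] is replaced by the cloud {u} × [0,a]. The two reflections of a cloud generate
    -- its shifts, and (u,w) is joined to (w,u) when {u,w} is an edge.
    module Base (q : ℕ) (a : M) (G : S) (und : ∀ u → u ≤ a → ∀ v → v ≤ a → pr u v ∈M G → pr v u ∈M G) where
      n n² : M
      n = a + 1M
      n² = n * n

      private
        module DV = Div n (0<suc a)

      uF wF : Fn 1
      uF = DV.divF
      wF = DV.modF

      ⟪_,_⟫ : M → M → M
      ⟪ u , w ⟫ = u * n + w

      private
        mk : Fn 1 → Fn 1 → Fn 1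
        mk u w = u ⊗ conF n ⊕ w
        r1 r2 sw r2i swi : Fn 1
        r1 = mk uF (conF a ∸F wF)
        r2i = mk uF (conF n ∸F wF)
        r2 = ite (wF ≈P conF 0M) x0 r2i
        swi = mk wF uF
        sw = ite (prF uF wF ∈P G) swi x0

      abstract
        u-of : ∀ {v} u w → w ≤ a → v ≈ ⟪ u , w ⟫ → uF $ (v ∷ []) ≈ u
        u-of u w p e = DV.div-of u w (≤⇒<suc p) e

        w-of : ∀ {v} u w → w ≤ a → v ≈ ⟪ u , w ⟫ → wF $ (v ∷ []) ≈ w
        w-of u w p e = DV.mod-of u w (≤⇒<suc p) e

        vert< : ∀ {u w} → u ≤ a → w ≤ a → ⟪ u , w ⟫ < n²
        vert< {u} {w} p q = suc≤⇒< (≤-trans (≤-reflexive (+-assoc _ w 1M)) (≤-trans (+-mono (≤-refl {u * n}) (+-mono q ≤-refl))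
          (≤-trans (≤-reflexive (≈-sym (suc* u n))) (*-mono (+-mono p ≤-refl) ≤-refl))))

        split : ∀ v → v < n² → Σ M λ u → Σ M λ w → u ≤ a × w ≤ a × v ≈ ⟪ u , w ⟫
        split v h = let u , w , w< , e = DV.divmod v in
          u , w , <suc⇒≤ (by-< stable-< u n id λ l → stable-< λ _ → ≤⇒≯ (≤-trans (*-mono l ≤-refl) (≤-trans (≤+ _ w) (≤-reflexive (≈-sym e)))) h) , <suc⇒≤ w< , e

        u≤a : ∀ v → v < n² → uF $ (v ∷ []) ≤ a
        u≤a v h = let u , w , p , q , e = split v h in ≤-resp (≈-sym (u-of u w q e)) ≈-refl p

      abstract
        -- Three prefixes carry the edges. All other labels are identities, which pad the degree to
        -- the power of two that the generators dictate and supply the loops.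
        piB : Bits (suc (suc (suc q))) → Fn 1
        piB (true ∷ _)                  = x0
        piB (false ∷ false ∷ false ∷ _) = r1
        piB (false ∷ false ∷ true ∷ _)  = r2
        piB (false ∷ true ∷ false ∷ _)  = sw
        piB (false ∷ true ∷ true ∷ _)   = x0

        on-r1 : ∀ j {v} u w → w ≤ a → v ≈ ⟪ u , w ⟫ → piB (false ∷ false ∷ false ∷ j) $ (v ∷ []) ≈ ⟪ u , a ∸ w ⟫
        on-r1 j u w p e = +-cong (*-cong (u-of u w p e) ≈-refl) (cong2 monusF ≈-refl (w-of u w p e))

        on-r2-0 : ∀ j {v} u w → w ≤ a → w ≈ 0M → v ≈ ⟪ u , w ⟫ → piB (false ∷ false ∷ true ∷ j) $ (v ∷ []) ≈ v
        on-r2-0 j u w p z e = ite-yes (wF ≈P conF 0M) x0 r2i (≈-trans (w-of u w p e) z)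

        on-r2 : ∀ j {v} u w → w ≤ a → (¬ₒ w ≈ 0M) → v ≈ ⟪ u , w ⟫ → piB (false ∷ false ∷ true ∷ j) $ (v ∷ []) ≈ ⟪ u , n ∸ w ⟫
        on-r2 j u w p z e = ≈-trans (ite-no (wF ≈P conF 0M) x0 r2i λ h → z (≈-trans (≈-sym (w-of u w p e)) h))
          (+-cong (*-cong (u-of u w p e) ≈-refl) (cong2 monusF ≈-refl (w-of u w p e)))

        on-sw : ∀ j {v} u w → w ≤ a → pr u w ∈M G → v ≈ ⟪ u , w ⟫ → piB (false ∷ true ∷ false ∷ j) $ (v ∷ []) ≈ ⟪ w , u ⟫
        on-sw j u w p m e = ≈-trans (ite-yes (prF uF wF ∈P G) swi x0 (∈-resp (pr-cong (≈-sym (u-of u w p e)) (≈-sym (w-of u w p e))) m))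
          (+-cong (*-cong (w-of u w p e) ≈-refl) (u-of u w p e))

        on-sw-no : ∀ j {v} u w → w ≤ a → (¬ₒ pr u w ∈M G) → v ≈ ⟪ u , w ⟫ → piB (false ∷ true ∷ false ∷ j) $ (v ∷ []) ≈ v
        on-sw-no j u w p m e = ite-no (prF uF wF ∈P G) swi x0 λ h → m (∈-resp (pr-cong (u-of u w p e) (w-of u w p e)) h)

        on-loop : ∀ j v → piB (true ∷ j) $ (v ∷ []) ≈ v
        on-loop j v = ≈-refl

        on-id : ∀ j v → piB (false ∷ true ∷ true ∷ j) $ (v ∷ []) ≈ v
        on-id j v = ≈-refl

        a∸≤ : ∀ {w} → w ≤ a → a ∸ w ≤ a
        a∸≤ p = ≤-trans (≤+ʳ _ _) (≤-reflexive (∸-+ p))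

        n∸≤ : ∀ {w} → w ≤ a → (¬ₒ w ≈ 0M) → n ∸ w ≤ a
        n∸≤ {w} p z = <suc⇒≤ (suc≤⇒< (≤-trans (+-mono ≤-refl (≤-trans (≤-reflexive (≈-sym (0+ 1M))) (<⇒suc≤ (≉0⇒> z)))) (≤-reflexive (≈-trans (+-comm _ w) (∸-+ (≤-trans p (≤+ a 1M)))))))

        ∸∸ : ∀ {x y} → y ≤ x → x ∸ (x ∸ y) ≈ y
        ∸∸ {x} {y} p = ∸-of y (≈-trans (+-comm _ y) (∸-+ p))

        -- Projected to `G`, an edge inside a cloud is a pause and an edge between clouds is an edge
        -- of `G`; walks in the base graph thus become lazy walks in `G`.
        piB-moves : ∀ e v → v < n² → ¬ₒ ¬ₒ ((uF $ (piB e $ (v ∷ []) ∷ []) ≈ uF $ (v ∷ [])) ⊎ (pr (uF $ (v ∷ [])) (uF $ (piB e $ (v ∷ []) ∷ [])) ∈M G))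
        piB-moves (true ∷ j) v h k = k (inj₁ (cong1 uF (on-loop j v)))
        piB-moves (false ∷ false ∷ false ∷ j) v h k = let u , w , p , q , e = split v h in
          k (inj₁ (≈-trans (u-of u (a ∸ w) (a∸≤ q) (on-r1 j u w q e)) (≈-sym (u-of u w q e))))
        piB-moves (false ∷ false ∷ true ∷ j) v h k = let u , w , p , q , e = split v h in by-em (w ≈ 0M) stable-𝕆
          (λ z → k (inj₁ (cong1 uF (on-r2-0 j u w q z e))))
          (λ z → k (inj₁ (≈-trans (u-of u (n ∸ w) (n∸≤ q z) (on-r2 j u w q z e)) (≈-sym (u-of u w q e)))))
        piB-moves (false ∷ true ∷ false ∷ j) v h k = let u , w , p , q , e = split v h in by-em (pr u w ∈M G) stable-𝕆
          (λ m → k (inj₂ (∈-resp (pr-cong (≈-sym (u-of u w q e)) (≈-sym (u-of w u p (on-sw j u w q m e)))) m)))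
          (λ m → k (inj₁ (cong1 uF (on-sw-no j u w q m e))))
        piB-moves (false ∷ true ∷ true ∷ j) v h k = k (inj₁ (cong1 uF (on-id j v)))

        piB< : ∀ e v → v < n² → piB e $ (v ∷ []) < n²
        piB< (true ∷ j) v h = <-resp (≈-sym (on-loop j v)) ≈-refl h
        piB< (false ∷ false ∷ false ∷ j) v h = let u , w , p , q , e = split v h in <-resp (≈-sym (on-r1 j u w q e)) ≈-refl (vert< p (a∸≤ q))
        piB< (false ∷ false ∷ true ∷ j) v h = let u , w , p , q , e = split v h in by-em (w ≈ 0M) stable-<
          (λ z → <-resp (≈-sym (on-r2-0 j u w q z e)) ≈-refl h) (λ z → <-resp (≈-sym (on-r2 j u w q z e)) ≈-refl (vert< p (n∸≤ q z)))
        piB< (false ∷ true ∷ false ∷ j) v h = let u , w , p , q , e = split v h in by-em (pr u w ∈M G) stable-<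
          (λ m → <-resp (≈-sym (on-sw j u w q m e)) ≈-refl (vert< q p)) (λ m → <-resp (≈-sym (on-sw-no j u w q m e)) ≈-refl h)
        piB< (false ∷ true ∷ true ∷ j) v h = <-resp (≈-sym (on-id j v)) ≈-refl h

        piBpiB : ∀ e v → v < n² → piB e $ (piB e $ (v ∷ []) ∷ []) ≈ v
        piBpiB (true ∷ j) v h = ≈-trans (on-loop j _) (on-loop j v)
        piBpiB (false ∷ false ∷ false ∷ j) v h = let u , w , p , q , e = split v h in
          ≈-trans (on-r1 j u (a ∸ w) (a∸≤ q) (on-r1 j u w q e)) (≈-trans (+-cong ≈-refl (∸∸ q)) (≈-sym e))
        piBpiB (false ∷ false ∷ true ∷ j) v h = let u , w , p , q , e = split v h in by-em (w ≈ 0M) stable-≈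
          (λ z → ≈-trans (cong1 (piB (false ∷ false ∷ true ∷ j)) (on-r2-0 j u w q z e)) (on-r2-0 j u w q z e))
          (λ z → ≈-trans (on-r2 j u (n ∸ w) (n∸≤ q z) (λ y → ≤⇒≯ q (suc≤⇒< (≤-reflexive (≈-trans (≈-sym (∸-+ (≤-trans q (≤+ a 1M)))) (≈-trans (+-cong ≈-refl y) (+0 w)))))) (on-r2 j u w q z e))
             (≈-trans (+-cong ≈-refl (∸∸ (≤-trans q (≤+ a 1M)))) (≈-sym e)))
        piBpiB (false ∷ true ∷ false ∷ j) v h = let u , w , p , q , e = split v h in by-em (pr u w ∈M G) stable-≈
          (λ m → ≈-trans (on-sw j w u p (und u p w q m) (on-sw j u w q m e)) (≈-sym e))
          (λ m → ≈-trans (cong1 (piB (false ∷ true ∷ false ∷ j)) (on-sw-no j u w q m e)) (on-sw-no j u w q m e))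
        piBpiB (false ∷ true ∷ true ∷ j) v h = ≈-trans (on-id j _) (on-id j v)

      baseG : Graph (suc (suc q)) n²
      baseG = record { π = piB ; π< = piB< ; ππ = piBpiB ; loop = λ e v _ → on-loop e v }

      module Closure (P : Pr 1) (cl : ∀ v → v < n² → holds P (v ∷ []) → ∀ e → holds P (piB e $ (v ∷ []) ∷ [])) where
        private
          zs : Bits q
          zs = Data.Vec.replicate q false
            where import Data.Vec
          e1 e2 e3 : Bits (suc (suc (suc q)))
          e1 = false ∷ false ∷ false ∷ zs
          e2 = false ∷ false ∷ true ∷ zs
          e3 = false ∷ true ∷ false ∷ zs
          abstract
            up : ∀ u w → u ≤ a → w < a → holds P (⟪ u , w ⟫ ∷ []) → holds P (⟪ u , w + 1M ⟫ ∷ [])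
            up u w p q h = resp1 P (≈-trans (on-r2 zs u (a ∸ w) (a∸≤ (proj₁ q)) nz′ (on-r1 zs u w (proj₁ q) ≈-refl)) (+-cong ≈-refl
                (∸-of (w + 1M) (≈-trans (solve 2 (λ d w → d :+ (w :+ con 1) := (w :+ d) :+ con 1) ≈-refl (a ∸ w) w) (+-cong (∸-+ (proj₁ q)) ≈-refl)))))
              (cl _ (piB< e1 _ (vert< p (proj₁ q))) (cl _ (vert< p (proj₁ q)) h e1) e2)
              where
              nz′ : ¬ₒ (a ∸ w ≈ 0M)
              nz′ z = proj₂ q (≈-trans (≈-sym (+0 w)) (≈-trans (+-cong ≈-refl (≈-sym z)) (∸-+ (proj₁ q))))
            down : ∀ u w → u ≤ a → w < a → holds P (⟪ u , w + 1M ⟫ ∷ []) → holds P (⟪ u , w ⟫ ∷ [])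
            down u w p q h = resp1 P (≈-trans (on-r1 zs u (n ∸ (w + 1M)) (n∸≤ (<⇒suc≤ q) (suc≉0 w)) (on-r2 zs u (w + 1M) (<⇒suc≤ q) (suc≉0 w) ≈-refl))
                (+-cong ≈-refl (∸-of w (suc-inj _ _ (≈-trans (solve 2 (λ d w → (d :+ w) :+ con 1 := (w :+ con 1) :+ d) ≈-refl (n ∸ (w + 1M)) w) (∸-+ (+-mono (proj₁ q) ≤-refl)))))))
              (cl _ (piB< e2 _ (vert< p (<⇒suc≤ q))) (cl _ (vert< p (<⇒suc≤ q)) h e2) e1)
            to0 : ∀ u → u ≤ a → ∀ w → w ≤ a → holds P (⟪ u , w ⟫ ∷ []) → holds P (⟪ u , 0M ⟫ ∷ [])
            to0 u p = indB a (subP P (conF u ⊗ conF n ⊕ x0 ∷ []) ⇒P subP P (conF u ⊗ conF n ⊕ conF 0M ∷ [])) id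
              (λ w q ih h → ih (down u w p q h))
            from0 : ∀ u → u ≤ a → holds P (⟪ u , 0M ⟫ ∷ []) → ∀ w → w ≤ a → holds P (⟪ u , w ⟫ ∷ [])
            from0 u p h = indB a (subP P (conF u ⊗ conF n ⊕ x0 ∷ [])) h (λ w q ih → up u w p q ih)
        abstract
          -- The first reflection followed by the second sends `w` to `w + 1M`, and in the other
          -- order they go back. So `P` spreads over the cloud of `u` through its vertex 0, in
          -- particular to `⟪ u , v ⟫`, where the switching label applies.
          cross : ∀ u w v → u ≤ a → w ≤ a → v ≤ a → pr u v ∈M G → holds P (⟪ u , w ⟫ ∷ []) → holds P (⟪ v , u ⟫ ∷ [])
          cross u w v p q r m h = resp1 P (on-sw zs u v r m ≈-refl) (cl _ (vert< p r) (from0 u p (to0 u p w q h) v r) e3)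

  -- Definable choice of walks and removal of pauses.

  module LazyWalks where
    open BaseGraph public
    open Generators

    -- The value is 0 if there is no witness.
    module Min (P : Pr 2) (B : M) where
      private
        some : Pr 1
        some = ∃P (conF B) P
        R : Pr 2
        R = (weakP some ⇒P (P ∧P ∀P x0 ((x0 <P x1) ⇒P (¬P (subP P (x0 ∷ x2 ∷ [])))))) ∧P (¬P (weakP some) ⇒P (x0 ≈P conF 0M))
        abstract
          ex : ∀ x → Σ M λ y → y ≤ B × holds R (y ∷ x)
          ex (u ∷ []) = stableP (∃P (conF B) R) (u ∷ []) λ k → by-em (holds some (u ∷ [])) stable-𝕆
            (λ s@(z , z≤ , h) → let y , y≤ , p , l = least (subP P (x0 ∷ conF u ∷ [])) z h in
              k (y , ≤-trans y≤ z≤ , (λ _ → p , λ w _ w< → l w w<) , λ n → stable-≈ λ _ → n s))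
            (λ n → k (0M , 0≤ B , (λ s → stableP (P ∧P ∀P x0 ((x0 <P x1) ⇒P (¬P (subP P (x0 ∷ x2 ∷ []))))) (0M ∷ u ∷ []) λ _ → n s) , λ _ → ≈-refl))
          un : ∀ x y z → holds R (y ∷ x) → holds R (z ∷ x) → y ≈ z
          un (u ∷ []) y z (a , b) (c , d) = by-em (holds some (u ∷ [])) stable-≈
            (λ s → let p , l = a s ; p' , l' = c s in by-< stable-≈ y z (λ h → stable-≈ λ _ → l' y (proj₁ h) h p)
              λ h → by-< stable-≈ z y (λ h' → stable-≈ λ _ → l z (proj₁ h') h' p') λ h' → ≤-antisym h' h)
            (λ n → ≈-trans (b n) (≈-sym (d n)))
      abstract
        minF : Fn 1
        minF = search R (conF B) ex un
        min-ok : ∀ u → (Σ M λ y → y ≤ B × holds P (y ∷ u ∷ [])) → holds P (minF $ (u ∷ []) ∷ u ∷ [])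
        min-ok u s = proj₁ (proj₁ (proj₂ (proj₂ (ex (u ∷ [])))) s)

    module Walk (q m : ℕ) (m≡ : suc m ≡ 24 ℕ.* 8) (t≥4 : 4 ℕ.≤ suc m ℕ.+ suc m)
                (g : Bits (suc q) → Bits ((suc m ℕ.+ suc m) ℕ.* suc (suc (suc q))))
                (g-ok : ∀ α → isZero α ≡ false → two^ (suc q) ℕ.≤ 4 ℕ.* ones g α)
                (a : M) (G : S) (und : ∀ u → u ≤ a → ∀ v → v ≤ a → pr u v ∈M G → pr v u ∈M G)
                (x : M) (x≤a : x ≤ a) where
      open Base q a G und
      private
        module R = Support (suc q) m m≡ t≥4 g g-ok n² baseG ⟪ x , 0M ⟫ (vert< x≤a (0≤ a))
      open R using (f0; pos; posF; W; RK)

      Tt : M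
      Tt = W 0M

      -- The cloud of u meets the support of f0.
      HP : Pr 1
      HP = (x0 ≤P conF a) ∧P ∃P (conF a) (conF 0M <P f0 ∘F (x1 ⊗ conF n ⊕ x0 ∷ []))

      private
        -- The support provides some cloud vertex and some address for each `u`, but a definable
        -- function of `u` is required; the pair with the least code is selected.
        selP : Pr 2
        selP = (fstF ∘F (x0 ∷ []) ≤P conF a) ∧P (posF ∘F (x1 ⊗ conF n ⊕ fstF ∘F (x0 ∷ []) ∷ sndF ∘F (x0 ∷ []) ∷ conF Tt ∷ []) ≈P conF ⟪ x , 0M ⟫)
        module Sel = Min selP (pr a (RK 0M))

      -- The machine walks towards `x` while the path has to start there, so time runs backwards.
      yF : Fn 2
      yF = uF ∘F (posF ∘F (x0 ⊗ conF n ⊕ fstF ∘F (Sel.minF ∘F (x0 ∷ []) ∷ []) ∷ sndF ∘F (Sel.minF ∘F (x0 ∷ []) ∷ []) ∷ conF Tt ∸F x1 ∷ []) ∷ [])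

      y⟨_,_⟩ : M → M → M
      y⟨ u , τ ⟩ = yF $ (u ∷ τ ∷ [])

      private
        wu αu vu : M → M
        wu u = fst (Sel.minF $ (u ∷ []))
        αu u = snd (Sel.minF $ (u ∷ []))
        vu u = ⟪ u , wu u ⟫
        abstract
          sel-ok : ∀ u → holds HP (u ∷ []) → wu u ≤ a × (pos (vu u) (αu u) Tt ≈ ⟪ x , 0M ⟫)
          sel-ok u (ua , w , wa , h) = let α , α≤ , e = R.reaches ⟪ u , w ⟫ (vert< ua wa) h in
            Sel.min-ok u (pr w α , pr-mono wa α≤ , ≤-resp (≈-sym (fst-pr w α ≈-refl)) ≈-refl wa
              , ≈-trans (cong3 posF (+-cong ≈-refl (fst-pr w α ≈-refl)) (snd-pr w α ≈-refl) ≈-refl) e)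
          vu< : ∀ u → holds HP (u ∷ []) → vu u < n²
          vu< u h = vert< (proj₁ h) (proj₁ (sel-ok u h))

      abstract
        y-start : ∀ u → holds HP (u ∷ []) → y⟨ u , 0M ⟩ ≈ x
        y-start u h = ≈-trans (cong1 uF (≈-trans (cong3 posF ≈-refl ≈-refl (∸-of Tt (0+ Tt))) (proj₂ (sel-ok u h)))) (u-of x 0M (0≤ a) ≈-refl)

        y-end : ∀ u → holds HP (u ∷ []) → y⟨ u , Tt ⟩ ≈ u
        y-end u h = ≈-trans (cong1 uF (≈-trans (cong3 posF ≈-refl ≈-refl (∸-0 ≤-refl)) (R.pos-0 (vu u) (αu u) (vu< u h)))) (u-of u (wu u) (proj₁ (sel-ok u h)) ≈-refl)

        y≤a : ∀ u τ → holds HP (u ∷ []) → y⟨ u , τ ⟩ ≤ a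
        y≤a u τ h = u≤a _ (R.pos< (vu u) (αu u) _ (vu< u h))

        -- Because of the reversed time an edge of the machine's walk is crossed in the opposite
        -- direction, and the symmetry of `G` turns it round.
        y-step : ∀ u τ → holds HP (u ∷ []) → τ < Tt → (¬ₒ (y⟨ u , τ + 1M ⟩ ≈ y⟨ u , τ ⟩)) → pr y⟨ u , τ ⟩ y⟨ u , τ + 1M ⟩ ∈M G
        y-step u τ h p ne = stable-∈ λ k → R.pos-step (vu u) (αu u) σ (vu< u h) λ
            { (inj₁ e) → ne (≈-sym (≈-trans ye (cong1 uF e)))
            ; (inj₂ (l , e)) → piB-moves l _ (R.pos< (vu u) (αu u) σ (vu< u h)) λ
              { (inj₁ e') → ne (≈-sym (≈-trans ye (≈-trans (cong1 uF e) e')))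
              ; (inj₂ e') → k (und _ (y≤a u (τ + 1M) h) _ (y≤a u τ h) (∈-resp (pr-cong ≈-refl (≈-sym (≈-trans ye (cong1 uF e)))) e')) } }
          where
          σ : M
          σ = Tt ∸ (τ + 1M)
          ye : y⟨ u , τ ⟩ ≈ uF $ (pos (vu u) (αu u) (σ + 1M) ∷ [])
          ye = cong1 uF (cong3 posF ≈-refl ≈-refl (∸-of (σ + 1M) (≈-trans (solve 2 (λ t s → t :+ (s :+ con 1) := (t :+ con 1) :+ s) ≈-refl τ σ) (∸-+ (<⇒suc≤ p)))))

      H-x : holds HP (x ∷ [])
      H-x = x≤a , 0M , 0≤ a , R.support-x₀

      abstract
        H-closed : ∀ u v → u ≤ a → v ≤ a → pr u v ∈M G → holds HP (u ∷ []) → holds HP (v ∷ [])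
        H-closed u v ua va m (_ , w , wa , h) = va , u , ua ,
          Base.Closure.cross q a G und (conF 0M <P f0) (λ z z< hz e → R.support-closed z z< hz e) u w v ua wa va m h

    -- Removing the repetitions from a lazy walk: the i-th element is the value after i changes.
    module Dedupe (yF : Fn 2) where
      private
        chP : Pr 2
        chP = yF ∘F (x0 ∷ x1 ⊕ conF 1M ∷ []) ≈P yF
        chF : Fn 2
        chF = ite chP (conF 0M) (conF 1M)
        abstract
          ch0 : ∀ {u τ} → yF $ (u ∷ τ + 1M ∷ []) ≈ yF $ (u ∷ τ ∷ []) → chF $ (u ∷ τ ∷ []) ≈ 0M
          ch0 {u} {τ} h = ite-yes chP (conF 0M) (conF 1M) {u ∷ τ ∷ []} (≈-trans h (congF yF λ { zero → ≈-refl ; (suc zero) → ≈-refl }))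
          ch1 : ∀ {u τ} → (¬ₒ (yF $ (u ∷ τ + 1M ∷ []) ≈ yF $ (u ∷ τ ∷ []))) → chF $ (u ∷ τ ∷ []) ≈ 1M
          ch1 {u} {τ} h = ite-no chP (conF 0M) (conF 1M) {u ∷ τ ∷ []} λ z → h (≈-trans z (congF yF λ { zero → ≈-refl ; (suc zero) → ≈-refl }))
      abstract
        cF2 : Fn 2
        cF2 = sumF chF

      c⟨_,_⟩ : M → M → M
      c⟨ u , τ ⟩ = cF2 $ (u ∷ τ ∷ [])

      abstract
        c-0 : ∀ u → c⟨ u , 0M ⟩ ≈ 0M
        c-0 = sum0 chF

        c-same : ∀ u τ → yF $ (u ∷ τ + 1M ∷ []) ≈ yF $ (u ∷ τ ∷ []) → c⟨ u , τ + 1M ⟩ ≈ c⟨ u , τ ⟩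
        c-same u τ h = ≈-trans (sumS chF u τ) (≈-trans (+-cong ≈-refl (ch0 h)) (+0 _))

        c-new : ∀ u τ → (¬ₒ (yF $ (u ∷ τ + 1M ∷ []) ≈ yF $ (u ∷ τ ∷ []))) → c⟨ u , τ + 1M ⟩ ≈ c⟨ u , τ ⟩ + 1M
        c-new u τ h = ≈-trans (sumS chF u τ) (+-cong ≈-refl (ch1 h))

        c-≤ : ∀ u τ → c⟨ u , τ ⟩ ≤ c⟨ u , τ + 1M ⟩ × c⟨ u , τ + 1M ⟩ ≤ c⟨ u , τ ⟩ + 1M
        c-≤ u τ = by-em (yF $ (u ∷ τ + 1M ∷ []) ≈ yF $ (u ∷ τ ∷ [])) (stable-× stable-≤ stable-≤)
          (λ h → ≤-reflexive (≈-sym (c-same u τ h)) , ≤-trans (≤-reflexive (c-same u τ h)) (≤+ _ 1M))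
          (λ h → ≤-trans (≤+ _ 1M) (≤-reflexive (≈-sym (c-new u τ h))) , ≤-reflexive (c-new u τ h))

        c≤τ : ∀ u τ → c⟨ u , τ ⟩ ≤ τ
        c≤τ u = indP (cF2 ∘F (conF u ∷ x0 ∷ []) ≤P x0) (≤-reflexive (c-0 u)) (λ τ h → ≤-trans (proj₂ (c-≤ u τ)) (+-mono h ≤-refl))

        c-mono : ∀ u σ d → c⟨ u , σ ⟩ ≤ c⟨ u , σ + d ⟩
        c-mono u σ = indP (conF c⟨ u , σ ⟩ ≤P cF2 ∘F (conF u ∷ conF σ ⊕ x0 ∷ [])) (≤-reflexive (cong2 cF2 ≈-refl (≈-sym (+0 σ))))
          (λ d h → ≤-trans h (≤-trans (proj₁ (c-≤ u (σ + d))) (≤-reflexive (cong2 cF2 ≈-refl (≈-sym (+suc σ d))))))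

        y-const : ∀ u σ d → c⟨ u , σ + d ⟩ ≈ c⟨ u , σ ⟩ → yF $ (u ∷ σ + d ∷ []) ≈ yF $ (u ∷ σ ∷ [])
        y-const u σ = indP ((cF2 ∘F (conF u ∷ conF σ ⊕ x0 ∷ []) ≈P conF c⟨ u , σ ⟩) ⇒P (yF ∘F (conF u ∷ conF σ ⊕ x0 ∷ []) ≈P conF (yF $ (u ∷ σ ∷ []))))
          (λ _ → cong2 yF ≈-refl (+0 σ))
          (λ d ih h → let e = ≈-trans (cong2 cF2 ≈-refl (≈-sym (+suc σ d))) h
                          e' = ≤-antisym (≤-trans (proj₁ (c-≤ u (σ + d))) (≤-reflexive e)) (c-mono u σ d) in
            ≈-trans (cong2 yF ≈-refl (+suc σ d)) (≈-trans (by-em (yF $ (u ∷ (σ + d) + 1M ∷ []) ≈ yF $ (u ∷ σ + d ∷ [])) stable-≈ id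
              λ ne → stable-≈ λ _ → proj₂ (≤⇒<suc (≤-refl {c⟨ u , σ + d ⟩})) (≈-trans e' (≈-trans (≈-sym e) (c-new u (σ + d) ne)))) (ih e')))

        -- The count never decreases and stands still only where the value does, so between two
        -- moments of equal count the walk has paused throughout.
        c-determines : ∀ u σ τ → c⟨ u , σ ⟩ ≈ c⟨ u , τ ⟩ → yF $ (u ∷ σ ∷ []) ≈ yF $ (u ∷ τ ∷ [])
        c-determines u σ τ h = by-or stable-≈ (≤-tot σ τ)
          (λ p → let d , e = slack p in ≈-sym (≈-trans (cong2 yF ≈-refl (≈-sym e)) (y-const u σ d (≈-trans (cong2 cF2 ≈-refl e) (≈-sym h)))))
          (λ p → let d , e = slack p in ≈-trans (cong2 yF ≈-refl (≈-sym e)) (y-const u τ d (≈-trans (cong2 cF2 ≈-refl e) h)))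

        -- The moment of the (i + 1)-st change.
        change : ∀ u T i → i < c⟨ u , T ⟩ → Σ M λ σ → σ < T × (c⟨ u , σ ⟩ ≈ i) × (c⟨ u , σ + 1M ⟩ ≈ i + 1M) × (¬ₒ (yF $ (u ∷ σ + 1M ∷ []) ≈ yF $ (u ∷ σ ∷ [])))
        change u T i p = let τ , τ≤ , h , l = least (conF (i + 1M) ≤P cF2 ∘F (conF u ∷ x0 ∷ [])) T (<⇒suc≤ p)
                             σ , e = pred τ (λ z → ≤⇒≯ (0≤ i) (suc≤⇒< (≤-trans h (≤-reflexive (≈-trans (cong2 cF2 ≈-refl z) (c-0 u))))))
                             σ<τ = suc≤⇒< (≤-reflexive e)
                             cσ = <suc⇒≤ (≰⇒> (l σ σ<τ))
                             h' = ≤-trans h (≤-reflexive (cong2 cF2 ≈-refl (≈-sym e)))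
                             e1 = ≤-antisym cσ (+-cancel-≤ 1M (≤-trans (≤-reflexive (+-comm 1M i)) (≤-trans h' (≤-trans (proj₂ (c-≤ u σ)) (≤-reflexive (+-comm _ 1M))))))
                         in σ , <-≤-trans σ<τ τ≤ , e1 , ≤-antisym (≤-trans (proj₂ (c-≤ u σ)) (+-mono cσ ≤-refl)) h'
                            , λ s → ≤⇒≯ (≤-trans h' (≤-trans (≤-reflexive (c-same u σ s)) cσ)) (≤⇒<suc ≤-refl)

  -- The strings H and Z.

  module Components where
    open LazyWalks public
    open Generators

    -- This and the next definitions are what satisfaction of the corresponding formulas unfolds to,
    -- so the conclusion is transferred by conversion.
    SliceM : S → S → M → Set
    SliceM W Z u = (lenM W ≤ lenM Z) × (∀ z → z < lenM Z →
      (z ∈M W → Σ M λ i → i ≤ z × Σ M λ y → y ≤ z × (z ≈ pr i y × pr (pr u i) y ∈M Z))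
      × ((Σ M λ i → i ≤ z × Σ M λ y → y ≤ z × (z ≈ pr i y × pr (pr u i) y ∈M Z)) → z ∈M W))

    AtM : S → M → (M → Set) → Set
    AtM W i P = Σ M λ y → y ≤ lenM W × (ValM W i y × P y)

    PathM : M → S → S → M → M → Set
    PathM a G W x u = Σ M λ b → AtM W 0M (_≈ x) × AtM W b (_≈ u) × (∀ i → i ≤ b → AtM W i (_≤ a))
      × (∀ i → i < b → AtM W i (λ y → AtM W (i + 1M) (λ y' → pr y y' ∈M G)))

    ComponentM : M → S → M → Set
    ComponentM a G x = Σ S λ H → Σ S λ Z →
      ((∀ z → z < lenM H → z ∈M H → z ≤ a) × x ∈M H)
      × (∀ u → u ∈M H → ∀ W → SliceM W Z u → PathM a G W x u)
      × ¬ₒ (Σ M λ u → Σ M λ v → u ≤ a × v ≤ a × pr u v ∈M G × u ∈M H × ¬ₒ (v ∈M H))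

    module Output (a : M) (G : S) (und : ∀ u → u ≤ a → ∀ v → v ≤ a → pr u v ∈M G → pr v u ∈M G) (x : M) (x≤a : x ≤ a)
      (HP : Pr 1) (yF : Fn 2) (T : M) (H≤ : ∀ u → holds HP (u ∷ []) → u ≤ a) (H-x : holds HP (x ∷ []))
      (H-closed : ∀ u v → u ≤ a → v ≤ a → pr u v ∈M G → holds HP (u ∷ []) → holds HP (v ∷ []))
      (y-start : ∀ u → holds HP (u ∷ []) → yF $ (u ∷ 0M ∷ []) ≈ x)
      (y-end : ∀ u → holds HP (u ∷ []) → yF $ (u ∷ T ∷ []) ≈ u)
      (y≤a : ∀ u τ → holds HP (u ∷ []) → yF $ (u ∷ τ ∷ []) ≤ a)
      (y-step : ∀ u τ → holds HP (u ∷ []) → τ < T → (¬ₒ (yF $ (u ∷ τ + 1M ∷ []) ≈ yF $ (u ∷ τ ∷ []))) →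
         pr (yF $ (u ∷ τ ∷ [])) (yF $ (u ∷ τ + 1M ∷ [])) ∈M G) where
      open Dedupe yF

      private
        elemP : Pr 3
        elemP = ∃P (conF T) ((cF2 ∘F (x1 ∷ x0 ∷ []) ≈P x2) ∧P (x3 ≈P yF ∘F (x1 ∷ x0 ∷ [])))
        x4 : Fn 5
        x4 = varF (suc (suc (suc (suc zero))))
        ZP : Pr 1
        ZP = ∃P x0 (∃P x1 (∃P x1 (∃P x2 ((x4 ≈P prF x3 x2) ∧P (x3 ≈P prF x1 x0) ∧P subP HP (x1 ∷ []) ∧P subP elemP (x1 ∷ x0 ∷ x2 ∷ [])))))
        BZ : M
        BZ = pr (pr a T) a + 1M
        cH = compP HP (a + 1M)
        cZ = compP ZP BZ
        H Z : S
        H = proj₁ cH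
        Z = proj₁ cZ
        Elem : M → M → M → Set
        Elem u i y = Σ M λ τ → τ ≤ T × (c⟨ u , τ ⟩ ≈ i × y ≈ yF $ (u ∷ τ ∷ []))
        abstract
          fromH : ∀ u → u ∈M H → holds HP (u ∷ [])
          fromH u h = proj₁ (proj₂ (proj₂ cH) u (<-≤-trans (mem<len H h) (proj₁ (proj₂ cH)))) h
          toH : ∀ u → holds HP (u ∷ []) → u ∈M H
          toH u h = proj₂ (proj₂ (proj₂ cH) u (≤⇒<suc (H≤ u h))) h

          toZ : ∀ u i y → holds HP (u ∷ []) → Elem u i y → pr (pr u i) y ∈M Z
          toZ u i y h el@(τ , τ≤ , ei , ey) = proj₂ (proj₂ (proj₂ cZ) _ (≤⇒<suc (pr-mono (pr-mono (H≤ u h) (≤-trans (≤-reflexive (≈-sym ei)) (≤-trans (c≤τ u τ) τ≤))) (≤-trans (≤-reflexive ey) (y≤a u τ h)))))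
            (pr u i , ≤prˡ _ y , y , ≤prʳ _ y , u , ≤prˡ u i , i , ≤prʳ u i , ≈-refl , ≈-refl , h , el)
          fromZ : ∀ u i y → pr (pr u i) y ∈M Z → Elem u i y
          fromZ u i y m with proj₁ (proj₂ (proj₂ cZ) _ (<-≤-trans (mem<len Z m) (proj₁ (proj₂ cZ)))) m
          ... | s , _ , y' , _ , u' , _ , i' , _ , e1 , e2 , _ , (τ , τ≤ , ei , ey) =
            let p1 , p2 = pr-inj e1 ; p3 , p4 = pr-inj (≈-trans p1 e2) in
            τ , τ≤ , ≈-trans (cong2 cF2 p3 ≈-refl) (≈-trans ei (≈-sym p4)) , ≈-trans p2 (≈-trans ey (cong2 yF (≈-sym p3) ≈-refl))

        module _ (u : M) (hu : holds HP (u ∷ [])) (W : S) (sl : SliceM W Z u) where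
          abstract
            inW : ∀ i y → Elem u i y → pr i y ∈M W
            inW i y el = proj₂ (proj₂ sl _ (≤-<-trans (pr-mono (≤prʳ u i) ≤-refl) (mem<len Z (toZ u i y hu el)))) (i , ≤prˡ i y , y , ≤prʳ i y , ≈-refl , toZ u i y hu el)
            outW : ∀ i y → pr i y ∈M W → Elem u i y
            outW i y m = let i' , _ , y' , _ , e , mz = proj₁ (proj₂ sl _ (<-≤-trans (mem<len W m) (proj₁ sl))) m ; e1 , e2 = pr-inj e in
              fromZ u i y (∈-resp (pr-cong (pr-cong ≈-refl (≈-sym e1)) (≈-sym e2)) mz)
            -- Many moments share the count `i`, but by `c-determines` they share the value as well.
            -- The row `i` of `W` therefore has a single element, which is the least one.
            val : ∀ i τ → τ ≤ T → c⟨ u , τ ⟩ ≈ i → let y = yF $ (u ∷ τ ∷ []) in y ≤ lenM W × ValM W i y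
            val i τ τ≤ e = proj₁ y< , λ k → k (inj₁ (y< , mem , λ s s< ms → let τ' , _ , e' , es = outW i s ms in
                proj₂ s< (≈-trans es (c-determines u τ' τ (≈-trans e' (≈-sym e))))))
              where
              mem : pr i (yF $ (u ∷ τ ∷ [])) ∈M W
              mem = inW i _ (τ , τ≤ , e , ≈-refl)
              y< : yF $ (u ∷ τ ∷ []) < lenM W
              y< = ≤-<-trans (≤prʳ i _) (mem<len W mem)

          path : PathM a G W x u
          path = b , at 0M 0M (0≤ T) (c-0 u) (_≈ x) (y-start u hu) , at b T ≤-refl ≈-refl (_≈ u) (y-end u hu)
               , (λ i i≤ → by-last i i≤) , λ i i< → step i i<
            where
            b : M
            b = c⟨ u , T ⟩
            at : ∀ i τ → τ ≤ T → c⟨ u , τ ⟩ ≈ i → (P : M → Set) → P (yF $ (u ∷ τ ∷ [])) → AtM W i P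
            at i τ τ≤ e P p = yF $ (u ∷ τ ∷ []) , proj₁ (val i τ τ≤ e) , proj₂ (val i τ τ≤ e) , p
            step : ∀ i → i < b → AtM W i (λ y → AtM W (i + 1M) (λ y' → pr y y' ∈M G))
            step i i< = let σ , σ< , e , e' , ne = change u T i i< in
              at i σ (proj₁ σ<) e (λ y → AtM W (i + 1M) (λ y' → pr y y' ∈M G)) (at (i + 1M) (σ + 1M) (<⇒suc≤ σ<) e' (λ y' → pr (yF $ (u ∷ σ ∷ [])) y' ∈M G) (y-step u σ hu σ< ne))
            timeOf : ∀ i → i ≤ b → Σ M λ τ → τ ≤ T × c⟨ u , τ ⟩ ≈ i
            timeOf i i≤ = stableP (∃P (conF T) (cF2 ∘F (conF u ∷ x0 ∷ []) ≈P conF i)) [] λ k → by-em (i ≈ b) stable-𝕆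
              (λ e → k (T , ≤-refl , ≈-sym e)) (λ ne → let σ , σ< , e , _ = change u T i (i≤ , ne) in k (σ , proj₁ σ< , e))
            by-last : ∀ i → i ≤ b → AtM W i (_≤ a)
            by-last i i≤ = let τ , τ≤ , e = timeOf i i≤ in at i τ τ≤ e (_≤ a) (y≤a u τ hu)

      component : ComponentM a G x
      component = H , Z , ((λ z _ h → H≤ z (fromH z h)) , toH x H-x) , (λ u h W sl → path u (fromH u h) W sl)
        , λ (u , v , ua , va , m , hu , nv) → nv (toH v (H-closed u v ua va m (fromH u hu)))

    module _ (q m : ℕ) (m≡ : suc m ≡ 24 ℕ.* 8) (t≥4 : 4 ℕ.≤ suc m ℕ.+ suc m)
             (g : Bits (suc q) → Bits ((suc m ℕ.+ suc m) ℕ.* suc (suc (suc q))))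
             (g-ok : ∀ α → isZero α ≡ false → two^ (suc q) ℕ.≤ 4 ℕ.* ones g α) where
      components : ∀ a G x → x ≤ a → (∀ u → u ≤ a → ∀ v → v ≤ a → pr u v ∈M G → pr v u ∈M G) → ComponentM a G x
      components a G x x≤a und = Output.component a G und x x≤a HP yF Tt (λ _ h → proj₁ h) H-x H-closed y-start y-end y≤a y-step
        where open Walk q m m≡ t≥4 g g-ok a G und x x≤a

-- Choice of the constants and conclusion.

open Completeness using (completeness)
open Generators using (generators; isZero; ones; two^)

open import Data.Nat as ℕ using (ℕ; suc)
import Data.Nat.Properties as ℕ
open import Data.Bool using (Bool; false)
open import Data.Vec using (Vec)
open import Data.Product using (Σ; _,_; proj₁; proj₂)
open import Relation.Binary.PropositionalEquality using (_≡_; refl)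

-- The power is 2 · 192 = 384, labels have length 18, and 2^16 generators of F_2^(384 · 18) are used.
abstract
  m q : ℕ
  m = 191
  q = 13

  m≡ : suc m ≡ 24 ℕ.* 8
  m≡ = refl

  t≥4 : 4 ℕ.≤ suc m ℕ.+ suc m
  t≥4 = ℕ.m≤m+n 4 380

  gens : Σ (Vec Bool (3 ℕ.+ q) → Vec Bool ((suc m ℕ.+ suc m) ℕ.* (5 ℕ.+ q))) λ g →
    ∀ α → isZero α ≡ false → two^ (3 ℕ.+ q) ℕ.≤ 4 ℕ.* ones g α
  -- The dimension `384 * (5 + q)` grows linearly with `q` and has to stay below `two^ q`; 13 is the
  -- least such `q`, and `6912 + 1280` is `two^ 13`.
  gens = generators q _ (ℕ.m≤m+n ((suc m ℕ.+ suc m) ℕ.* (5 ℕ.+ q)) 1280)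

theorem4p7 : VL⊢ Thm47
theorem4p7 = completeness Thm47 λ 𝓜 a G x (x≤a , und) →
  Models.Components.components 𝓜 (suc (suc q)) m m≡ t≥4 (proj₁ gens) (proj₂ gens) a G x x≤a und
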